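{- Let $\mathbb{F}$ be a field, let $\Delta$ be a finite simplicial complex with $\operatorname{depth}_{\mathbb{F}}\Delta=d-1$, and let $r$ be an integer with $2\le r\le d/2$. Let $\mathcal{A},\mathcal{B}$ be nonempty families of $r$-element faces of $\Delta$ that are cross-intersecting (i.e. $A\cap B\neq\emptyset$ for all $A\in\mathcal{A}$, $B\in\mathcal{B}$). If $\Delta$ is shifted with respect to $\{v_1<\cdots<v_r\}$, then \[|\mathcal{A}|+|\mathcal{B}|\le f_r(\Delta)-\gamma+1,\] where $\gamma$ is the number of $r$-element faces of $\Delta$ containing no element of $\{v_1,\dots,v_r\}$.
   Context: A simplicial complex is a finite nonempty family of sets closed under taking subsets. $f_k(\Delta)$ denotes the number of $k$-element faces of $\Delta$. The link of a face $A$ is $\operatorname{link}_\Delta A=\{B\in\Delta: A\cap B=\emptyset,\ A\cup B\in\Delta\}$. $\Delta$ is Cohen-Macaulay over $\mathbb{F}$ if $\tilde H_i(\operatorname{link}_\Delta A;\mathbb{F})=0$ for all $A\in\Delta$ and all $i<\dim\operatorname{link}_\Delta A$ (where $\dim A=|A|-1$); $\operatorname{depth}_{\mathbb{F}}\Delta$ is the largest $k$ such that the subcomplex of faces of dimension at most $k$ is Cohen-Macaulay over $\mathbb{F}$. $\Delta$ is shifted with respect to $\{v_1<\cdots<v_t\}$ if for every $i$, every vertex $w\notin\{v_1,\dots,v_i\}$ and every face $B$ with $w\in B$, $v_i\notin B$, also $(B\setminus\{w\})\cup\{v_i\}\in\Delta$. -}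

module Defs where

open import Level using (Level; _⊔_) renaming (suc to lsuc)
open import Data.Nat using (ℕ; zero; suc; _+_; _≤_; _<_)
open import Data.Bool using (Bool; true; false; if_then_else_; _∧_)
open import Data.Fin using (Fin; zero; suc)
import Data.Fin as Fin
open import Data.Fin.Subset using (Subset; inside; outside; Side; _∈_; _∉_; _⊆_; _∪_; _∩_; _-_; ⁅_⁆; ∣_∣; Nonempty)
open import Data.Vec using (Vec; []; _∷_)
open import Data.Product using (Σ; ∃; _×_)
open import Relation.Nullary using (¬_)
open import Relation.Binary.PropositionalEquality using (_≡_; _≢_)
open import Algebra.Bundles using (CommutativeRing)

record Field (c ℓ : Level) : Set (lsuc (c ⊔ ℓ)) where
  field
    commutativeRing : CommutativeRing c ℓ
  open CommutativeRing commutativeRing public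
  field
    0≉1     : ¬ (0# ≈ 1#)
    inverse : ∀ x → ¬ (x ≈ 0#) → Σ Carrier (λ y → (x * y) ≈ 1#)

Family : ℕ → Set
Family n = Subset n → Bool

_∈F_ : ∀ {n} → Subset n → Family n → Set
S ∈F Φ = Φ S ≡ true

count : ∀ {n} → Family n → ℕ
count {zero}  Φ = if Φ [] then 1 else 0
count {suc n} Φ = count (λ S → Φ (outside ∷ S)) + count (λ S → Φ (inside ∷ S))

sizeIs : ∀ {n} → ℕ → Subset n → Bool
sizeIs k S = Data.Nat._≡ᵇ_ ∣ S ∣ k

record IsComplex {n} (Δ : Family n) : Set where
  field
    nonempty   : ∃ λ S → S ∈F Δ
    downClosed : ∀ S T → T ⊆ S → S ∈F Δ → T ∈F Δ

f : ∀ {n} → Family n → ℕ → ℕ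
f Δ k = count (λ S → Δ S ∧ sizeIs k S)

disjointᵇ : ∀ {n} → Subset n → Subset n → Bool
disjointᵇ []            []            = true
disjointᵇ (inside ∷ A)  (inside ∷ B)  = false
disjointᵇ (_ ∷ A)       (_ ∷ B)       = disjointᵇ A B

link : ∀ {n} → Family n → Subset n → Family n
link Δ A B = disjointᵇ A B ∧ Δ (A ∪ B)

-- k-skeleton, indexed by face SIZE: faces with at most k elements
-- (this is the (k-1)-dimensional skeleton).
≤ᵇ-size : ∀ {n} → Subset n → ℕ → Bool
≤ᵇ-size S k = Data.Nat._≤ᵇ_ ∣ S ∣ k

skel : ∀ {n} → ℕ → Family n → Family n
skel k Δ S = ≤ᵇ-size S k ∧ Δ S

-- Δ has a face with exactly k elements  (i.e. dim Δ ≥ k - 1)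
HasFaceOfSize : ∀ {n} → Family n → ℕ → Set
HasFaceOfSize Δ k = ∃ λ S → S ∈F Δ × ∣ S ∣ ≡ k

module Homology {c ℓ} (F : Field c ℓ) where
  open Field F hiding (_+_; _*_)
  open Field F using () renaming (_+_ to _+ᶠ_; _*_ to _*ᶠ_)

  Σᶠ : ∀ {n} → (Fin n → Carrier) → Carrier
  Σᶠ {zero}  g = 0#
  Σᶠ {suc n} g = g Fin.zero +ᶠ Σᶠ (λ i → g (Fin.suc i))

  below : ∀ {n} → Subset n → Fin n → ℕ
  below (s ∷ S) zero    = 0
  below (s ∷ S) (suc v) = isIn s + below S v
    where
    isIn : Side → ℕ
    isIn inside  = 1
    isIn outside = 0

  sgn : ℕ → Carrier
  sgn zero    = 1#
  sgn (suc k) = - sgn k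

  memᵇ : ∀ {n} → Fin n → Subset n → Bool
  memᵇ zero    (inside ∷ S)  = true
  memᵇ zero    (outside ∷ S) = false
  memᵇ (suc v) (s ∷ S)       = memᵇ v S

  -- Chains are functions on subsets (only values on faces of the
  -- relevant size matter).  The simplicial boundary, evaluated at a
  -- face S (with respect to the ordering of Fin n):
  --   (∂ c)(S) = Σ_{v ∉ S, S ∪ {v} ∈ Γ} (-1)^{#{u ∈ S : u < v}} c(S ∪ {v}).
  -- For the reduced complex, faces of size 0 (the empty face) form
  -- degree -1, and ∂ on vertices is the augmentation.
  ∂ : ∀ {n} → Family n → (Subset n → Carrier) → Subset n → Carrier
  ∂ Γ c S = Σᶠ (λ v → if memᵇ v S then 0#
                      else (if Γ (S ∪ ⁅ v ⁆) then sgn (below S v) *ᶠ c (S ∪ ⁅ v ⁆) else 0#))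

  -- H̃_{j-1}(Γ; F) = 0, indexed by the size j of the faces (so j = i + 1
  -- where i is the homological degree): every j-cycle is a boundary.
  ReducedHomologyVanishes : ∀ {n} → Family n → ℕ → Set (c ⊔ ℓ)
  ReducedHomologyVanishes {n} Γ j =
    (z : Subset n → Carrier) →
    (∀ S → S ∈F Γ → suc ∣ S ∣ ≡ j → ∂ Γ z S ≈ 0#) →
    ∃ λ (b : Subset n → Carrier) → ∀ S → S ∈F Γ → ∣ S ∣ ≡ j → ∂ Γ b S ≈ z S

  -- Cohen–Macaulay over F: for every face A and every i < dim link A,
  -- H̃_i(link A; F) = 0.  In size indexing, i = j - 1 and
  -- i < dim(link A) iff link A has a face with more than j elements.
  CohenMacaulay : ∀ {n} → Family n → Set (c ⊔ ℓ)
  CohenMacaulay Δ = ∀ A → A ∈F Δ → ∀ j → (∃ λ m → j < m × HasFaceOfSize (link Δ A) m) →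
                    ReducedHomologyVanishes (link Δ A) j

  -- depth_F Δ = d - 1: the (d-1)-dimensional skeleton (faces of size ≤ d)
  -- is Cohen–Macaulay, d - 1 ≤ dim Δ, and no skeleton of larger dimension
  -- k ≤ dim Δ is Cohen–Macaulay.
  DepthIsPred : ∀ {n} → Family n → ℕ → Set (c ⊔ ℓ)
  DepthIsPred Δ d = HasFaceOfSize Δ d × CohenMacaulay (skel d Δ)
                  × (∀ m → d < m → HasFaceOfSize Δ m → ¬ CohenMacaulay (skel m Δ))

IsShiftedWrt : ∀ {n t} → Family n → (Fin t → Fin n) → Set
IsShiftedWrt {n} {t} Δ v =
  (∀ i j → v i ≡ v j → i ≡ j) ×
  (∀ (i : Fin t) (w : Fin n) → (∀ j → Data.Fin.toℕ j ≤ Data.Fin.toℕ i → w ≢ v j) →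
     ∀ B → B ∈F Δ → w ∈ B → v i ∉ B → ((B - w) ∪ ⁅ v i ⁆) ∈F Δ)

avoidsᵇ : ∀ {n t} → (Fin t → Fin n) → Subset n → Bool
avoidsᵇ {t = zero}  v S = true
avoidsᵇ {t = suc t} v S = disjointᵇ ⁅ v Fin.zero ⁆ S ∧ avoidsᵇ (λ i → v (Fin.suc i)) S

γ : ∀ {n t} → Family n → (Fin t → Fin n) → ℕ → ℕ
γ Δ v r = count (λ S → Δ S ∧ sizeIs r S ∧ avoidsᵇ v S)

{-# OPTIONS --safe #-}
module Submission where

-- The links of the skeleton are acyclic over F, hence over ℚ: an integral relation between boundaries
-- of faces, divided by its content, stays a nontrivial relation over F.  So contracting the face spaces
-- (in the exterior algebra over ℚ) by the Vandermonde forms φ₀, φ₁, … is cofree: what J forms kill in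
-- degree i is a J-fold contraction from degree i + J, as long as i + J ≤ 2r.  The dimensions E J i of
-- these killed spaces satisfy E J i = E (J + 1) i + E (J + 1) (i - 1).  Purity and shiftedness give the
-- same recursion for the number of i-faces avoiding v₁, …, v_J, so that γ = E r r.
--
-- Perturb the forms so that the dimension bounds survive and every basis vector contracts the kernel of
-- φ_k on a component of the span of 𝒜 (or ℬ) into its image.  Components are indexed by words: a letter
-- false takes the kernel of the next form, a letter true its image.  Contractions are derivations, so
-- components of 𝒜 and ℬ along complementary words have product zero; by genericity the words of the
-- nonzero components of 𝒜 and of ℬ are cross-intersecting.  Counting disjoint pairs of words with r
-- letters false, and comparing with f Δ r = Σ_j C(r + j - 1, j) E (r + j) (r - j), gives the bound.

open import Defs
open import Level using (Level; 0ℓ; _⊔_)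
open import Algebra.Bundles using (CommutativeRing)
open import Algebra.Structures using (IsCommutativeRing)
import Algebra.Properties.Ring as RingProperties
import Algebra.Properties.Semiring.Mult as Mult
import Algebra.Properties.Semiring.Sum as SemiringSum
import Algebra.Solver.Ring
import Algebra.Solver.Ring.AlmostCommutativeRing as ACR
open import Data.Bool using (Bool; true; false; not; _∧_; if_then_else_)
import Data.Bool as Bool
import Data.Bool.Properties as Boolₚ
open import Data.Empty using (⊥; ⊥-elim)
open import Data.Fin using (Fin; zero; suc; toℕ; fromℕ<; punchIn; splitAt; _↑ˡ_; _↑ʳ_)
import Data.Fin.Properties as Finₚ
open import Data.Fin.Subset using (Subset; inside; outside; ∣_∣; _∩_; _∪_; ⁅_⁆; _⊆_; Nonempty) renaming (⊥ to ∅)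
import Data.Fin.Subset as Subset
import Data.Fin.Subset.Properties as Subₚ
open import Data.Integer using (ℤ; -[1+_]; _⊖_)
import Data.Integer as ℤ
import Data.Integer.Properties as ℤₚ
open import Data.List using (List; []; _∷_; length; replicate)
open import Data.Maybe using (Maybe; just; nothing)
open import Data.Nat using (ℕ; zero; suc; _≤_; _<_; z≤n; s≤s)
import Data.Nat as ℕ
import Data.Nat.Properties as ℕₚ
open import Data.Nat.Divisibility using (divides)
import Data.Nat.GCD as GCD
open import Data.Nat.Solver using (module +-*-Solver)
open import Data.Product using (Σ; ∃; _×_; _,_; proj₁; proj₂)
open import Data.Rational using (ℚ; mkℚ; toℚᵘ; 0ℚ; 1ℚ; 1/_)
import Data.Rational as ℚ
import Data.Rational.Properties as ℚₚ
open import Data.Rational.Unnormalised using (mkℚᵘ; _≃_; *≡*)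
import Data.Rational.Unnormalised.Properties as ℚᵘₚ
open import Data.Sum using (_⊎_; inj₁; inj₂; [_,_]′)
open import Data.Unit using (⊤; tt)
open import Data.Vec using ([]; _∷_; lookup; _[_]≔_)
import Data.Vec as Vec
import Data.Vec.Properties as Vecₚ
open import Function using (_∘_)
open import Relation.Binary.Definitions using (DecidableEquality)
open import Relation.Binary.PropositionalEquality as ≡ using (_≡_; _≢_; refl; sym; trans; cong; cong₂; subst; isEquivalence; module ≡-Reasoning)
open import Relation.Nullary using (¬_; Dec; yes; no; does)
open import Relation.Nullary.Decidable using (decidable-stable; ¬¬-excluded-middle; dec-true; _×-dec_; _→-dec_)

-- Characteristic 0 is forced by the inductive step for cofreeness. The obstruction is a
-- finite-dimensional quotient with two endomorphisms whose commutator is the identity; by traces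
-- its dimension is 0 as a scalar, hence 0. Over `F` this says nothing once the characteristic
-- divides the dimension.
--
-- The perturbation reconciles two demands. Vandermonde forms have computable dimensions but need
-- not be generic for 𝒜 and ℬ; generic forms come without known dimensions. Only facts that survive
-- a small change of one form are carried along: upper bounds for the killed spaces, and one full
-- contraction that is not zero.
--
-- A nonzero component either dies under all remaining forms, and then has dimension at most one
-- below the ambient bound, or reaches a nonzero scalar, and the words reached are again
-- cross-intersecting. Losses and gains balance except at the one word without a letter true, whose
-- component is zero for both families: this is the final 1.
--
-- Equality in `F` is not decidable, so bases and pivots exist only under double negation; this is
-- harmless, as the conclusion is a decidable inequality.

infixl 1 _>>=_

-- Double negation as a monad

_>>=_ : ∀ {a b} {A : Set a} {B : Set b} → ¬ ¬ A → (A → ¬ ¬ B) → ¬ ¬ B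
(m >>= f) k = m (λ x → f x k)

return : ∀ {a} {A : Set a} → A → ¬ ¬ A
return x k = k x

-- Finiteness of the index set is what allows double negation to move out of a universal quantifier.
¬¬-choice : ∀ {a n} {P : Fin n → Set a} → (∀ i → ¬ ¬ P i) → ¬ ¬ (∀ i → P i)
¬¬-choice {n = zero}  f = return (λ ())
¬¬-choice {n = suc n} f =
  f zero >>= λ p →
  ¬¬-choice (f ∘ suc) >>= λ q →
  return λ { zero → p ; (suc i) → q i }

-- Integers in a commutative ring, and homogeneous linear systems

module FromInteger {c ℓ} (R : CommutativeRing c ℓ) where
  open CommutativeRing R renaming (refl to ≈-refl; sym to ≈-sym; trans to ≈-trans)
  open Mult semiring using (×-homo-+; ×1-homo-*) renaming (_×_ to _·_)
  open RingProperties ring using (-‿distribˡ-*; -‿distribʳ-*; -0#≈0#; -‿involutive; -‿+-comm)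
  open import Relation.Binary.Reasoning.Setoid setoid

  fromℤ : ℤ → Carrier
  fromℤ (ℤ.+ n)  = n · 1#
  fromℤ -[1+ n ] = - (suc n · 1#)

  fromℤ-neg : ∀ i → fromℤ (ℤ.- i) ≈ - fromℤ i
  fromℤ-neg (ℤ.+ zero)  = ≈-sym -0#≈0#
  fromℤ-neg (ℤ.+ suc n) = ≈-refl
  fromℤ-neg -[1+ n ]    = ≈-sym (-‿involutive _)

  fromℤ-⊖ : ∀ m n → fromℤ (m ⊖ n) ≈ m · 1# - n · 1#
  fromℤ-⊖ m zero = ≈-sym (≈-trans (+-congˡ -0#≈0#) (+-identityʳ _))
  fromℤ-⊖ zero (suc n) = ≈-sym (+-identityˡ _)
  fromℤ-⊖ (suc m) (suc n) = begin
    fromℤ (suc m ⊖ suc n)                 ≡⟨ cong fromℤ (ℤₚ.[1+m]⊖[1+n]≡m⊖n m n) ⟩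
    fromℤ (m ⊖ n)                         ≈⟨ fromℤ-⊖ m n ⟩
    m · 1# - n · 1#                       ≈⟨ +-congʳ (≈-sym (+-identityˡ _)) ⟩
    0# + m · 1# - n · 1#                  ≈⟨ +-congʳ (+-congʳ (≈-sym (-‿inverseʳ 1#))) ⟩
    1# - 1# + m · 1# - n · 1#             ≈⟨ +-congʳ (+-assoc _ _ _) ⟩
    1# + (- 1# + m · 1#) - n · 1#         ≈⟨ +-congʳ (+-congˡ (+-comm _ _)) ⟩
    1# + (m · 1# - 1#) - n · 1#           ≈⟨ +-congʳ (≈-sym (+-assoc _ _ _)) ⟩
    1# + m · 1# - 1# - n · 1#             ≈⟨ +-assoc _ _ _ ⟩
    1# + m · 1# + (- 1# - n · 1#)         ≈⟨ +-congˡ (-‿+-comm _ _) ⟩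
    suc m · 1# - suc n · 1#               ∎

  fromℤ-+ : ∀ i j → fromℤ (i ℤ.+ j) ≈ fromℤ i + fromℤ j
  fromℤ-+ (ℤ.+ m)  (ℤ.+ n)  = ×-homo-+ 1# m n
  fromℤ-+ (ℤ.+ m)  -[1+ n ] = fromℤ-⊖ m (suc n)
  fromℤ-+ -[1+ m ] (ℤ.+ n)  = ≈-trans (fromℤ-⊖ n (suc m)) (+-comm _ _)
  fromℤ-+ -[1+ m ] -[1+ n ] = begin
    - (suc (suc (m ℕ.+ n)) · 1#)       ≡⟨ cong (λ k → - (k · 1#)) (sym (cong suc (ℕₚ.+-suc m n))) ⟩
    - ((suc m ℕ.+ suc n) · 1#)         ≈⟨ -‿cong (×-homo-+ 1# (suc m) (suc n)) ⟩
    - (suc m · 1# + suc n · 1#)        ≈⟨ ≈-sym (-‿+-comm _ _) ⟩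
    - (suc m · 1#) - (suc n · 1#)      ∎

  fromℤ-*⁺ : ∀ m j → fromℤ (ℤ.+ m ℤ.* j) ≈ m · 1# * fromℤ j
  fromℤ-*⁺ m (ℤ.+ n) = begin
    fromℤ (ℤ.+ m ℤ.* ℤ.+ n)  ≡⟨ cong fromℤ (sym (ℤₚ.pos-* m n)) ⟩
    (m ℕ.* n) · 1#           ≈⟨ ×1-homo-* m n ⟩
    m · 1# * (n · 1#)        ∎
  fromℤ-*⁺ m -[1+ n ] = begin
    fromℤ (ℤ.+ m ℤ.* -[1+ n ])     ≡⟨ cong fromℤ (sym (ℤₚ.neg-distribʳ-* (ℤ.+ m) (ℤ.+ suc n))) ⟩
    fromℤ (ℤ.- (ℤ.+ m ℤ.* ℤ.+ suc n)) ≈⟨ fromℤ-neg (ℤ.+ m ℤ.* ℤ.+ suc n) ⟩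
    - fromℤ (ℤ.+ m ℤ.* ℤ.+ suc n)  ≈⟨ -‿cong (fromℤ-*⁺ m (ℤ.+ suc n)) ⟩
    - (m · 1# * (suc n · 1#))      ≈⟨ -‿distribʳ-* _ _ ⟩
    m · 1# * - (suc n · 1#)        ∎

  fromℤ-* : ∀ i j → fromℤ (i ℤ.* j) ≈ fromℤ i * fromℤ j
  fromℤ-* (ℤ.+ m) j = fromℤ-*⁺ m j
  fromℤ-* -[1+ m ] j = begin
    fromℤ (-[1+ m ] ℤ.* j)           ≡⟨ cong fromℤ (sym (ℤₚ.neg-distribˡ-* (ℤ.+ suc m) j)) ⟩
    fromℤ (ℤ.- (ℤ.+ suc m ℤ.* j))    ≈⟨ fromℤ-neg (ℤ.+ suc m ℤ.* j) ⟩
    - fromℤ (ℤ.+ suc m ℤ.* j)        ≈⟨ -‿cong (fromℤ-*⁺ (suc m) j) ⟩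
    - (suc m · 1# * fromℤ j)         ≈⟨ -‿distribˡ-* _ _ ⟩
    - (suc m · 1#) * fromℤ j         ∎

  morphism : ACR._-Raw-AlmostCommutative⟶_ (CommutativeRing.rawRing ℤₚ.+-*-commutativeRing) (ACR.fromCommutativeRing R)
  morphism = record
    { ⟦_⟧ = fromℤ ; +-homo = fromℤ-+ ; *-homo = fromℤ-* ; -‿homo = fromℤ-neg
    ; 0-homo = ≈-refl ; 1-homo = +-identityʳ 1# }

  fromℤ-≟ : ∀ i j → Maybe (fromℤ i ≈ fromℤ j)
  fromℤ-≟ i j with i ℤ.≟ j
  ... | yes p = just (reflexive (cong fromℤ p))
  ... | no _  = nothing

  module Solver = Algebra.Solver.Ring
    (CommutativeRing.rawRing ℤₚ.+-*-commutativeRing) (ACR.fromCommutativeRing R) morphism fromℤ-≟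

module Dependence {c ℓ} (F : Field c ℓ) where
  open Field F renaming (refl to ≈-refl; sym to ≈-sym; trans to ≈-trans; zero to *-zero)
  open SemiringSum semiring using (sum; sum-cong-≋; ∑-distrib-+; *-distribˡ-sum; *-distribʳ-sum; sum-remove; sum-replicate-zero)
  open RingProperties ring using (-‿distribˡ-*; -‿distribʳ-*)
  open FromInteger commutativeRing using (module Solver)
  open Solver using (solve; _:+_; _:*_; :-_; _:=_)
  open import Relation.Binary.Reasoning.Setoid setoid

  -- Gaussian elimination, one equation and one unknown at a time. An abstract field does not decide
  -- whether the first equation has a nonzero coefficient; the double negation comes from the search
  -- for that pivot.
  nonzero-solution : ∀ {m k} (M : Fin k → Fin m → Carrier) → m < k →
    ¬ ¬ (∃ λ (x : Fin k → Carrier) → (∃ λ i → ¬ x i ≈ 0#) × (∀ j → sum (λ i → x i * M i j) ≈ 0#))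
  nonzero-solution {zero} {suc k} M _ = return ((λ _ → 1#) , (zero , λ e → 0≉1 (≈-sym e)) , λ ())
  nonzero-solution {suc m} {suc k} M (s≤s m<k) =
    ¬¬-excluded-middle {A = ∃ λ i → ¬ M i zero ≈ 0#} >>= λ where
      (no ¬pivot) →
        ¬¬-choice (λ i h → ¬pivot (i , h)) >>= λ column≈0 →
        nonzero-solution (λ i j → M i (suc j)) (ℕₚ.m<n⇒m<1+n m<k) >>= λ (x , x≉0 , eqs) →
        return (x , x≉0 , λ where
          zero → ≈-trans (sum-cong-≋ {x = λ i → x i * M i zero} (λ i → ≈-trans (*-congˡ (column≈0 i)) (zeroʳ (x i)))) (sum-replicate-zero (suc k))
          (suc j) → eqs j)
      (yes (p , pivot)) → eliminate p (inverse (M p zero) pivot)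
    where
    eliminate : ∀ p → Σ Carrier (λ y → M p zero * y ≈ 1#) → _
    eliminate p (y , My≈1) =
      nonzero-solution N m<k >>= λ (x , (i , xi≉0) , eqs) →
      return (extend x , (punchIn p i , λ e → xi≉0 (≈-trans (reflexive (sym (extend-other x i))) e)) , λ j → solution x eqs j)
      where
      rest : Fin k → Fin (suc m) → Carrier
      rest i = M (punchIn p i)
      -- The system that remains after the first equation has been solved for the unknown `p` and
      -- the result substituted in the others; `extend` recovers that unknown.
      N : Fin k → Fin m → Carrier
      N i j = rest i (suc j) + - (rest i zero * y * M p (suc j))
      extend : (Fin k → Carrier) → Fin (suc k) → Carrier
      extend x i with p Finₚ.≟ i
      ... | yes _  = - (sum (λ i → x i * rest i zero) * y)
      ... | no p≢i = x (Data.Fin.punchOut p≢i)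
      extend-pivot : ∀ x → extend x p ≡ - (sum (λ i → x i * rest i zero) * y)
      extend-pivot x with p Finₚ.≟ p
      ... | yes _  = refl
      ... | no p≢p = ⊥-elim (p≢p refl)
      extend-other : ∀ x i → extend x (punchIn p i) ≡ x i
      extend-other x i with p Finₚ.≟ punchIn p i
      ... | yes e  = ⊥-elim (Finₚ.punchInᵢ≢i p i (sym e))
      ... | no p≢i = cong x (trans (Finₚ.punchOut-cong p refl) (Finₚ.punchOut-punchIn p))
      split : ∀ x j → sum (λ i → extend x i * M i j) ≈
                      - (sum (λ i → x i * rest i zero) * y) * M p j + sum (λ i → x i * rest i j)
      split x j = begin
        sum (λ i → extend x i * M i j)
          ≈⟨ sum-remove {i = p} (λ i → extend x i * M i j) ⟩
        extend x p * M p j + sum (λ i → extend x (punchIn p i) * rest i j)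
          ≈⟨ +-cong (*-congʳ (reflexive (extend-pivot x))) (sum-cong-≋ (λ i → *-congʳ (reflexive (extend-other x i)))) ⟩
        _ ∎
      solution : ∀ x → (∀ j → sum (λ i → x i * N i j) ≈ 0#) → ∀ j → sum (λ i → extend x i * M i j) ≈ 0#
      solution x eqs zero = let s = sum (λ i → x i * rest i zero) in begin
        sum (λ i → extend x i * M i zero)  ≈⟨ split x zero ⟩
        - (s * y) * M p zero + s           ≈⟨ solve 3 (λ s y m → :- (s :* y) :* m :+ s := s :+ :- (s :* (m :* y))) ≈-refl s y (M p zero) ⟩
        s + - (s * (M p zero * y))         ≈⟨ +-congˡ (-‿cong (≈-trans (*-congˡ My≈1) (*-identityʳ s))) ⟩
        s + - s                            ≈⟨ -‿inverseʳ s ⟩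
        0#                                 ∎
      solution x eqs (suc j) =
        let s = sum (λ i → x i * rest i zero)
            t = sum (λ i → x i * rest i (suc j))
            q = M p (suc j) in begin
        sum (λ i → extend x i * M i (suc j))  ≈⟨ split x (suc j) ⟩
        - (s * y) * q + t                     ≈⟨ solve 4 (λ s y q t → :- (s :* y) :* q :+ t := t :+ s :* :- (y :* q)) ≈-refl s y q t ⟩
        t + s * - (y * q)                     ≈⟨ +-congˡ (*-distribʳ-sum (- (y * q)) (λ i → x i * rest i zero)) ⟩
        t + sum (λ i → x i * rest i zero * - (y * q))
          ≈⟨ ≈-sym (∑-distrib-+ (λ i → x i * rest i (suc j)) (λ i → x i * rest i zero * - (y * q))) ⟩
        sum (λ i → x i * rest i (suc j) + x i * rest i zero * - (y * q))
          ≈⟨ sum-cong-≋ (λ i → solve 5 (λ x r z y q → x :* r :+ x :* z :* :- (y :* q) := x :* (r :+ :- (z :* y :* q))) ≈-refl (x i) (rest i (suc j)) (rest i zero) y q) ⟩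
        sum (λ i → x i * N i j)               ≈⟨ eqs j ⟩
        0#                                    ∎

-- The rational numbers, presented abstractly so that arithmetic never unfolds.
record Rationals : Set₁ where
  infixl 6 _+_
  infixl 7 _*_
  infix  8 -_
  infix  4 _≟_
  field
    R     : Set
    _+_   : R → R → R
    _*_   : R → R → R
    -_    : R → R
    0#    : R
    1#    : R
    isCommutativeRing : IsCommutativeRing _≡_ _+_ _*_ -_ 0# 1#
    _≟_   : DecidableEquality R
    1≢0   : 1# ≢ 0#
    inverse : ∀ x → x ≢ 0# → ∃ λ y → x * y ≡ 1#

  scalarRing : CommutativeRing 0ℓ 0ℓ
  scalarRing = record { isCommutativeRing = isCommutativeRing }

  open FromInteger scalarRing public using (fromℤ)

  field
    fromℕ-suc≢0 : ∀ n → fromℤ (ℤ.+ suc n) ≢ 0#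
    fraction : ∀ x → ∃ λ n → ∃ λ i → x * fromℤ (ℤ.+ suc n) ≡ fromℤ i

  scalarField : Field 0ℓ 0ℓ
  scalarField = record
    { commutativeRing = scalarRing ; 0≉1 = λ e → 1≢0 (sym e) ; inverse = inverse }

-- The exterior algebra and contractions by linear forms

module Exterior (Q : Rationals) where
  open Rationals Q hiding (_+_; _*_; -_)
  private
    module Q = Rationals Q
    module QR = CommutativeRing scalarRing
    module QS = FromInteger.Solver scalarRing

  -- The exterior algebra on n generators: x & y stands for x + e₀ ∧ y.
  infix 4 _&_

  data Ext : ℕ → Set where
    ⟨_⟩ : R → Ext zero
    _&_ : ∀ {n} → Ext n → Ext n → Ext (suc n)

  infixl 6 _+_ _−_
  infixl 7 _⊛_ _·_
  infix  8 -_

  opaque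
    _+_ : ∀ {n} → Ext n → Ext n → Ext n
    ⟨ x ⟩ + ⟨ y ⟩ = ⟨ x Q.+ y ⟩
    (x & x′) + (y & y′) = x + y & x′ + y′

    -_ : ∀ {n} → Ext n → Ext n
    - ⟨ x ⟩ = ⟨ Q.- x ⟩
    - (x & x′) = - x & - x′

    -- Coordinatewise product; it makes Ext n a commutative ring over which scalar
    -- multiplication is multiplication by constants.
    _⊛_ : ∀ {n} → Ext n → Ext n → Ext n
    ⟨ x ⟩ ⊛ ⟨ y ⟩ = ⟨ x Q.* y ⟩
    (x & x′) ⊛ (y & y′) = x ⊛ y & x′ ⊛ y′

    const : ∀ {n} → R → Ext n
    const {zero}  c = ⟨ c ⟩
    const {suc n} c = const c & const c

  _−_ : ∀ {n} → Ext n → Ext n → Ext n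
  x − y = x + - y

  _·_ : ∀ {n} → R → Ext n → Ext n
  c · x = const c ⊛ x

  𝟎 : ∀ {n} → Ext n
  𝟎 = const 0#

  opaque
    unfolding _+_

    +-assoc : ∀ {n} (x y z : Ext n) → x + y + z ≡ x + (y + z)
    +-assoc ⟨ x ⟩ ⟨ y ⟩ ⟨ z ⟩ = cong ⟨_⟩ (QR.+-assoc x y z)
    +-assoc (x & x′) (y & y′) (z & z′) = cong₂ _&_ (+-assoc x y z) (+-assoc x′ y′ z′)

    +-comm : ∀ {n} (x y : Ext n) → x + y ≡ y + x
    +-comm ⟨ x ⟩ ⟨ y ⟩ = cong ⟨_⟩ (QR.+-comm x y)
    +-comm (x & x′) (y & y′) = cong₂ _&_ (+-comm x y) (+-comm x′ y′)

    +-identityˡ : ∀ {n} (x : Ext n) → 𝟎 + x ≡ x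
    +-identityˡ ⟨ x ⟩ = cong ⟨_⟩ (QR.+-identityˡ x)
    +-identityˡ (x & x′) = cong₂ _&_ (+-identityˡ x) (+-identityˡ x′)

    +-identityʳ : ∀ {n} (x : Ext n) → x + 𝟎 ≡ x
    +-identityʳ x = trans (+-comm x 𝟎) (+-identityˡ x)

    -‿inverseˡ : ∀ {n} (x : Ext n) → - x + x ≡ 𝟎
    -‿inverseˡ ⟨ x ⟩ = cong ⟨_⟩ (QR.-‿inverseˡ x)
    -‿inverseˡ (x & x′) = cong₂ _&_ (-‿inverseˡ x) (-‿inverseˡ x′)

    -‿inverseʳ : ∀ {n} (x : Ext n) → x + - x ≡ 𝟎
    -‿inverseʳ x = trans (+-comm x (- x)) (-‿inverseˡ x)

    ⊛-assoc : ∀ {n} (x y z : Ext n) → x ⊛ y ⊛ z ≡ x ⊛ (y ⊛ z)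
    ⊛-assoc ⟨ x ⟩ ⟨ y ⟩ ⟨ z ⟩ = cong ⟨_⟩ (QR.*-assoc x y z)
    ⊛-assoc (x & x′) (y & y′) (z & z′) = cong₂ _&_ (⊛-assoc x y z) (⊛-assoc x′ y′ z′)

    ⊛-comm : ∀ {n} (x y : Ext n) → x ⊛ y ≡ y ⊛ x
    ⊛-comm ⟨ x ⟩ ⟨ y ⟩ = cong ⟨_⟩ (QR.*-comm x y)
    ⊛-comm (x & x′) (y & y′) = cong₂ _&_ (⊛-comm x y) (⊛-comm x′ y′)

    1· : ∀ {n} (x : Ext n) → 1# · x ≡ x
    1· ⟨ x ⟩ = cong ⟨_⟩ (QR.*-identityˡ x)
    1· (x & x′) = cong₂ _&_ (1· x) (1· x′)

    ⊛-distribˡ : ∀ {n} (x y z : Ext n) → x ⊛ (y + z) ≡ x ⊛ y + x ⊛ z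
    ⊛-distribˡ ⟨ x ⟩ ⟨ y ⟩ ⟨ z ⟩ = cong ⟨_⟩ (QR.distribˡ x y z)
    ⊛-distribˡ (x & x′) (y & y′) (z & z′) = cong₂ _&_ (⊛-distribˡ x y z) (⊛-distribˡ x′ y′ z′)

  extRing : ℕ → CommutativeRing 0ℓ 0ℓ
  extRing n = record
    { Carrier = Ext n ; _≈_ = _≡_ ; _+_ = _+_ ; _*_ = _⊛_ ; -_ = -_ ; 0# = 𝟎 ; 1# = const 1#
    ; isCommutativeRing = record
      { isRing = record
        { +-isAbelianGroup = record
          { isGroup = record
            { isMonoid = record
              { isSemigroup = record
                { isMagma = record { isEquivalence = isEquivalence ; ∙-cong = cong₂ _+_ }
                ; assoc = +-assoc }
              ; identity = +-identityˡ , +-identityʳ }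
            ; inverse = -‿inverseˡ , -‿inverseʳ
            ; ⁻¹-cong = cong -_ }
          ; comm = +-comm }
        ; *-cong = cong₂ _⊛_
        ; *-assoc = ⊛-assoc
        ; *-identity = 1· , λ x → trans (⊛-comm x _) (1· x)
        ; distrib = ⊛-distribˡ , λ x y z → trans (⊛-comm (y + z) x) (trans (⊛-distribˡ x y z) (cong₂ _+_ (⊛-comm x y) (⊛-comm x z))) }
      ; *-comm = ⊛-comm } }

  module ES {n} = FromInteger.Solver (extRing n)
  open ES using (solve; _:+_; _:*_; :-_; _:=_; _:-_; con)
  open ≡-Reasoning

  opaque
    unfolding _+_

    const-+ : ∀ {n} a b → const {n} (a Q.+ b) ≡ const a + const b
    const-+ {zero} a b = refl
    const-+ {suc n} a b = cong₂ _&_ (const-+ a b) (const-+ a b)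

    const-* : ∀ {n} a b → const {n} (a Q.* b) ≡ const a ⊛ const b
    const-* {zero} a b = refl
    const-* {suc n} a b = cong₂ _&_ (const-* a b) (const-* a b)

    const-neg : ∀ {n} a → const {n} (Q.- a) ≡ - const a
    const-neg {zero} a = refl
    const-neg {suc n} a = cong₂ _&_ (const-neg a) (const-neg a)

  +-· : ∀ {n} a b (x : Ext n) → (a Q.+ b) · x ≡ a · x + b · x
  +-· a b x = trans (cong (_⊛ x) (const-+ a b)) (solve 3 (λ a b x → (a :+ b) :* x := a :* x :+ b :* x) refl (const a) (const b) x)

  *-· : ∀ {n} a b (x : Ext n) → (a Q.* b) · x ≡ a · (b · x)
  *-· a b x = trans (cong (_⊛ x) (const-* a b)) (⊛-assoc (const a) (const b) x)

  neg-· : ∀ {n} a (x : Ext n) → (Q.- a) · x ≡ - (a · x)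
  neg-· a x = trans (cong (_⊛ x) (const-neg a)) (solve 2 (λ a x → :- a :* x := :- (a :* x)) refl (const a) x)

  0· : ∀ {n} (x : Ext n) → 0# · x ≡ 𝟎
  0· x = CommutativeRing.zeroˡ (extRing _) x

  ·𝟎 : ∀ {n} c → c · 𝟎 {n} ≡ 𝟎
  ·𝟎 c = CommutativeRing.zeroʳ (extRing _) (const c)

  -𝟎 : ∀ {n} → - 𝟎 {n} ≡ 𝟎
  -𝟎 = trans (sym (+-identityˡ (- 𝟎))) (-‿inverseʳ 𝟎)

  ·-+ : ∀ {n} c (x y : Ext n) → c · (x + y) ≡ c · x + c · y
  ·-+ c = ⊛-distribˡ (const c)

  ·-neg : ∀ {n} c (x : Ext n) → c · (- x) ≡ - (c · x)
  ·-neg c x = solve 2 (λ a x → a :* :- x := :- (a :* x)) refl (const c) x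

  ·-injective : ∀ {n} c (x : Ext n) → c ≢ 0# → c · x ≡ 𝟎 → x ≡ 𝟎
  ·-injective c x c≢0 e with inverse c c≢0
  ... | d , cd≡1 = begin
    x              ≡⟨ sym (1· x) ⟩
    1# · x         ≡⟨ cong (_· x) (trans (sym cd≡1) (QR.*-comm c d)) ⟩
    (d Q.* c) · x  ≡⟨ *-· d c x ⟩
    d · (c · x)    ≡⟨ cong (d ·_) e ⟩
    d · 𝟎          ≡⟨ ·𝟎 d ⟩
    𝟎              ∎

  Form : ℕ → Set
  Form n = Fin n → R

  opaque
    unfolding _+_

    -- Interior product by a linear form. The second half carries a minus sign because the
    -- contraction has to pass the first generator. For the constant form 1 it is the simplicial
    -- boundary.
    ι : ∀ {n} → Form n → Ext n → Ext n
    ι φ ⟨ x ⟩ = 𝟎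
    ι φ (x & y) = ι (φ ∘ suc) x + φ zero · y & - ι (φ ∘ suc) y

    ε : ∀ {n} → Fin n → Ext n → Ext n
    ε zero    (x & y) = 𝟎 & x
    ε (suc v) (x & y) = ε v x & - ε v y

    ι-+ : ∀ {n} φ (x y : Ext n) → ι φ (x + y) ≡ ι φ x + ι φ y
    ι-+ φ ⟨ x ⟩ ⟨ y ⟩ = sym (+-identityˡ 𝟎)
    ι-+ φ (x & x′) (y & y′) = cong₂ _&_
      (trans (cong (_+ _) (ι-+ _ x y)) (solve 5 (λ i j c x y → i :+ j :+ c :* (x :+ y) := i :+ c :* x :+ (j :+ c :* y)) refl
        (ι (φ ∘ suc) x) (ι (φ ∘ suc) y) (const (φ zero)) x′ y′))
      (trans (cong -_ (ι-+ _ x′ y′)) (solve 2 (λ x y → :- (x :+ y) := :- x :+ :- y) refl (ι (φ ∘ suc) x′) (ι (φ ∘ suc) y′)))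

    ι-· : ∀ {n} φ c (x : Ext n) → ι φ (c · x) ≡ c · ι φ x
    ι-· φ c ⟨ x ⟩ = sym (·𝟎 c)
    ι-· φ c (x & x′) = cong₂ _&_
      (trans (cong (_+ _) (ι-· _ c x)) (solve 4 (λ c i p x → c :* i :+ p :* (c :* x) := c :* (i :+ p :* x)) refl
        (const c) (ι (φ ∘ suc) x) (const (φ zero)) x′))
      (trans (cong -_ (ι-· _ c x′)) (sym (·-neg c _)))

    ι-𝟎 : ∀ {n} (φ : Form n) → ι φ 𝟎 ≡ 𝟎
    ι-𝟎 φ = trans (cong (ι φ) (sym (0· 𝟎))) (trans (ι-· φ 0# 𝟎) (0· _))

    ι-neg : ∀ {n} φ (x : Ext n) → ι φ (- x) ≡ - ι φ x
    ι-neg φ x = begin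
      ι φ (- x)             ≡⟨ cong (ι φ) (trans (cong -_ (sym (1· x))) (sym (neg-· 1# x))) ⟩
      ι φ ((Q.- 1#) · x)    ≡⟨ ι-· φ (Q.- 1#) x ⟩
      (Q.- 1#) · ι φ x      ≡⟨ trans (neg-· 1# _) (cong -_ (1· _)) ⟩
      - ι φ x               ∎

    ι-cong : ∀ {n} {φ ψ : Form n} → (∀ v → φ v ≡ ψ v) → ∀ x → ι φ x ≡ ι ψ x
    ι-cong e ⟨ x ⟩ = refl
    ι-cong e (x & y) = cong₂ _&_ (cong₂ _+_ (ι-cong (e ∘ suc) x) (cong (_· y) (e zero))) (cong -_ (ι-cong (e ∘ suc) y))

    ι-form+ : ∀ {n} (φ ψ : Form n) x → ι (λ v → φ v Q.+ ψ v) x ≡ ι φ x + ι ψ x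
    ι-form+ φ ψ ⟨ x ⟩ = sym (+-identityˡ 𝟎)
    ι-form+ φ ψ (x & y) = cong₂ _&_
      (trans (cong₂ _+_ (ι-form+ (φ ∘ suc) (ψ ∘ suc) x) (+-· (φ zero) (ψ zero) y))
        (solve 4 (λ i j a b → i :+ j :+ (a :+ b) := i :+ a :+ (j :+ b)) refl (ι (φ ∘ suc) x) (ι (ψ ∘ suc) x) (φ zero · y) (ψ zero · y)))
      (trans (cong -_ (ι-form+ (φ ∘ suc) (ψ ∘ suc) y)) (solve 2 (λ x y → :- (x :+ y) := :- x :+ :- y) refl (ι (φ ∘ suc) y) (ι (ψ ∘ suc) y)))

    ι-form· : ∀ {n} c (φ : Form n) x → ι (λ v → c Q.* φ v) x ≡ c · ι φ x
    ι-form· c φ ⟨ x ⟩ = sym (·𝟎 c)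
    ι-form· c φ (x & y) = cong₂ _&_
      (trans (cong₂ _+_ (ι-form· c (φ ∘ suc) x) (*-· c (φ zero) y)) (sym (·-+ c _ _)))
      (trans (cong -_ (ι-form· c (φ ∘ suc) y)) (sym (·-neg c _)))

    ι-ι : ∀ {n} (φ : Form n) x → ι φ (ι φ x) ≡ 𝟎
    ι-ι φ ⟨ x ⟩ = refl
    ι-ι φ (x & y) = cong₂ _&_
      (begin
        ι (φ ∘ suc) (ι (φ ∘ suc) x + φ zero · y) + φ zero · (- ι (φ ∘ suc) y)      ≡⟨ cong₂ _+_ (ι-+ (φ ∘ suc) (ι (φ ∘ suc) x) (φ zero · y)) (·-neg (φ zero) (ι (φ ∘ suc) y)) ⟩
        ι (φ ∘ suc) (ι (φ ∘ suc) x) + ι (φ ∘ suc) (φ zero · y) − φ zero · ι (φ ∘ suc) y   ≡⟨ cong₂ _−_ (cong₂ _+_ (ι-ι (φ ∘ suc) x) (ι-· (φ ∘ suc) _ y)) refl ⟩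
        𝟎 + φ zero · ι (φ ∘ suc) y − φ zero · ι (φ ∘ suc) y                 ≡⟨ trans (cong₂ _−_ (+-identityˡ _) refl) (-‿inverseʳ _) ⟩
        𝟎                                                     ∎)
      (trans (cong -_ (ι-neg (φ ∘ suc) (ι (φ ∘ suc) y))) (trans (cong (λ t → - - t) (ι-ι (φ ∘ suc) y)) (trans (cong -_ -𝟎) -𝟎)))

    -- Polarisation of `ι-ι` at the sum of the two forms.
    ι-anti : ∀ {n} (φ ψ : Form n) x → ι φ (ι ψ x) ≡ - ι ψ (ι φ x)
    ι-anti {n} φ ψ x = begin
      p                          ≡⟨ solve 2 (λ p q → p := p :+ q :- q) refl p q ⟩
      p + q − q                  ≡⟨ cong (_− q) lemma ⟩
      𝟎 − q                      ≡⟨ +-identityˡ _ ⟩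
      - q                        ∎
      where
      p q : Ext n
      p = ι φ (ι ψ x)
      q = ι ψ (ι φ x)
      s : Form n
      s v = φ v Q.+ ψ v
      lemma : p + q ≡ 𝟎
      lemma = begin
        p + q                                                          ≡⟨ solve 2 (λ p q → p :+ q := con (ℤ.+ 0) :+ q :+ (p :+ con (ℤ.+ 0))) refl p q ⟩
        𝟎 + q + (p + 𝟎)                                                ≡⟨ cong₂ (λ a b → a + q + (p + b)) (sym (ι-ι φ x)) (sym (ι-ι ψ x)) ⟩
        ι φ (ι φ x) + q + (p + ι ψ (ι ψ x))                            ≡⟨ cong₂ _+_ (sym (ι-form+ φ ψ (ι φ x))) (sym (ι-form+ φ ψ (ι ψ x))) ⟩
        ι s (ι φ x) + ι s (ι ψ x)                                      ≡⟨ sym (ι-+ s (ι φ x) (ι ψ x)) ⟩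
        ι s (ι φ x + ι ψ x)                                            ≡⟨ cong (ι s) (sym (ι-form+ φ ψ x)) ⟩
        ι s (ι s x)                                                    ≡⟨ ι-ι s x ⟩
        𝟎                                                              ∎

    ε-+ : ∀ {n} v (x y : Ext n) → ε v (x + y) ≡ ε v x + ε v y
    ε-+ zero (x & x′) (y & y′) = cong₂ _&_ (sym (+-identityˡ 𝟎)) refl
    ε-+ (suc v) (x & x′) (y & y′) = cong₂ _&_ (ε-+ v x y)
      (trans (cong -_ (ε-+ v x′ y′)) (solve 2 (λ x y → :- (x :+ y) := :- x :+ :- y) refl (ε v x′) (ε v y′)))

    ε-· : ∀ {n} v c (x : Ext n) → ε v (c · x) ≡ c · ε v x
    ε-· zero c (x & x′) = cong₂ _&_ (sym (·𝟎 c)) refl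
    ε-· (suc v) c (x & x′) = cong₂ _&_ (ε-· v c x) (trans (cong -_ (ε-· v c x′)) (sym (·-neg c _)))

    ε-𝟎 : ∀ {n} (v : Fin n) → ε v 𝟎 ≡ 𝟎
    ε-𝟎 v = trans (cong (ε v) (sym (0· 𝟎))) (trans (ε-· v 0# 𝟎) (0· _))

    ε-neg : ∀ {n} v (x : Ext n) → ε v (- x) ≡ - ε v x
    ε-neg v x = begin
      ε v (- x)             ≡⟨ cong (ε v) (trans (cong -_ (sym (1· x))) (sym (neg-· 1# x))) ⟩
      ε v ((Q.- 1#) · x)    ≡⟨ ε-· v (Q.- 1#) x ⟩
      (Q.- 1#) · ε v x      ≡⟨ trans (neg-· 1# _) (cong -_ (1· _)) ⟩
      - ε v x               ∎

    -- The Clifford relation between contraction and exterior multiplication by a generator. Every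
    -- splitting of an element along a vertex rests on it: where `φ v` is invertible, `ε v` provides
    -- preimages, and where `φ v` is zero the two operators anticommute.
    ι-ε : ∀ {n} (φ : Form n) v x → ι φ (ε v x) ≡ φ v · x − ε v (ι φ x)
    ι-ε φ zero (x & y) = cong₂ _&_
      (trans (cong (_+ φ zero · x) (ι-𝟎 _)) (solve 1 (λ x → con (ℤ.+ 0) :+ x := x :- con (ℤ.+ 0)) refl (φ zero · x)))
      (solve 2 (λ p q → :- p := q :- (p :+ q)) refl (ι (φ ∘ suc) x) (φ zero · y))
    ι-ε φ (suc v) (x & y) = cong₂ _&_
      (begin
        ι (φ ∘ suc) (ε v x) + φ zero · (- ε v y)                            ≡⟨ cong₂ _+_ (ι-ε (φ ∘ suc) v x) (·-neg _ _) ⟩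
        φ (suc v) · x − ε v (ι (φ ∘ suc) x) − φ zero · ε v y                ≡⟨ solve 3 (λ a b c → a :- b :- c := a :- (b :+ c)) refl (φ (suc v) · x) (ε v (ι (φ ∘ suc) x)) (φ zero · ε v y) ⟩
        φ (suc v) · x − (ε v (ι (φ ∘ suc) x) + φ zero · ε v y)              ≡⟨ cong (λ t → φ (suc v) · x − (ε v (ι (φ ∘ suc) x) + t)) (sym (ε-· v _ y)) ⟩
        φ (suc v) · x − (ε v (ι (φ ∘ suc) x) + ε v (φ zero · y))            ≡⟨ cong (λ t → φ (suc v) · x − t) (sym (ε-+ v _ _)) ⟩
        φ (suc v) · x − ε v (ι (φ ∘ suc) x + φ zero · y)                    ∎)
      (begin
        - ι (φ ∘ suc) (- ε v y)                    ≡⟨ cong -_ (ι-neg (φ ∘ suc) (ε v y)) ⟩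
        - - ι (φ ∘ suc) (ε v y)                    ≡⟨ cong (λ t → - - t) (ι-ε (φ ∘ suc) v y) ⟩
        - - (φ (suc v) · y − ε v (ι (φ ∘ suc) y))  ≡⟨ solve 2 (λ a b → :- (:- (a :- b)) := a :- :- (:- b)) refl (φ (suc v) · y) (ε v (ι (φ ∘ suc) y)) ⟩
        φ (suc v) · y − - - ε v (ι (φ ∘ suc) y)    ≡⟨ cong (λ t → φ (suc v) · y − - t) (sym (ε-neg v _)) ⟩
        φ (suc v) · y − - ε v (- ι (φ ∘ suc) y)    ∎)

    ∑ : ∀ {n k} → (Fin k → Ext n) → Ext n
    ∑ {k = zero}  f = 𝟎
    ∑ {k = suc k} f = f zero + ∑ (f ∘ suc)

    ∑-cong : ∀ {n k} {f g : Fin k → Ext n} → (∀ i → f i ≡ g i) → ∑ f ≡ ∑ g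
    ∑-cong {k = zero}  h = refl
    ∑-cong {k = suc k} h = cong₂ _+_ (h zero) (∑-cong (h ∘ suc))

    basis : ∀ {n} → Fin n → Form n
    basis zero    zero    = 1#
    basis zero    (suc w) = 0#
    basis (suc v) zero    = 0#
    basis (suc v) (suc w) = basis v w

    basis-diag : ∀ {n} (v : Fin n) → basis v v ≡ 1#
    basis-diag zero    = refl
    basis-diag (suc v) = basis-diag v

    basis-support : ∀ {n} (v w : Fin n) → basis v w ≢ 0# → v ≡ w
    basis-support zero zero _ = refl
    basis-support zero (suc w) h = ⊥-elim (h refl)
    basis-support (suc v) zero h = ⊥-elim (h refl)
    basis-support (suc v) (suc w) h = cong suc (basis-support v w h)

    basis-off : ∀ {n} (v w : Fin n) → v ≢ w → basis v w ≡ 0#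
    basis-off v w v≢w = decidable-stable (basis v w ≟ 0#) (λ h → v≢w (basis-support v w h))

    left right : ∀ {n} → Ext (suc n) → Ext n
    left  (x & y) = x
    right (x & y) = y

    ∑-pair : ∀ {n k} (f : Fin k → Ext (suc n)) → ∑ f ≡ (∑ (left ∘ f) & ∑ (right ∘ f))
    ∑-pair {k = zero} f = refl
    ∑-pair {k = suc k} f with f zero | ∑-pair (f ∘ suc)
    ... | _ & _ | e = cong (_ +_) e

    ι-expand : ∀ {n} (φ : Form n) x → ι φ x ≡ ∑ (λ v → φ v · ι (basis v) x)
    ι-expand φ ⟨ x ⟩ = refl
    ι-expand φ (x & y) = sym (begin
      φ zero · ι (basis zero) (x & y) + ∑ (λ v → φ (suc v) · ι (basis (suc v)) (x & y))
        ≡⟨ cong₂ _+_ (cong (φ zero ·_) head) (∑-pair (λ v → φ (suc v) · ι (basis (suc v)) (x & y))) ⟩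
      (φ zero · y + ∑ (λ v → φ (suc v) · (ι (basis v) x + 0# · y)) & φ zero · 𝟎 + ∑ (λ v → φ (suc v) · (- ι (basis v) y)))
        ≡⟨ cong₂ _&_
           (trans (+-comm _ _) (cong (_+ φ zero · y) (trans (∑-cong (λ v → cong (φ (suc v) ·_) (trans (cong₂ _+_ refl (0· y)) (+-identityʳ _)))) (sym (ι-expand (φ ∘ suc) x)))))
           (trans (cong₂ _+_ (·𝟎 _) refl) (trans (+-identityˡ _) (trans (∑-cong (λ v → ·-neg (φ (suc v)) (ι (basis v) y)))
             (trans (∑-neg (λ v → φ (suc v) · ι (basis v) y)) (cong -_ (sym (ι-expand (φ ∘ suc) y))))))) ⟩
      ι φ (x & y) ∎)
      where
      ι-zero : ∀ {m} (z : Ext m) → ι (λ _ → 0#) z ≡ 𝟎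
      ι-zero z = trans (ι-cong (λ v → sym (QR.zeroˡ 0#)) z) (trans (ι-form· 0# (λ _ → 0#) z) (0· _))
      head : ι (basis zero) (x & y) ≡ (y & 𝟎)
      head = cong₂ _&_ (trans (cong₂ _+_ (ι-zero x) (1· y)) (+-identityˡ y)) (trans (cong -_ (ι-zero y)) -𝟎)
      ∑-neg : ∀ {m k} (f : Fin k → Ext m) → ∑ (λ v → - f v) ≡ - ∑ f
      ∑-neg {k = zero} f = sym -𝟎
      ∑-neg {k = suc k} f = trans (cong (- f zero +_) (∑-neg (f ∘ suc)))
        (solve 2 (λ x y → :- x :+ :- y := :- (x :+ y)) refl (f zero) (∑ (f ∘ suc)))

    coef : ∀ {n} → Ext n → Subset n → R
    coef ⟨ x ⟩ [] = x
    coef (x & y) (outside ∷ A) = coef x A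
    coef (x & y) (inside ∷ A)  = coef y A

    tabulate : ∀ {n} → (Subset n → R) → Ext n
    tabulate {zero}  f = ⟨ f [] ⟩
    tabulate {suc n} f = tabulate (f ∘ (outside ∷_)) & tabulate (f ∘ (inside ∷_))

    coef-tabulate : ∀ {n} (f : Subset n → R) A → coef (tabulate f) A ≡ f A
    coef-tabulate f [] = refl
    coef-tabulate f (outside ∷ A) = coef-tabulate (f ∘ (outside ∷_)) A
    coef-tabulate f (inside ∷ A)  = coef-tabulate (f ∘ (inside ∷_)) A

    coef-+ : ∀ {n} (x y : Ext n) A → coef (x + y) A ≡ coef x A Q.+ coef y A
    coef-+ ⟨ x ⟩ ⟨ y ⟩ [] = refl
    coef-+ (x & _) (y & _) (outside ∷ A) = coef-+ x y A
    coef-+ (_ & x) (_ & y) (inside ∷ A)  = coef-+ x y A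

    coef-neg : ∀ {n} (x : Ext n) A → coef (- x) A ≡ Q.- coef x A
    coef-neg ⟨ x ⟩ [] = refl
    coef-neg (x & _) (outside ∷ A) = coef-neg x A
    coef-neg (_ & x) (inside ∷ A)  = coef-neg x A

    coef-· : ∀ {n} c (x : Ext n) A → coef (c · x) A ≡ c Q.* coef x A
    coef-· c ⟨ x ⟩ [] = refl
    coef-· c (x & _) (outside ∷ A) = coef-· c x A
    coef-· c (_ & x) (inside ∷ A)  = coef-· c x A

    coef-𝟎 : ∀ {n} (A : Subset n) → coef 𝟎 A ≡ 0#
    coef-𝟎 [] = refl
    coef-𝟎 (outside ∷ A) = coef-𝟎 A
    coef-𝟎 (inside ∷ A)  = coef-𝟎 A

    coef-ext : ∀ {n} (x y : Ext n) → (∀ A → coef x A ≡ coef y A) → x ≡ y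
    coef-ext ⟨ x ⟩ ⟨ y ⟩ h = cong ⟨_⟩ (h [])
    coef-ext (x & x′) (y & y′) h = cong₂ _&_ (coef-ext x y (h ∘ (outside ∷_))) (coef-ext x′ y′ (h ∘ (inside ∷_)))

    zero-by-coef : ∀ {n} (x : Ext n) → (∀ A → coef x A ≢ 0# → ⊥) → x ≡ 𝟎
    zero-by-coef x h = coef-ext x 𝟎 λ A → trans (decidable-stable (coef x A ≟ 0#) (h A)) (sym (coef-𝟎 A))

    ≢0-+ : ∀ {x y} → x Q.+ y ≢ 0# → x ≡ 0# → y ≢ 0#
    ≢0-+ h refl y≡0 = h (trans (QR.+-identityˡ _) y≡0)

    ≢0-*ʳ : ∀ {x y} → x Q.* y ≢ 0# → y ≢ 0#
    ≢0-*ʳ h refl = h (QR.zeroʳ _)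

    ≢0-*ˡ : ∀ {x y} → x Q.* y ≢ 0# → x ≢ 0#
    ≢0-*ˡ h refl = h (QR.zeroˡ _)

    ≢0-neg : ∀ {x} → Q.- x ≢ 0# → x ≢ 0#
    ≢0-neg h refl = h (CommutativeRing.trans scalarRing (sym (QR.+-identityˡ _)) (QR.-‿inverseʳ 0#))

    ι-support : ∀ {n} (φ : Form n) x A → coef (ι φ x) A ≢ 0# →
      ∃ λ v → φ v ≢ 0# × lookup A v ≡ outside × coef x (A [ v ]≔ inside) ≢ 0#
    ι-support φ ⟨ x ⟩ [] h = ⊥-elim (h refl)
    ι-support φ (x & y) (inside ∷ A) h
      with ι-support (φ ∘ suc) y A (≢0-neg (λ e → h (trans (coef-neg (ι (φ ∘ suc) y) A) e)))
    ... | v , p , q , r = suc v , p , q , r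
    ι-support φ (x & y) (outside ∷ A) h with coef (ι (φ ∘ suc) x) A ≟ 0#
    ... | no c≢0 with ι-support (φ ∘ suc) x A c≢0
    ...   | v , p , q , r = suc v , p , q , r
    ι-support φ (x & y) (outside ∷ A) h | yes c≡0 = zero , ≢0-*ˡ step , refl , ≢0-*ʳ {φ zero} step
      where
      step : φ zero Q.* coef y A ≢ 0#
      step = ≢0-+ (λ e → h (trans (coef-+ (ι (φ ∘ suc) x) (φ zero · y) A) (trans (cong (_ Q.+_) (coef-· (φ zero) y A)) e))) c≡0

    ε-support : ∀ {n} v (x : Ext n) A → coef (ε v x) A ≢ 0# → lookup A v ≡ inside × coef x (A [ v ]≔ outside) ≢ 0#
    ε-support zero (x & y) (outside ∷ A) h = ⊥-elim (h (coef-𝟎 A))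
    ε-support zero (x & y) (inside ∷ A) h = refl , h
    ε-support (suc v) (x & y) (outside ∷ A) h = ε-support v x A h
    ε-support (suc v) (x & y) (inside ∷ A) h = ε-support v y A (≢0-neg (λ e → h (trans (coef-neg (ε v y) A) e)))

-- Linear algebra modulo a subspace

module LinearAlgebra (Q : Rationals) where
  open Rationals Q hiding (_+_; _*_; -_)
  open Exterior Q
  private
    module Q = Rationals Q
    module QR = CommutativeRing scalarRing
    module QS = FromInteger.Solver scalarRing
    module S = SemiringSum QR.semiring
  open ES using (solve; _:+_; _:*_; :-_; _:=_; _:-_; con)
  open ≡-Reasoning

  opaque
    unfolding ∑ _+_

    ∑-+ : ∀ {n k} (f g : Fin k → Ext n) → ∑ (λ i → f i + g i) ≡ ∑ f + ∑ g
    ∑-+ {k = zero}  f g = sym (+-identityˡ 𝟎)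
    ∑-+ {k = suc k} f g = trans (cong (f zero + g zero +_) (∑-+ (f ∘ suc) (g ∘ suc)))
      (solve 4 (λ a b c d → a :+ b :+ (c :+ d) := a :+ c :+ (b :+ d)) refl (f zero) (g zero) (∑ (f ∘ suc)) (∑ (g ∘ suc)))

    ∑-map : ∀ {m n k} (L : Ext m → Ext n) → L 𝟎 ≡ 𝟎 → (∀ x y → L (x + y) ≡ L x + L y) →
            (f : Fin k → Ext m) → L (∑ f) ≡ ∑ (L ∘ f)
    ∑-map {k = zero}  L L𝟎 L+ f = L𝟎
    ∑-map {k = suc k} L L𝟎 L+ f = trans (L+ _ _) (cong (L (f zero) +_) (∑-map L L𝟎 L+ (f ∘ suc)))

    ∑-𝟎 : ∀ {n k} → ∑ {n} {k} (λ _ → 𝟎) ≡ 𝟎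
    ∑-𝟎 {k = zero}  = refl
    ∑-𝟎 {k = suc k} = trans (+-identityˡ _) (∑-𝟎 {k = k})

    ∑-swap : ∀ {n k l} (f : Fin k → Fin l → Ext n) → ∑ (λ i → ∑ (f i)) ≡ ∑ (λ j → ∑ (λ i → f i j))
    ∑-swap {k = zero} {l} f = sym (∑-𝟎 {k = l})
    ∑-swap {k = suc k} f = trans (cong (∑ (f zero) +_) (∑-swap (f ∘ suc))) (sym (∑-+ (f zero) (λ j → ∑ (λ i → f (suc i) j))))

    ∑-scalar : ∀ {n k} (c : Fin k → R) (x : Ext n) → ∑ (λ i → c i · x) ≡ S.sum c · x
    ∑-scalar {k = zero}  c x = sym (0· x)
    ∑-scalar {k = suc k} c x = trans (cong (c zero · x +_) (∑-scalar (c ∘ suc) x)) (sym (+-· _ _ x))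

  lc : ∀ {n k} → (Fin k → R) → (Fin k → Ext n) → Ext n
  lc c v = ∑ (λ i → c i · v i)

  lc-cong : ∀ {n k} {c d : Fin k → R} {v : Fin k → Ext n} → (∀ i → c i ≡ d i) → lc c v ≡ lc d v
  lc-cong {v = v} h = ∑-cong (λ i → cong (_· v i) (h i))

  lc-+ : ∀ {n k} (c d : Fin k → R) (v : Fin k → Ext n) → lc (λ i → c i Q.+ d i) v ≡ lc c v + lc d v
  lc-+ c d v = trans (∑-cong (λ i → +-· (c i) (d i) (v i))) (∑-+ _ _)

  lc-· : ∀ {n k} a (c : Fin k → R) (v : Fin k → Ext n) → lc (λ i → a Q.* c i) v ≡ a · lc c v
  lc-· a c v = trans (∑-cong (λ i → *-· a (c i) (v i))) (sym (∑-map (a ·_) (·𝟎 a) (·-+ a) _))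

  lc-neg : ∀ {n k} (c : Fin k → R) (v : Fin k → Ext n) → lc (λ i → Q.- c i) v ≡ - lc c v
  lc-neg c v = trans (∑-cong (λ i → neg-· (c i) (v i)))
    (sym (∑-map -_ -𝟎 (λ x y → solve 2 (λ x y → :- (x :+ y) := :- x :+ :- y) refl x y) _))

  lc-𝟎 : ∀ {n k} (v : Fin k → Ext n) → lc (λ _ → 0#) v ≡ 𝟎
  lc-𝟎 {k = k} v = trans (∑-cong (λ i → 0· (v i))) (∑-𝟎 {k = k})

  lc-vectors− : ∀ {n k} (c : Fin k → R) (v w : Fin k → Ext n) → lc c (λ i → v i − w i) ≡ lc c v − lc c w
  lc-vectors− c v w = begin
    lc c (λ i → v i − w i)                     ≡⟨ ∑-cong (λ i → ·-+ (c i) (v i) (- w i)) ⟩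
    ∑ (λ i → c i · v i + c i · (- w i))        ≡⟨ ∑-+ _ _ ⟩
    lc c v + ∑ (λ i → c i · (- w i))           ≡⟨ cong (lc c v +_) (trans (∑-cong (λ i → ·-neg (c i) (w i))) (trans (∑-cong (λ i → sym (neg-· (c i) (w i)))) (lc-neg c w))) ⟩
    lc c v − lc c w                            ∎

  lc-lc : ∀ {n k l} (c : Fin k → R) (M : Fin k → Fin l → R) (u : Fin l → Ext n) →
          lc c (λ i → lc (M i) u) ≡ lc (λ j → S.sum (λ i → c i Q.* M i j)) u
  lc-lc c M u = begin
    ∑ (λ i → c i · lc (M i) u)                     ≡⟨ ∑-cong (λ i → sym (lc-· (c i) (M i) u)) ⟩
    ∑ (λ i → ∑ (λ j → (c i Q.* M i j) · u j))      ≡⟨ ∑-swap _ ⟩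
    ∑ (λ j → ∑ (λ i → (c i Q.* M i j) · u j))      ≡⟨ ∑-cong (λ j → ∑-scalar (λ i → c i Q.* M i j) (u j)) ⟩
    lc (λ j → S.sum (λ i → c i Q.* M i j)) u       ∎

  opaque
    unfolding ∑ basis

    lc-basis : ∀ {n k} (i : Fin k) (v : Fin k → Ext n) → lc (basis i) v ≡ v i
    lc-basis zero v = trans (cong₂ _+_ (1· (v zero)) (lc-𝟎 (v ∘ suc))) (+-identityʳ _)
    lc-basis (suc i) v = trans (cong₂ _+_ (0· (v zero)) (lc-basis i (v ∘ suc))) (+-identityˡ _)

  infixr 5 _◂_
  _◂_ : ∀ {a} {A : Set a} {k} → A → (Fin k → A) → Fin (suc k) → A
  (x ◂ f) zero    = x
  (x ◂ f) (suc i) = f i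

  opaque
    unfolding ∑

    ∑-suc : ∀ {n k} (f : Fin (suc k) → Ext n) → ∑ f ≡ f zero + ∑ (f ∘ suc)
    ∑-suc f = refl

    ∑-empty : ∀ {n} (f : Fin 0 → Ext n) → ∑ f ≡ 𝟎
    ∑-empty f = refl

    lc-suc : ∀ {n k} (c : Fin (suc k) → R) (v : Fin (suc k) → Ext n) → lc c v ≡ c zero · v zero + lc (c ∘ suc) (v ∘ suc)
    lc-suc c v = refl

    lc-empty : ∀ {n} (c : Fin 0 → R) (v : Fin 0 → Ext n) → lc c v ≡ 𝟎
    lc-empty c v = refl

  dimExt : ℕ → ℕ
  dimExt zero    = 1
  dimExt (suc n) = dimExt n ℕ.+ dimExt n

  coord : ∀ {n} → Ext n → Fin (dimExt n) → R
  coord ⟨ x ⟩ i = x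
  coord {suc n} (x & y) i = [ coord x , coord y ]′ (splitAt (dimExt n) i)

  opaque
    unfolding _+_

    coord-zero : ∀ {n} (x : Ext n) → (∀ i → coord x i ≡ 0#) → x ≡ 𝟎
    coord-zero ⟨ x ⟩ h = cong ⟨_⟩ (h zero)
    coord-zero {suc n} (x & y) h = cong₂ _&_
      (coord-zero x (λ i → trans (cong [ coord x , coord y ]′ (sym (Finₚ.splitAt-↑ˡ (dimExt n) i (dimExt n)))) (h (i ↑ˡ dimExt n))))
      (coord-zero y (λ i → trans (cong [ coord x , coord y ]′ (sym (Finₚ.splitAt-↑ʳ (dimExt n) (dimExt n) i))) (h (dimExt n ↑ʳ i))))

    coord-+ : ∀ {n} (x y : Ext n) i → coord (x + y) i ≡ coord x i Q.+ coord y i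
    coord-+ ⟨ x ⟩ ⟨ y ⟩ i = refl
    coord-+ {suc n} (x & x′) (y & y′) i with splitAt (dimExt n) i
    ... | inj₁ j = coord-+ x y j
    ... | inj₂ j = coord-+ x′ y′ j

    coord-· : ∀ {n} c (x : Ext n) i → coord (c · x) i ≡ c Q.* coord x i
    coord-· c ⟨ x ⟩ i = refl
    coord-· {suc n} c (x & x′) i with splitAt (dimExt n) i
    ... | inj₁ j = coord-· c x j
    ... | inj₂ j = coord-· c x′ j

  coord-lc : ∀ {n k} (c : Fin k → R) (v : Fin k → Ext n) j → coord (lc c v) j ≡ S.sum (λ i → c i Q.* coord (v i) j)
  coord-lc {k = zero} c v j = trans (cong (λ x → coord x j) (trans (lc-empty c v) (sym (0· 𝟎)))) (trans (coord-· 0# 𝟎 j) (QR.zeroˡ _))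
  coord-lc {k = suc k} c v j = trans (cong (λ x → coord x j) (lc-suc c v)) (trans (coord-+ (c zero · v zero) (lc (c ∘ suc) (v ∘ suc)) j)
    (cong₂ Q._+_ (coord-· (c zero) (v zero) j) (coord-lc (c ∘ suc) (v ∘ suc) j)))

  dependent : ∀ {n k} (v : Fin k → Ext n) → dimExt n < k →
    ¬ ¬ (∃ λ (c : Fin k → R) → (∃ λ i → c i ≢ 0#) × lc c v ≡ 𝟎)
  dependent v big =
    Dependence.nonzero-solution scalarField (λ i → coord (v i)) big >>= λ (c , c≢0 , eqs) →
    return (c , c≢0 , coord-zero _ (λ j → trans (coord-lc c v j) (eqs j)))

  record IsSubspace {n} (P : Ext n → Set) : Set where
    field
      𝟎∈ : P 𝟎
      +∈ : ∀ {x y} → P x → P y → P (x + y)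
      ·∈ : ∀ c {x} → P x → P (c · x)

    neg∈ : ∀ {x} → P x → P (- x)
    neg∈ {x} p = subst P (trans (neg-· 1# x) (cong -_ (1· x))) (·∈ (Q.- 1#) p)

    −∈ : ∀ {x y} → P x → P y → P (x − y)
    −∈ p q = +∈ p (neg∈ q)

    cancel∈ : ∀ {x y} → P (x − y) → P y → P x
    cancel∈ {x} {y} p q = subst P (solve 2 (λ x y → x :- y :+ y := x) refl x y) (+∈ p q)

    cancel∈ˡ : ∀ {x y} → P (x − y) → P x → P y
    cancel∈ˡ {x} {y} p q = subst P (solve 2 (λ x y → x :- (x :- y) := y) refl x y) (−∈ q p)

    ∑∈ : ∀ {k} {f : Fin k → Ext n} → (∀ i → P (f i)) → P (∑ f)
    ∑∈ {zero}  {f} h = subst P (sym (∑-empty f)) 𝟎∈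
    ∑∈ {suc k} {f} h = subst P (sym (∑-suc f)) (+∈ (h zero) (∑∈ (h ∘ suc)))

    lc∈ : ∀ {k} (c : Fin k → R) {v : Fin k → Ext n} → (∀ i → P (v i)) → P (lc c v)
    lc∈ c h = ∑∈ (λ i → ·∈ (c i) (h i))

  IndependentMod : ∀ {n k} → (Ext n → Set) → (Fin k → Ext n) → Set
  IndependentMod B v = ∀ c → B (lc c v) → ∀ i → c i ≡ 0#

  SpanMod : ∀ {n k} → (Ext n → Set) → (Fin k → Ext n) → Ext n → Set
  SpanMod B v z = ∃ λ c → B (z − lc c v)

  BasisMod : ∀ {n} → (Ext n → Set) → (Ext n → Set) → Set
  BasisMod {n} B Z = ∃ λ k → Σ (Fin k → Ext n) λ v →
    (∀ i → Z (v i)) × IndependentMod B v × (∀ z → Z z → ¬ ¬ SpanMod B v z)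

  module _ {n} {B : Ext n → Set} (Bsub : IsSubspace B) where
    open IsSubspace Bsub

    independent-bound : ∀ {k} (v : Fin k → Ext n) → IndependentMod B v → k ≤ dimExt n
    independent-bound {k} v ind = decidable-stable (k ℕ.≤? dimExt n) λ k≰ →
      dependent v (ℕₚ.≰⇒> k≰) (λ (c , (i , ci≢0) , e) → ci≢0 (ind c (subst B (sym e) 𝟎∈) i))

    extend-independent : ∀ {k} (v : Fin k → Ext n) z → IndependentMod B v → ¬ SpanMod B v z → IndependentMod B (z ◂ v)
    extend-independent v z ind z∉ c Blc = λ { zero → c₀≡0 ; (suc i) → ind (c ∘ suc) (subst B drop Blc) i }
      where
      c₀≡0 : c zero ≡ 0#
      c₀≡0 = decidable-stable (c zero ≟ 0#) λ c₀≢0 → let (d , cd≡1) = inverse (c zero) c₀≢0 in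
        z∉ ((λ i → (Q.- d) Q.* c (suc i)) , subst B (begin
          d · lc c (z ◂ v)                                       ≡⟨ cong (d ·_) (lc-suc c (z ◂ v)) ⟩
          d · (c zero · z + lc (c ∘ suc) v)                      ≡⟨ ·-+ d _ _ ⟩
          d · (c zero · z) + d · lc (c ∘ suc) v                  ≡⟨ cong₂ _+_ (trans (sym (*-· d (c zero) z)) (trans (cong (_· z) (trans (QR.*-comm d _) cd≡1)) (1· z)))
                                                                     (solve 1 (λ x → x := :- (:- x)) refl (d · lc (c ∘ suc) v)) ⟩
          z − - (d · lc (c ∘ suc) v)                             ≡⟨ cong (z −_) (trans (sym (neg-· d _)) (sym (lc-· (Q.- d) (c ∘ suc) v))) ⟩
          z − lc (λ i → (Q.- d) Q.* c (suc i)) v                 ∎) (·∈ d Blc))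
      drop : lc c (z ◂ v) ≡ lc (c ∘ suc) v
      drop = trans (lc-suc c (z ◂ v)) (trans (cong (_+ lc (c ∘ suc) v) (trans (cong (_· z) c₀≡0) (0· z))) (+-identityˡ _))

    -- `dimExt n` bounds every independent family, so greedy enlargement stops before the fuel is
    -- spent; the case without fuel is contradictory.
    basis-mod : ∀ (Z : Ext n → Set) → ¬ ¬ BasisMod B Z
    basis-mod Z = grow (suc (dimExt n)) 0 (λ ()) (λ ()) (λ _ _ ()) refl
      where
      grow : ∀ fuel k (v : Fin k → Ext n) → (∀ i → Z (v i)) → IndependentMod B v → k ℕ.+ fuel ≡ suc (dimExt n) → ¬ ¬ BasisMod B Z
      grow zero k v Zv ind e = λ _ → ℕₚ.1+n≰n (subst (_≤ dimExt n) (trans (sym (ℕₚ.+-identityʳ k)) e) (independent-bound v ind))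
      grow (suc fuel) k v Zv ind e =
        ¬¬-excluded-middle {A = ∃ λ z → Z z × ¬ SpanMod B v z} >>= λ where
          (yes (z , Zz , z∉)) → grow fuel (suc k) (z ◂ v) (λ { zero → Zz ; (suc i) → Zv i })
            (extend-independent v z ind z∉) (trans (sym (ℕₚ.+-suc k fuel)) e)
          (no none) → return (k , v , Zv , ind , λ z Zz z∉ → none (z , Zz , z∉))

    -- The coordinates of the `v i` with respect to `u` form a linear system; with `m < k` it has a
    -- nonzero solution, which is a relation among the `v i`.
    steinitz : ∀ {k m} (v : Fin k → Ext n) (u : Fin m → Ext n) → IndependentMod B v → (∀ i → ¬ ¬ SpanMod B u (v i)) → k ≤ m
    steinitz {k} {m} v u ind spans = decidable-stable (k ℕ.≤? m) λ k≰m → contradict (ℕₚ.≰⇒> k≰m) (λ x → x)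
      where
      contradict : m < k → ¬ ¬ ⊥
      contradict m<k =
        ¬¬-choice spans >>= λ span →
        Dependence.nonzero-solution scalarField (λ i → proj₁ (span i)) m<k >>= λ (x , (i , xi≢0) , eqs) →
        return (xi≢0 (ind x (cancel∈ (subst B (lc-vectors− x v (λ i → lc (proj₁ (span i)) u)) (lc∈ x (λ i → proj₂ (span i))))
          (subst B (sym (trans (lc-lc x (λ i → proj₁ (span i)) u) (trans (lc-cong eqs) (lc-𝟎 u)))) 𝟎∈)) i))

  -- Maps on a quotient are given by choosing preimages that exist only under double negation. A
  -- linear relation records such a map without making the choices; being well defined is then the
  -- condition that it carries `B` into `B`.
  record IsLinear {n} (ρ : Ext n → Ext n → Set) : Set where
    field
      𝟎ρ : ρ 𝟎 𝟎
      +ρ : ∀ {x x′ y y′} → ρ x x′ → ρ y y′ → ρ (x + y) (x′ + y′)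
      ·ρ : ∀ c {x x′} → ρ x x′ → ρ (c · x) (c · x′)

    −ρ : ∀ {x x′ y y′} → ρ x x′ → ρ y y′ → ρ (x − y) (x′ − y′)
    −ρ {y = y} {y′} p q = +ρ p (subst (λ t → ρ t (- y′)) (negate y) (subst (ρ _) (negate y′) (·ρ (Q.- 1#) q)))
      where
      negate : ∀ (x : Ext n) → (Q.- 1#) · x ≡ - x
      negate x = trans (neg-· 1# x) (cong -_ (1· x))

    lcρ : ∀ {k} (c : Fin k → R) {v w : Fin k → Ext n} → (∀ i → ρ (v i) (w i)) → ρ (lc c v) (lc c w)
    lcρ {zero}  c {v} {w} h = subst (λ t → ρ t (lc c w)) (sym (lc-empty c v)) (subst (ρ 𝟎) (sym (lc-empty c w)) 𝟎ρ)
    lcρ {suc k} c {v} {w} h = subst (λ t → ρ t (lc c w)) (sym (lc-suc c v)) (subst (ρ _) (sym (lc-suc c w))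
      (+ρ (·ρ (c zero) (h zero)) (lcρ (c ∘ suc) (h ∘ suc))))

  module _ {n} {Z B : Ext n → Set} (Zsub : IsSubspace Z) (Bsub : IsSubspace B) (B-stable : ∀ {x} → ¬ ¬ B x → B x) where
    private
      module ZS = IsSubspace Zsub
      module BS = IsSubspace Bsub

    -- ρ is an endomorphism of Z / B, given as a linear relation.
    surjective⇒injective : {ρ : Ext n → Ext n → Set} → IsLinear ρ →
      (∀ z → Z z → ¬ ¬ (∃ λ y → Z y × ρ y z)) → (∀ {x y} → ρ x y → B x → B y) →
      ∀ {x y} → Z x → ρ x y → B y → B x
    surjective⇒injective {ρ} lin surj wd {x} {y} Zx ρxy By = B-stable λ x∉B → contradict x∉B (λ z → z)
      where
      open IsLinear lin
      contradict : ¬ B x → ¬ ¬ ⊥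
      contradict x∉B =
        basis-mod Bsub Z >>= λ (k , v , Zv , ind , span) →
        ¬¬-choice (λ i → surj (v i) (Zv i)) >>= λ pre →
        -- Preimages of a basis are independent. An `x` outside `B` that is sent into `B` would stay
        -- independent of them, giving one vector more than the basis has.
        let p = λ i → proj₁ (pre i)
            pind : IndependentMod B p
            pind c Bc = ind c (wd (lcρ c (λ i → proj₂ (proj₂ (pre i)))) Bc)
            xind : IndependentMod B (x ◂ p)
            xind = extend-independent Bsub p x pind λ (c , Bc) →
              x∉B (BS.cancel∈ Bc (subst B (sym (trans (lc-cong (ind c (BS.cancel∈ˡ (wd (−ρ ρxy (lcρ c (λ i → proj₂ (proj₂ (pre i))))) Bc) By))) (lc-𝟎 p))) BS.𝟎∈))
        in return (ℕₚ.1+n≰n (steinitz Bsub (x ◂ p) v xind λ { zero → span x Zx ; (suc i) → span (p i) (proj₁ (proj₂ (pre i))) }))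

    -- Modulo `B`, the coordinates of a composite are given by the product of the coordinate
    -- matrices; this is what makes traces of linear relations available.
    compose-mod : ∀ {k} {v : Fin k → Ext n} {ρ : Ext n → Ext n → Set} → IsLinear ρ → (∀ {x y} → ρ x y → B x → B y) →
      ∀ {M} {N : Fin k → Fin k → R} {x y} {w : Fin k → Ext n} → B (x − lc M v) → ρ x y → (∀ i → ρ (v i) (w i)) → (∀ i → B (w i − lc (N i) v)) →
      B (y − lc (λ j → S.sum (λ l → M l Q.* N l j)) v)
    compose-mod {v = v} lin wd {M} {N} {x} {y} {w} Bx ρxy ρvw Bw =
      subst B (solve 3 (λ a b c → a :- b :+ (b :- c) := a :- c) refl y (lc M w) (lc (λ j → S.sum (λ l → M l Q.* N l j)) v))
        (BS.+∈ (wd (IsLinear.−ρ lin ρxy (IsLinear.lcρ lin M ρvw)) Bx)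
          (subst B (trans (lc-vectors− M w (λ l → lc (N l) v)) (cong (lc M w −_) (lc-lc M N v))) (BS.lc∈ M Bw)))

    -- The commutator of two endomorphisms of Z / B has trace 0, but here it is the identity.
    commutator-one : {δ γ : Ext n → Ext n → Set} → IsLinear δ → IsLinear γ →
      (∀ {x y} → δ x y → B x → B y) → (∀ {x y} → γ x y → B x → B y) →
      (∀ z → Z z → ¬ ¬ (∃ λ d → Z d × δ z d × ∃ λ g → Z g × γ z g × ∃ λ g′ → γ d g′ × ∃ λ h → δ g h × B (z − (g′ − h)))) →
      ∀ z → Z z → B z
    commutator-one {δ} {γ} δlin γlin δwd γwd relations z Zz = B-stable (
      basis-mod Bsub Z >>= λ (k , v , Zv , ind , span) →
      ¬¬-choice (λ i → relations (v i) (Zv i)) >>= λ rel →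
      ¬¬-choice (λ i → span (proj₁ (rel i)) (proj₁ (proj₂ (rel i)))) >>= λ sd →
      ¬¬-choice (λ i → span (proj₁ (proj₂ (proj₂ (proj₂ (rel i))))) (proj₁ (proj₂ (proj₂ (proj₂ (proj₂ (rel i))))))) >>= λ sg →
      span z Zz >>= λ (c , Bz) →
      return (finish k v ind (λ i → proj₁ (sd i)) (λ i → proj₁ (sg i))
        (λ i → let (d , Zd , vd , g , Zg , vg , g′ , dg′ , h , gh , Bv) = rel i in g′ , h ,
          compose-mod γlin γwd (proj₂ (sd i)) dg′ (λ l → proj₁ (proj₂ (proj₂ (proj₂ (proj₂ (proj₂ (rel l))))))) (λ l → proj₂ (sg l)) ,
          compose-mod δlin δwd (proj₂ (sg i)) gh (λ l → proj₁ (proj₂ (proj₂ (rel l)))) (λ l → proj₂ (sd l)) , Bv)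
        c Bz))
      where
      trace-swap : ∀ {k} (M N : Fin k → Fin k → R) →
        S.sum (λ i → S.sum (λ l → M i l Q.* N l i)) ≡ S.sum (λ i → S.sum (λ l → N i l Q.* M l i))
      trace-swap M N = trans (S.∑-comm (λ i l → M i l Q.* N l i)) (S.sum-cong-≋ (λ l → S.sum-cong-≋ (λ i → QR.*-comm (M i l) (N l i))))
      sum-ones : ∀ k → S.sum {k} (λ _ → 1#) ≡ fromℤ (ℤ.+ k)
      sum-ones zero    = refl
      sum-ones (suc k) = cong (1# Q.+_) (sum-ones k)
      sum-sub : ∀ {k} (f g : Fin k → R) → S.sum (λ i → f i Q.+ Q.- g i) ≡ S.sum f Q.+ Q.- S.sum g
      sum-sub {zero} f g = sym (QR.-‿inverseʳ 0#)
      sum-sub {suc k} f g = trans (cong (f zero Q.+ Q.- g zero Q.+_) (sum-sub (f ∘ suc) (g ∘ suc)))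
        (QS.solve 4 (λ a b c d → (a QS.:- b) QS.:+ (c QS.:- d) QS.:= (a QS.:+ c) QS.:- (b QS.:+ d)) refl (f zero) (g zero) (S.sum (f ∘ suc)) (S.sum (g ∘ suc)))
      finish : ∀ k (v : Fin k → Ext n) → IndependentMod B v → (M N : Fin k → Fin k → R) →
        (∀ i → ∃ λ g → ∃ λ h → B (g − lc (λ j → S.sum (λ l → M i l Q.* N l j)) v) ×
                               B (h − lc (λ j → S.sum (λ l → N i l Q.* M l j)) v) × B (v i − (g − h))) →
        ∀ c → B (z − lc c v) → B z
      finish zero v ind M N eqs c Bz = BS.cancel∈ Bz (subst B (sym (lc-empty c v)) BS.𝟎∈)
      -- The identity matrix of size `k` would be a commutator of matrices, so its trace `k` would
      -- be 0. Characteristic 0 refutes this.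
      finish k@(suc k′) v ind M N eqs c Bz = ⊥-elim (fromℕ-suc≢0 k′ (begin
        fromℤ (ℤ.+ k)                                  ≡⟨ sym (sum-ones k) ⟩
        S.sum {k} (λ _ → 1#)                           ≡⟨ S.sum-cong-≋ {k} diagonal ⟩
        S.sum (λ i → P i i Q.+ Q.- P′ i i)             ≡⟨ sum-sub (λ i → P i i) (λ i → P′ i i) ⟩
        S.sum (λ i → P i i) Q.+ Q.- S.sum (λ i → P′ i i) ≡⟨ cong (Q._+ Q.- S.sum (λ i → P′ i i)) (trace-swap M N) ⟩
        S.sum (λ i → P′ i i) Q.+ Q.- S.sum (λ i → P′ i i) ≡⟨ QR.-‿inverseʳ _ ⟩
        0#                                             ∎))
        where
        P P′ : Fin k → Fin k → R
        P  i j = S.sum (λ l → M i l Q.* N l j)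
        P′ i j = S.sum (λ l → N i l Q.* M l j)
        coefficient : Fin k → Fin k → R
        coefficient i j = basis i j Q.+ Q.- (P i j Q.+ Q.- P′ i j)
        expand : ∀ i → lc (coefficient i) v ≡ v i − (lc (P i) v − lc (P′ i) v)
        expand i = trans (lc-+ (basis i) (λ j → Q.- (P i j Q.+ Q.- P′ i j)) v) (cong₂ _+_ (lc-basis i v)
          (trans (lc-neg (λ j → P i j Q.+ Q.- P′ i j) v) (cong -_ (trans (lc-+ (P i) (λ j → Q.- P′ i j) v) (cong (lc (P i) v +_) (lc-neg (P′ i) v))))))
        vanish : ∀ i → B (lc (coefficient i) v)
        vanish i = let (g , h , Bg , Bh , Bv) = eqs i in subst B
          (trans (solve 5 (λ v g h p q → v :- (g :- h) :+ (g :- p) :- (h :- q) := v :- (p :- q)) refl (v i) g h (lc (P i) v) (lc (P′ i) v)) (sym (expand i)))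
          (BS.−∈ (BS.+∈ Bv Bg) Bh)
        diagonal : ∀ i → 1# ≡ P i i Q.+ Q.- P′ i i
        diagonal i = begin
          1#                 ≡⟨ sym (basis-diag i) ⟩
          basis i i          ≡⟨ QS.solve 2 (λ b p → b QS.:= (b QS.:- p) QS.:+ p) refl (basis i i) (P i i Q.+ Q.- P′ i i) ⟩
          coefficient i i Q.+ (P i i Q.+ Q.- P′ i i) ≡⟨ cong (Q._+ (P i i Q.+ Q.- P′ i i)) (ind (coefficient i) (vanish i) i) ⟩
          0# Q.+ (P i i Q.+ Q.- P′ i i) ≡⟨ QR.+-identityˡ _ ⟩
          P i i Q.+ Q.- P′ i i ∎

-- Sizes of subsets and links of vertices

∧-split : ∀ {a b} → a ∧ b ≡ true → a ≡ true × b ≡ true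
∧-split {true} {true} _ = refl , refl

∧-join : ∀ {a b} → a ≡ true → b ≡ true → a ∧ b ≡ true
∧-join refl refl = refl

size-insert : ∀ {n} (A : Subset n) v → lookup A v ≡ outside → ∣ A [ v ]≔ inside ∣ ≡ suc ∣ A ∣
size-insert (outside ∷ A) zero e = refl
size-insert (outside ∷ A) (suc v) e = size-insert A v e
size-insert (inside ∷ A) (suc v) e = cong suc (size-insert A v e)

size-delete : ∀ {n} (A : Subset n) v → lookup A v ≡ inside → ∣ A ∣ ≡ suc ∣ A [ v ]≔ outside ∣
size-delete (inside ∷ A) zero e = refl
size-delete (outside ∷ A) (suc v) e = size-delete A v e
size-delete (inside ∷ A) (suc v) e = cong suc (size-delete A v e)

linkᵥ : ∀ {n} → Fin n → Family n → Family n
linkᵥ v Γ A = not (lookup A v) ∧ Γ (A [ v ]≔ inside)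

DownClosed : ∀ {n} → Family n → Set
DownClosed Γ = ∀ A v → Γ (A [ v ]≔ inside) ≡ true → Γ A ≡ true

not-inside : ∀ {b} → not b ≡ true → b ≡ outside
not-inside {false} _ = refl

link-downClosed : ∀ {n} {Γ : Family n} v → DownClosed Γ → DownClosed (linkᵥ v Γ)
link-downClosed {Γ = Γ} v dc A w h with v Finₚ.≟ w | ∧-split {not (lookup (A [ w ]≔ inside) v)} h
... | yes refl | p , q = ⊥-elim (absurd (trans (sym (cong not (Vecₚ.lookup∘updateAt v A))) p))
  where absurd : ¬ (false ≡ true)
        absurd ()
... | no v≢w | p , q = ∧-join
  (trans (cong not (sym (Vecₚ.lookup∘updateAt′ v w v≢w A))) p)
  (dc _ w (trans (cong Γ (Vecₚ.[]≔-commutes A v w v≢w)) q))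

-- Face spaces inside the exterior algebra

module Contraction (Q : Rationals) where
  open Rationals Q hiding (_+_; _*_; -_)
  open Exterior Q
  open LinearAlgebra Q
  private
    module Q = Rationals Q
    module QR = CommutativeRing scalarRing
    module QS = FromInteger.Solver scalarRing
  open ES using (solve; _:+_; _:*_; :-_; _:=_; _:-_; con)
  open ≡-Reasoning

  In : ∀ {n} → Family n → ℕ → Ext n → Set
  In Γ i z = ∀ A → coef z A ≢ 0# → Γ A ≡ true × ∣ A ∣ ≡ i

  In-subspace : ∀ {n} {Γ : Family n} {i} → IsSubspace (In Γ i)
  In-subspace = record
    { 𝟎∈ = λ A h → ⊥-elim (h (coef-𝟎 A))
    ; +∈ = λ {x} {y} p q A h → add x y p q A h
    ; ·∈ = λ c {x} p A h → p A (≢0-*ʳ {c} (λ e → h (trans (coef-· c x A) e))) }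
    where
    add : ∀ {n} {Γ : Family n} {i} x y → In Γ i x → In Γ i y → In Γ i (x + y)
    add x y p q A h with coef x A ≟ 0#
    ... | no ≢0 = p A ≢0
    ... | yes ≡0 = q A (≢0-+ (λ e → h (trans (coef-+ x y A) e)) ≡0)

  private module InS {n} {Γ : Family n} {i} = IsSubspace (In-subspace {n} {Γ} {i})

  ι-In : ∀ {n} {Γ : Family n} {i z} → DownClosed Γ → ∀ φ → In Γ (suc i) z → In Γ i (ι φ z)
  ι-In {z = z} dc φ p A h with ι-support φ z A h
  ... | v , _ , A∌v , c≢0 with p _ c≢0
  ...   | q , e = dc A v q , ℕₚ.suc-injective (trans (sym (size-insert A v A∌v)) e)

  ι-In₀ : ∀ {n} {Γ : Family n} {z} φ → In Γ 0 z → ι φ z ≡ 𝟎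
  ι-In₀ {z = z} φ p = zero-by-coef _ λ A h → let (v , _ , A∌v , c≢0) = ι-support φ z A h in
    ℕₚ.1+n≢0 (trans (sym (size-insert A v A∌v)) (proj₂ (p _ c≢0)))

  ι-link : ∀ {n} {Γ : Family n} {i z} v → In Γ (suc i) z → In (linkᵥ v Γ) i (ι (basis v) z)
  ι-link {z = z} v p A h with ι-support (basis v) z A h
  ... | w , b≢0 , A∌w , c≢0 with basis-support v w b≢0
  ...   | refl with p _ c≢0
  ...     | q , e = ∧-join (cong not A∌w) q , ℕₚ.suc-injective (trans (sym (size-insert A v A∌w)) e)

  ε-link : ∀ {n} {Γ : Family n} {i z} v → In (linkᵥ v Γ) i z → In Γ (suc i) (ε v z)
  ε-link {Γ = Γ} {z = z} v p A h with ε-support v z A h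
  ... | A∋v , c≢0 with p _ c≢0
  ...   | q , e = trans (cong Γ (sym (trans (Vecₚ.[]≔-idempotent A v) (trans (cong (A [ v ]≔_) (sym A∋v)) (Vecₚ.[]≔-lookup A v)))))
                    (proj₂ (∧-split {not (lookup (A [ v ]≔ outside) v)} q))
                , trans (size-delete A v A∋v) (cong suc e)

  link-In : ∀ {n} {Γ : Family n} {i z} → DownClosed Γ → ∀ v → In (linkᵥ v Γ) i z → In Γ i z
  link-In dc v p A h with p A h
  ... | q , e = dc A v (proj₂ (∧-split {not (lookup A v)} q)) , e

  link-ι : ∀ {n} {Γ : Family n} {i z} v → In (linkᵥ v Γ) i z → ι (basis v) z ≡ 𝟎
  link-ι {z = z} v p = zero-by-coef _ λ A h → let (w , b≢0 , A∌w , c≢0) = ι-support (basis v) z A h in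
    inside≢outside (trans (sym (Vecₚ.lookup∘updateAt w A))
      (subst (λ w → lookup (A [ w ]≔ inside) w ≡ outside) (basis-support v w b≢0)
        (not-inside (proj₁ (∧-split (proj₁ (p _ (subst (λ w → coef z (A [ w ]≔ inside) ≢ 0#) (sym (basis-support v w b≢0)) c≢0))))))))
    where
    inside≢outside : ¬ (inside ≡ outside)
    inside≢outside ()

  one : ∀ {n} → Form n
  one _ = 1#

  -- Contraction by `one` is the boundary operator, so this is the vanishing of reduced homology at
  -- the faces with `i` elements.
  Exact : ∀ {n} → Family n → ℕ → Set
  Exact Γ i = ∀ z → In Γ i z → ι one z ≡ 𝟎 → ¬ ¬ (∃ λ y → In Γ (suc i) y × ι one y ≡ z)

  -- The void family is allowed, as the link of a non-vertex.
  CM : ∀ {n} → Family n → ℕ → Set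
  CM Γ zero    = ⊤
  CM Γ (suc r) = (∀ i → i ≤ r → Exact Γ i) × (∀ v → CM (linkᵥ v Γ) r)

  Nonvanishing : ∀ {n} → Form n → Set
  Nonvanishing β = ∀ v → β v ≢ 0#

  *≢0 : ∀ {x y} → x ≢ 0# → y ≢ 0# → x Q.* y ≢ 0#
  *≢0 {x} {y} x≢0 y≢0 xy≡0 with inverse x x≢0
  ... | d , xd≡1 = y≢0 (begin
    y              ≡⟨ sym (QR.*-identityˡ y) ⟩
    1# Q.* y       ≡⟨ cong (Q._* y) (sym xd≡1) ⟩
    x Q.* d Q.* y  ≡⟨ QS.solve 3 (λ x d y → x QS.:* d QS.:* y QS.:= d QS.:* (x QS.:* y)) refl x d y ⟩
    d Q.* (x Q.* y) ≡⟨ trans (cong (d Q.*_) xy≡0) (QR.zeroʳ d) ⟩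
    0#             ∎)

  fromℤ-injective : ∀ i → fromℤ i ≡ 0# → i ≡ ℤ.0ℤ
  fromℤ-injective (ℤ.+ zero) e = refl
  fromℤ-injective (ℤ.+ suc n) e = ⊥-elim (fromℕ-suc≢0 n e)
  fromℤ-injective -[1+ n ] e = ⊥-elim (≢0-neg {Q.- fromℤ (ℤ.+ suc n)}
    (λ e′ → fromℕ-suc≢0 n (trans (sym (RingProperties.-‿involutive QR.ring _)) e′)) e)

  -- The diagonal automorphism that multiplies the generator `v` by `β v`. It conjugates contraction
  -- by a nonvanishing `β` into contraction by `one` and preserves supports, so acyclicity holds for
  -- all nonvanishing forms at once.
  scaleBy : ∀ {n} → Form n → Ext n → Ext n
  scaleBy β ⟨ x ⟩ = ⟨ x ⟩
  scaleBy β (x & y) = scaleBy (β ∘ suc) x & β zero · scaleBy (β ∘ suc) y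

  opaque
    unfolding _+_ ι

    scaleBy-+ : ∀ {n} (β : Form n) x y → scaleBy β (x + y) ≡ scaleBy β x + scaleBy β y
    scaleBy-+ β ⟨ x ⟩ ⟨ y ⟩ = refl
    scaleBy-+ β (x & x′) (y & y′) = cong₂ _&_ (scaleBy-+ _ x y) (trans (cong (β zero ·_) (scaleBy-+ _ x′ y′)) (·-+ _ _ _))

    scaleBy-· : ∀ {n} (β : Form n) c x → scaleBy β (c · x) ≡ c · scaleBy β x
    scaleBy-· β c ⟨ x ⟩ = refl
    scaleBy-· β c (x & y) = cong₂ _&_ (scaleBy-· _ c x) (trans (cong (β zero ·_) (scaleBy-· _ c y))
      (solve 3 (λ b c x → b :* (c :* x) := c :* (b :* x)) refl (const (β zero)) (const c) (scaleBy (β ∘ suc) y)))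

    scaleBy-neg : ∀ {n} (β : Form n) x → scaleBy β (- x) ≡ - scaleBy β x
    scaleBy-neg β ⟨ x ⟩ = refl
    scaleBy-neg β (x & y) = cong₂ _&_ (scaleBy-neg _ x) (trans (cong (β zero ·_) (scaleBy-neg _ y)) (·-neg _ _))

    scaleBy-𝟎 : ∀ {n} (β : Form n) → scaleBy β 𝟎 ≡ 𝟎
    scaleBy-𝟎 {zero}  β = refl
    scaleBy-𝟎 {suc n} β = cong₂ _&_ (scaleBy-𝟎 _) (trans (cong (β zero ·_) (scaleBy-𝟎 _)) (·𝟎 _))

    ι-scaleBy : ∀ {n} (β : Form n) z → ι one (scaleBy β z) ≡ scaleBy β (ι β z)
    ι-scaleBy β ⟨ x ⟩ = refl
    ι-scaleBy β (x & y) = cong₂ _&_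
      (trans (cong₂ _+_ (ι-scaleBy _ x) (1· _)) (sym (trans (scaleBy-+ _ (ι (β ∘ suc) x) (β zero · y)) (cong₂ _+_ refl (scaleBy-· _ _ y)))))
      (trans (cong -_ (trans (ι-· one (β zero) _) (cong (β zero ·_) (ι-scaleBy _ y))))
        (sym (trans (cong (β zero ·_) (scaleBy-neg _ (ι (β ∘ suc) y))) (·-neg _ _))))

    scaleBy-inverse : ∀ {n} (β γ : Form n) → (∀ v → β v Q.* γ v ≡ 1#) → ∀ z → scaleBy β (scaleBy γ z) ≡ z
    scaleBy-inverse β γ e ⟨ x ⟩ = refl
    scaleBy-inverse β γ e (x & y) = cong₂ _&_ (scaleBy-inverse _ _ (e ∘ suc) x) (begin
      β zero · scaleBy (β ∘ suc) (γ zero · scaleBy (γ ∘ suc) y)  ≡⟨ cong (β zero ·_) (scaleBy-· _ _ _) ⟩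
      β zero · (γ zero · scaleBy (β ∘ suc) (scaleBy (γ ∘ suc) y)) ≡⟨ sym (*-· _ _ _) ⟩
      (β zero Q.* γ zero) · scaleBy (β ∘ suc) (scaleBy (γ ∘ suc) y) ≡⟨ cong₂ _·_ (e zero) (scaleBy-inverse _ _ (e ∘ suc) y) ⟩
      1# · y ≡⟨ 1· y ⟩
      y ∎)

    scaleBy-support : ∀ {n} (β : Form n) z A → coef (scaleBy β z) A ≢ 0# → coef z A ≢ 0#
    scaleBy-support β ⟨ x ⟩ [] h = h
    scaleBy-support β (x & y) (outside ∷ A) h = scaleBy-support _ x A h
    scaleBy-support β (x & y) (inside ∷ A) h = scaleBy-support _ y A (≢0-*ʳ {β zero} (λ e → h (trans (coef-· (β zero) (scaleBy (β ∘ suc) y) A) e)))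

  exact-form : ∀ {n} {Γ : Family n} {i} → Exact Γ i → ∀ (β : Form n) → Nonvanishing β →
    ∀ z → In Γ i z → ι β z ≡ 𝟎 → ¬ ¬ (∃ λ y → In Γ (suc i) y × z ≡ ι β y)
  exact-form ex β nv z p e =
    ex (scaleBy β z) (λ A h → p A (scaleBy-support β z A h)) (trans (ι-scaleBy β z) (trans (cong (scaleBy β) e) (scaleBy-𝟎 β))) >>= λ (y , q , e′) →
    return (scaleBy β⁻¹ y , (λ A h → q A (scaleBy-support β⁻¹ y A h)) , (begin
      z                                           ≡⟨ sym (scaleBy-inverse β⁻¹ β (λ v → trans (QR.*-comm _ _) (proj₂ (inverse (β v) (nv v)))) z) ⟩
      scaleBy β⁻¹ (scaleBy β z)                     ≡⟨ cong (scaleBy β⁻¹) (trans (sym e′) (cong (ι one) (sym (scaleBy-inverse β β⁻¹ (λ v → proj₂ (inverse (β v) (nv v))) y)))) ⟩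
      scaleBy β⁻¹ (ι one (scaleBy β (scaleBy β⁻¹ y))) ≡⟨ cong (scaleBy β⁻¹) (ι-scaleBy β _) ⟩
      scaleBy β⁻¹ (scaleBy β (ι β (scaleBy β⁻¹ y)))   ≡⟨ scaleBy-inverse β⁻¹ β (λ v → trans (QR.*-comm _ _) (proj₂ (inverse (β v) (nv v)))) _ ⟩
      ι β (scaleBy β⁻¹ y)                           ∎))
    where
    β⁻¹ : Form _
    β⁻¹ v = proj₁ (inverse (β v) (nv v))

-- Vandermonde forms, Newton bases, and forms that vanish at one vertex

module Vandermonde (Q : Rationals) {N : ℕ} (x̂ : Fin N → Rationals.R Q) (distinct : ∀ {v w} → x̂ v ≡ x̂ w → v ≡ w)
                   (b : Rationals.R Q) (b-fresh : ∀ v → x̂ v ≢ b) where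
  open Rationals Q hiding (_+_; _*_; -_)
  open Exterior Q
  open LinearAlgebra Q
  open Contraction Q
  private
    module Q = Rationals Q
    module QR = CommutativeRing scalarRing
    module QS = FromInteger.Solver scalarRing
    module InS {n} {Γ : Family n} {i} = IsSubspace (In-subspace {n} {Γ} {i})
  open ES using (solve; _:+_; _:*_; :-_; _:=_; _:-_; con)
  open ≡-Reasoning

  -- A form is a function on the vertices. The forms with index below `n` span `β` times the
  -- polynomials of degree less than `n` in `x̂`, and the arguments below are changes of basis in
  -- this space of polynomials.
  pw : Form N → ℕ → Form N
  pw β zero    = β
  pw β (suc k) v = x̂ v Q.* pw β k v

  shift : R → Form N → Form N
  shift a β v = β v Q.* (x̂ v Q.+ Q.- a)

  pw-shift : ∀ a β k v → pw (shift a β) k v ≡ pw β (suc k) v Q.+ (Q.- a) Q.* pw β k v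
  pw-shift a β zero v = QS.solve 3 (λ b x a → b QS.:* (x QS.:- a) QS.:= x QS.:* b QS.:+ QS.:- a QS.:* b) refl (β v) (x̂ v) a
  pw-shift a β (suc k) v = trans (cong (x̂ v Q.*_) (pw-shift a β k v))
    (QS.solve 3 (λ x p a → x QS.:* (x QS.:* p QS.:+ QS.:- a QS.:* p) QS.:= x QS.:* (x QS.:* p) QS.:+ QS.:- a QS.:* (x QS.:* p)) refl (x̂ v) (pw β k v) a)

  pw-cong : ∀ {β β′} → (∀ v → β v ≡ β′ v) → ∀ k v → pw β k v ≡ pw β′ k v
  pw-cong e zero v = e v
  pw-cong e (suc k) v = cong (x̂ v Q.*_) (pw-cong e k v)

  pw-zero : ∀ {β v} → β v ≡ 0# → ∀ k → pw β k v ≡ 0#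
  pw-zero e zero = e
  pw-zero {v = v} e (suc k) = trans (cong (x̂ v Q.*_) (pw-zero e k)) (QR.zeroʳ _)

  ι-pw-shift : ∀ a β k z → ι (pw (shift a β) k) z ≡ ι (pw β (suc k)) z − a · ι (pw β k) z
  ι-pw-shift a β k z = begin
    ι (pw (shift a β) k) z                                           ≡⟨ ι-cong (pw-shift a β k) z ⟩
    ι (λ v → pw β (suc k) v Q.+ (Q.- a) Q.* pw β k v) z              ≡⟨ ι-form+ _ _ z ⟩
    ι (pw β (suc k)) z + ι (λ v → (Q.- a) Q.* pw β k v) z            ≡⟨ cong (ι (pw β (suc k)) z +_) (trans (ι-form· (Q.- a) (pw β k) z) (neg-· a _)) ⟩
    ι (pw β (suc k)) z − a · ι (pw β k) z                            ∎

  Killed : Form N → ℕ → Ext N → Set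
  Killed β n z = ∀ k → k < n → ι (pw β k) z ≡ 𝟎

  −𝟎 : ∀ {n} (x : Ext n) → x − 𝟎 ≡ x
  −𝟎 x = trans (cong (x +_) -𝟎) (+-identityʳ x)

  killed-shift : ∀ {β n z} a → Killed β (suc n) z → Killed (shift a β) n z
  killed-shift {β} {n} {z} a h k k<n = trans (ι-pw-shift a β k z)
    (trans (cong₂ (λ x y → x − a · y) (h (suc k) (s≤s k<n)) (h k (ℕₚ.m<n⇒m<1+n k<n))) (trans (cong (𝟎 −_) (·𝟎 a)) (−𝟎 𝟎)))

  -- The constant 1 and the multiples of `x - a` together span all polynomials of the next degree
  -- bound.
  killed-unshift : ∀ {β n z} a → ι β z ≡ 𝟎 → Killed (shift a β) n z → Killed β (suc n) z
  killed-unshift a e h zero _ = e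
  killed-unshift {β} {suc n} {z} a e h (suc k) (s≤s k<n) = begin
    ι (pw β (suc k)) z                                                   ≡⟨ solve 2 (λ x y → x := x :- y :+ y) refl _ (a · ι (pw β k) z) ⟩
    ι (pw β (suc k)) z − a · ι (pw β k) z + a · ι (pw β k) z             ≡⟨ cong₂ _+_ (trans (sym (ι-pw-shift a β k z)) (h k k<n))
                                                                              (trans (cong (a ·_) (killed-unshift {n = suc n} a e h k (ℕₚ.m<n⇒m<1+n k<n))) (·𝟎 a)) ⟩
    𝟎 + 𝟎                                                                ≡⟨ +-identityˡ 𝟎 ⟩
    𝟎                                                                    ∎

  killed-cong : ∀ {β β′ n z} → (∀ v → β v ≡ β′ v) → Killed β n z → Killed β′ n z
  killed-cong e h k k<n = trans (ι-cong (λ v → sym (pw-cong e k v)) _) (h k k<n)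

  killed-subspace : ∀ {β n} → IsSubspace (Killed β n)
  killed-subspace = record
    { 𝟎∈ = λ k _ → ι-𝟎 _
    ; +∈ = λ {x} {y} p q k l → trans (ι-+ _ x y) (trans (cong₂ _+_ (p k l) (q k l)) (+-identityˡ 𝟎))
    ; ·∈ = λ c {x} p k l → trans (ι-· _ c x) (trans (cong (c ·_) (p k l)) (·𝟎 c)) }

  ι-kills : ∀ {φ ψ : Form N} {z : Ext N} → ι φ z ≡ 𝟎 → ι φ (ι ψ z) ≡ 𝟎
  ι-kills {φ} {ψ} {z} e = trans (ι-anti φ ψ z) (trans (cong -_ (trans (cong (ι ψ) e) (ι-𝟎 ψ))) -𝟎)

  killed-ι : ∀ {β n z} φ → Killed β n z → Killed β n (ι φ z)
  killed-ι {β} φ h k k<n = ι-kills {pw β k} (h k k<n)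

  killed-step : ∀ {β n z} → Killed β n z → ι (pw β n) z ≡ 𝟎 → Killed β (suc n) z
  killed-step {β} {n} {z} h e k k<1+n with k ℕₚ.≟ n
  ... | yes refl = e
  ... | no k≢n = h k (ℕₚ.≤∧≢⇒< (ℕₚ.≤-pred k<1+n) k≢n)

  Ω : Form N → ℕ → Ext N → Ext N
  Ω β zero    w = w
  Ω β (suc k) w = ι (pw β k) (Ω β k w)

  Ω-cong : ∀ {β β′} → (∀ v → β v ≡ β′ v) → ∀ k w → Ω β k w ≡ Ω β′ k w
  Ω-cong e zero w = refl
  Ω-cong {β} {β′} e (suc k) w = trans (cong (ι (pw β k)) (Ω-cong e k w)) (ι-cong (pw-cong e k) _)

  Ω-+ : ∀ β k x y → Ω β k (x + y) ≡ Ω β k x + Ω β k y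
  Ω-+ β zero x y = refl
  Ω-+ β (suc k) x y = trans (cong (ι (pw β k)) (Ω-+ β k x y)) (ι-+ _ _ _)

  Ω-· : ∀ β k c x → Ω β k (c · x) ≡ c · Ω β k x
  Ω-· β zero c x = refl
  Ω-· β (suc k) c x = trans (cong (ι (pw β k)) (Ω-· β k c x)) (ι-· _ c _)

  Ω-neg : ∀ β k x → Ω β k (- x) ≡ - Ω β k x
  Ω-neg β zero x = refl
  Ω-neg β (suc k) x = trans (cong (ι (pw β k)) (Ω-neg β k x)) (ι-neg _ _)

  Ω-𝟎 : ∀ β k → Ω β k 𝟎 ≡ 𝟎
  Ω-𝟎 β zero = refl
  Ω-𝟎 β (suc k) = trans (cong (ι (pw β k)) (Ω-𝟎 β k)) (ι-𝟎 _)

  Ω-In : ∀ {Γ : Family N} → DownClosed Γ → ∀ β k {i w} → In Γ (k ℕ.+ i) w → In Γ i (Ω β k w)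
  Ω-In dc β zero p = p
  Ω-In {Γ} dc β (suc k) {i} {w} p = ι-In dc (pw β k) (Ω-In dc β k (subst (λ d → In Γ d w) (sym (ℕₚ.+-suc k i)) p))

  Ω-killed : ∀ β n w → Killed β n (Ω β n w)
  Ω-killed β (suc n) w = killed-step (killed-ι (pw β n) (Ω-killed β n w)) (ι-ι (pw β n) _)

  sg : ℕ → R
  sg zero    = 1#
  sg (suc k) = Q.- sg k

  sg² : ∀ k → sg k Q.* sg k ≡ 1#
  sg² zero = QR.*-identityˡ 1#
  sg² (suc k) = trans (QS.solve 1 (λ s → QS.:- s QS.:* QS.:- s QS.:= s QS.:* s) refl (sg k)) (sg² k)

  sg-cancel : ∀ k (x : Ext N) → sg k · (sg k · x) ≡ x
  sg-cancel k x = trans (sym (*-· _ _ x)) (trans (cong (_· x) (sg² k)) (1· x))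

  sg≢0 : ∀ k → sg k ≢ 0#
  sg≢0 k e = 1≢0 (trans (sym (sg² k)) (trans (cong (Q._* sg k) e) (QR.zeroˡ _)))

  Ω-ι : ∀ β k ψ x → ι ψ (Ω β k x) ≡ sg k · Ω β k (ι ψ x)
  Ω-ι β zero ψ x = sym (1· _)
  Ω-ι β (suc k) ψ x = begin
    ι ψ (ι (pw β k) (Ω β k x))               ≡⟨ ι-anti ψ (pw β k) _ ⟩
    - ι (pw β k) (ι ψ (Ω β k x))             ≡⟨ cong (λ t → - ι (pw β k) t) (Ω-ι β k ψ x) ⟩
    - ι (pw β k) (sg k · Ω β k (ι ψ x))      ≡⟨ cong -_ (ι-· _ (sg k) _) ⟩
    - (sg k · Ω β (suc k) (ι ψ x))           ≡⟨ sym (neg-· (sg k) _) ⟩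
    sg (suc k) · Ω β (suc k) (ι ψ x)         ∎

  Ω-ι′ : ∀ β k ψ x → Ω β k (ι ψ x) ≡ sg k · ι ψ (Ω β k x)
  Ω-ι′ β k ψ x = sym (trans (cong (sg k ·_) (Ω-ι β k ψ x)) (sg-cancel k _))

  -- All powers `pw β k` vanish at `v` together with `β`, so by `ι-ε` each contraction anticommutes
  -- with `ε v`.
  Ω-ε : ∀ β k v → β v ≡ 0# → ∀ x → ε v (Ω β k x) ≡ sg k · Ω β k (ε v x)
  Ω-ε β zero v e x = sym (1· _)
  Ω-ε β (suc k) v e x = begin
    ε v (ι (pw β k) (Ω β k x))                                 ≡⟨ solve 2 (λ p q → q := :- (p :- q) :+ p) refl (pw β k v · Ω β k x) _ ⟩
    - (pw β k v · Ω β k x − ε v (ι (pw β k) (Ω β k x))) + pw β k v · Ω β k x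
      ≡⟨ cong₂ (λ p q → - p + q) (sym (ι-ε (pw β k) v (Ω β k x))) (trans (cong (_· Ω β k x) (pw-zero e k)) (0· _)) ⟩
    - ι (pw β k) (ε v (Ω β k x)) + 𝟎                           ≡⟨ +-identityʳ _ ⟩
    - ι (pw β k) (ε v (Ω β k x))                               ≡⟨ cong (λ t → - ι (pw β k) t) (Ω-ε β k v e x) ⟩
    - ι (pw β k) (sg k · Ω β k (ε v x))                        ≡⟨ cong -_ (ι-· _ (sg k) _) ⟩
    - (sg k · Ω β (suc k) (ε v x))                             ≡⟨ sym (neg-· (sg k) _) ⟩
    sg (suc k) · Ω β (suc k) (ε v x)                           ∎

  -- Passing from 1, x, x², … to the basis 1, x − a, (x − a) x, … does not change the product of the forms.
  newton : ∀ a β k z → Ω (shift a β) k (ι β z) ≡ Ω β (suc k) z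
  newton a β zero z = refl
  newton a β (suc k) z = begin
    ι (pw (shift a β) k) (Ω (shift a β) k (ι β z))                       ≡⟨ cong (ι _) (newton a β k z) ⟩
    ι (pw (shift a β) k) (Ω β (suc k) z)                                 ≡⟨ ι-pw-shift a β k _ ⟩
    Ω β (suc (suc k)) z − a · ι (pw β k) (Ω β (suc k) z)                 ≡⟨ cong (λ t → Ω β (suc (suc k)) z − a · t) (Ω-killed β (suc k) z k ℕₚ.≤-refl) ⟩
    Ω β (suc (suc k)) z − a · 𝟎                                          ≡⟨ trans (cong (λ t → Ω β (suc (suc k)) z − t) (·𝟎 a)) (−𝟎 _) ⟩
    Ω β (suc (suc k)) z                                                  ∎

  ι-shift-shift : ∀ a c β z → ι (shift c β) z ≡ ι (shift a β) z + (a Q.+ Q.- c) · ι β z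
  ι-shift-shift a c β z = trans (ι-cong (λ v → QS.solve 4 (λ b x a c → b QS.:* (x QS.:- c) QS.:= b QS.:* (x QS.:- a) QS.:+ (a QS.:- c) QS.:* b) refl (β v) (x̂ v) a c) z)
    (trans (ι-form+ (shift a β) (λ v → (a Q.+ Q.- c) Q.* β v) z) (cong (ι (shift a β) z +_) (ι-form· (a Q.+ Q.- c) β z)))

  -- Write `x - c` as `x - a` plus the constant `a - c`. The first summand repeats a form that `Ω`
  -- contracts by anyway, so only the constant contributes.
  newton₂ : ∀ a c β k z → Ω (shift a β) (suc k) (ι (shift c β) z) ≡ (a Q.+ Q.- c) · Ω β (suc (suc k)) z
  newton₂ a c β k z = begin
    Ω γa (suc k) (ι (shift c β) z)                                                  ≡⟨ cong (Ω γa (suc k)) (ι-shift-shift a c β z) ⟩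
    Ω γa (suc k) (ι γa z + (a Q.+ Q.- c) · ι β z)                                   ≡⟨ Ω-+ γa (suc k) _ _ ⟩
    Ω γa (suc k) (ι γa z) + Ω γa (suc k) ((a Q.+ Q.- c) · ι β z)                    ≡⟨ cong₂ _+_ vanish (trans (Ω-· γa (suc k) _ _) (cong (_ ·_) (newton a β (suc k) z))) ⟩
    𝟎 + (a Q.+ Q.- c) · Ω β (suc (suc k)) z                                         ≡⟨ +-identityˡ _ ⟩
    (a Q.+ Q.- c) · Ω β (suc (suc k)) z                                             ∎
    where
    γa : Form N
    γa = shift a β
    vanish : Ω γa (suc k) (ι γa z) ≡ 𝟎
    vanish = trans (Ω-ι′ γa (suc k) γa z) (trans (cong (sg (suc k) ·_) (Ω-killed γa (suc k) z 0 (s≤s z≤n))) (·𝟎 _))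

  Image : Family N → ℕ → Form N → ℕ → Ext N → Set
  Image Γ i β n z = ¬ ¬ (∃ λ w → In Γ (n ℕ.+ i) w × z ≡ Ω β n w)

  image-subspace : ∀ {Γ i β n} → IsSubspace (Image Γ i β n)
  image-subspace {β = β} {n} = record
    { 𝟎∈ = return (𝟎 , InS.𝟎∈ , sym (Ω-𝟎 β n))
    ; +∈ = λ p q → p >>= λ (w , wI , e) → q >>= λ (w′ , wI′ , e′) → return (w + w′ , InS.+∈ wI wI′ , trans (cong₂ _+_ e e′) (sym (Ω-+ β n w w′)))
    ; ·∈ = λ c p → p >>= λ (w , wI , e) → return (c · w , InS.·∈ c wI , trans (cong (c ·_) e) (sym (Ω-· β n c w))) }

  image-stable : ∀ {Γ i β n z} → ¬ ¬ Image Γ i β n z → Image Γ i β n z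
  image-stable h k = h (λ p → p k)

  -- All nonvanishing `β` are included because the induction changes the weight: it multiplies `β`
  -- by a linear factor, and it repairs a zero of `β` at one vertex.
  Cofree : Family N → ℕ → ℕ → Set
  Cofree Γ r n = ∀ β → Nonvanishing β → ∀ i → i ℕ.+ n ≤ r → ∀ z → In Γ i z → Killed β n z → Image Γ i β n z

  module _ {Γ : Family N} (dc : DownClosed Γ) (v : Fin N) {r n : ℕ}
           (cofree : Cofree Γ (suc r) n) (cofree-link : Cofree (linkᵥ v Γ) r n)
           (β : Form N) (βv≡0 : β v ≡ 0#) (β≢0 : ∀ w → w ≢ v → β w ≢ 0#) where
    private
      dcl = link-downClosed {Γ = Γ} v dc
      ιv = ι (basis v)

      β⁺ : Form N
      β⁺ w = β w Q.+ basis v w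

      β⁺-nonvanishing : Nonvanishing β⁺
      β⁺-nonvanishing w with v Finₚ.≟ w
      ... | yes refl = λ e → 1≢0 (trans (sym (trans (cong₂ Q._+_ βv≡0 (basis-diag v)) (QR.+-identityˡ 1#))) e)
      ... | no v≢w = λ e → β≢0 w (v≢w ∘ sym) (trans (sym (trans (cong (β w Q.+_) (basis-off v w v≢w)) (QR.+-identityʳ _))) e)

      pw⁺ : ∀ k w → pw β⁺ k w ≡ pw β k w Q.+ pw (basis v) k w
      pw⁺ zero w = refl
      pw⁺ (suc k) w = trans (cong (x̂ w Q.*_) (pw⁺ k w)) (QR.distribˡ _ _ _)

      pw-basis : ∀ k w → pw (basis v) k w ≡ pw (λ _ → 1#) k v Q.* basis v w
      pw-basis k w with v Finₚ.≟ w
      pw-basis zero w | yes refl = sym (QR.*-identityˡ _)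
      pw-basis (suc k) w | yes refl = trans (cong (x̂ v Q.*_) (pw-basis k v)) (sym (QR.*-assoc _ _ _))
      pw-basis k w | no v≢w = trans (pw-zero (basis-off v w v≢w) k) (sym (trans (cong (_ Q.*_) (basis-off v w v≢w)) (QR.zeroʳ _)))

      ι⁺ : ∀ k z → ιv z ≡ 𝟎 → ι (pw β⁺ k) z ≡ ι (pw β k) z
      ι⁺ k z e = begin
        ι (pw β⁺ k) z                                           ≡⟨ ι-cong (λ w → trans (pw⁺ k w) (cong (pw β k w Q.+_) (pw-basis k w))) z ⟩
        ι (λ w → pw β k w Q.+ pw (λ _ → 1#) k v Q.* basis v w) z ≡⟨ ι-form+ _ _ z ⟩
        ι (pw β k) z + ι (λ w → pw (λ _ → 1#) k v Q.* basis v w) z ≡⟨ cong (ι (pw β k) z +_) (trans (ι-form· _ (basis v) z) (trans (cong (_ ·_) e) (·𝟎 _))) ⟩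
        ι (pw β k) z + 𝟎                                        ≡⟨ +-identityʳ _ ⟩
        ι (pw β k) z                                            ∎

      ιv-Ω : ∀ γ′ k z → ιv z ≡ 𝟎 → ιv (Ω γ′ k z) ≡ 𝟎
      ιv-Ω γ′ k z e = trans (Ω-ι γ′ k (basis v) z) (trans (cong (λ t → sg k · Ω γ′ k t) e) (trans (cong (sg k ·_) (Ω-𝟎 γ′ k)) (·𝟎 _)))

      Ω⁺ : ∀ k z → ιv z ≡ 𝟎 → Ω β⁺ k z ≡ Ω β k z
      Ω⁺ zero z e = refl
      Ω⁺ (suc k) z e = trans (cong (ι (pw β⁺ k)) (Ω⁺ k z e)) (ι⁺ k _ (ιv-Ω β k z e))

      link-image : ∀ {i z} → i ℕ.+ n ≤ r → In (linkᵥ v Γ) i z → Killed β n z →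
                   ¬ ¬ (∃ λ w → In (linkᵥ v Γ) (n ℕ.+ i) w × z ≡ Ω β n w)
      link-image {i} {z} le zI kz =
        cofree-link β⁺ β⁺-nonvanishing i le z zI (λ k k<n → trans (ι⁺ k z (link-ι {Γ = Γ} v zI)) (kz k k<n)) >>= λ (w , wI , e) →
        return (w , wI , trans e (Ω⁺ n w (link-ι {Γ = Γ} v wI)))

      part : Ext N → Ext N
      part z = z − ε v (ιv z)

      ιv-ε : ∀ z → ιv z ≡ 𝟎 → ιv (ε v z) ≡ z
      ιv-ε z e = trans (ι-ε (basis v) v z) (trans (cong₂ (λ c t → c · z − ε v t) (basis-diag v) e) (trans (cong₂ _−_ (1· z) (ε-𝟎 v)) (−𝟎 z)))

      ιv-part : ∀ z → ιv (part z) ≡ 𝟎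
      ιv-part z = trans (ι-+ (basis v) z _) (trans (cong (ιv z +_) (trans (ι-neg _ _) (cong -_ (ιv-ε (ιv z) (ι-ι (basis v) z))))) (-‿inverseʳ _))

      part-In : ∀ {i z} → In Γ i z → In Γ i (part z)
      part-In {zero} {z} zI = subst (In Γ 0) (sym (trans (cong (λ t → z − ε v t) (ι-In₀ (basis v) zI)) (trans (cong (z −_) (ε-𝟎 v)) (−𝟎 z)))) zI
      part-In {suc i} zI = InS.−∈ zI (ε-link v (ι-link v zI))

      outer : ∀ i → i ℕ.+ n < suc r → ∀ z → In Γ i z → Killed β n z → Image Γ i β n (ε v (ιv z))
      outer zero le z zI kz = return (𝟎 , InS.𝟎∈ , trans (cong (ε v) (ι-In₀ (basis v) zI)) (trans (ε-𝟎 v) (sym (Ω-𝟎 β n))))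
      outer (suc i) (s≤s le) z zI kz =
        link-image (ℕₚ.<⇒≤ le) (ι-link v zI) (killed-ι (basis v) kz) >>= λ (w , wI , e) →
        return (sg n · ε v w , InS.·∈ (sg n) (subst (λ d → In Γ d (ε v w)) (sym (ℕₚ.+-suc n i)) (ε-link v wI)) ,
          trans (cong (ε v) e) (trans (Ω-ε β n v βv≡0 w) (sym (Ω-· β n (sg n) (ε v w)))))

    -- Split `z` into `ε v (ιv z)` and a part free of `v`. The first comes from the link of `v`,
    -- where `β` and the repaired form `β⁺` contract alike, and `ε v` commutes with `Ω β n` up to
    -- sign. The second is a contraction by the powers of `β⁺`; in the Newton basis at `x̂ v` these
    -- differ from those of `β` in a single form, and the discrepancy is again an element of the
    -- link. The strict inequality leaves room to solve in the link.
    cofree-degenerate : ∀ i → i ℕ.+ n < suc r → ∀ z → In Γ i z → Killed β n z → Image Γ i β n z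
    cofree-degenerate i le z zI kz =
      outer i le z zI kz >>= λ (w₁ , w₁I , e₁) →
      cofree β⁺ β⁺-nonvanishing i (ℕₚ.<⇒≤ le) z₀ (part-In zI)
        (λ k k<n → trans (ι⁺ k z₀ (ιv-part z)) (z₀-killed k k<n)) >>= λ (y , yI , e) →
      inner n refl y yI e >>= λ (w₂ , w₂I , e₂) →
      return (w₁ + w₂ , InS.+∈ w₁I w₂I ,
        trans (solve 2 (λ z e → z := e :+ (z :- e)) refl z (ε v (ιv z))) (trans (cong₂ _+_ e₁ e₂) (sym (Ω-+ β n w₁ w₂))))
      where
      z₀ = part z
      z₀-killed : Killed β n z₀
      z₀-killed = IsSubspace.−∈ killed-subspace kz λ k k<n →
        trans (ι-ε (pw β k) v (ιv z)) (trans (cong₂ _−_ (trans (cong (_· ιv z) (pw-zero βv≡0 k)) (0· _)) (trans (cong (ε v) (killed-ι (basis v) kz k k<n)) (ε-𝟎 v))) (−𝟎 𝟎))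
      inner : ∀ m → n ≡ m → ∀ y → In Γ (n ℕ.+ i) y → z₀ ≡ Ω β⁺ n y → Image Γ i β n z₀
      inner zero refl y yI e = return (y , yI , e)
      inner (suc m) refl y yI e =
        link-image (ℕₚ.≤-pred le) uI u-killed >>= λ (w , wI , eu) →
        return (y₀ + w , InS.+∈ (part-In yI) (link-In dc v wI) , trans z₀-split (trans (cong (Ω β n y₀ +_) eu) (sym (Ω-+ β n y₀ w))))
        where
        a = x̂ v
        γa : Form N
        γa = shift a β
        -- `β` and `β⁺` differ only at `v`, where the factor `x̂ - a` is zero.
        γa≡ : ∀ w → shift a β⁺ w ≡ γa w
        γa≡ w with v Finₚ.≟ w
        ... | yes refl = trans (trans (cong (β⁺ v Q.*_) (QR.-‿inverseʳ a)) (QR.zeroʳ _)) (sym (trans (cong (β v Q.*_) (QR.-‿inverseʳ a)) (QR.zeroʳ _)))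
        ... | no v≢w = cong (Q._* _) (trans (cong (β w Q.+_) (basis-off v w v≢w)) (QR.+-identityʳ _))
        γav≡0 : γa v ≡ 0#
        γav≡0 = trans (cong (Q._* (x̂ v Q.+ Q.- a)) βv≡0) (QR.zeroˡ _)
        y₁ = ιv y
        y₀ = part y
        y₁I : In (linkᵥ v Γ) (m ℕ.+ i) y₁
        y₁I = ι-link v yI
        u t : Ext N
        u = Ω γa m y₁
        t = Ω β n y₁
        ιβ⁺ : ι β⁺ y ≡ ι β y₀ − ε v (ι β y₁) + y₁
        ιβ⁺ = begin
          ι β⁺ y                                    ≡⟨ ι-form+ β (basis v) y ⟩
          ι β y + y₁                                ≡⟨ cong (λ s → ι β s + y₁) (solve 2 (λ y e → y := y :- e :+ e) refl y (ε v y₁)) ⟩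
          ι β (y₀ + ε v y₁) + y₁                    ≡⟨ cong (_+ y₁) (trans (ι-+ β y₀ (ε v y₁)) (cong (ι β y₀ +_) (trans (ι-ε β v y₁)
                                                       (trans (cong (_− ε v (ι β y₁)) (trans (cong (_· y₁) βv≡0) (0· y₁))) (+-identityˡ _))))) ⟩
          ι β y₀ − ε v (ι β y₁) + y₁                ∎
        Ωε : Ω γa m (ε v (ι β y₁)) ≡ sg m · ε v t
        Ωε = begin
          Ω γa m (ε v (ι β y₁))                     ≡⟨ sym (sg-cancel m _) ⟩
          sg m · (sg m · Ω γa m (ε v (ι β y₁)))     ≡⟨ cong (sg m ·_) (sym (Ω-ε γa m v γav≡0 (ι β y₁))) ⟩
          sg m · ε v (Ω γa m (ι β y₁))              ≡⟨ cong (λ s → sg m · ε v s) (newton a β m y₁) ⟩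
          sg m · ε v t                              ∎
        z₀≡ : z₀ ≡ Ω β n y₀ − sg m · ε v t + u
        z₀≡ = begin
          z₀                                                       ≡⟨ e ⟩
          Ω β⁺ n y                                                 ≡⟨ sym (newton a β⁺ m y) ⟩
          Ω (shift a β⁺) m (ι β⁺ y)                                ≡⟨ Ω-cong γa≡ m (ι β⁺ y) ⟩
          Ω γa m (ι β⁺ y)                                          ≡⟨ cong (Ω γa m) ιβ⁺ ⟩
          Ω γa m (ι β y₀ − ε v (ι β y₁) + y₁)                      ≡⟨ trans (Ω-+ γa m _ y₁) (cong (_+ u) (trans (Ω-+ γa m _ _) (cong (Ω γa m (ι β y₀) +_) (Ω-neg γa m _)))) ⟩
          Ω γa m (ι β y₀) − Ω γa m (ε v (ι β y₁)) + u              ≡⟨ cong₂ (λ p q → p − q + u) (newton a β m y₀) Ωε ⟩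
          Ω β n y₀ − sg m · ε v t + u                              ∎
        ιy₁ : ιv y₁ ≡ 𝟎
        ιy₁ = ι-ι (basis v) y
        -- Every other term of `z₀≡` is annihilated by `ιv`, so applying it isolates `t`.
        t≡𝟎 : t ≡ 𝟎
        t≡𝟎 = ·-injective (sg m) t (sg≢0 m) (begin
          sg m · t                                                            ≡⟨ cong (sg m ·_) (sym (ιv-ε t (ιv-Ω β n y₁ ιy₁))) ⟩
          sg m · ιv (ε v t)                                                   ≡⟨ sym (ι-· (basis v) (sg m) _) ⟩
          ιv (sg m · ε v t)                                                   ≡⟨ cong ιv (trans (solve 3 (λ p s u → s := p :+ u :- (p :- s :+ u)) refl (Ω β n y₀) (sg m · ε v t) u) (cong (Ω β n y₀ + u −_) (sym z₀≡))) ⟩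
          ιv (Ω β n y₀ + u − z₀)                                              ≡⟨ trans (ι-+ _ _ _) (cong₂ _+_ (ι-+ _ _ _) (ι-neg _ _)) ⟩
          ιv (Ω β n y₀) + ιv u − ιv z₀                                        ≡⟨ cong₂ _−_ (cong₂ _+_ (ιv-Ω β n y₀ (ιv-part y)) (ιv-Ω γa m y₁ ιy₁)) (ιv-part z) ⟩
          𝟎 + 𝟎 − 𝟎                                                           ≡⟨ trans (−𝟎 _) (+-identityˡ 𝟎) ⟩
          𝟎                                                                   ∎)
        z₀-split : z₀ ≡ Ω β n y₀ + u
        z₀-split = trans z₀≡ (trans (cong (λ s → Ω β n y₀ − sg m · ε v s + u) t≡𝟎)
          (cong (_+ u) (trans (cong (λ s → Ω β n y₀ − s) (trans (cong (sg m ·_) (ε-𝟎 v)) (·𝟎 _))) (−𝟎 _))))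
        uI : In (linkᵥ v Γ) i u
        uI = Ω-In dcl γa m y₁I
        u-killed : Killed β n u
        u-killed = killed-unshift a (trans (Ω-ι γa m β y₁) (trans (cong (sg m ·_) (trans (newton a β m y₁) t≡𝟎)) (·𝟎 _))) (Ω-killed γa m y₁)

-- Cofreeness of the face spaces, by induction on the number of forms

module Cofreeness (Q : Rationals) {N : ℕ} (x̂ : Fin N → Rationals.R Q) (distinct : ∀ {v w} → x̂ v ≡ x̂ w → v ≡ w)
                   (b : Rationals.R Q) (b-fresh : ∀ v → x̂ v ≢ b) where
  open Rationals Q hiding (_+_; _*_; -_)
  open Exterior Q
  open LinearAlgebra Q
  open Contraction Q
  open Vandermonde Q x̂ distinct b b-fresh
  private
    module Q = Rationals Q
    module QR = CommutativeRing scalarRing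
    module QS = FromInteger.Solver scalarRing
    module InS {n} {Γ : Family n} {i} = IsSubspace (In-subspace {n} {Γ} {i})
    module KS {β n} = IsSubspace (killed-subspace {β} {n})
  open ES using (solve; _:+_; _:*_; :-_; _:=_; _:-_; con)
  open ≡-Reasoning

  difference≢0 : ∀ {x y} → x ≢ y → x Q.+ Q.- y ≢ 0#
  difference≢0 {x} {y} x≢y e = x≢y (begin
    x                     ≡⟨ QS.solve 2 (λ x y → x QS.:= x QS.:- y QS.:+ y) refl x y ⟩
    x Q.+ Q.- y Q.+ y     ≡⟨ cong (Q._+ y) e ⟩
    0# Q.+ y              ≡⟨ QR.+-identityˡ y ⟩
    y                     ∎)

  -- The claim is that `Z` modulo `B` is zero. The polynomials of degree at most `m + 1` are spanned
  -- by two linear factors, `x - a` and `x - b`, and the multiples of their product; the hypotheses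
  -- for `suc m` forms apply to either factor with these multiples. This first shows that elements
  -- supported on a link lie in `B`. That makes a second endomorphism well defined, and its
  -- commutator with a simpler one finishes the step.
  module Step {Γ : Family N} (dc : DownClosed Γ) {r m : ℕ}
              (cofreeΓ : Cofree Γ (suc r) (suc m))
              (cofree-link : ∀ v → Cofree (linkᵥ v Γ) r (suc m))
              (cofree-link⁺ : ∀ v → Cofree (linkᵥ v Γ) r (suc (suc m)))
              (β : Form N) (nv : Nonvanishing β) (i : ℕ) (le : i ℕ.+ suc (suc m) ≤ suc r) where
    private
      n : ℕ
      n = suc (suc m)
      Z B : Ext N → Set
      Z z = In Γ i z × Killed β n z
      B = Image Γ i β n

      le₁ : i ℕ.+ suc m ≤ r
      le₁ = ℕₚ.≤-pred (subst (_≤ suc r) (ℕₚ.+-suc i (suc m)) le)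

      le₂ : suc i ℕ.+ suc m ≤ suc r
      le₂ = s≤s le₁

      degree : ∀ {w} → In Γ (suc m ℕ.+ suc i) w → In Γ (n ℕ.+ i) w
      degree {w} = subst (λ d → In Γ d w) (cong suc (ℕₚ.+-suc m i))

      degree′ : ∀ {w} → In Γ (n ℕ.+ i) w → In Γ (suc m ℕ.+ suc i) w
      degree′ {w} = subst (λ d → In Γ d w) (sym (cong suc (ℕₚ.+-suc m i)))

      Z-subspace : IsSubspace Z
      Z-subspace = record
        { 𝟎∈ = InS.𝟎∈ , KS.𝟎∈
        ; +∈ = λ p q → InS.+∈ (proj₁ p) (proj₁ q) , KS.+∈ (proj₂ p) (proj₂ q)
        ; ·∈ = λ c p → InS.·∈ c (proj₁ p) , KS.·∈ c (proj₂ p) }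

      B-subspace : IsSubspace B
      B-subspace = image-subspace {Γ} {i} {β} {n}

      B-stable : ∀ {z} → ¬ ¬ B z → B z
      B-stable {z} = image-stable {Γ} {i} {β} {n} {z}

      module BS = IsSubspace B-subspace

    -- Modulo B, exchanging the forms β (x − b) and β (x − x̂ v) is a surjective endomorphism,
    -- which kills every element of the link of v.
    module _ (v : Fin N) where
      private
        a : R
        a = x̂ v
        γa γb Ψ : Form N
        γa = shift a β
        γb = shift b β
        Ψ  = shift a γb

        Ψ≡ : ∀ w → shift b γa w ≡ Ψ w
        Ψ≡ w = QS.solve 4 (λ β x a b → β QS.:* (x QS.:- a) QS.:* (x QS.:- b) QS.:= β QS.:* (x QS.:- b) QS.:* (x QS.:- a)) refl (β w) (x̂ w) a b

        γav≡0 : γa v ≡ 0#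
        γav≡0 = trans (cong (β v Q.*_) (QR.-‿inverseʳ a)) (QR.zeroʳ _)

        γa≢0 : ∀ w → w ≢ v → γa w ≢ 0#
        γa≢0 w w≢v = *≢0 (nv w) (difference≢0 (w≢v ∘ distinct))

        γb≢0 : Nonvanishing γb
        γb≢0 w = *≢0 (nv w) (difference≢0 (b-fresh w))

        a−b b−a : R
        a−b = a Q.+ Q.- b
        b−a = b Q.+ Q.- a

        a−b≢0 : a−b ≢ 0#
        a−b≢0 = difference≢0 (b-fresh v)

        b−a≢0 : b−a ≢ 0#
        b−a≢0 = difference≢0 (λ e → b-fresh v (sym e))

        ρ : Ext N → Ext N → Set
        ρ x x′ = ∃ λ y → In Γ (suc i) y × Killed Ψ m y × x ≡ ι γb y × x′ ≡ ι γa y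

        ρ-linear : IsLinear ρ
        ρ-linear = record
          { 𝟎ρ = 𝟎 , InS.𝟎∈ , KS.𝟎∈ , sym (ι-𝟎 γb) , sym (ι-𝟎 γa)
          ; +ρ = λ (y , p , q , e , e′) (w , p′ , q′ , h , h′) → y + w , InS.+∈ p p′ , KS.+∈ q q′ ,
              trans (cong₂ _+_ e h) (sym (ι-+ γb y w)) , trans (cong₂ _+_ e′ h′) (sym (ι-+ γa y w))
          ; ·ρ = λ c (y , p , q , e , e′) → c · y , InS.·∈ c p , KS.·∈ c q ,
              trans (cong (c ·_) e) (sym (ι-· γb c y)) , trans (cong (c ·_) e′) (sym (ι-· γa c y)) }

        killed-β : ∀ z → ι γa z ≡ 𝟎 → ι γb z ≡ 𝟎 → ι β z ≡ 𝟎
        killed-β z ea eb = ·-injective b−a (ι β z) b−a≢0 (begin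
          b−a · ι β z                       ≡⟨ solve 2 (λ p q → q := p :+ q :- p) refl (ι γb z) _ ⟩
          ι γb z + b−a · ι β z − ι γb z     ≡⟨ cong (_− ι γb z) (sym (ι-shift-shift b a β z)) ⟩
          ι γa z − ι γb z                   ≡⟨ cong₂ _−_ ea eb ⟩
          𝟎 − 𝟎                             ≡⟨ −𝟎 𝟎 ⟩
          𝟎                                 ∎)

        -- `z` is killed by the `suc m` powers of `γa`, which vanishes at `v` only, so
        -- `cofree-degenerate` writes it as a contraction by them. Leaving out the contraction by
        -- `γa` itself gives the `y` that relates `ι γb y` to `z`.
        surjective : ∀ z → Z z → ¬ ¬ (∃ λ y → Z y × ρ y z)
        surjective z (zI , kz) =
          cofree-degenerate dc v cofreeΓ (cofree-link v) γa γav≡0 γa≢0 i (s≤s le₁) z zI (killed-shift a kz) >>= λ (w , wI , e) →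
          return (witness w wI e)
          where
          witness : ∀ w → In Γ (suc m ℕ.+ i) w → z ≡ Ω γa (suc m) w → ∃ λ y → Z y × ρ y z
          witness w wI e = x , (ι-In dc γb yI , killed-unshift b (killed-β x xa xb) (killed-unshift a xb (killed-ι γb ky))) ,
                           y , yI , ky , refl , ea
            where
            y x : Ext N
            y = sg m · Ω (shift b γa) m w
            x = ι γb y
            yI : In Γ (suc i) y
            yI = InS.·∈ (sg m) (Ω-In dc (shift b γa) m (subst (λ d → In Γ d w) (sym (ℕₚ.+-suc m i)) wI))
            ky : Killed Ψ m y
            ky = KS.·∈ (sg m) (killed-cong Ψ≡ (Ω-killed (shift b γa) m w))
            ea : z ≡ ι γa y
            ea = trans e (trans (sym (newton b γa m w)) (trans (Ω-ι′ (shift b γa) m γa w) (sym (ι-· γa (sg m) _))))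
            xb : ι γb x ≡ 𝟎
            xb = ι-ι γb y
            xa : ι γa x ≡ 𝟎
            xa = trans (ι-anti γa γb y) (trans (cong (λ t → - ι γb t) (sym ea)) (trans (cong -_ (killed-shift b kz 0 (s≤s z≤n))) -𝟎))

        preserves : ∀ {x y} → ρ x y → B x → B y
        preserves {x} {x′} (y , yI , ky , e , e′) Bx =
          Bx >>= λ (s , sI , es) →
          cofreeΓ γb γb≢0 (suc i) le₂ (y − f′ s) (InS.−∈ yI (fI s sI)) (kq s es) >>= λ (t , tI , et) →
          return ((sg (suc m) Q.* b−a) · t , InS.·∈ _ (degree tI) , final s es t et)
          where
          c : R
          c = proj₁ (inverse a−b a−b≢0)
          -- Another solution over the same `x`, built from the witness that `x` lies in `B` and
          -- killed by `γa`. Its difference from `y` is killed by all `suc m` powers of `γb`, so it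
          -- is a contraction by them, and contracting once more by `γa` lands in `B`.
          f′ : Ext N → Ext N
          f′ s = (c Q.* sg (suc m)) · Ω γa (suc m) s
          fI : ∀ s → In Γ (n ℕ.+ i) s → In Γ (suc i) (f′ s)
          fI s sI = InS.·∈ _ (Ω-In dc γa (suc m) (degree′ sI))
          ιbf : ∀ s → x ≡ Ω β n s → ι γb (f′ s) ≡ x
          ιbf s es = begin
            ι γb (f′ s)                                              ≡⟨ ι-· γb _ (Ω γa (suc m) s) ⟩
            (c Q.* sg (suc m)) · ι γb (Ω γa (suc m) s)               ≡⟨ *-· c (sg (suc m)) _ ⟩
            c · (sg (suc m) · ι γb (Ω γa (suc m) s))                 ≡⟨ cong (c ·_) (sym (Ω-ι′ γa (suc m) γb s)) ⟩
            c · Ω γa (suc m) (ι γb s)                                ≡⟨ cong (c ·_) (newton₂ a b β m s) ⟩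
            c · (a−b · Ω β n s)                                      ≡⟨ sym (*-· c a−b _) ⟩
            (c Q.* a−b) · Ω β n s                                    ≡⟨ cong (_· Ω β n s) (trans (QR.*-comm c a−b) (proj₂ (inverse a−b a−b≢0))) ⟩
            1# · Ω β n s                                             ≡⟨ 1· _ ⟩
            Ω β n s                                                  ≡⟨ sym es ⟩
            x                                                        ∎
          ιaf : ∀ s → ι γa (f′ s) ≡ 𝟎
          ιaf s = trans (ι-· γa _ (Ω γa (suc m) s)) (trans (cong ((c Q.* sg (suc m)) ·_) (Ω-killed γa (suc m) s 0 (s≤s z≤n))) (·𝟎 _))
          kq : ∀ s → x ≡ Ω β n s → Killed γb (suc m) (y − f′ s)
          kq s es = killed-unshift a
            (trans (ι-+ γb y (- f′ s)) (trans (cong (ι γb y +_) (trans (ι-neg γb (f′ s)) (cong -_ (trans (ιbf s es) e)))) (-‿inverseʳ _)))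
            (KS.−∈ ky (KS.·∈ _ (killed-cong Ψ≡ (killed-shift b (Ω-killed γa (suc m) s)))))
          final : ∀ s → x ≡ Ω β n s → ∀ t → y − f′ s ≡ Ω γb (suc m) t → x′ ≡ Ω β n ((sg (suc m) Q.* b−a) · t)
          final s es t et = begin
            x′                                               ≡⟨ e′ ⟩
            ι γa y                                           ≡⟨ cong (ι γa) (solve 2 (λ y f → y := y :- f :+ f) refl y (f′ s)) ⟩
            ι γa (y − f′ s + f′ s)                           ≡⟨ trans (ι-+ γa _ (f′ s)) (trans (cong (ι γa (y − f′ s) +_) (ιaf s)) (+-identityʳ _)) ⟩
            ι γa (y − f′ s)                                  ≡⟨ cong (ι γa) et ⟩
            ι γa (Ω γb (suc m) t)                            ≡⟨ Ω-ι γb (suc m) γa t ⟩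
            sg (suc m) · Ω γb (suc m) (ι γa t)               ≡⟨ cong (sg (suc m) ·_) (newton₂ b a β m t) ⟩
            sg (suc m) · (b−a · Ω β n t)                     ≡⟨ sym (*-· (sg (suc m)) b−a _) ⟩
            (sg (suc m) Q.* b−a) · Ω β n t                   ≡⟨ sym (Ω-· β n _ t) ⟩
            Ω β n ((sg (suc m) Q.* b−a) · t)                 ∎

      -- A multiple of `ε v κ` contracts to `κ` under `γb`, and to 𝟎 under `γa` because `γa v` is
      -- zero. So `ρ` relates `κ` to 𝟎, and `ρ` is injective modulo `B`.
      link-vanishes : ∀ {κ} → In (linkᵥ v Γ) i κ → Killed β n κ → B κ
      link-vanishes {κ} κI kκ = surjective⇒injective Z-subspace B-subspace B-stable ρ-linear surjective preserves
        (link-In dc v κI , kκ) (c · ε v κ , InS.·∈ c (ε-link v κI) , KS.·∈ c killed , sym ιb , sym ιa) BS.𝟎∈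
        where
        c : R
        c = proj₁ (inverse (γb v) (γb≢0 v))
        ιε : ∀ φ → ι φ κ ≡ 𝟎 → ι φ (ε v κ) ≡ φ v · κ
        ιε φ e = trans (ι-ε φ v κ) (trans (cong (λ t → φ v · κ − ε v t) e) (trans (cong (φ v · κ −_) (ε-𝟎 v)) (−𝟎 _)))
        ιb : ι γb (c · ε v κ) ≡ κ
        ιb = trans (ι-· γb c _) (trans (cong (c ·_) (ιε γb (killed-shift b kκ 0 (s≤s z≤n))))
          (trans (sym (*-· c _ κ)) (trans (cong (_· κ) (trans (QR.*-comm c _) (proj₂ (inverse (γb v) (γb≢0 v))))) (1· κ))))
        ιa : ι γa (c · ε v κ) ≡ 𝟎
        ιa = trans (ι-· γa c _) (trans (cong (c ·_) (trans (ιε γa (killed-shift a kκ 0 (s≤s z≤n))) (trans (cong (_· κ) γav≡0) (0· κ)))) (·𝟎 c))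
        killed : Killed Ψ m (ε v κ)
        killed k k<m = trans (ιε (pw Ψ k) (killed-shift a (killed-shift b kκ) k k<m))
          (trans (cong (_· κ) (pw-zero {Ψ} {v} (trans (cong (γb v Q.*_) (QR.-‿inverseʳ a)) (QR.zeroʳ _)) k)) (0· κ))

    private
      φ φ′ : Form N
      φ  = pw β m
      φ′ = pw β (suc m)

      -- Exchanges the last two forms: `z` is written as a contraction by `φ` of some `y` killed by
      -- the earlier forms, and `y` is contracted by `φ′` instead.
      δ : Ext N → Ext N → Set
      δ z d = ∃ λ y → In Γ (suc i) y × Killed β m y × z ≡ ι φ y × d ≡ ι φ′ y

      δ-linear : IsLinear δ
      δ-linear = record
        { 𝟎ρ = 𝟎 , InS.𝟎∈ , KS.𝟎∈ , sym (ι-𝟎 φ) , sym (ι-𝟎 φ′)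
        ; +ρ = λ (y , p , q , e , e′) (w , p′ , q′ , h , h′) → y + w , InS.+∈ p p′ , KS.+∈ q q′ ,
            trans (cong₂ _+_ e h) (sym (ι-+ φ y w)) , trans (cong₂ _+_ e′ h′) (sym (ι-+ φ′ y w))
        ; ·ρ = λ c (y , p , q , e , e′) → c · y , InS.·∈ c p , KS.·∈ c q ,
            trans (cong (c ·_) e) (sym (ι-· φ c y)) , trans (cong (c ·_) e′) (sym (ι-· φ′ c y)) }

      -- If `z` is `Ω β n w`, adding `ι φ′ (Ω β m w)` to `y` makes it killed by `φ` as well, hence a
      -- contraction by `suc m` forms, which `ι φ′` sends into `B`. The added term is invisible to
      -- `ι φ′`, whose square is zero.
      δ-preserves : ∀ {z d} → δ z d → B z → B d
      δ-preserves {z} {d} (y , yI , ky , e , e′) Bz =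
        Bz >>= λ (w , wI , ew) →
        cofreeΓ β nv (suc i) le₂ (y + p w) (InS.+∈ yI (pI w wI)) (killed-step (KS.+∈ ky (killed-ι φ′ (Ω-killed β m w))) (φq w ew)) >>= λ (t , tI , et) →
        return (t , degree tI , final w t et)
        where
        p : Ext N → Ext N
        p w = ι φ′ (Ω β m w)
        pI : ∀ w → In Γ (n ℕ.+ i) w → In Γ (suc i) (p w)
        pI w wI = ι-In dc φ′ (Ω-In dc β m (subst (λ j → In Γ j w) (sym (trans (ℕₚ.+-suc m (suc i)) (cong suc (ℕₚ.+-suc m i)))) wI))
        φq : ∀ w → z ≡ Ω β n w → ι φ (y + p w) ≡ 𝟎
        φq w ew = begin
          ι φ (y + p w)                     ≡⟨ ι-+ φ y (p w) ⟩
          ι φ y + ι φ (p w)                 ≡⟨ cong₂ _+_ (trans (sym e) ew) (ι-anti φ φ′ _) ⟩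
          Ω β n w − Ω β n w                 ≡⟨ -‿inverseʳ _ ⟩
          𝟎                                 ∎
        final : ∀ w t → y + p w ≡ Ω β (suc m) t → d ≡ Ω β n t
        final w t et = begin
          d                        ≡⟨ e′ ⟩
          ι φ′ y                   ≡⟨ sym (trans (cong (ι φ′ y +_) (ι-ι φ′ _)) (+-identityʳ _)) ⟩
          ι φ′ y + ι φ′ (p w)      ≡⟨ sym (ι-+ φ′ y (p w)) ⟩
          ι φ′ (y + p w)           ≡⟨ cong (ι φ′) et ⟩
          Ω β n t                  ∎

      Lift : Ext N → (Fin N → Ext N) → Set
      Lift z w = ∀ v → In (linkᵥ v Γ) (suc i) (w v) × Killed β m (w v) × ι (basis v) z ≡ ι φ (ι φ′ (w v))

      -- The partner of `δ`, assembled from the links: each `ι (basis v) z` is a contraction by `φ`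
      -- and `φ′` inside the link of `v`, and the local preimages are summed with the weights `φ v`,
      -- as in the expansion of `ι φ` over the vertices.
      G : Ext N → Ext N → Set
      G z g = ∃ λ w → Lift z w × g ≡ ι φ (lc φ w)

      ι-lc : ∀ ψ (c : Fin N → R) (w : Fin N → Ext N) → ι ψ (lc c w) ≡ lc c (λ v → ι ψ (w v))
      ι-lc ψ c w = trans (∑-map (ι ψ) (ι-𝟎 ψ) (ι-+ ψ) _) (∑-cong (λ v → ι-· ψ (c v) (w v)))

      lc-vectors+ : ∀ (c : Fin N → R) (w w′ : Fin N → Ext N) → lc c (λ v → w v + w′ v) ≡ lc c w + lc c w′
      lc-vectors+ c w w′ = trans (∑-cong (λ v → ·-+ (c v) (w v) (w′ v))) (∑-+ _ _)

      G-linear : IsLinear G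
      G-linear = record
        { 𝟎ρ = (λ _ → 𝟎) , (λ v → InS.𝟎∈ , KS.𝟎∈ , trans (ι-𝟎 _) (sym (trans (cong (ι φ) (ι-𝟎 φ′)) (ι-𝟎 φ)))) ,
               sym (trans (ι-lc φ φ (λ _ → 𝟎)) (trans (∑-cong (λ v → trans (cong (φ v ·_) (ι-𝟎 φ)) (·𝟎 _))) (∑-𝟎 {k = N})))
        ; +ρ = λ {x} {x′} {y} {y′} (w , l , e) (w′ , l′ , e′) → (λ v → w v + w′ v) ,
               (λ v → let (p , q , h) = l v ; (p′ , q′ , h′) = l′ v in InS.+∈ p p′ , KS.+∈ q q′ ,
                 trans (ι-+ _ x y) (trans (cong₂ _+_ h h′) (sym (trans (cong (ι φ) (ι-+ φ′ _ _)) (ι-+ φ _ _))))) ,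
               trans (cong₂ _+_ e e′) (sym (trans (cong (ι φ) (lc-vectors+ φ w w′)) (ι-+ φ _ _)))
        ; ·ρ = λ c {x} (w , l , e) → (λ v → c · w v) ,
               (λ v → let (p , q , h) = l v in InS.·∈ c p , KS.·∈ c q ,
                 trans (ι-· _ c x) (trans (cong (c ·_) h) (sym (trans (cong (ι φ) (ι-· φ′ c _)) (ι-· φ c _))))) ,
               trans (cong (c ·_) e) (sym (trans (cong (ι φ) (trans (∑-cong (λ v → solve 3 (λ a b x → a :* (b :* x) := b :* (a :* x)) refl (const (φ v)) (const c) (w v)))
                 (sym (∑-map (c ·_) (·𝟎 c) (·-+ c) _)))) (ι-· φ c _))) }

      -- The ambiguity in the choice of w lies in the links, hence in B.
      G-preserves : ∀ {z g} → G z g → B z → B g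
      G-preserves {z} {g} (w , lift , e) Bz = Bz >>= λ (s , sI , es) → vanish s sI es
        where
        vanish : ∀ s → In Γ (n ℕ.+ i) s → z ≡ Ω β n s → B g
        vanish s sI es = subst B (sym g≡) (BS.lc∈ φ λ v → link-vanishes v (κI v) (killed-step (killed-step (κk v) (ι-ι φ _)) (κφ′ v)))
          where
          p : Ext N
          p = Ω β m s
          pI : In Γ (suc (suc i)) p
          pI = Ω-In dc β m (subst (λ j → In Γ j s) (sym (trans (ℕₚ.+-suc m (suc i)) (cong suc (ℕₚ.+-suc m i)))) sI)
          k κ : Fin N → Ext N
          k v = w v + ι (basis v) p
          κ v = ι φ (k v)
          kI : ∀ v → In (linkᵥ v Γ) (suc i) (k v)
          kI v = InS.+∈ (proj₁ (lift v)) (ι-link v pI)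
          κI : ∀ v → In (linkᵥ v Γ) i (κ v)
          κI v = ι-In (link-downClosed {Γ = Γ} v dc) φ (kI v)
          κk : ∀ v → Killed β m (κ v)
          κk v = killed-ι φ (KS.+∈ (proj₁ (proj₂ (lift v))) (killed-ι (basis v) (Ω-killed β m s)))
          ιz : ∀ v → ι (basis v) z ≡ - ι φ (ι φ′ (ι (basis v) p))
          ιz v = begin
            ι (basis v) z                              ≡⟨ cong (ι (basis v)) es ⟩
            ι (basis v) (ι φ′ (ι φ p))                 ≡⟨ ι-anti (basis v) φ′ _ ⟩
            - ι φ′ (ι (basis v) (ι φ p))               ≡⟨ cong (λ t → - ι φ′ t) (ι-anti (basis v) φ p) ⟩
            - ι φ′ (- ι φ (ι (basis v) p))             ≡⟨ cong -_ (trans (ι-neg φ′ _) (cong -_ (ι-anti φ′ φ _))) ⟩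
            - - - ι φ (ι φ′ (ι (basis v) p))           ≡⟨ solve 1 (λ x → :- (:- (:- x)) := :- x) refl _ ⟩
            - ι φ (ι φ′ (ι (basis v) p))               ∎
          κφ′ : ∀ v → ι φ′ (κ v) ≡ 𝟎
          κφ′ v = begin
            ι φ′ (ι φ (k v))                                                   ≡⟨ ι-anti φ′ φ _ ⟩
            - ι φ (ι φ′ (k v))                                                 ≡⟨ cong -_ (trans (cong (ι φ) (ι-+ φ′ _ _)) (ι-+ φ _ _)) ⟩
            - (ι φ (ι φ′ (w v)) + ι φ (ι φ′ (ι (basis v) p)))                  ≡⟨ cong (λ t → - (t + ι φ (ι φ′ (ι (basis v) p)))) (trans (sym (proj₂ (proj₂ (lift v)))) (ιz v)) ⟩
            - (- ι φ (ι φ′ (ι (basis v) p)) + ι φ (ι φ′ (ι (basis v) p)))      ≡⟨ trans (cong -_ (-‿inverseˡ _)) -𝟎 ⟩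
            𝟎                                                                  ∎
          g≡ : g ≡ lc φ κ
          g≡ = begin
            g                                                     ≡⟨ e ⟩
            ι φ (lc φ w)                                          ≡⟨ sym (+-identityʳ _) ⟩
            ι φ (lc φ w) + 𝟎                                      ≡⟨ cong (ι φ (lc φ w) +_) (trans (sym (ι-ι φ p)) (cong (ι φ) (ι-expand φ p))) ⟩
            ι φ (lc φ w) + ι φ (lc φ (λ v → ι (basis v) p))       ≡⟨ sym (trans (cong (ι φ) (lc-vectors+ φ w _)) (ι-+ φ _ _)) ⟩
            ι φ (lc φ k)                                          ≡⟨ ι-lc φ φ k ⟩
            lc φ κ                                                ∎

      lift-exists : ∀ j z → j ≡ i → In Γ j z → Killed β n z → ∀ v →
        ¬ ¬ (∃ λ w → In (linkᵥ v Γ) (suc j) w × Killed β m w × ι (basis v) z ≡ ι φ (ι φ′ w))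
      lift-exists zero z refl zI kz v = return (𝟎 , InS.𝟎∈ , KS.𝟎∈ , trans (ι-In₀ (basis v) zI) (sym (trans (cong (ι φ) (ι-𝟎 φ′)) (ι-𝟎 φ))))
      lift-exists (suc j) z refl zI kz v =
        cofree-link⁺ v β nv j (ℕₚ.≤-pred le) (ι (basis v) z) (ι-link v zI) (killed-ι (basis v) kz) >>= λ (u , uI , e) →
        return (- Ω β m u ,
          InS.neg∈ (Ω-In (link-downClosed {Γ = Γ} v dc) β m (subst (λ d → In (linkᵥ v Γ) d u) (sym (trans (ℕₚ.+-suc m (suc j)) (cong suc (ℕₚ.+-suc m j)))) uI)) ,
          KS.neg∈ (Ω-killed β m u) ,
          trans e (trans (ι-anti φ′ φ _) (sym (trans (cong (ι φ) (ι-neg φ′ _)) (ι-neg φ _)))))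

      -- The source of the identity operator is the expansion of `z = ι φ y` over the vertices. In
      -- the link of `v`, the element `ι (basis v) y` plus `ι φ′ (w v)` is killed by `φ`, hence
      -- equals `ι φ (u v)`. Summing with the weights `φ v` gives `z ≡ ι φ U − ι φ′ W`, where the
      -- first term is `G` after `δ` and the second is `δ` after `G`.
      module Commutation (z : Ext N) (zI : In Γ i z) (kz : Killed β n z)
                         (t : Ext N) (tI : In Γ (suc m ℕ.+ i) t) (et : z ≡ Ω β (suc m) t)
                         (w : Fin N → Ext N) (lift : Lift z w) where
        y d W : Ext N
        y = Ω β m t
        d = ι φ′ y
        W = lc φ w
        q : Fin N → Ext N
        q v = ι (basis v) y + ι φ′ (w v)
        yI : In Γ (suc i) y
        yI = Ω-In dc β m (subst (λ j → In Γ j t) (sym (ℕₚ.+-suc m i)) tI)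
        ky : Killed β m y
        ky = Ω-killed β m t
        wI : ∀ v → In (linkᵥ v Γ) (suc i) (w v)
        wI v = proj₁ (lift v)
        kw : ∀ v → Killed β m (w v)
        kw v = proj₁ (proj₂ (lift v))
        ew : ∀ v → ι (basis v) z ≡ ι φ (ι φ′ (w v))
        ew v = proj₂ (proj₂ (lift v))
        φq : ∀ v → ι φ (q v) ≡ 𝟎
        φq v = begin
          ι φ (ι (basis v) y + ι φ′ (w v))              ≡⟨ ι-+ φ _ _ ⟩
          ι φ (ι (basis v) y) + ι φ (ι φ′ (w v))        ≡⟨ cong₂ _+_ (ι-anti φ (basis v) y) (sym (ew v)) ⟩
          - ι (basis v) (ι φ y) + ι (basis v) z         ≡⟨ cong (λ x → - ι (basis v) x + ι (basis v) z) (sym et) ⟩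
          - ι (basis v) z + ι (basis v) z               ≡⟨ -‿inverseˡ _ ⟩
          𝟎                                             ∎
        qI : ∀ v → In (linkᵥ v Γ) i (q v)
        qI v = InS.+∈ (ι-link v yI) (ι-In (link-downClosed {Γ = Γ} v dc) φ′ (wI v))
        kq : ∀ v → Killed β (suc m) (q v)
        kq v = killed-step (KS.+∈ (killed-ι (basis v) ky) (killed-ι φ′ (kw v))) (φq v)
        WI : In Γ (suc i) W
        WI = InS.lc∈ φ (λ v → link-In dc v (wI v))
        kW : Killed β m W
        kW = KS.lc∈ φ kw
        φφ′W : ι φ (ι φ′ W) ≡ 𝟎
        φφ′W = begin
          ι φ (ι φ′ W)                            ≡⟨ cong (ι φ) (ι-lc φ′ φ w) ⟩
          ι φ (lc φ (λ v → ι φ′ (w v)))           ≡⟨ ι-lc φ φ _ ⟩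
          lc φ (λ v → ι φ (ι φ′ (w v)))           ≡⟨ ∑-cong (λ v → cong (φ v ·_) (sym (ew v))) ⟩
          lc φ (λ v → ι (basis v) z)              ≡⟨ sym (ι-expand φ z) ⟩
          ι φ z                                   ≡⟨ kz m (ℕₚ.m<n⇒m<1+n ℕₚ.≤-refl) ⟩
          𝟎                                       ∎
        φd : ι φ d ≡ 𝟎
        φd = trans (ι-anti φ φ′ y) (trans (cong (λ x → - ι φ′ x) (sym et)) (trans (cong -_ (kz (suc m) ℕₚ.≤-refl)) -𝟎))
        module _ (u : Fin N → Ext N) (uI : ∀ v → In (linkᵥ v Γ) (suc i) (u v)) (ku : ∀ v → Killed β m (u v)) (eq : ∀ v → q v ≡ ι φ (u v)) where
          U : Ext N
          U = lc φ u
          ed : ∀ v → ι (basis v) d ≡ ι φ (ι φ′ (u v))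
          ed v = begin
            ι (basis v) (ι φ′ y)                                ≡⟨ ι-anti (basis v) φ′ y ⟩
            - ι φ′ (ι (basis v) y)                              ≡⟨ cong -_ (sym (trans (cong (ι φ′ (ι (basis v) y) +_) (ι-ι φ′ (w v))) (+-identityʳ _))) ⟩
            - (ι φ′ (ι (basis v) y) + ι φ′ (ι φ′ (w v)))        ≡⟨ cong -_ (sym (ι-+ φ′ _ _)) ⟩
            - ι φ′ (q v)                                        ≡⟨ cong (λ x → - ι φ′ x) (eq v) ⟩
            - ι φ′ (ι φ (u v))                                  ≡⟨ sym (ι-anti φ φ′ (u v)) ⟩
            ι φ (ι φ′ (u v))                                    ∎
          zUW : z ≡ ι φ U − ι φ′ W
          zUW = begin
            z                                                       ≡⟨ et ⟩
            ι φ y                                                   ≡⟨ ι-expand φ y ⟩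
            lc φ (λ v → ι (basis v) y)                              ≡⟨ ∑-cong (λ v → cong (φ v ·_) (trans (solve 2 (λ a b → a := a :+ b :- b) refl (ι (basis v) y) (ι φ′ (w v))) (cong (_− ι φ′ (w v)) (eq v)))) ⟩
            lc φ (λ v → ι φ (u v) − ι φ′ (w v))                     ≡⟨ lc-vectors− φ _ _ ⟩
            lc φ (λ v → ι φ (u v)) − lc φ (λ v → ι φ′ (w v))        ≡⟨ cong₂ _−_ (sym (ι-lc φ φ u)) (sym (ι-lc φ′ φ w)) ⟩
            ι φ U − ι φ′ W                                          ∎
          relations : ∃ λ d → Z d × δ z d × ∃ λ g → Z g × G z g × ∃ λ g′ → G d g′ × ∃ λ h → δ g h × B (z − (g′ − h))
          relations =
            d , (ι-In dc φ′ yI , killed-step (killed-step (killed-ι φ′ ky) φd) (ι-ι φ′ y)) ,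
            (y , yI , ky , et , refl) ,
            ι φ W , (ι-In dc φ WI , killed-step (killed-step (killed-ι φ kW) (ι-ι φ W)) (trans (ι-anti φ′ φ W) (trans (cong -_ φφ′W) -𝟎))) ,
            (w , lift , refl) ,
            ι φ U , (u , (λ v → uI v , ku v , ed v) , refl) ,
            ι φ′ W , (W , WI , kW , refl , refl) ,
            subst B (sym (trans (cong (_− (ι φ U − ι φ′ W)) zUW) (-‿inverseʳ _))) BS.𝟎∈

      commutation : ∀ z → Z z → ¬ ¬ (∃ λ d → Z d × δ z d × ∃ λ g → Z g × G z g × ∃ λ g′ → G d g′ × ∃ λ h → δ g h × B (z − (g′ − h)))
      commutation z (zI , kz) =
        cofreeΓ β nv i (ℕₚ.m≤n⇒m≤1+n le₁) z zI (λ k k< → kz k (ℕₚ.m<n⇒m<1+n k<)) >>= λ (t , tI , et) →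
        ¬¬-choice (lift-exists i z refl zI kz) >>= λ lifts →
        continue t tI et (λ v → proj₁ (lifts v)) (λ v → proj₂ (lifts v))
        where
        continue : ∀ t → In Γ (suc m ℕ.+ i) t → z ≡ Ω β (suc m) t → ∀ w → Lift z w →
          ¬ ¬ (∃ λ d → Z d × δ z d × ∃ λ g → Z g × G z g × ∃ λ g′ → G d g′ × ∃ λ h → δ g h × B (z − (g′ − h)))
        continue t tI et w lift =
          ¬¬-choice (λ v → cofree-link v β nv i le₁ (C.q v) (C.qI v) (C.kq v)) >>= λ T →
          return (C.relations (λ v → Ω β m (proj₁ (T v)))
            (λ v → Ω-In (link-downClosed {Γ = Γ} v dc) β m (subst (λ j → In (linkᵥ v Γ) j (proj₁ (T v))) (sym (ℕₚ.+-suc m i)) (proj₁ (proj₂ (T v)))))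
            (λ v → Ω-killed β m (proj₁ (T v)))
            (λ v → proj₂ (proj₂ (T v))))
          where module C = Commutation z zI kz t tI et w lift

    step : ∀ z → In Γ i z → Killed β n z → Image Γ i β n z
    step z zI kz = commutator-one Z-subspace B-subspace B-stable δ-linear G-linear δ-preserves G-preserves commutation z (zI , kz)

  -- Induction on the number of forms, and on `r` for the links. A single form is acyclicity after a
  -- diagonal rescaling; the commutator argument starts with two.
  cofree : ∀ n r {Γ : Family N} → DownClosed Γ → CM Γ r → Cofree Γ r n
  cofree zero r dc cm β nv i le z zI kz = return (z , zI , refl)
  cofree (suc n) zero dc cm β nv i le = ⊥-elim (ℕₚ.1+n≰n (ℕₚ.≤-trans (ℕₚ.m≤n+m (suc n) i) (ℕₚ.≤-trans le z≤n)))
  cofree (suc zero) (suc r) {Γ} dc (exact , _) β nv i le z zI kz =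
    exact-form (exact i (ℕₚ.≤-pred (subst (_≤ suc r) (ℕₚ.+-comm i 1) le))) β nv z zI (kz 0 (s≤s z≤n))
  cofree (suc (suc m)) (suc r) {Γ} dc cm@(_ , links) β nv i le = Step.step dc
    (cofree (suc m) (suc r) dc cm)
    (λ v → cofree (suc m) r (link-downClosed {Γ = Γ} v dc) (links v))
    (λ v → cofree (suc (suc m)) r (link-downClosed {Γ = Γ} v dc) (links v))
    β nv i le

-- Enumerating families of subsets

sizeIs⇒≡ : ∀ {n} k (S : Subset n) → sizeIs k S ≡ true → ∣ S ∣ ≡ k
sizeIs⇒≡ k S e = ℕₚ.≡ᵇ⇒≡ ∣ S ∣ k (subst Bool.T (sym e) _)

≡⇒sizeIs : ∀ {n} k (S : Subset n) → ∣ S ∣ ≡ k → sizeIs k S ≡ true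
≡⇒sizeIs k S e with ∣ S ∣ ℕ.≡ᵇ k in eq
... | true = refl
... | false = ⊥-elim (subst Bool.T eq (ℕₚ.≡⇒≡ᵇ ∣ S ∣ k e))

bool-cases : ∀ b → b ≡ true ⊎ b ≡ false
bool-cases true  = inj₁ refl
bool-cases false = inj₂ refl

¬true⇒false : ∀ {b} → ¬ (b ≡ true) → b ≡ false
¬true⇒false {true}  h = ⊥-elim (h refl)
¬true⇒false {false} h = refl

true≢false : ∀ {b} → b ≡ true → b ≡ false → ⊥
true≢false refl ()

faces : ∀ {n} → Family n → ℕ → Family n
faces Λ j S = Λ S ∧ sizeIs j S

faces⇒ : ∀ {n} (Λ : Family n) j S → faces Λ j S ≡ true → Λ S ≡ true × ∣ S ∣ ≡ j
faces⇒ Λ j S e = let (p , q) = ∧-split e in p , sizeIs⇒≡ j S q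

⇒faces : ∀ {n} (Λ : Family n) j S → Λ S ≡ true → ∣ S ∣ ≡ j → faces Λ j S ≡ true
⇒faces Λ j S p q = ∧-join p (≡⇒sizeIs j S q)

enum : ∀ {n} (Φ : Family n) → Fin (count Φ) → Subset n
enum {zero} Φ i = []
enum {suc n} Φ i = [ (λ j → outside ∷ enum (Φ ∘ (outside ∷_)) j) , (λ j → inside ∷ enum (Φ ∘ (inside ∷_)) j) ]′
                     (splitAt (count (Φ ∘ (outside ∷_))) i)

enum-∈ : ∀ {n} (Φ : Family n) i → Φ (enum Φ i) ≡ true
enum-∈ {zero} Φ i with Φ []
enum-∈ {zero} Φ i | true = refl
enum-∈ {zero} Φ () | false
enum-∈ {suc n} Φ i with splitAt (count (Φ ∘ (outside ∷_))) i
... | inj₁ j = enum-∈ (Φ ∘ (outside ∷_)) j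
... | inj₂ j = enum-∈ (Φ ∘ (inside ∷_)) j

index : ∀ {n} (Φ : Family n) S → Φ S ≡ true → ∃ λ i → enum Φ i ≡ S
index {zero} Φ [] e with Φ []
index {zero} Φ [] refl | true = zero , refl
index {suc n} Φ (outside ∷ S) e with index (Φ ∘ (outside ∷_)) S e
... | i , h = i ↑ˡ count (Φ ∘ (inside ∷_)) , trans (cong [ _ , _ ]′ (Finₚ.splitAt-↑ˡ (count (Φ ∘ (outside ∷_))) i _)) (cong (outside ∷_) h)
index {suc n} Φ (inside ∷ S) e with index (Φ ∘ (inside ∷_)) S e
... | i , h = count (Φ ∘ (outside ∷_)) ↑ʳ i , trans (cong [ _ , _ ]′ (Finₚ.splitAt-↑ʳ (count (Φ ∘ (outside ∷_))) _ i)) (cong (inside ∷_) h)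

enum-injective : ∀ {n} (Φ : Family n) {i j} → enum Φ i ≡ enum Φ j → i ≡ j
enum-injective {zero} Φ {i} {j} e with Φ []
enum-injective {zero} Φ {zero} {zero} e | true = refl
enum-injective {suc n} Φ {i} {j} e
  with splitAt (count (Φ ∘ (outside ∷_))) i in ei | splitAt (count (Φ ∘ (outside ∷_))) j in ej
... | inj₁ p | inj₁ q = trans (sym (Finₚ.splitAt⁻¹-↑ˡ ei)) (trans (cong (_↑ˡ _) (enum-injective (Φ ∘ (outside ∷_)) (Vecₚ.∷-injectiveʳ e))) (Finₚ.splitAt⁻¹-↑ˡ ej))
... | inj₂ p | inj₂ q = trans (sym (Finₚ.splitAt⁻¹-↑ʳ ei)) (trans (cong (_ ↑ʳ_) (enum-injective (Φ ∘ (inside ∷_)) (Vecₚ.∷-injectiveʳ e))) (Finₚ.splitAt⁻¹-↑ʳ ej))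
... | inj₁ p | inj₂ q with () ← Vecₚ.∷-injectiveˡ e
... | inj₂ p | inj₁ q with () ← Vecₚ.∷-injectiveˡ e

-- Simplicial chains over a commutative ring

module Boundary {c ℓ} (R : CommutativeRing c ℓ) where
  open CommutativeRing R renaming (refl to ≈-refl; sym to ≈-sym; trans to ≈-trans; zero to *-zero)
  open RingProperties ring using (-0#≈0#; -‿+-comm; -‿distribʳ-*; -‿distribˡ-*; -‿involutive)
  open FromInteger R using (fromℤ; fromℤ-+; fromℤ-neg; module Solver)
  open Solver using (solve; _:+_; _:*_; :-_; _:=_; _:-_)
  open import Relation.Binary.Reasoning.Setoid setoid

  Chain : ℕ → Set c
  Chain n = Subset n → Carrier

  -- The boundary of the full simplex. A subcomplex enters through the support of the chain and not
  -- through the operator, so `bd-bd` holds without hypotheses.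
  bd : ∀ {n} → Chain n → Chain n
  bd z []            = 0#
  bd z (outside ∷ S) = z (inside ∷ S) + bd (z ∘ (outside ∷_)) S
  bd z (inside ∷ S)  = - bd (z ∘ (inside ∷_)) S

  bd-local : ∀ {n} (z z′ : Chain n) S → (∀ v → lookup S v ≡ outside → z (S [ v ]≔ inside) ≈ z′ (S [ v ]≔ inside)) → bd z S ≈ bd z′ S
  bd-local z z′ [] h = ≈-refl
  bd-local z z′ (outside ∷ S) h = +-cong (h zero refl) (bd-local _ _ S (λ v → h (suc v)))
  bd-local z z′ (inside ∷ S) h = -‿cong (bd-local _ _ S (λ v → h (suc v)))

  bd-cong : ∀ {n} {z z′ : Chain n} → (∀ S → z S ≈ z′ S) → ∀ S → bd z S ≈ bd z′ S
  bd-cong h S = bd-local _ _ S (λ v _ → h _)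

  bd-0 : ∀ {n} (S : Subset n) → bd (λ _ → 0#) S ≈ 0#
  bd-0 [] = ≈-refl
  bd-0 (outside ∷ S) = ≈-trans (+-identityˡ _) (bd-0 S)
  bd-0 (inside ∷ S) = ≈-trans (-‿cong (bd-0 S)) -0#≈0#

  bd-+ : ∀ {n} (z w : Chain n) S → bd (λ A → z A + w A) S ≈ bd z S + bd w S
  bd-+ z w [] = ≈-sym (+-identityˡ _)
  bd-+ z w (outside ∷ S) = ≈-trans (+-congˡ (bd-+ (z ∘ (outside ∷_)) (w ∘ (outside ∷_)) S))
    (solve 4 (λ a b c d → a :+ b :+ (c :+ d) := a :+ c :+ (b :+ d)) ≈-refl _ _ _ _)
  bd-+ z w (inside ∷ S) = ≈-trans (-‿cong (bd-+ (z ∘ (inside ∷_)) (w ∘ (inside ∷_)) S)) (≈-sym (-‿+-comm _ _))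

  bd-· : ∀ {n} a (z : Chain n) S → bd (λ A → a * z A) S ≈ a * bd z S
  bd-· a z [] = ≈-sym (zeroʳ a)
  bd-· a z (outside ∷ S) = ≈-trans (+-congˡ (bd-· a (z ∘ (outside ∷_)) S)) (≈-sym (distribˡ a _ _))
  bd-· a z (inside ∷ S) = ≈-trans (-‿cong (bd-· a (z ∘ (inside ∷_)) S)) (-‿distribʳ-* a _)

  bd-neg : ∀ {n} (z : Chain n) S → bd (λ A → - z A) S ≈ - bd z S
  bd-neg z [] = ≈-sym -0#≈0#
  bd-neg z (outside ∷ S) = ≈-trans (+-congˡ (bd-neg (z ∘ (outside ∷_)) S)) (-‿+-comm _ _)
  bd-neg z (inside ∷ S) = -‿cong (bd-neg (z ∘ (inside ∷_)) S)

  bd-bd : ∀ {n} (z : Chain n) S → bd (bd z) S ≈ 0#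
  bd-bd z [] = ≈-refl
  bd-bd z (outside ∷ S) = begin
    - bd z₁ S + bd (λ A → z₁ A + bd z₀ A) S       ≈⟨ +-congˡ (≈-trans (bd-+ z₁ (bd z₀) S) (≈-trans (+-congˡ (bd-bd z₀ S)) (+-identityʳ _))) ⟩
    - bd z₁ S + bd z₁ S                           ≈⟨ -‿inverseˡ _ ⟩
    0#                                            ∎
    where
    z₀ z₁ : Chain _
    z₀ = z ∘ (outside ∷_)
    z₁ = z ∘ (inside ∷_)
  bd-bd z (inside ∷ S) = ≈-trans (-‿cong (≈-trans (bd-neg (bd (z ∘ (inside ∷_))) S) (-‿cong (bd-bd (z ∘ (inside ∷_)) S)))) (≈-trans (-‿involutive _) ≈-refl)

  Supported : ∀ {n} → Family n → Chain n → Set ℓ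
  Supported P z = ∀ S → P S ≡ false → z S ≈ 0#

  restrict : ∀ {n} → Family n → Chain n → Chain n
  restrict P z S = if P S then z S else 0#

  restrict-∈ : ∀ {n} (P : Family n) z {S} → P S ≡ true → restrict P z S ≈ z S
  restrict-∈ P z e rewrite e = ≈-refl

  restrict-∉ : ∀ {n} (P : Family n) z {S} → P S ≡ false → restrict P z S ≈ 0#
  restrict-∉ P z e rewrite e = ≈-refl

  indicator : ∀ {n} → Subset n → Chain n
  indicator []            []            = 1#
  indicator (outside ∷ A) (outside ∷ B) = indicator A B
  indicator (inside ∷ A)  (inside ∷ B)  = indicator A B
  indicator (outside ∷ A) (inside ∷ B)  = 0#
  indicator (inside ∷ A)  (outside ∷ B) = 0#

  indicator-self : ∀ {n} (A : Subset n) → indicator A A ≡ 1#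
  indicator-self [] = refl
  indicator-self (outside ∷ A) = indicator-self A
  indicator-self (inside ∷ A) = indicator-self A

  indicator-other : ∀ {n} (A B : Subset n) → A ≢ B → indicator A B ≡ 0#
  indicator-other [] [] h = ⊥-elim (h refl)
  indicator-other (outside ∷ A) (outside ∷ B) h = indicator-other A B (h ∘ cong (outside ∷_))
  indicator-other (inside ∷ A) (inside ∷ B) h = indicator-other A B (h ∘ cong (inside ∷_))
  indicator-other (outside ∷ A) (inside ∷ B) h = refl
  indicator-other (inside ∷ A) (outside ∷ B) h = refl

-- Integral chains, Bézout cofactors and content

module ℤB = Boundary ℤₚ.+-*-commutativeRing

module _ {c ℓ} (R : CommutativeRing c ℓ) where
  open CommutativeRing R renaming (refl to ≈-refl; sym to ≈-sym; trans to ≈-trans; zero to *-zero)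
  open Boundary R
  open FromInteger R using (fromℤ; fromℤ-+; fromℤ-neg)

  bd-fromInteger : ∀ {n} (m : Subset n → ℤ) S → fromℤ (ℤB.bd m S) ≈ bd (fromℤ ∘ m) S
  bd-fromInteger m [] = ≈-refl
  bd-fromInteger m (outside ∷ S) = ≈-trans (fromℤ-+ (m (inside ∷ S)) _) (+-congˡ (bd-fromInteger (m ∘ (outside ∷_)) S))
  bd-fromInteger m (inside ∷ S) = ≈-trans (fromℤ-neg (ℤB.bd (m ∘ (inside ∷_)) S)) (-‿cong (bd-fromInteger (m ∘ (inside ∷_)) S))

-- Bézout in a form that also covers a = b = 0.
bezout-ℕ : ∀ a b → ∃ λ g → ∃ λ a′ → ∃ λ b′ → ∃ λ u → ∃ λ v →
  ℤ.+ a ≡ g ℤ.* a′ × ℤ.+ b ≡ g ℤ.* b′ × u ℤ.* a′ ℤ.+ v ℤ.* b′ ≡ ℤ.1ℤ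
bezout-ℕ a b with GCD.Bézout.lemma a b
... | GCD.Bézout.result zero g _ = ℤ.0ℤ , ℤ.1ℤ , ℤ.0ℤ , ℤ.1ℤ , ℤ.0ℤ , zeros (GCD.GCD.gcd∣m g) , zeros (GCD.GCD.gcd∣n g) , refl
  where zeros : ∀ {x} → 0 Data.Nat.Divisibility.∣ x → ℤ.+ x ≡ ℤ.0ℤ
        zeros (divides q refl) = cong ℤ.+_ (ℕₚ.*-zeroʳ q)
... | GCD.Bézout.result (suc d) g id with GCD.GCD.gcd∣m g | GCD.GCD.gcd∣n g
...   | divides p refl | divides q refl = ℤ.+ suc d , ℤ.+ p , ℤ.+ q , cofactors id
  where
  times : ∀ p → ℤ.+ (p ℕ.* suc d) ≡ ℤ.+ suc d ℤ.* ℤ.+ p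
  times p = trans (ℤₚ.pos-* p (suc d)) (ℤₚ.*-comm (ℤ.+ p) (ℤ.+ suc d))
  cancel : ∀ x y p q → suc d ℕ.+ y ℕ.* (q ℕ.* suc d) ≡ x ℕ.* (p ℕ.* suc d) → ℤ.+ x ℤ.* ℤ.+ p ≡ ℤ.1ℤ ℤ.+ ℤ.+ y ℤ.* ℤ.+ q
  cancel x y p q e = trans (sym (ℤₚ.pos-* x p)) (trans (cong ℤ.+_ (sym
    (ℕₚ.*-cancelʳ-≡ (1 ℕ.+ y ℕ.* q) (x ℕ.* p) (suc d)
      (trans (cong (suc d ℕ.+_) (ℕₚ.*-assoc y q (suc d))) (trans e (sym (ℕₚ.*-assoc x p (suc d)))))))) (cong (λ t → ℤ.1ℤ ℤ.+ t) (ℤₚ.pos-* y q)))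
  cofactors : GCD.Bézout.Identity (suc d) (p ℕ.* suc d) (q ℕ.* suc d) → ∃ λ u → ∃ λ v →
    ℤ.+ (p ℕ.* suc d) ≡ ℤ.+ suc d ℤ.* ℤ.+ p × ℤ.+ (q ℕ.* suc d) ≡ ℤ.+ suc d ℤ.* ℤ.+ q × u ℤ.* ℤ.+ p ℤ.+ v ℤ.* ℤ.+ q ≡ ℤ.1ℤ
  cofactors (GCD.Bézout.+- x y e) = ℤ.+ x , ℤ.- (ℤ.+ y) , times p , times q ,
    trans (cong₂ ℤ._+_ (cancel x y p q e) (sym (ℤₚ.neg-distribˡ-* (ℤ.+ y) (ℤ.+ q))))
      (trans (ℤₚ.+-assoc ℤ.1ℤ (ℤ.+ y ℤ.* ℤ.+ q) _) (cong (λ t → ℤ.1ℤ ℤ.+ t) (ℤₚ.+-inverseʳ (ℤ.+ y ℤ.* ℤ.+ q))))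
  cofactors (GCD.Bézout.-+ x y e) = ℤ.- (ℤ.+ x) , ℤ.+ y , times p , times q ,
    trans (ℤₚ.+-comm _ (ℤ.+ y ℤ.* ℤ.+ q)) (trans (cong₂ ℤ._+_ (cancel y x q p e) (sym (ℤₚ.neg-distribˡ-* (ℤ.+ x) (ℤ.+ p))))
      (trans (ℤₚ.+-assoc ℤ.1ℤ (ℤ.+ x ℤ.* ℤ.+ p) _) (cong (λ t → ℤ.1ℤ ℤ.+ t) (ℤₚ.+-inverseʳ (ℤ.+ x ℤ.* ℤ.+ p)))))

module CommutativeIdentities {c ℓ} (R : CommutativeRing c ℓ) where
  open CommutativeRing R using (_≈_; _*_) renaming (refl to ≈-refl)
  open FromInteger.Solver R using (solve; _:*_; _:=_)

  *-swapˡ : ∀ x y z → x * (y * z) ≈ y * (x * z)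
  *-swapˡ = solve 3 (λ x y z → x :* (y :* z) := y :* (x :* z)) ≈-refl

  *-interchange : ∀ u a h m → u * a * (h * m) ≈ u * h * (a * m)
  *-interchange = solve 4 (λ u a h m → u :* a :* (h :* m) := u :* h :* (a :* m)) ≈-refl

  *-collect : ∀ u s a → u * s * (s * a) ≈ u * a * (s * s)
  *-collect = solve 3 (λ u s a → u :* s :* (s :* a) := u :* a :* (s :* s)) ≈-refl

open CommutativeIdentities ℤₚ.+-*-commutativeRing using (*-swapˡ; *-collect)

signed : ∀ a → ∃ λ s → a ≡ s ℤ.* ℤ.+ ℤ.∣ a ∣ × s ℤ.* s ≡ ℤ.1ℤ
signed (ℤ.+ a)  = ℤ.1ℤ , sym (ℤₚ.*-identityˡ _) , refl
signed -[1+ a ] = ℤ.-1ℤ , sym (ℤₚ.-1*i≡-i _) , refl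

bezout : ∀ a b → ∃ λ g → ∃ λ a′ → ∃ λ b′ → ∃ λ u → ∃ λ v →
  a ≡ g ℤ.* a′ × b ≡ g ℤ.* b′ × u ℤ.* a′ ℤ.+ v ℤ.* b′ ≡ ℤ.1ℤ
bezout a b with signed a | signed b | bezout-ℕ ℤ.∣ a ∣ ℤ.∣ b ∣
... | s , ea , ss | t , eb , t² | g , a′ , b′ , u , v , ea′ , eb′ , e =
  g , s ℤ.* a′ , t ℤ.* b′ , u ℤ.* s , v ℤ.* t ,
  trans ea (trans (cong (s ℤ.*_) ea′) (*-swapˡ s g a′)) ,
  trans eb (trans (cong (t ℤ.*_) eb′) (*-swapˡ t g b′)) ,
  trans (cong₂ ℤ._+_ (*-collect u s a′) (*-collect v t b′))
    (trans (cong₂ (λ x y → u ℤ.* a′ ℤ.* x ℤ.+ v ℤ.* b′ ℤ.* y) ss t²) (trans (cong₂ ℤ._+_ (ℤₚ.*-identityʳ (u ℤ.* a′)) (ℤₚ.*-identityʳ (v ℤ.* b′))) e))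

module Content {c ℓ} (R : CommutativeRing c ℓ) where
  open CommutativeRing R renaming (refl to ≈-refl; sym to ≈-sym; trans to ≈-trans)
  open CommutativeIdentities R using (*-interchange)

  total : ∀ {n} → (Subset n → Carrier) → Carrier
  total {zero}  f = f []
  total {suc n} f = total (f ∘ (outside ∷_)) + total (f ∘ (inside ∷_))

  total-cong : ∀ {n} {f g : Subset n → Carrier} → (∀ A → f A ≈ g A) → total f ≈ total g
  total-cong {zero}  h = h []
  total-cong {suc n} h = +-cong (total-cong (h ∘ (outside ∷_))) (total-cong (h ∘ (inside ∷_)))

  total-* : ∀ {n} c (f : Subset n → Carrier) → total (λ A → c * f A) ≈ c * total f
  total-* {zero}  c f = ≈-refl
  total-* {suc n} c f = ≈-trans (+-cong (total-* c (f ∘ (outside ∷_))) (total-* c (f ∘ (inside ∷_)))) (≈-sym (distribˡ c _ _))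

  Bezout : Set _
  Bezout = ∀ a b → ∃ λ g → ∃ λ a′ → ∃ λ b′ → ∃ λ u → ∃ λ v → a ≈ g * a′ × b ≈ g * b′ × u * a′ + v * b′ ≈ 1#

  -- The cofactors `a` certify that the primitive part `m′` stays nonzero in every field, whatever
  -- the characteristic. The zero vector is included, with `g` equal to 0.
  Unimodular : ∀ {n} → (Subset n → Carrier) → Set _
  Unimodular {n} m = ∃ λ g → ∃ λ (m′ : Subset n → Carrier) → ∃ λ (a : Subset n → Carrier) → (∀ A → m A ≈ g * m′ A) × total (λ A → a A * m′ A) ≈ 1#

  content-split : Bezout → ∀ {n} (m : Subset n → Carrier) → Unimodular m
  content-split bezout {zero} m = m [] , (λ _ → 1#) , (λ _ → 1#) , (λ { [] → ≈-sym (*-identityʳ (m [])) }) , *-identityˡ 1#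
  content-split bezout {suc n} m = combine (content-split bezout (m ∘ (outside ∷_))) (content-split bezout (m ∘ (inside ∷_)))
    where
    part : ∀ u h (m a : Subset n → Carrier) → total (λ A → a A * m A) ≈ 1# → total (λ A → u * a A * (h * m A)) ≈ u * h
    part u h m a e = ≈-trans (total-cong (λ A → *-interchange u (a A) h (m A)))
      (≈-trans (total-* (u * h) (λ A → a A * m A)) (≈-trans (*-congˡ e) (*-identityʳ (u * h))))
    combine : Unimodular (m ∘ (outside ∷_)) → Unimodular (m ∘ (inside ∷_)) → Unimodular m
    combine (g₀ , m₀ , a₀ , e₀ , s₀) (g₁ , m₁ , a₁ , e₁ , s₁) with bezout g₀ g₁
    ... | g , h₀ , h₁ , u , v , eg₀ , eg₁ , e =
      g , m′ , a′ , factors , ≈-trans (+-cong (part u h₀ m₀ a₀ s₀) (part v h₁ m₁ a₁ s₁)) e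
      where
      m′ a′ : Subset (suc n) → Carrier
      m′ (outside ∷ A) = h₀ * m₀ A
      m′ (inside ∷ A)  = h₁ * m₁ A
      a′ (outside ∷ A) = u * a₀ A
      a′ (inside ∷ A)  = v * a₁ A
      factors : ∀ A → m A ≈ g * m′ A
      factors (outside ∷ A) = ≈-trans (e₀ A) (≈-trans (*-congʳ eg₀) (*-assoc g h₀ (m₀ A)))
      factors (inside ∷ A)  = ≈-trans (e₁ A) (≈-trans (*-congʳ eg₁) (*-assoc g h₁ (m₁ A)))

module ℤC = Content ℤₚ.+-*-commutativeRing

-- Column bases of boundary matrices, and exactness

_≟ₛ_ : ∀ {n} → DecidableEquality (Subset n)
_≟ₛ_ = Vecₚ.≡-dec Boolₚ._≟_

count-mono : ∀ {n} {Φ Ψ : Family n} → (∀ S → Φ S ≡ true → Ψ S ≡ true) → count Φ ≤ count Ψ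
count-mono {zero} {Φ} {Ψ} h with Φ [] | h []
... | false | _ = z≤n
... | true  | p rewrite p refl = s≤s z≤n
count-mono {suc n} h = ℕₚ.+-mono-≤ (count-mono (h ∘ (outside ∷_))) (count-mono (h ∘ (inside ∷_)))

count-strict : ∀ {n} {Φ Ψ : Family n} → (∀ S → Φ S ≡ true → Ψ S ≡ true) → ∀ S → Φ S ≡ false → Ψ S ≡ true → count Φ < count Ψ
count-strict {zero} {Φ} {Ψ} h [] p q rewrite p | q = s≤s z≤n
count-strict {suc n} h (outside ∷ S) p q = ℕₚ.+-mono-<-≤ (count-strict (h ∘ (outside ∷_)) S p q) (count-mono (h ∘ (inside ∷_)))
count-strict {suc n} h (inside ∷ S) p q = ℕₚ.+-mono-≤-< (count-mono (h ∘ (outside ∷_))) (count-strict (h ∘ (inside ∷_)) S p q)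

subset-choice : ∀ {ℓ n} {P : Subset n → Set ℓ} → (∀ S → ¬ ¬ P S) → ¬ ¬ (∀ S → P S)
subset-choice {n = zero} h = h [] >>= λ p → return λ { [] → p }
subset-choice {n = suc n} h =
  subset-choice (h ∘ (outside ∷_)) >>= λ p →
  subset-choice (h ∘ (inside ∷_)) >>= λ q →
  return λ { (outside ∷ S) → p S ; (inside ∷ S) → q S }

without : ∀ {n} → Subset n → Family n → Family n
without A Φ S with A ≟ₛ S
... | yes _ = false
... | no _  = Φ S

without-self : ∀ {n} A (Φ : Family n) → without A Φ A ≡ false
without-self A Φ with A ≟ₛ A
... | yes _ = refl
... | no h  = ⊥-elim (h refl)

without-other : ∀ {n} A (Φ : Family n) S → without A Φ S ≡ false → A ≡ S ⊎ Φ S ≡ false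
without-other A Φ S e with A ≟ₛ S
... | yes p = inj₁ p
... | no _  = inj₂ e

without-⊆ : ∀ {n} A (Φ : Family n) S → without A Φ S ≡ true → Φ S ≡ true
without-⊆ A Φ S e with A ≟ₛ S
without-⊆ A Φ S () | yes _
... | no _ = e

module Chains {κ ℓ} (K : Field κ ℓ) where
  open Field K renaming (refl to ≈-refl; sym to ≈-sym; trans to ≈-trans; zero to *-zero)
  open Boundary commutativeRing public
  open SemiringSum semiring using (sum; sum-cong-≋; ∑-distrib-+; *-distribˡ-sum; sum-replicate-zero)
  open RingProperties ring using (-0#≈0#; -‿+-comm; -‿distribʳ-*; -‿distribˡ-*; -‿involutive)
  open FromInteger commutativeRing using (module Solver)
  open Solver using (solve; _:+_; _:*_; :-_; _:=_; _:-_)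
  open import Relation.Binary.Reasoning.Setoid setoid

  sum-zero : ∀ {k} {g : Fin k → Carrier} → (∀ i → g i ≈ 0#) → sum g ≈ 0#
  sum-zero {k} {g} h = ≈-trans (sum-cong-≋ {x = g} h) (sum-replicate-zero k)

  sum-single : ∀ {k} (g : Fin k → Carrier) j → (∀ i → i ≢ j → g i ≈ 0#) → sum g ≈ g j
  sum-single g zero h = ≈-trans (+-congˡ (sum-zero (λ i → h (suc i) λ ()))) (+-identityʳ _)
  sum-single g (suc j) h = ≈-trans (+-cong (h zero λ ()) (sum-single (g ∘ suc) j (λ i i≢j → h (suc i) (i≢j ∘ Finₚ.suc-injective)))) (+-identityˡ _)

  combination : ∀ {k n} → (Fin k → Carrier) → (Fin k → Chain n) → Chain n
  combination x u S = sum (λ i → x i * u i S)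

  combination-supported : ∀ {k n} {Φ : Family n} (x : Fin k → Carrier) {u : Fin k → Chain n} → (∀ i → Supported Φ (u i)) → Supported Φ (combination x u)
  combination-supported x h S e = sum-zero (λ i → ≈-trans (*-congˡ (h i S e)) (zeroʳ _))

  combination-+ : ∀ {k n} (x : Fin k → Carrier) (u w : Fin k → Chain n) S →
    combination x (λ i S → u i S + w i S) S ≈ combination x u S + combination x w S
  combination-+ x u w S = ≈-trans (sum-cong-≋ {x = λ i → x i * (u i S + w i S)} (λ i → distribˡ (x i) (u i S) (w i S)))
    (∑-distrib-+ (λ i → x i * u i S) (λ i → x i * w i S))

  combination-cong : ∀ {k n} (x : Fin k → Carrier) (u w : Fin k → Chain n) S → (∀ i → u i S ≈ w i S) → combination x u S ≈ combination x w S
  combination-cong x u w S h = sum-cong-≋ {x = λ i → x i * u i S} (λ i → *-congˡ (h i))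

  bd-combination : ∀ {k n} (x : Fin k → Carrier) (u : Fin k → Chain n) S → bd (combination x u) S ≈ combination x (bd ∘ u) S
  bd-combination {zero} x u S = bd-0 S
  bd-combination {suc k} x u S = ≈-trans (bd-+ (λ A → x zero * u zero A) (combination (x ∘ suc) (u ∘ suc)) S)
    (+-cong (bd-· (x zero) (u zero) S) (bd-combination (x ∘ suc) (u ∘ suc) S))

  combination-indicator : ∀ {k n} (x : Fin k → Carrier) (A : Fin k → Subset n) → (∀ {i j} → A i ≡ A j → i ≡ j) →
    ∀ j → combination x (indicator ∘ A) (A j) ≈ x j
  combination-indicator x A inj j = ≈-trans (sum-single _ j (λ i i≢j → ≈-trans (*-congˡ (reflexive (indicator-other (A i) (A j) (i≢j ∘ inj)))) (zeroʳ _)))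
    (≈-trans (*-congˡ (reflexive (indicator-self (A j)))) (*-identityʳ _))

  indicator-supported : ∀ {n} {Φ : Family n} A → Φ A ≡ true → Supported Φ (indicator A)
  indicator-supported {Φ = Φ} A A∈ S S∉ = reflexive (indicator-other A S λ { refl → true≢false A∈ S∉ })

  dependent-chains : ∀ {k n} (Φ : Family n) (u : Fin k → Chain n) → (∀ i → Supported Φ (u i)) → count Φ < k →
    ¬ ¬ (∃ λ (x : Fin k → Carrier) → (∃ λ i → ¬ x i ≈ 0#) × ∀ S → combination x u S ≈ 0#)
  dependent-chains Φ u supp big =
    Dependence.nonzero-solution K (λ i j → u i (enum Φ j)) big >>= λ (x , x≉0 , eqs) →
    return (x , x≉0 , λ S → [ on x eqs S , combination-supported x supp S ]′ (bool-cases (Φ S)))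
    where
    on : ∀ x → (∀ j → sum (λ i → x i * u i (enum Φ j)) ≈ 0#) → ∀ S → Φ S ≡ true → combination x u S ≈ 0#
    on x eqs S S∈ with index Φ S S∈
    ... | j , refl = eqs j

  Cycle : ∀ {n} → Chain n → Set ℓ
  Cycle z = ∀ S → bd z S ≈ 0#

  ExactChains : ∀ {n} → Family n → ℕ → Set (κ ⊔ ℓ)
  ExactChains Λ j = ∀ z → Supported (faces Λ j) z → Cycle z → ¬ ¬ (∃ λ b → Supported (faces Λ (suc j)) b × ∀ S → bd b S ≈ z S)

  bd-supported : ∀ {n} {Λ : Family n} → DownClosed Λ → ∀ j z → Supported (faces Λ (suc j)) z → Supported (faces Λ j) (bd z)
  bd-supported {Λ = Λ} dc j z supp S S∉ = ≈-trans (bd-local z (λ _ → 0#) S (λ v v∉ → supp _ (¬true⇒false λ S+v∈ →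
    let (p , q) = faces⇒ Λ (suc j) (S [ v ]≔ inside) S+v∈ in
    true≢false (⇒faces Λ j S (dc S v p) (ℕₚ.suc-injective (trans (sym (size-insert S v v∉)) q))) S∉))) (bd-0 S)

  supported-+ : ∀ {n} {Φ : Family n} {z w} a → Supported Φ z → Supported Φ w → Supported Φ (λ S → z S + a * w S)
  supported-+ a p q S e = ≈-trans (+-cong (p S e) (≈-trans (*-congˡ (q S e)) (zeroʳ a))) (+-identityˡ 0#)

  bd-+· : ∀ {n} (z w : Chain n) a S → bd (λ S → z S + a * w S) S ≈ bd z S + a * bd w S
  bd-+· z w a S = ≈-trans (bd-+ z (λ S → a * w S) S) (+-congˡ (bd-· a w S))

  -- Faces label the columns of a boundary matrix. `Spanning` and `Independent` together say that
  -- the columns in 𝓑 form a basis of the column space of Φ.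
  Spanning : ∀ {n} → Family n → Family n → Set (κ ⊔ ℓ)
  Spanning Φ 𝓑 = ∀ z → Supported Φ z → ¬ ¬ (∃ λ b → Supported 𝓑 b × ∀ S → bd b S ≈ bd z S)

  Independent : ∀ {n} → Family n → Set (κ ⊔ ℓ)
  Independent 𝓑 = ∀ z → Supported 𝓑 z → Cycle z → ¬ ¬ (∀ S → z S ≈ 0#)

  spanning-without : ∀ {n} {Φ 𝓑 : Family n} {z A} → Supported 𝓑 z → Cycle z → ¬ (z A ≈ 0#) → Spanning Φ 𝓑 → Spanning Φ (without A 𝓑)
  spanning-without {𝓑 = 𝓑} {z} {A} supp cyc zA≉0 span w w-supp =
    span w w-supp >>= λ (b , b-supp , e) → return (replacement b b-supp e)
    where
    y : Carrier
    y = proj₁ (inverse (z A) zA≉0)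
    zy≈1 : z A * y ≈ 1#
    zy≈1 = proj₂ (inverse (z A) zA≉0)
    replacement : ∀ b → Supported 𝓑 b → (∀ S → bd b S ≈ bd w S) → ∃ λ b′ → Supported (without A 𝓑) b′ × ∀ S → bd b′ S ≈ bd w S
    replacement b b-supp e = b′ , (λ S S∉ → [ (λ { refl → at-A }) , supported-+ {Φ = 𝓑} {z = b} {w = z} (- (b A * y)) b-supp supp S ]′ (without-other A 𝓑 S S∉)) ,
      λ S → ≈-trans (bd-+· b z (- (b A * y)) S) (≈-trans (+-cong (e S) (≈-trans (*-congˡ (cyc S)) (zeroʳ _))) (+-identityʳ _))
      where
      b′ : Chain _
      b′ S = b S + - (b A * y) * z S
      at-A : b′ A ≈ 0#
      at-A = begin
        b A + - (b A * y) * z A    ≈⟨ solve 3 (λ b y z → b :+ :- (b :* y) :* z := b :- b :* (z :* y)) ≈-refl (b A) y (z A) ⟩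
        b A + - (b A * (z A * y))  ≈⟨ +-congˡ (-‿cong (≈-trans (*-congˡ zy≈1) (*-identityʳ _))) ⟩
        b A + - b A                ≈⟨ -‿inverseʳ _ ⟩
        0#                         ∎

  -- A face in the support of a cycle can be deleted without losing any boundary; the deletions end
  -- when no nonzero cycle is left.
  independent-spanning : ∀ {n} (Φ : Family n) → ¬ ¬ (∃ λ 𝓑 → (∀ S → 𝓑 S ≡ true → Φ S ≡ true) × Spanning Φ 𝓑 × Independent 𝓑)
  independent-spanning Φ = shrink (count Φ) Φ ℕₚ.≤-refl (λ S e → e) (λ z supp → return (z , supp , λ S → ≈-refl))
    where
    shrink : ∀ fuel 𝓑 → count 𝓑 ≤ fuel → (∀ S → 𝓑 S ≡ true → Φ S ≡ true) → Spanning Φ 𝓑 →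
      ¬ ¬ (∃ λ 𝓑 → (∀ S → 𝓑 S ≡ true → Φ S ≡ true) × Spanning Φ 𝓑 × Independent 𝓑)
    shrink fuel 𝓑 bound sub span =
      ¬¬-excluded-middle {A = ∃ λ z → Supported 𝓑 z × Cycle z × ∃ λ A → ¬ (z A ≈ 0#)} >>= λ where
        (no none) → return (𝓑 , sub , span , λ z supp cyc → subset-choice (λ S zS≉0 → none (z , supp , cyc , S , zS≉0)))
        (yes (z , supp , cyc , A , zA≉0)) → smaller fuel bound z A supp cyc zA≉0
      where
      smaller : ∀ fuel → count 𝓑 ≤ fuel → ∀ z A → Supported 𝓑 z → Cycle z → ¬ (z A ≈ 0#) → _
      smaller fuel bound z A supp cyc zA≉0 with bool-cases (𝓑 A)
      ... | inj₂ A∉ = ⊥-elim (zA≉0 (supp A A∉))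
      ... | inj₁ A∈ with fuel | ℕₚ.<-≤-trans (count-strict (without-⊆ A 𝓑) A (without-self A 𝓑) A∈) bound
      ...   | suc fuel′ | s≤s less = shrink fuel′ (without A 𝓑) less (λ S → sub S ∘ without-⊆ A 𝓑 S) (spanning-without {z = z} supp cyc zA≉0 span)

  -- The disjoint union of two families, coded as one family on an extra point so that a single
  -- enumeration and a single chain serve both.
  pairFamily : ∀ {n} → Family n → Family n → Family (suc n)
  pairFamily 𝓑 𝓒 (outside ∷ S) = 𝓑 S
  pairFamily 𝓑 𝓒 (inside ∷ S)  = 𝓒 S

  pairChain : ∀ {n} → Chain n → Chain n → Chain (suc n)
  pairChain b c (outside ∷ S) = b S
  pairChain b c (inside ∷ S)  = c S

  -- Subtract from a face the chain on 𝓑 with the same boundary; by exactness the rest is a boundary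
  -- of a chain on 𝓒. This turns acyclicity into an inequality between numbers of faces, which no
  -- longer mentions the field.
  spanning-bound : ∀ {n} {Λ : Family n} {j} {𝓑 𝓒 : Family n} → DownClosed Λ → ExactChains Λ j → (∀ S → 𝓑 S ≡ true → faces Λ j S ≡ true) →
    Spanning (faces Λ j) 𝓑 → Spanning (faces Λ (suc j)) 𝓒 → count (faces Λ j) ≤ count 𝓑 ℕ.+ count 𝓒
  spanning-bound {n} {Λ} {j} {𝓑} {𝓒} dc exact sub spanB spanC = decidable-stable (_ ℕ.≤? _) λ ≰ → contradict (ℕₚ.≰⇒> ≰) (λ x → x)
    where
    Φ : Family n
    Φ = faces Λ j
    Decomposition : Fin (count Φ) → Set (κ ⊔ ℓ)
    Decomposition i = ∃ λ b → ∃ λ c → Supported 𝓑 b × Supported 𝓒 c × ∀ S → indicator (enum Φ i) S ≈ bd c S + b S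
    decompose : ∀ i → ¬ ¬ Decomposition i
    decompose i =
      spanB e e-supp >>= λ (b , b-supp , eb) →
      exact (λ S → e S + - 1# * b S) (supported-+ (- 1#) e-supp (λ S S∉ → b-supp S (¬true⇒false λ S∈ → true≢false (sub S S∈) S∉)))
        (λ S → ≈-trans (bd-+· e b (- 1#) S) (≈-trans (+-congˡ (*-congˡ (eb S))) (cancel (bd e S)))) >>= λ (a , a-supp , ea) →
      spanC a a-supp >>= λ (c , c-supp , ec) →
      return (b , c , b-supp , c-supp , λ S → ≈-sym (≈-trans (+-congʳ (≈-trans (ec S) (ea S)))
        (≈-trans (+-assoc _ _ _) (≈-trans (+-congˡ (≈-trans (+-comm _ _) (cancel (b S)))) (+-identityʳ _)))))
      where
      e : Chain n
      e = indicator (enum Φ i)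
      e-supp : Supported Φ e
      e-supp = indicator-supported {Φ = Φ} (enum Φ i) (enum-∈ Φ i)
      cancel : ∀ x → x + - 1# * x ≈ 0#
      cancel x = ≈-trans (+-congˡ (≈-trans (≈-sym (-‿distribˡ-* 1# x)) (-‿cong (*-identityˡ x)))) (-‿inverseʳ x)
    contradict : count 𝓑 ℕ.+ count 𝓒 < count Φ → ¬ ¬ ⊥
    contradict big =
      ¬¬-choice decompose >>= λ dec →
      dependent-chains (pairFamily 𝓑 𝓒) (λ i → pairChain (proj₁ (dec i)) (proj₁ (proj₂ (dec i))))
        (λ i → λ { (outside ∷ S) → proj₁ (proj₂ (proj₂ (dec i))) S ; (inside ∷ S) → proj₁ (proj₂ (proj₂ (proj₂ (dec i)))) S }) big >>= λ (x , (i , xi≉0) , eqs) →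
      return (xi≉0 (finish dec x eqs i))
      where
      finish : (dec : ∀ i → Decomposition i) → ∀ x → (∀ S → combination x (λ i → pairChain (proj₁ (dec i)) (proj₁ (proj₂ (dec i)))) S ≈ 0#) → ∀ i → x i ≈ 0#
      finish dec x eqs i = begin
        x i                                            ≈⟨ ≈-sym (combination-indicator x (enum Φ) (enum-injective Φ) i) ⟩
        combination x (indicator ∘ enum Φ) (enum Φ i)  ≈⟨ combination-cong x (indicator ∘ enum Φ) (λ l S → bd (c l) S + b l S) S (λ l → proj₂ (proj₂ (proj₂ (proj₂ (dec l)))) S) ⟩
        combination x (λ l S → bd (c l) S + b l S) S   ≈⟨ combination-+ x (bd ∘ c) b S ⟩
        combination x (bd ∘ c) S + combination x b S   ≈⟨ +-cong (≈-sym (bd-combination x c S)) (eqs (outside ∷ S)) ⟩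
        bd (combination x c) S + 0#                    ≈⟨ +-identityʳ _ ⟩
        bd (combination x c) S                         ≈⟨ bd-cong {z = combination x c} {z′ = λ _ → 0#} (λ A → eqs (inside ∷ A)) S ⟩
        bd (λ _ → 0#) S                                ≈⟨ bd-0 S ⟩
        0#                                             ∎
        where
        S : Subset n
        S = enum Φ i
        b c : Fin (count Φ) → Chain n
        b l = proj₁ (dec l)
        c l = proj₁ (proj₂ (dec l))

  -- The cycle `z`, the faces in 𝓑 and the boundaries of the faces in 𝓒 are one too many for the
  -- chain space, so a relation exists. Taking its boundary removes the part on 𝓑. If the
  -- coefficient of `z` were 0, independence of 𝓒 would make the relation trivial; otherwise it
  -- exhibits `z` as a boundary.
  independent-exact : ∀ {n} {Λ : Family n} {j} {𝓑 𝓒 : Family n} → DownClosed Λ →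
    (∀ S → 𝓑 S ≡ true → faces Λ j S ≡ true) → (∀ S → 𝓒 S ≡ true → faces Λ (suc j) S ≡ true) →
    Independent 𝓑 → Independent 𝓒 → count (faces Λ j) ≤ count 𝓑 ℕ.+ count 𝓒 → ExactChains Λ j
  independent-exact {n} {Λ} {j} {𝓑} {𝓒} dc subB subC indB indC bound z z-supp cyc =
    dependent-chains (faces Λ j) u u-supp (s≤s bound) >>= λ (x , x≉0 , eqs) → solveFor x x≉0 eqs
    where
    Ψ : Family (suc n)
    Ψ = pairFamily 𝓑 𝓒
    value : Chain (suc n) → Chain n
    value y S = bd (y ∘ (inside ∷_)) S + y (outside ∷ S)
    u : Fin (suc (count Ψ)) → Chain n
    u zero    = z
    u (suc i) = value (indicator (enum Ψ i))
    value-supp : ∀ U → Ψ U ≡ true → Supported (faces Λ j) (value (indicator U))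
    value-supp (outside ∷ B) B∈ S S∉ = ≈-trans (+-cong (bd-0 S) (indicator-supported {Φ = faces Λ j} B (subB B B∈) S S∉)) (+-identityˡ 0#)
    value-supp (inside ∷ C) C∈ S S∉ = ≈-trans (+-congʳ (bd-supported {Λ = Λ} dc j (indicator C) (indicator-supported {Φ = faces Λ (suc j)} C (subC C C∈)) S S∉)) (+-identityˡ 0#)
    u-supp : ∀ i → Supported (faces Λ j) (u i)
    u-supp zero    = z-supp
    u-supp (suc i) = value-supp (enum Ψ i) (enum-∈ Ψ i)
    solveFor : ∀ x → (∃ λ i → ¬ x i ≈ 0#) → (∀ S → combination x u S ≈ 0#) → ¬ ¬ (∃ λ b → Supported (faces Λ (suc j)) b × ∀ S → bd b S ≈ z S)
    solveFor x x≉0 eqs =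
      indB (y ∘ (outside ∷_)) (λ S → y-supp (outside ∷ S)) outer-cycle >>= λ outer≈0 →
      ¬¬-excluded-middle {A = x zero ≈ 0#} >>= λ where
        (yes x₀≈0) → indC (y ∘ (inside ∷_)) (λ S → y-supp (inside ∷ S)) (λ S → ≈-trans (reduce outer≈0 S) (≈-trans (-‿cong (≈-trans (*-congʳ x₀≈0) (zeroˡ _))) -0#≈0#)) >>= λ inner≈0 →
          λ _ → all-zero x₀≈0 (λ { (outside ∷ S) → outer≈0 S ; (inside ∷ S) → inner≈0 S }) x≉0
        (no x₀≉0) → return ((λ S → - proj₁ (inverse (x zero) x₀≉0) * y (inside ∷ S)) ,
          (λ S S∉ → ≈-trans (*-congˡ (y-supp (inside ∷ S) (¬true⇒false λ S∈ → true≢false (subC S S∈) S∉))) (zeroʳ _)) ,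
          λ S → begin
            bd (λ S → - inv x₀≉0 * y (inside ∷ S)) S    ≈⟨ bd-· (- inv x₀≉0) (y ∘ (inside ∷_)) S ⟩
            - inv x₀≉0 * bd (y ∘ (inside ∷_)) S         ≈⟨ *-congˡ (reduce outer≈0 S) ⟩
            - inv x₀≉0 * - (x zero * z S)               ≈⟨ solve 3 (λ i x z → :- i :* :- (x :* z) := x :* i :* z) ≈-refl (inv x₀≉0) (x zero) (z S) ⟩
            x zero * inv x₀≉0 * z S                     ≈⟨ *-congʳ (proj₂ (inverse (x zero) x₀≉0)) ⟩
            1# * z S                                    ≈⟨ *-identityˡ _ ⟩
            z S                                         ∎)
      where
      inv : ¬ x zero ≈ 0# → Carrier
      inv h = proj₁ (inverse (x zero) h)
      y : Chain (suc n)
      y = combination (x ∘ suc) (indicator ∘ enum Ψ)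
      y-supp : Supported Ψ y
      y-supp = combination-supported {Φ = Ψ} (x ∘ suc) (λ i → indicator-supported {Φ = Ψ} (enum Ψ i) (enum-∈ Ψ i))
      relation : ∀ S → x zero * z S + (bd (y ∘ (inside ∷_)) S + y (outside ∷ S)) ≈ 0#
      relation S = ≈-trans (+-congˡ (begin
        bd (y ∘ (inside ∷_)) S + y (outside ∷ S)
          ≈⟨ +-congʳ (bd-combination (x ∘ suc) (λ i → indicator (enum Ψ i) ∘ (inside ∷_)) S) ⟩
        combination (x ∘ suc) (λ i → bd (indicator (enum Ψ i) ∘ (inside ∷_))) S + y (outside ∷ S)
          ≈⟨ ≈-sym (combination-+ (x ∘ suc) (λ i → bd (indicator (enum Ψ i) ∘ (inside ∷_))) (λ i → indicator (enum Ψ i) ∘ (outside ∷_)) S) ⟩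
        combination (x ∘ suc) (u ∘ suc) S ∎)) (eqs S)
      outer-cycle : Cycle (y ∘ (outside ∷_))
      outer-cycle S = begin
        bd (y ∘ (outside ∷_)) S
          ≈⟨ ≈-sym (≈-trans (+-cong (≈-trans (*-congˡ (cyc S)) (zeroʳ _)) (≈-trans (+-congʳ (bd-bd (y ∘ (inside ∷_)) S)) (+-identityˡ _))) (+-identityˡ _)) ⟩
        x zero * bd z S + (bd (bd (y ∘ (inside ∷_))) S + bd (y ∘ (outside ∷_)) S)
          ≈⟨ ≈-sym (≈-trans (bd-+ (λ A → x zero * z A) (value y) S) (+-cong (bd-· (x zero) z S) (bd-+ (bd (y ∘ (inside ∷_))) (y ∘ (outside ∷_)) S))) ⟩
        bd (λ A → x zero * z A + value y A) S
          ≈⟨ bd-cong relation S ⟩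
        bd (λ _ → 0#) S  ≈⟨ bd-0 S ⟩
        0# ∎
      reduce : (∀ S → y (outside ∷ S) ≈ 0#) → ∀ S → bd (y ∘ (inside ∷_)) S ≈ - (x zero * z S)
      reduce outer≈0 S = begin
        bd (y ∘ (inside ∷_)) S       ≈⟨ solve 3 (λ a b c → b := (a :+ (b :+ c)) :- a :- c) ≈-refl (x zero * z S) _ (y (outside ∷ S)) ⟩
        (x zero * z S + value y S) + - (x zero * z S) + - y (outside ∷ S) ≈⟨ +-cong (+-congʳ (relation S)) (≈-trans (-‿cong (outer≈0 S)) -0#≈0#) ⟩
        0# + - (x zero * z S) + 0#   ≈⟨ ≈-trans (+-identityʳ _) (+-identityˡ _) ⟩
        - (x zero * z S) ∎
      all-zero : x zero ≈ 0# → (∀ U → y U ≈ 0#) → (∃ λ i → ¬ x i ≈ 0#) → ⊥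
      all-zero x₀≈0 y≈0 (zero , h)  = h x₀≈0
      all-zero x₀≈0 y≈0 (suc i , h) = h (≈-trans (≈-sym (combination-indicator (x ∘ suc) (enum Ψ) (enum-injective Ψ) i)) (y≈0 (enum Ψ i)))

-- Inclusion, insertion and links of subsets

infix 4 _⊑_
_⊑_ : ∀ {n} → Subset n → Subset n → Set
A ⊑ B = ∀ v → lookup A v ≡ inside → lookup B v ≡ inside

⊑⇒⊆ : ∀ {n} (A B : Subset n) → A ⊑ B → A ⊆ B
⊑⇒⊆ A B h {v} p = Vecₚ.lookup⇒[]= v B (h v (Vecₚ.[]=⇒lookup p))

insert-⊑ : ∀ {n} (A B : Subset n) v → A ⊑ B → lookup B v ≡ inside → A [ v ]≔ inside ⊑ B
insert-⊑ A B v h e w p with v Finₚ.≟ w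
... | yes refl = e
... | no v≢w = h w (trans (sym (Vecₚ.lookup∘updateAt′ w v (v≢w ∘ sym) A)) p)

⊑-insert : ∀ {n} (A : Subset n) v → A ⊑ A [ v ]≔ inside
⊑-insert A v w p with v Finₚ.≟ w
... | yes refl = Vecₚ.lookup∘updateAt v A
... | no v≢w = trans (Vecₚ.lookup∘updateAt′ w v (v≢w ∘ sym) A) p

⊑-union : ∀ {n} (A S : Subset n) → A ⊑ A ∪ S
⊑-union (inside ∷ A) (_ ∷ S) zero e = refl
⊑-union (_ ∷ A) (_ ∷ S) (suc v) e = ⊑-union A S v e

⊑-head : ∀ {n a b} {A B : Subset n} → a ∷ A ⊑ b ∷ B → A ⊑ B
⊑-head h v = h (suc v)

missing : ∀ {n} (A D : Subset n) → A ⊑ D → ∣ A ∣ < ∣ D ∣ → ∃ λ u → lookup D u ≡ inside × lookup A u ≡ outside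
missing (outside ∷ A) (inside ∷ D) h p = zero , refl , refl
missing (inside ∷ A) (outside ∷ D) h p with () ← h zero refl
missing (inside ∷ A) (inside ∷ D) h (s≤s p) with missing A D (⊑-head h) p
... | u , q = suc u , q
missing (outside ∷ A) (outside ∷ D) h p with missing A D (⊑-head h) p
... | u , q = suc u , q

union-insert : ∀ {n} (A S : Subset n) v → A ∪ (S [ v ]≔ inside) ≡ (A ∪ S) [ v ]≔ inside
union-insert (a ∷ A) (s ∷ S) zero = cong (_∷ (A ∪ S)) (Boolₚ.∨-zeroʳ a)
union-insert (a ∷ A) (s ∷ S) (suc v) = cong (_ ∷_) (union-insert A S v)

insert-union : ∀ {n} (A S : Subset n) v → (A [ v ]≔ inside) ∪ S ≡ (A ∪ S) [ v ]≔ inside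
insert-union (a ∷ A) (s ∷ S) zero = refl
insert-union (a ∷ A) (s ∷ S) (suc v) = cong (_ ∷_) (insert-union A S v)

insert-present : ∀ {n} (A : Subset n) v → lookup A v ≡ inside → A [ v ]≔ inside ≡ A
insert-present A v e = trans (cong (A [ v ]≔_) (sym e)) (Vecₚ.[]≔-lookup A v)

singleton-insert : ∀ {n} (v : Fin n) → ⁅ v ⁆ ≡ ∅ [ v ]≔ inside
singleton-insert zero    = refl
singleton-insert (suc v) = cong (outside ∷_) (singleton-insert v)

union-singleton : ∀ {n} (A : Subset n) v → A ∪ ⁅ v ⁆ ≡ A [ v ]≔ inside
union-singleton A v = trans (cong (A ∪_) (singleton-insert v)) (trans (union-insert A ∅ v) (cong (_[ v ]≔ inside) (Subₚ.∪-identityʳ A)))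

size-union : ∀ {n} (A S : Subset n) → disjointᵇ A S ≡ true → ∣ A ∪ S ∣ ≡ ∣ A ∣ ℕ.+ ∣ S ∣
size-union [] [] e = refl
size-union (outside ∷ A) (outside ∷ S) e = size-union A S e
size-union (outside ∷ A) (inside ∷ S) e = trans (cong suc (size-union A S e)) (sym (ℕₚ.+-suc _ _))
size-union (inside ∷ A) (outside ∷ S) e = cong suc (size-union A S e)
size-union (inside ∷ A) (inside ∷ S) ()

disjoint-singleton : ∀ {n} (A : Subset n) v → lookup A v ≡ outside → disjointᵇ A ⁅ v ⁆ ≡ true
disjoint-singleton (outside ∷ A) zero e = disjoint-∅ A
  where
  disjoint-∅ : ∀ {n} (A : Subset n) → disjointᵇ A ∅ ≡ true
  disjoint-∅ [] = refl
  disjoint-∅ (outside ∷ A) = disjoint-∅ A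
  disjoint-∅ (inside ∷ A) = disjoint-∅ A
disjoint-singleton (outside ∷ A) (suc v) e = disjoint-singleton A v e
disjoint-singleton (inside ∷ A) (suc v) e = disjoint-singleton A v e

difference : ∀ {n} (A D : Subset n) → A ⊑ D → ∃ λ B → disjointᵇ A B ≡ true × A ∪ B ≡ D
difference [] [] h = [] , refl , refl
difference (a ∷ A) (d ∷ D) h with difference A D (⊑-head h)
difference (outside ∷ A) (outside ∷ D) h | B , p , q = outside ∷ B , p , cong (outside ∷_) q
difference (outside ∷ A) (inside ∷ D) h | B , p , q = inside ∷ B , p , cong (inside ∷_) q
difference (inside ∷ A) (inside ∷ D) h | B , p , q = outside ∷ B , p , cong (inside ∷_) q
difference (inside ∷ A) (outside ∷ D) h | B , p , q with () ← h zero refl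

link-insert : ∀ {n} (Δ : Family n) A v B → lookup A v ≡ outside → linkᵥ v (link Δ A) B ≡ link Δ (A [ v ]≔ inside) B
link-insert Δ A v B e = trans (cong (λ T → not (lookup B v) ∧ disjointᵇ A (B [ v ]≔ inside) ∧ Δ T) (trans (union-insert A B v) (sym (insert-union A B v))))
  (trans (sym (Boolₚ.∧-assoc (not (lookup B v)) _ _)) (cong (_∧ Δ ((A [ v ]≔ inside) ∪ B)) (disjoint-move A B v e)))
  where
  disjoint-move : ∀ {n} (A B : Subset n) v → lookup A v ≡ outside → not (lookup B v) ∧ disjointᵇ A (B [ v ]≔ inside) ≡ disjointᵇ (A [ v ]≔ inside) B
  disjoint-move (outside ∷ A) (outside ∷ B) zero e = refl
  disjoint-move (outside ∷ A) (inside ∷ B) zero e = refl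
  disjoint-move (outside ∷ A) (b ∷ B) (suc v) e = disjoint-move A B v e
  disjoint-move (inside ∷ A) (outside ∷ B) (suc v) e = disjoint-move A B v e
  disjoint-move (inside ∷ A) (inside ∷ B) (suc v) e = Boolₚ.∧-zeroʳ _

link-present : ∀ {n} (Δ : Family n) A v B → lookup A v ≡ inside → linkᵥ v (link Δ A) B ≡ false
link-present Δ A v B e = trans (cong (not (lookup B v) ∧_) (cong (_∧ Δ (A ∪ (B [ v ]≔ inside))) (meets A B v e))) (Boolₚ.∧-zeroʳ _)
  where
  meets : ∀ {n} (A B : Subset n) v → lookup A v ≡ inside → disjointᵇ A (B [ v ]≔ inside) ≡ false
  meets (inside ∷ A) (b ∷ B) zero e = refl
  meets (outside ∷ A) (b ∷ B) (suc v) e = meets A B v e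
  meets (inside ∷ A) (outside ∷ B) (suc v) e = meets A B v e
  meets (inside ∷ A) (inside ∷ B) (suc v) e = refl

-- Transfer of acyclicity to the rational numbers

module Transfer {c ℓ} (F : Field c ℓ) (Q : Rationals) where
  open Rationals Q hiding (_+_; _*_; -_)
  open Exterior Q
  open LinearAlgebra Q
  open Contraction Q
  private
    module F = Field F
    module Q = Rationals Q
    module QR = CommutativeRing scalarRing
    module FC = Chains F
    module QC = Chains scalarField
    module FI = FromInteger F.commutativeRing
    module QI = FromInteger scalarRing

  common-denominator : ∀ {n} (q : Subset n → R) → ∃ λ N → ∃ λ (m : Subset n → ℤ) → ∀ S → q S Q.* fromℤ (ℤ.+ suc N) ≡ fromℤ (m S)
  common-denominator {zero} q with fraction (q [])
  ... | N , i , e = N , (λ _ → i) , λ { [] → e }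
  common-denominator {suc n} q with common-denominator (q ∘ (outside ∷_)) | common-denominator (q ∘ (inside ∷_))
  ... | N₀ , m₀ , e₀ | N₁ , m₁ , e₁ = N₁ ℕ.+ N₀ ℕ.* suc N₁ , m , clear
    where
    m : Subset (suc n) → ℤ
    m (outside ∷ S) = m₀ S ℤ.* ℤ.+ suc N₁
    m (inside ∷ S)  = m₁ S ℤ.* ℤ.+ suc N₀
    denominator : fromℤ (ℤ.+ (suc N₀ ℕ.* suc N₁)) ≡ fromℤ (ℤ.+ suc N₀) Q.* fromℤ (ℤ.+ suc N₁)
    denominator = trans (cong fromℤ (ℤₚ.pos-* (suc N₀) (suc N₁))) (QI.fromℤ-* (ℤ.+ suc N₀) (ℤ.+ suc N₁))
    clear : ∀ S → q S Q.* fromℤ (ℤ.+ (suc N₀ ℕ.* suc N₁)) ≡ fromℤ (m S)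
    clear (outside ∷ S) = trans (cong (q (outside ∷ S) Q.*_) denominator) (trans (sym (QR.*-assoc _ _ _))
      (trans (cong (Q._* fromℤ (ℤ.+ suc N₁)) (e₀ S)) (sym (QI.fromℤ-* (m₀ S) (ℤ.+ suc N₁)))))
    clear (inside ∷ S) = trans (cong (q (inside ∷ S) Q.*_) (trans denominator (QR.*-comm _ _))) (trans (sym (QR.*-assoc _ _ _))
      (trans (cong (Q._* fromℤ (ℤ.+ suc N₀)) (e₁ S)) (sym (QI.fromℤ-* (m₁ S) (ℤ.+ suc N₀)))))

  fromℤ-total : ∀ {n} (a m : Subset n → ℤ) → (∀ S → FI.fromℤ (m S) F.≈ F.0#) → FI.fromℤ (ℤC.total (λ S → a S ℤ.* m S)) F.≈ F.0#
  fromℤ-total {zero} a m h = F.trans (FI.fromℤ-* (a []) (m [])) (F.trans (F.*-congˡ (h [])) (F.zeroʳ _))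
  fromℤ-total {suc n} a m h = F.trans (FI.fromℤ-+ (ℤC.total (λ S → a (outside ∷ S) ℤ.* m (outside ∷ S))) (ℤC.total (λ S → a (inside ∷ S) ℤ.* m (inside ∷ S))))
    (F.trans (F.+-cong (fromℤ-total (a ∘ (outside ∷_)) (m ∘ (outside ∷_)) (h ∘ (outside ∷_))) (fromℤ-total (a ∘ (inside ∷_)) (m ∘ (inside ∷_)) (h ∘ (inside ∷_)))) (F.+-identityˡ _))

  -- A rational dependency, cleared of denominators and divided by its content, stays nonzero in F.
  independent-transfer : ∀ {n} {𝓑 : Family n} → FC.Independent 𝓑 → QC.Independent 𝓑
  independent-transfer {n} {𝓑} ind q supp cyc = clear-denominators (common-denominator q)
    where
    divide : ∀ N (m : Subset n → ℤ) → (∀ S → q S Q.* fromℤ (ℤ.+ suc N) ≡ fromℤ (m S)) → ∀ g (m′ a : Subset n → ℤ) →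
      (∀ S → m S ≡ g ℤ.* m′ S) → ℤC.total (λ S → a S ℤ.* m′ S) ≡ ℤ.1ℤ → Dec (g ≡ ℤ.0ℤ) → ¬ ¬ (∀ S → q S ≡ 0#)
    divide N m clear g m′ a factor unit (yes g≡0) = return λ S → decidable-stable (q S ≟ 0#) λ qS≢0 →
      *≢0 qS≢0 (fromℕ-suc≢0 N) (trans (clear S) (cong fromℤ (trans (factor S) (trans (cong (ℤ._* m′ S) g≡0) (ℤₚ.*-zeroˡ (m′ S))))))
    -- Independence over `F` makes the image of `m′` in `F` vanish, whereas the cofactors combine
    -- `m′` to 1.
    divide N m clear g m′ a factor unit (no g≢0) =
      ind (FI.fromℤ ∘ m′) (λ S S∉ → F.reflexive (cong FI.fromℤ (m′-supp S S∉)))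
        (λ S → F.trans (F.sym (bd-fromInteger F.commutativeRing m′ S)) (F.reflexive (cong FI.fromℤ (m′-cyc S)))) >>= λ m′≈0 →
      λ _ → F.0≉1 (F.trans (F.sym (fromℤ-total a m′ m′≈0)) (F.trans (F.reflexive (cong FI.fromℤ unit)) (F.+-identityʳ F.1#)))
      where
      g′≢0 : fromℤ g ≢ 0#
      g′≢0 e = g≢0 (fromℤ-injective g e)
      cancel : ∀ {x} → fromℤ g Q.* x ≡ 0# → x ≡ 0#
      cancel {x} e = decidable-stable (x ≟ 0#) λ x≢0 → *≢0 g′≢0 x≢0 e
      scaled : ∀ S → q S Q.* fromℤ (ℤ.+ suc N) ≡ fromℤ g Q.* fromℤ (m′ S)
      scaled S = trans (clear S) (trans (cong fromℤ (factor S)) (QI.fromℤ-* g (m′ S)))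
      m′-supp : ∀ S → 𝓑 S ≡ false → m′ S ≡ ℤ.0ℤ
      m′-supp S S∉ = fromℤ-injective (m′ S) (cancel (trans (sym (scaled S)) (trans (cong (Q._* fromℤ (ℤ.+ suc N)) (supp S S∉)) (QR.zeroˡ _))))
      m′-cyc : ∀ S → ℤB.bd m′ S ≡ ℤ.0ℤ
      m′-cyc S = fromℤ-injective (ℤB.bd m′ S) (trans (bd-fromInteger scalarRing m′ S) (cancel
        (trans (sym (QC.bd-· (fromℤ g) (fromℤ ∘ m′) S)) (trans (QC.bd-cong {z = λ A → fromℤ g Q.* fromℤ (m′ A)} {z′ = λ A → fromℤ (ℤ.+ suc N) Q.* q A} (λ A → trans (sym (scaled A)) (QR.*-comm (q A) (fromℤ (ℤ.+ suc N)))) S)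
          (trans (QC.bd-· (fromℤ (ℤ.+ suc N)) q S) (trans (cong (fromℤ (ℤ.+ suc N) Q.*_) (cyc S)) (QR.zeroʳ _)))))))
    clear-denominators : (∃ λ N → ∃ λ (m : Subset n → ℤ) → ∀ S → q S Q.* fromℤ (ℤ.+ suc N) ≡ fromℤ (m S)) → ¬ ¬ (∀ S → q S ≡ 0#)
    clear-denominators (N , m , clear) = by-content (ℤC.content-split bezout m)
      where
      by-content : ℤC.Unimodular m → ¬ ¬ (∀ S → q S ≡ 0#)
      by-content (g , m′ , a , factor , unit) = divide N m clear g m′ a factor unit (g ℤ.≟ ℤ.0ℤ)

  -- The same 𝓑 and 𝓒 serve both fields: `F` supplies the inequality between counts, and
  -- independence passes to the rationals, where the inequality gives exactness back.
  exact-transfer : ∀ {n} {Λ : Family n} {j} → DownClosed Λ → FC.ExactChains Λ j → QC.ExactChains Λ j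
  exact-transfer {Λ = Λ} {j} dc exact z supp cyc =
    FC.independent-spanning (faces Λ j) >>= λ (𝓑 , subB , spanB , indB) →
    FC.independent-spanning (faces Λ (suc j)) >>= λ (𝓒 , subC , spanC , indC) →
    QC.independent-exact {Λ = Λ} {j} {𝓑} {𝓒} dc subB subC (independent-transfer {𝓑 = 𝓑} indB) (independent-transfer {𝓑 = 𝓒} indC)
      (FC.spanning-bound {Λ = Λ} {j} {𝓑} {𝓒} dc exact subB spanB spanC) z supp cyc

  opaque
    unfolding _+_ ι coef

    coef-ι-one : ∀ {n} (x : Ext n) A → coef (ι one x) A ≡ QC.bd (coef x) A
    coef-ι-one ⟨ x ⟩ [] = refl
    coef-ι-one (x & y) (outside ∷ A) = trans (coef-+ (ι one x) (1# · y) A)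
      (trans (QR.+-comm _ _) (cong₂ Q._+_ (cong (λ t → coef t A) (1· y)) (coef-ι-one x A)))
    coef-ι-one (x & y) (inside ∷ A) = trans (coef-neg (ι one y) A) (cong Q.-_ (coef-ι-one y A))

  exact-ext : ∀ {n} {Λ : Family n} {j} → QC.ExactChains Λ j → Exact Λ j
  exact-ext {Λ = Λ} {j} exact z p e =
    exact (coef z) (λ S S∉ → decidable-stable (coef z S ≟ 0#) λ ≢0 → true≢false (let (a , b) = p S ≢0 in ⇒faces Λ j S a b) S∉)
      (λ S → trans (sym (coef-ι-one z S)) (trans (cong (λ t → coef t S) e) (coef-𝟎 S))) >>= λ (b , supp , eq) →
    return (tabulate b ,
      (λ A ≢0 → faces⇒ Λ (suc j) A ([ (λ e → e) , (λ A∉ → ⊥-elim (≢0 (trans (coef-tabulate b A) (supp A A∉)))) ]′ (bool-cases (faces Λ (suc j) A)))) ,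
      coef-ext (ι one (tabulate b)) z (λ A → trans (coef-ι-one (tabulate b) A) (trans (QC.bd-cong (coef-tabulate b) A) (eq A))))

  CM-cong : ∀ {n} {Γ Γ′ : Family n} → (∀ B → Γ B ≡ Γ′ B) → ∀ s → CM Γ s → CM Γ′ s
  CM-cong h zero cm = tt
  CM-cong {Γ = Γ} {Γ′} h (suc s) (ex , lk) =
    (λ i i≤s z p e → ex i i≤s z (λ A c → let (a , b) = p A c in trans (h A) a , b) e >>= λ (y , q , e′) →
      return (y , (λ A c → let (a , b) = q A c in trans (sym (h A)) a , b) , e′)) ,
    λ v → CM-cong (λ B → cong (not (lookup B v) ∧_) (h (B [ v ]≔ inside))) s (lk v)

  CM-void : ∀ {n} {Γ : Family n} → (∀ B → Γ B ≡ false) → ∀ s → CM Γ s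
  CM-void void zero = tt
  CM-void {Γ = Γ} void (suc s) =
    (λ i i≤s z p e → return (𝟎 , IsSubspace.𝟎∈ (In-subspace {Γ = Γ} {suc i}) , trans (ι-𝟎 one) (sym (zero-by-coef z λ A c → true≢false (proj₁ (p A c)) (void A))))) ,
    λ v → CM-void (λ B → trans (cong (not (lookup B v) ∧_) (void (B [ v ]≔ inside))) (Boolₚ.∧-zeroʳ _)) s

-- Purity of the skeleton and acyclicity of links

≤⇒≤ᵇ : ∀ {m k} → m ≤ k → (m ℕ.≤ᵇ k) ≡ true
≤⇒≤ᵇ {m} {k} h with m ℕ.≤ᵇ k in eq
... | true = refl
... | false = ⊥-elim (subst Bool.T eq (ℕₚ.≤⇒≤ᵇ h))

module LinkHomology {c ℓ} (F : Field c ℓ) where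
  open Field F renaming (refl to ≈-refl; sym to ≈-sym; trans to ≈-trans; zero to *-zero)
  open Chains F
  open Homology F
  open RingProperties ring using (-0#≈0#; -‿+-comm; -‿distribˡ-*)

  Σᶠ-neg : ∀ {n} {g h : Fin n → Carrier} → (∀ v → g v ≈ - h v) → Σᶠ g ≈ - Σᶠ h
  Σᶠ-neg {zero}  e = ≈-sym -0#≈0#
  Σᶠ-neg {suc n} e = ≈-trans (+-cong (e zero) (Σᶠ-neg (e ∘ suc))) (-‿+-comm _ _)

  -- The test for membership in Γ moves into the chain, and the sign that counts the elements below
  -- `v` is produced by `bd` one position at a time.
  ∂≈bd : ∀ {n} (Γ : Family n) c S → ∂ Γ c S ≈ bd (restrict Γ c) S
  ∂≈bd Γ c [] = ≈-refl
  ∂≈bd Γ c (outside ∷ S) = +-cong (head (S ∪ ∅) (Subₚ.∪-identityʳ S)) (∂≈bd (Γ ∘ (outside ∷_)) (c ∘ (outside ∷_)) S)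
    where
    head : ∀ T → T ≡ S → (if Γ (inside ∷ T) then 1# * c (inside ∷ T) else 0#) ≈ restrict Γ c (inside ∷ S)
    head T refl with Γ (inside ∷ S)
    ... | true = *-identityˡ _
    ... | false = ≈-refl
  ∂≈bd Γ c (inside ∷ S) = ≈-trans (+-identityˡ _) (≈-trans (Σᶠ-neg flip) (-‿cong (∂≈bd (Γ ∘ (inside ∷_)) (c ∘ (inside ∷_)) S)))
    where
    flip : ∀ v → (if memᵇ v S then 0# else (if Γ (inside ∷ (S ∪ ⁅ v ⁆)) then (- sgn (below S v)) * c (inside ∷ (S ∪ ⁅ v ⁆)) else 0#))
                ≈ - (if memᵇ v S then 0# else (if Γ (inside ∷ (S ∪ ⁅ v ⁆)) then sgn (below S v) * c (inside ∷ (S ∪ ⁅ v ⁆)) else 0#))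
    flip v with memᵇ v S | Γ (inside ∷ (S ∪ ⁅ v ⁆))
    ... | true  | _     = ≈-sym -0#≈0#
    ... | false | true  = ≈-sym (-‿distribˡ-* _ _)
    ... | false | false = ≈-sym -0#≈0#

  bd-∅ : ∀ {n} (S : Subset n) → bd (indicator ∅) S ≈ 0#
  bd-∅ [] = ≈-refl
  bd-∅ (outside ∷ S) = ≈-trans (+-identityˡ _) (bd-∅ S)
  bd-∅ (inside ∷ S) = ≈-trans (-‿cong (bd-0 S)) -0#≈0#

  bd-vertex : ∀ {n} v (S : Subset n) → bd (indicator ⁅ v ⁆) S ≈ indicator ∅ S
  bd-vertex zero (outside ∷ S) = ≈-trans (+-congˡ (bd-0 S)) (+-identityʳ _)
  bd-vertex zero (inside ∷ S) = ≈-trans (-‿cong (bd-∅ S)) -0#≈0#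
  bd-vertex (suc v) (outside ∷ S) = ≈-trans (+-identityˡ _) (bd-vertex v S)
  bd-vertex (suc v) (inside ∷ S) = ≈-trans (-‿cong (bd-0 S)) -0#≈0#

  module _ {n} (Δ : Family n) (complex : IsComplex Δ) (d : ℕ) where
    down : ∀ A B → A ⊑ B → Δ B ≡ true → Δ A ≡ true
    down A B h = IsComplex.downClosed complex B A (⊑⇒⊆ A B h)

    link-down : ∀ A → DownClosed (link Δ A)
    link-down A B v h with ∧-split {disjointᵇ A (B [ v ]≔ inside)} h
    ... | p , q = ∧-join (disjoint-mono A B v p) (down (A ∪ B) (A ∪ (B [ v ]≔ inside)) (subst (A ∪ B ⊑_) (sym (union-insert A B v)) (⊑-insert (A ∪ B) v)) q)
      where
      disjoint-mono : ∀ {n} (A B : Subset n) v → disjointᵇ A (B [ v ]≔ inside) ≡ true → disjointᵇ A B ≡ true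
      disjoint-mono (outside ∷ A) (outside ∷ B) zero e = e
      disjoint-mono (outside ∷ A) (inside ∷ B) zero e = e
      disjoint-mono (inside ∷ A) (b ∷ B) zero ()
      disjoint-mono (outside ∷ A) (b ∷ B) (suc v) e = disjoint-mono A B v e
      disjoint-mono (inside ∷ A) (outside ∷ B) (suc v) e = disjoint-mono A B v e
      disjoint-mono (inside ∷ A) (inside ∷ B) (suc v) ()

    link-skel : ∀ A T → ∣ A ∣ ℕ.+ ∣ T ∣ ≤ d → link (skel d Δ) A T ≡ link Δ A T
    link-skel A T h with bool-cases (disjointᵇ A T)
    ... | inj₂ e rewrite e = refl
    ... | inj₁ e rewrite e | ≤⇒≤ᵇ (subst (_≤ d) (sym (size-union A T e)) h) = refl

    -- Homology at size `j` involves only faces with at most `suc j` elements, and up to there the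
    -- link in the skeleton agrees with the link in Δ.
    exactChains : ∀ A j → ∣ A ∣ ℕ.+ j < d → ReducedHomologyVanishes (link (skel d Δ) A) j → ExactChains (link Δ A) j
    exactChains A j small vanish z supp cyc = return (restrict (faces Λ (suc j)) b , (λ S S∉ → restrict-∉ (faces Λ (suc j)) b S∉) , boundary)
      where
      Γ Λ : Family n
      Γ = link (skel d Δ) A
      Λ = link Δ A
      agree : ∀ T → ∣ T ∣ ≤ suc j → Γ T ≡ Λ T
      agree T h = link-skel A T (ℕₚ.≤-trans (ℕₚ.+-monoʳ-≤ ∣ A ∣ h) (subst (_≤ d) (sym (ℕₚ.+-suc ∣ A ∣ j)) small))
      premise : ∀ S → S ∈F Γ → suc ∣ S ∣ ≡ j → ∂ Γ z S ≈ 0#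
      premise S S∈ e = ≈-trans (∂≈bd Γ z S) (≈-trans (bd-local (restrict Γ z) z S same) (cyc S))
        where
        same : ∀ v → lookup S v ≡ outside → restrict Γ z (S [ v ]≔ inside) ≈ z (S [ v ]≔ inside)
        same v v∉ with bool-cases (Γ (S [ v ]≔ inside))
        ... | inj₁ p = restrict-∈ Γ z p
        ... | inj₂ p = ≈-trans (restrict-∉ Γ z p) (≈-sym (supp _ (cong (_∧ sizeIs j (S [ v ]≔ inside)) (trans (sym (agree _ (ℕₚ.≤-trans (ℕₚ.≤-reflexive (trans (size-insert S v v∉) e)) (ℕₚ.n≤1+n j)))) p))))
      b : Chain n
      b = proj₁ (vanish z premise)
      boundary : ∀ S → bd (restrict (faces Λ (suc j)) b) S ≈ z S
      boundary S with bool-cases (faces Λ j S)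
      ... | inj₂ S∉ = ≈-trans (bd-supported {Λ = Λ} (link-down A) j (restrict (faces Λ (suc j)) b) (λ S S∉ → restrict-∉ (faces Λ (suc j)) b S∉) S S∉) (≈-sym (supp S S∉))
      ... | inj₁ S∈ with faces⇒ Λ j S S∈
      ...   | p , q = ≈-trans (bd-local _ (restrict Γ b) S same) (≈-trans (≈-sym (∂≈bd Γ b S)) (proj₂ (vanish z premise) S (trans (agree S (ℕₚ.≤-trans (ℕₚ.≤-reflexive q) (ℕₚ.n≤1+n j))) p) q))
        where
        same : ∀ v → lookup S v ≡ outside → restrict (faces Λ (suc j)) b (S [ v ]≔ inside) ≈ restrict Γ b (S [ v ]≔ inside)
        same v v∉ = reflexive (cong (λ t → if t then b (S [ v ]≔ inside) else 0#) (trans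
          (trans (cong (Λ (S [ v ]≔ inside) ∧_) (≡⇒sizeIs (suc j) (S [ v ]≔ inside) size)) (Boolₚ.∧-identityʳ _)) (sym (agree _ (ℕₚ.≤-reflexive size)))))
          where
          size : ∣ S [ v ]≔ inside ∣ ≡ suc j
          size = trans (size-insert S v v∉) (cong suc q)

    -- The Cohen-Macaulay condition gives vanishing only below the dimension of a link. For a good
    -- face that dimension is known: its link in the skeleton reaches the size `d` minus that of the
    -- face.
    Good : Subset n → Set
    Good A = ∃ λ D → A ⊑ D × Δ D ≡ true × ∣ D ∣ ≡ d

    good? : ∀ A → Dec (Good A)
    good? A = Subₚ.anySubset? λ D → Finₚ.all? (λ v → (lookup A v Boolₚ.≟ inside) →-dec (lookup D v Boolₚ.≟ inside)) ×-dec (Δ D Boolₚ.≟ true) ×-dec (∣ D ∣ ℕ.≟ d)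

    good-mono : ∀ A B → A ⊑ B → Good B → Good A
    good-mono A B h (D , B⊑D , rest) = D , (λ v → B⊑D v ∘ h v) , rest

    size-mono : ∀ {n} (A B : Subset n) → A ⊑ B → ∣ A ∣ ≤ ∣ B ∣
    size-mono A B h = Subₚ.p⊆q⇒∣p∣≤∣q∣ (⊑⇒⊆ A B h)

    module _ (cm : CohenMacaulay (skel d Δ)) where
      exactLink : ∀ A j → Good A → ∣ A ∣ ℕ.+ j < d → ExactChains (link Δ A) j
      exactLink A j (D , A⊑D , D∈ , D-size) small = exactChains A j small (cm A A∈ j (∣ B ∣ , j<B , B , B∈ , refl))
        where
        B : Subset n
        B = proj₁ (difference A D A⊑D)
        B-disjoint : disjointᵇ A B ≡ true
        B-disjoint = proj₁ (proj₂ (difference A D A⊑D))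
        union : A ∪ B ≡ D
        union = proj₂ (proj₂ (difference A D A⊑D))
        sizes : ∣ A ∣ ℕ.+ ∣ B ∣ ≡ d
        sizes = trans (sym (size-union A B B-disjoint)) (trans (cong ∣_∣ union) D-size)
        j<B : j < ∣ B ∣
        j<B = ℕₚ.+-cancelˡ-< (∣ A ∣) j (∣ B ∣) (subst (∣ A ∣ ℕ.+ j <_) (sym sizes) small)
        A∈ : skel d Δ A ≡ true
        A∈ = ∧-join (≤⇒≤ᵇ (subst (∣ A ∣ ≤_) D-size (size-mono A D A⊑D))) (down A D A⊑D D∈)
        B∈ : link (skel d Δ) A B ≡ true
        B∈ = trans (link-skel A B (ℕₚ.≤-reflexive sizes)) (∧-join B-disjoint (trans (cong Δ union) D∈))

      -- In the link of a good face no edge joins a good vertex to a bad one, so a bad vertex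
      -- would be a boundary after discarding the good edges.
      good-insert : ∀ t A x → suc t ℕ.+ ∣ A ∣ ≡ d → Good A → Δ (A [ x ]≔ inside) ≡ true → Good (A [ x ]≔ inside)
      good-insert t A x e good A+x∈ with bool-cases (lookup A x)
      ... | inj₁ x∈ = subst Good (sym (insert-present A x x∈)) good
      good-insert zero A x e good A+x∈ | inj₂ x∉ = A [ x ]≔ inside , (λ v (p : lookup (A [ x ]≔ inside) v ≡ inside) → p) , A+x∈ , trans (size-insert A x x∉) e
      good-insert (suc t) A x e good@(D , A⊑D , D∈ , D-size) A+x∈ | inj₂ x∉ = decidable-stable (good? (A [ x ]≔ inside)) λ bad → contradict bad (λ z → z)
        where
        Λ : Family n
        Λ = link Δ A
        spare : ∃ λ u → lookup D u ≡ inside × lookup A u ≡ outside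
        spare = missing A D A⊑D (subst (∣ A ∣ <_) (trans e (sym D-size)) (s≤s (ℕₚ.m≤n+m ∣ A ∣ (suc t))))
        u : Fin n
        u = proj₁ spare
        vertex∈ : ∀ v → lookup A v ≡ outside → Δ (A [ v ]≔ inside) ≡ true → faces Λ 1 ⁅ v ⁆ ≡ true
        vertex∈ v v∉ h = ⇒faces Λ 1 ⁅ v ⁆ (∧-join (disjoint-singleton A v v∉) (trans (cong Δ (union-singleton A v)) h)) (Subₚ.∣⁅x⁆∣≡1 v)
        u-good : Good (A [ u ]≔ inside)
        u-good = D , insert-⊑ A D u A⊑D (proj₁ (proj₂ spare)) , D∈ , D-size
        -- A reduced cycle on two points, hence the boundary of a chain of edges: the link of the
        -- good face `A` has a face with at least two elements.
        z : Chain n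
        z S = indicator ⁅ x ⁆ S + - 1# * indicator ⁅ u ⁆ S
        z-supp : Supported (faces Λ 1) z
        z-supp = supported-+ {Φ = faces Λ 1} (- 1#) (indicator-supported {Φ = faces Λ 1} ⁅ x ⁆ (vertex∈ x x∉ A+x∈))
          (indicator-supported {Φ = faces Λ 1} ⁅ u ⁆ (vertex∈ u (proj₂ (proj₂ spare)) (down (A [ u ]≔ inside) D (insert-⊑ A D u A⊑D (proj₁ (proj₂ spare))) D∈)))
        z-cycle : Cycle z
        z-cycle S = ≈-trans (bd-+· (indicator ⁅ x ⁆) (indicator ⁅ u ⁆) (- 1#) S) (≈-trans (+-cong (bd-vertex x S) (*-congˡ (bd-vertex u S)))
          (≈-trans (+-congˡ (≈-trans (≈-sym (-‿distribˡ-* 1# _)) (-‿cong (*-identityˡ _)))) (-‿inverseʳ _)))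
        contradict : ¬ Good (A [ x ]≔ inside) → ¬ ¬ ⊥
        contradict bad = exactLink A 1 good (subst (ℕ._< d) (ℕₚ.+-comm 1 ∣ A ∣) (subst (suc ∣ A ∣ <_) e (s≤s (s≤s (ℕₚ.m≤n+m ∣ A ∣ t))))) z z-supp z-cycle >>= λ (b , b-supp , b-eq) →
          return (cut b b-supp b-eq)
          where
          cut : ∀ b → Supported (faces Λ 2) b → (∀ S → bd b S ≈ z S) → ⊥
          cut b b-supp b-eq = 0≉1 (≈-trans (≈-sym (bd-bd b′ ∅)) (≈-trans (bd-local (bd b′) (indicator ⁅ x ⁆) ∅ (λ v v∉ → at-vertex _ (trans (size-insert ∅ v v∉) (cong suc (Subₚ.∣⊥∣≡0 n)))))
              (≈-trans (bd-vertex x ∅) (reflexive (indicator-self {n} ∅)))))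
            where
            b′ : Chain n
            b′ S with good? (A ∪ S)
            ... | yes _ = 0#
            ... | no _  = b S
            b′-good : ∀ S → Good (A ∪ S) → b′ S ≈ 0#
            b′-good S g with good? (A ∪ S)
            ... | yes _ = ≈-refl
            ... | no h  = ⊥-elim (h g)
            b′-bad : ∀ S → ¬ Good (A ∪ S) → b′ S ≈ b S
            b′-bad S h with good? (A ∪ S)
            ... | yes g = ⊥-elim (h g)
            ... | no _  = ≈-refl
            b′-∉ : ∀ S → faces Λ 2 S ≡ false → b′ S ≈ 0#
            b′-∉ S S∉ with good? (A ∪ S)
            ... | yes _ = ≈-refl
            ... | no _  = b-supp S S∉
            at-vertex : ∀ S → ∣ S ∣ ≡ 1 → bd b′ S ≈ indicator ⁅ x ⁆ S
            at-vertex S size with bool-cases (faces Λ 1 S)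
            ... | inj₂ S∉ = ≈-trans (≈-trans (bd-local b′ b S λ v v∉ → ≈-trans (b′-∉ _ (edge∉ v)) (≈-sym (b-supp _ (edge∉ v)))) (≈-trans (bd-local b (λ _ → 0#) S λ v _ → b-supp _ (edge∉ v)) (bd-0 S)))
                (≈-sym (indicator-supported {Φ = faces Λ 1} ⁅ x ⁆ (vertex∈ x x∉ A+x∈) S S∉))
              where
              edge∉ : ∀ v → faces Λ 2 (S [ v ]≔ inside) ≡ false
              edge∉ v = ¬true⇒false λ T∈ → true≢false (⇒faces Λ 1 S (link-down A S v (proj₁ (faces⇒ Λ 2 _ T∈))) size) S∉
            ... | inj₁ S∈ with good? (A ∪ S)
            ...   | no S-bad = ≈-trans (bd-local b′ b S λ v v∉ → b′-bad _ λ g → S-bad (good-mono (A ∪ S) (A ∪ (S [ v ]≔ inside)) (subst (A ∪ S ⊑_) (sym (union-insert A S v)) (⊑-insert (A ∪ S) v)) g))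
                (≈-trans (b-eq S) (≈-trans (+-congˡ (≈-trans (*-congˡ (reflexive (indicator-other ⁅ u ⁆ S λ { refl → S-bad (subst Good (sym (union-singleton A u)) u-good) }))) (zeroʳ _))) (+-identityʳ _)))
            ...   | yes S-good = ≈-trans (≈-trans (bd-local b′ (λ _ → 0#) S zero-edge) (bd-0 S))
                (≈-sym (reflexive (indicator-other ⁅ x ⁆ S λ { refl → bad (subst Good (union-singleton A x) S-good) })))
              where
              zero-edge : ∀ v → lookup S v ≡ outside → b′ (S [ v ]≔ inside) ≈ 0#
              zero-edge v v∉ with bool-cases (faces Λ 2 (S [ v ]≔ inside))
              ... | inj₂ T∉ = b′-∉ _ T∉
              -- An edge at a good vertex is good, by the induction hypothesis for the larger good
              -- face `A ∪ S`.
              ... | inj₁ T∈ = b′-good _ (subst Good (sym (union-insert A S v)) (good-insert t (A ∪ S) v size′ S-good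
                  (subst (λ U → Δ U ≡ true) (union-insert A S v) (proj₂ (∧-split {disjointᵇ A (S [ v ]≔ inside)} (proj₁ (faces⇒ Λ 2 _ T∈)))))))
                where
                size′ : suc t ℕ.+ ∣ A ∪ S ∣ ≡ d
                size′ = trans (cong (suc t ℕ.+_) (trans (size-union A S (proj₁ (∧-split {disjointᵇ A S} (proj₁ (faces⇒ Λ 1 S S∈))))) (trans (cong (∣ A ∣ ℕ.+_) size) (ℕₚ.+-comm ∣ A ∣ 1))))
                  (trans (ℕₚ.+-suc (suc t) ∣ A ∣) e)

      module _ (top : HasFaceOfSize Δ d) where
        -- Built up from the empty face, which lies in the face of size `d` given by `top`;
        -- `good-insert` adds the vertices one at a time.
        pure : ∀ k A → ∣ A ∣ ≡ k → k ≤ d → Δ A ≡ true → Good A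
        pure zero A e k≤d A∈ = proj₁ top , (λ v p → ⊥-elim (ℕₚ.1+n≢0 (trans (sym (size-delete A v p)) e))) , proj₁ (proj₂ top) , proj₂ (proj₂ top)
        pure (suc k) A e k<d A∈ with missing (∅ {n}) A (λ v p → ⊥-elim (true≢false p (Vecₚ.lookup-replicate v outside))) (subst (_< ∣ A ∣) (sym (Subₚ.∣⊥∣≡0 n)) (subst (0 <_) (sym e) (s≤s z≤n)))
        ... | x , x∈ , _ = subst Good restore (good-insert (d ℕ.∸ suc k) (A [ x ]≔ outside) x
              (trans (cong (suc (d ℕ.∸ suc k) ℕ.+_) smaller) (trans (sym (ℕₚ.+-suc (d ℕ.∸ suc k) k)) (ℕₚ.m∸n+n≡m k<d)))
              (pure k (A [ x ]≔ outside) smaller (ℕₚ.<⇒≤ k<d) (down (A [ x ]≔ outside) A (subst (A [ x ]≔ outside ⊑_) restore (⊑-insert (A [ x ]≔ outside) x)) A∈)) (trans (cong Δ restore) A∈))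
          where
          restore : (A [ x ]≔ outside) [ x ]≔ inside ≡ A
          restore = trans (Vecₚ.[]≔-idempotent A x) (insert-present A x x∈)
          smaller : ∣ A [ x ]≔ outside ∣ ≡ k
          smaller = ℕₚ.suc-injective (trans (sym (size-delete A x x∈)) e)

        module _ (Q : Rationals) where
          open Contraction Q using (CM)
          open Transfer F Q

          -- A set that is not a face has a void link, where nothing is to be shown. A face is good
          -- by `pure`, and the bound on `s` keeps the degrees below the dimension of its link.
          cohenMacaulay-link : ∀ s A → s ℕ.+ ∣ A ∣ ≤ d → CM (link Δ A) s
          cohenMacaulay-link zero A h = tt
          cohenMacaulay-link (suc s) A h with bool-cases (Δ A)
          ... | inj₂ A∉ = CM-void (λ B → ¬true⇒false λ B∈ → true≢false (down A (A ∪ B) (⊑-union A B) (proj₂ (∧-split {disjointᵇ A B} B∈))) A∉) (suc s)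
          ... | inj₁ A∈ = (λ i i≤s → exact-ext {Λ = link Δ A} (exact-transfer {Λ = link Δ A} (link-down A)
                (exactLink A i (pure ∣ A ∣ A refl (ℕₚ.m+n≤o⇒n≤o (suc s) h) A∈) (ℕₚ.≤-trans (s≤s (ℕₚ.≤-trans (ℕₚ.+-monoʳ-≤ ∣ A ∣ i≤s) (ℕₚ.≤-reflexive (ℕₚ.+-comm ∣ A ∣ s)))) h)))) , links
            where
            links : ∀ v → CM (linkᵥ v (link Δ A)) s
            links v with bool-cases (lookup A v)
            ... | inj₁ v∈ = CM-void (λ B → link-present Δ A v B v∈) s
            ... | inj₂ v∉ = CM-cong (λ B → sym (link-insert Δ A v B v∉)) s (cohenMacaulay-link s (A [ v ]≔ inside)
                  (subst (_≤ d) (trans (sym (ℕₚ.+-suc s ∣ A ∣)) (cong (s ℕ.+_) (sym (size-insert A v v∉)))) h))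

          cohenMacaulay : ∀ s → s ≤ d → CM Δ s
          cohenMacaulay s h = CM-cong (λ B → trans (cong (_∧ Δ (∅ ∪ B)) (disjoint-∅ B)) (cong Δ (Subₚ.∪-identityˡ B))) s
            (cohenMacaulay-link s ∅ (subst (_≤ d) (trans (sym (ℕₚ.+-identityʳ s)) (cong (s ℕ.+_) (sym (Subₚ.∣⊥∣≡0 n)))) h))
            where
            disjoint-∅ : ∀ {n} (B : Subset n) → disjointᵇ ∅ B ≡ true
            disjoint-∅ [] = refl
            disjoint-∅ (outside ∷ B) = disjoint-∅ B
            disjoint-∅ (inside ∷ B) = disjoint-∅ B

-- Counting faces that avoid the shifting vertices

+-interchange : ∀ a b c d → a ℕ.+ b ℕ.+ (c ℕ.+ d) ≡ a ℕ.+ c ℕ.+ (b ℕ.+ d)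
+-interchange = solve 4 (λ a b c d → a :+ b :+ (c :+ d) := a :+ c :+ (b :+ d)) refl
  where open +-*-Solver

count-cong : ∀ {n} {Φ Ψ : Family n} → (∀ S → Φ S ≡ Ψ S) → count Φ ≡ count Ψ
count-cong {zero} h = cong (λ b → if b then 1 else 0) (h [])
count-cong {suc n} h = cong₂ ℕ._+_ (count-cong (h ∘ (outside ∷_))) (count-cong (h ∘ (inside ∷_)))

count-void : ∀ n → count {n} (λ _ → false) ≡ 0
count-void zero    = refl
count-void (suc n) = cong₂ ℕ._+_ (count-void n) (count-void n)

count-split : ∀ {n} (Φ : Family n) v → count Φ ≡ count (λ S → not (lookup S v) ∧ Φ S) ℕ.+ count (linkᵥ v Φ)
count-split {suc n} Φ zero = sym (cong₂ ℕ._+_ (trans (cong (count (Φ ∘ (outside ∷_)) ℕ.+_) (count-void n)) (ℕₚ.+-identityʳ _)) (trans (cong (count (Φ ∘ (inside ∷_)) ℕ.+_) (count-void n)) (ℕₚ.+-identityʳ _)))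
count-split {suc n} Φ (suc v) = trans (cong₂ ℕ._+_ (count-split (Φ ∘ (outside ∷_)) v) (count-split (Φ ∘ (inside ∷_)) v))
  (+-interchange (count (λ S → not (lookup S v) ∧ Φ (outside ∷ S))) _ _ _)

⇔⇒≡ : ∀ {a b} → (a ≡ true → b ≡ true) → (b ≡ true → a ≡ true) → a ≡ b
⇔⇒≡ {true}  {b}     p q = sym (p refl)
⇔⇒≡ {false} {true}  p q = q refl
⇔⇒≡ {false} {false} p q = refl

does⇒ : ∀ {ℓ} {P : Set ℓ} (p? : Dec P) → does p? ≡ true → P
does⇒ (yes p) _ = p

-- Meaningful only where the truncated subtraction is exact, i.e. E h J (i + 1) = E h (J + 1) (i + 1) + E h (J + 1) i.
E : (ℕ → ℕ) → ℕ → ℕ → ℕ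
E h zero    i       = h i
E h (suc J) zero    = E h J zero
E h (suc J) (suc i) = E h J (suc i) ℕ.∸ E h (suc J) i

E-unique : ∀ (h : ℕ → ℕ) (g : ℕ → ℕ → ℕ) M I → (∀ i → g 0 i ≡ h i) → (∀ J → J < M → g (suc J) 0 ≡ g J 0) →
  (∀ J i → J < M → i < I → g J (suc i) ≡ g (suc J) (suc i) ℕ.+ g (suc J) i) → ∀ J i → J ≤ M → i ≤ I → g J i ≡ E h J i
E-unique h g M I base bottom step zero i _ _ = base i
E-unique h g M I base bottom step (suc J) zero J<M _ = trans (bottom J J<M) (E-unique h g M I base bottom step J zero (ℕₚ.<⇒≤ J<M) z≤n)
E-unique h g M I base bottom step (suc J) (suc i) J<M i<I = trans (sym (trans (cong (ℕ._∸ g (suc J) i) (step J i J<M i<I)) (ℕₚ.m+n∸n≡m (g (suc J) (suc i)) (g (suc J) i))))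
  (cong₂ ℕ._∸_ (E-unique h g M I base bottom step J (suc i) (ℕₚ.<⇒≤ J<M) i<I) (E-unique h g M I base bottom step (suc J) i J<M (ℕₚ.<⇒≤ i<I)))

module Avoiding {n} (Δ : Family n) (complex : IsComplex Δ) (r : ℕ) (v : Fin r → Fin n) (shifted : IsShiftedWrt Δ v)
  (extend : ∀ A → Δ A ≡ true → ∣ A ∣ < r ℕ.+ r → ∃ λ y → lookup A y ≡ outside × Δ (A [ y ]≔ inside) ≡ true) where

  Avoids : ℕ → Subset n → Set
  Avoids m S = ∀ i → toℕ i < m → lookup S (v i) ≡ outside

  avoids? : ∀ m S → Dec (Avoids m S)
  avoids? m S = Finₚ.all? (λ i → (toℕ i ℕ.<? m) →-dec (lookup S (v i) Boolₚ.≟ outside))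

  avoiding : ℕ → ℕ → Family n
  avoiding m i S = faces Δ i S ∧ does (avoids? m S)

  closed : ∀ A B → A ⊑ B → Δ B ≡ true → Δ A ≡ true
  closed A B h = IsComplex.downClosed complex B A (⊑⇒⊆ A B h)

  lookup-insert : ∀ {n} (A : Subset n) x y → x ≢ y → lookup (A [ x ]≔ inside) y ≡ lookup A y
  lookup-insert A x y x≢y = Vecₚ.lookup∘updateAt′ y x (x≢y ∘ sym) A

  -- Extend B one vertex at a time; the shift moves each new vertex to the next v k.
  fill : ∀ m → m < r → ∀ B → Δ B ≡ true → ∣ B ∣ < r → Avoids (suc m) B → ∀ k → k ≤ suc m →
    ∃ λ T → Δ T ≡ true × B ⊑ T × ∣ T ∣ ≤ ∣ B ∣ ℕ.+ k × (∀ i → toℕ i < k → lookup T (v i) ≡ inside) ×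
            (∀ i → k ≤ toℕ i → toℕ i < suc m → lookup T (v i) ≡ outside)
  fill m m<r B B∈ B<r avoids zero _ = B , B∈ , (λ _ e → e) , ℕₚ.≤-reflexive (sym (ℕₚ.+-identityʳ _)) , (λ _ ()) , (λ i _ → avoids i)
  fill m m<r B B∈ B<r avoids (suc k) k<m with fill m m<r B B∈ B<r avoids k (ℕₚ.<⇒≤ k<m)
  -- Fewer than `r` elements in `B` and at most `r` added so far keep `T` below size `r + r`, where
  -- purity still provides a further vertex. This is where `2 * r ≤ d` is felt.
  ... | T , T∈ , B⊑T , size , has , hasn't with extend T T∈ (ℕₚ.≤-<-trans size (ℕₚ.+-mono-<-≤ B<r (ℕₚ.≤-trans (ℕ.s≤s⁻¹ k<m) (ℕₚ.<⇒≤ m<r))))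
  ...   | y , y∉ , T+y∈ = T [ vk ]≔ inside , T+vk∈ , (λ w e → ⊑-insert T vk w (B⊑T w e)) ,
          ℕₚ.≤-trans (ℕₚ.≤-reflexive (size-insert T vk vk∉)) (ℕₚ.≤-trans (s≤s size) (ℕₚ.≤-reflexive (sym (ℕₚ.+-suc ∣ B ∣ k)))) , has′ , hasn't′
    where
    k<r : k < r
    k<r = ℕₚ.≤-trans k<m m<r
    ik : Fin r
    ik = fromℕ< k<r
    ik≡ : toℕ ik ≡ k
    ik≡ = Finₚ.toℕ-fromℕ< k<r
    vk : Fin n
    vk = v ik
    vk∉ : lookup T vk ≡ outside
    vk∉ = hasn't ik (ℕₚ.≤-reflexive (sym ik≡)) (subst (_< suc m) (sym ik≡) k<m)
    T+vk∈ : Δ (T [ vk ]≔ inside) ≡ true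
    T+vk∈ with y Finₚ.≟ vk
    ... | yes refl = T+y∈
    ... | no y≢vk = IsComplex.downClosed complex (((T [ y ]≔ inside) Subset.- y) ∪ ⁅ vk ⁆) (T [ vk ]≔ inside) smaller
          (proj₂ shifted ik y distinct (T [ y ]≔ inside) T+y∈ (Vecₚ.lookup⇒[]= y _ (Vecₚ.lookup∘updateAt y T))
            (λ vk∈ → true≢false (Vecₚ.[]=⇒lookup vk∈) (trans (lookup-insert T y vk y≢vk) vk∉)))
      where
      distinct : ∀ j → toℕ j ≤ toℕ ik → y ≢ v j
      distinct j j≤k refl with ℕₚ.m≤n⇒m<n∨m≡n j≤k
      ... | inj₁ j<k = true≢false (has j (subst (toℕ j <_) ik≡ j<k)) y∉
      ... | inj₂ j≡k = y≢vk (cong v (Finₚ.toℕ-injective j≡k))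
      smaller : T [ vk ]≔ inside ⊆ ((T [ y ]≔ inside) Subset.- y) ∪ ⁅ vk ⁆
      smaller {w} w∈ with w Finₚ.≟ vk
      ... | yes refl = Subₚ.x∈p∪q⁺ (inj₂ (Subₚ.x∈⁅x⁆ w))
      ... | no w≢vk = Subₚ.x∈p∪q⁺ (inj₁ (Subₚ.x∈p∧x≢y⇒x∈p-y (Vecₚ.lookup⇒[]= w _ (⊑-insert T y w w∈T)) λ { refl → true≢false w∈T y∉ }))
        where
        w∈T : lookup T w ≡ inside
        w∈T = trans (sym (lookup-insert T vk w (w≢vk ∘ sym))) (Vecₚ.[]=⇒lookup w∈)
    has′ : ∀ i → toℕ i < suc k → lookup (T [ vk ]≔ inside) (v i) ≡ inside
    has′ i i<sk with ℕₚ.m≤n⇒m<n∨m≡n (ℕ.s≤s⁻¹ i<sk)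
    ... | inj₁ i<k = ⊑-insert T vk (v i) (has i i<k)
    ... | inj₂ i≡k = subst (λ j → lookup (T [ vk ]≔ inside) (v j) ≡ inside) (Finₚ.toℕ-injective (trans ik≡ (sym i≡k))) (Vecₚ.lookup∘updateAt vk T)
    hasn't′ : ∀ i → suc k ≤ toℕ i → toℕ i < suc m → lookup (T [ vk ]≔ inside) (v i) ≡ outside
    hasn't′ i k<i i≤m = trans (lookup-insert T vk (v i) λ e → ℕₚ.<-irrefl (trans (sym ik≡) (cong toℕ (proj₁ shifted ik i e))) k<i) (hasn't i (ℕₚ.<⇒≤ k<i) i≤m)

  -- In sizes below `r`, the faces that avoid the shifting vertices up to index `m` form the base of
  -- a cone with the vertex of index `m` as apex.
  cone : ∀ {m} (m<r : m < r) B → Δ B ≡ true → ∣ B ∣ < r → Avoids (suc m) B → Δ (B [ v (fromℕ< m<r) ]≔ inside) ≡ true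
  cone {m} m<r B B∈ B<r avoids with fill m m<r B B∈ B<r avoids (suc m) ℕₚ.≤-refl
  ... | T , T∈ , B⊑T , _ , has , _ = closed (B [ v (fromℕ< m<r) ]≔ inside) T
    (insert-⊑ B T (v (fromℕ< m<r)) B⊑T (has (fromℕ< m<r) (s≤s (ℕₚ.≤-reflexive (Finₚ.toℕ-fromℕ< m<r))))) T∈

  avoids-step : ∀ {m} (m<r : m < r) S → Avoids m S → lookup S (v (fromℕ< m<r)) ≡ outside → Avoids (suc m) S
  avoids-step m<r S av e i i<sm with ℕₚ.m≤n⇒m<n∨m≡n (ℕ.s≤s⁻¹ i<sm)
  ... | inj₁ i<m = av i i<m
  ... | inj₂ i≡m = subst (λ j → lookup S (v j) ≡ outside) (Finₚ.toℕ-injective (trans (Finₚ.toℕ-fromℕ< m<r) (sym i≡m))) e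

  avoids-last : ∀ {m} (m<r : m < r) S → Avoids (suc m) S → lookup S (v (fromℕ< m<r)) ≡ outside
  avoids-last m<r S av = av (fromℕ< m<r) (s≤s (ℕₚ.≤-reflexive (Finₚ.toℕ-fromℕ< m<r)))

  avoiding⇒ : ∀ m i S → avoiding m i S ≡ true → Δ S ≡ true × ∣ S ∣ ≡ i × Avoids m S
  avoiding⇒ m i S e = let (p , q) = ∧-split {faces Δ i S} e ; (a , b) = faces⇒ Δ i S p in a , b , does⇒ (avoids? m S) q

  ⇒avoiding : ∀ m i S → Δ S ≡ true → ∣ S ∣ ≡ i → Avoids m S → avoiding m i S ≡ true
  ⇒avoiding m i S a b c = ∧-join (⇒faces Δ i S a b) (dec-true (avoids? m S) c)

  -- Faces are sorted by whether they contain the next shifting vertex. By `cone`, removing it is a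
  -- bijection onto all smaller faces avoiding it.
  avoiding-recursion : ∀ m i → m < r → i < r → count (avoiding m (suc i)) ≡ count (avoiding (suc m) (suc i)) ℕ.+ count (avoiding (suc m) i)
  avoiding-recursion m i m<r i<r = trans (count-split (avoiding m (suc i)) x) (cong₂ ℕ._+_ (count-cong deletion) (count-cong linking))
    where
    x : Fin n
    x = v (fromℕ< m<r)
    deletion : ∀ S → not (lookup S x) ∧ avoiding m (suc i) S ≡ avoiding (suc m) (suc i) S
    deletion S = ⇔⇒≡
      (λ e → let (p , q) = ∧-split {not (lookup S x)} e ; (a , b , c) = avoiding⇒ m (suc i) S q in ⇒avoiding (suc m) (suc i) S a b (avoids-step m<r S c (not-inside p)))
      (λ e → let (a , b , c) = avoiding⇒ (suc m) (suc i) S e in ∧-join (cong not (avoids-last m<r S c)) (⇒avoiding m (suc i) S a b (λ j j<m → c j (ℕₚ.m<n⇒m<1+n j<m))))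
    linking : ∀ S → linkᵥ x (avoiding m (suc i)) S ≡ avoiding (suc m) i S
    linking S = ⇔⇒≡ forward backward
      where
      forward : linkᵥ x (avoiding m (suc i)) S ≡ true → avoiding (suc m) i S ≡ true
      forward e with ∧-split {not (lookup S x)} e
      ... | p , q with avoiding⇒ m (suc i) (S [ x ]≔ inside) q
      ...   | a , b , c = ⇒avoiding (suc m) i S (closed S (S [ x ]≔ inside) (⊑-insert S x) a) (ℕₚ.suc-injective (trans (sym (size-insert S x (not-inside p))) b))
              (avoids-step m<r S (λ j j<m → trans (sym (lookup-insert S x (v j) (λ e → ℕₚ.<-irrefl (trans (cong toℕ (sym (proj₁ shifted _ j e))) (Finₚ.toℕ-fromℕ< m<r)) j<m))) (c j j<m)) (not-inside p))
      backward : avoiding (suc m) i S ≡ true → linkᵥ x (avoiding m (suc i)) S ≡ true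
      backward e with avoiding⇒ (suc m) i S e
      ... | a , b , c = ∧-join (cong not (avoids-last m<r S c)) (⇒avoiding m (suc i) (S [ x ]≔ inside) (cone m<r S a (subst (_< r) (sym b) i<r) c)
            (trans (size-insert S x (avoids-last m<r S c)) (cong suc b))
            (λ j j<m → trans (lookup-insert S x (v j) (λ e → ℕₚ.<-irrefl (trans (cong toℕ (sym (proj₁ shifted _ j e))) (Finₚ.toℕ-fromℕ< m<r)) j<m)) (c j (ℕₚ.m<n⇒m<1+n j<m))))

  avoidsᵇ⇒ : ∀ {n t} (v : Fin t → Fin n) S → avoidsᵇ v S ≡ true → ∀ i → lookup S (v i) ≡ outside
  avoidsᵇ⇒ v S e zero = disjoint⇒ (v zero) S (proj₁ (∧-split {disjointᵇ ⁅ v zero ⁆ S} e))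
    where
    disjoint⇒ : ∀ {n} x (S : Subset n) → disjointᵇ ⁅ x ⁆ S ≡ true → lookup S x ≡ outside
    disjoint⇒ zero (outside ∷ S) e = refl
    disjoint⇒ (suc x) (s ∷ S) e = disjoint⇒ x S e
  avoidsᵇ⇒ v S e (suc i) = avoidsᵇ⇒ (v ∘ suc) S (proj₂ (∧-split {disjointᵇ ⁅ v zero ⁆ S} e)) i

  γ≤avoiding : γ Δ v r ≤ count (avoiding r r)
  γ≤avoiding = count-mono λ S e → let (p , q) = ∧-split {Δ S} e ; (a , b) = ∧-split {sizeIs r S} q in
    ⇒avoiding r r S p (sizeIs⇒≡ r S a) (λ i _ → avoidsᵇ⇒ v S b i)

  avoiding-none : ∀ i → count (avoiding 0 i) ≡ f Δ i
  avoiding-none i = count-cong λ S → ⇔⇒≡ (λ e → proj₁ (∧-split {faces Δ i S} e)) (λ e → let (a , b) = faces⇒ Δ i S e in ⇒avoiding 0 i S a b (λ _ ()))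

  avoiding-empty : ∀ m → count (avoiding (suc m) 0) ≡ count (avoiding m 0)
  avoiding-empty m = count-cong λ S → ⇔⇒≡
    (λ e → let (a , b , c) = avoiding⇒ (suc m) 0 S e in ⇒avoiding m 0 S a b (λ j j<m → c j (ℕₚ.m<n⇒m<1+n j<m)))
    (λ e → let (a , b , c) = avoiding⇒ m 0 S e in ⇒avoiding (suc m) 0 S a b (λ j _ → ¬true⇒false λ p → ℕₚ.1+n≢0 (trans (sym (size-delete S (v j) p)) b)))

  γ≤E : γ Δ v r ≤ E (f Δ) r r
  γ≤E = ℕₚ.≤-trans γ≤avoiding (ℕₚ.≤-reflexive (E-unique (f Δ) (λ m i → count (avoiding m i)) r r avoiding-none (λ m _ → avoiding-empty m) avoiding-recursion r r ℕₚ.≤-refl ℕₚ.≤-refl))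

-- Dimensions of subspaces of the exterior algebra

module Dimension (Q : Rationals) where
  open Rationals Q hiding (_+_; _*_; -_)
  open Exterior Q
  open LinearAlgebra Q
  open Contraction Q
  private
    module Q = Rationals Q
    module QR = CommutativeRing scalarRing
    module QC = Chains scalarField
    module S = SemiringSum QR.semiring
  open ES using (solve; _:+_; _:*_; :-_; _:=_; _:-_; con)
  open ≡-Reasoning

  Zero : ∀ {n} → Ext n → Set
  Zero z = z ≡ 𝟎

  zero-subspace : ∀ {n} → IsSubspace (Zero {n})
  zero-subspace = record
    { 𝟎∈ = refl
    ; +∈ = λ p q → trans (cong₂ _+_ p q) (+-identityˡ 𝟎)
    ; ·∈ = λ c p → trans (cong (c ·_) p) (·𝟎 c) }

  −≡𝟎 : ∀ {n} {x y : Ext n} → x − y ≡ 𝟎 → x ≡ y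
  −≡𝟎 {x = x} {y} e = trans (solve 2 (λ x y → x := x :- y :+ y) refl x y) (trans (cong (_+ y) e) (+-identityˡ y))

  ≡⇒−≡𝟎 : ∀ {n} {x y : Ext n} → x ≡ y → x − y ≡ 𝟎
  ≡⇒−≡𝟎 refl = -‿inverseʳ _

  Independent : ∀ {n k} → (Fin k → Ext n) → Set
  Independent = IndependentMod Zero

  Dim : ∀ {n} → (Ext n → Set) → ℕ → Set
  Dim {n} V k = Σ (Fin k → Ext n) λ v → (∀ i → V (v i)) × Independent v × (∀ z → V z → ¬ ¬ SpanMod Zero v z)

  dim-exists : ∀ {n} (V : Ext n → Set) → ¬ ¬ (∃ λ k → Dim V k)
  dim-exists V = basis-mod zero-subspace V

  dim-bound : ∀ {n k m} {V : Ext n → Set} → Dim V k → (u : Fin m → Ext n) → (∀ i → V (u i)) → Independent u → m ≤ k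
  dim-bound (v , _ , _ , span) u Vu ind = steinitz zero-subspace u v ind (λ i → span (u i) (Vu i))

  dim-mono : ∀ {n k m} {V W : Ext n → Set} → (∀ z → V z → W z) → Dim V k → Dim W m → k ≤ m
  dim-mono sub (v , Vv , ind , _) dimW = dim-bound dimW v (λ i → sub (v i) (Vv i)) ind

  dim-unique : ∀ {n k m} {V : Ext n → Set} → Dim V k → Dim V m → k ≡ m
  dim-unique p q = ℕₚ.≤-antisym (dim-mono (λ _ x → x) p q) (dim-mono (λ _ x → x) q p)

  dim-positive : ∀ {n k} {V : Ext n → Set} → Dim V k → ∀ z → V z → z ≢ 𝟎 → 1 ≤ k
  dim-positive dimV z Vz z≢0 = dim-bound dimV (λ (_ : Fin 1) → z) (λ _ → Vz) λ c e → λ { zero → decidable-stable (c zero ≟ 0#) λ c≢0 →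
    z≢0 (·-injective (c zero) z c≢0 (trans (sym (+-identityʳ _)) (trans (cong (c zero · z +_) (sym (lc-empty (c ∘ suc) (λ _ → z)))) (trans (sym (lc-suc c (λ _ → z))) e)))) }

  dim-nonzero : ∀ {n k} {V : Ext n → Set} → Dim V (suc k) → ∃ λ z → V z × z ≢ 𝟎
  dim-nonzero (v , Vv , ind , _) = v zero , Vv zero , λ e → 1≢0 (trans (sym (basis-diag zero)) (ind (basis zero) (trans (lc-basis zero v) e) zero))

  append : ∀ {a b} {A : Set} → (Fin a → A) → (Fin b → A) → Fin (a ℕ.+ b) → A
  append {zero}  v y = y
  append {suc a} v y = v zero ◂ append (v ∘ suc) y

  append-↑ˡ : ∀ {a b} {A : Set} (v : Fin a → A) (y : Fin b → A) i → append v y (i ↑ˡ b) ≡ v i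
  append-↑ˡ v y zero = refl
  append-↑ˡ v y (suc i) = append-↑ˡ (v ∘ suc) y i

  append-↑ʳ : ∀ a {b} {A : Set} (v : Fin a → A) (y : Fin b → A) i → append v y (a ↑ʳ i) ≡ y i
  append-↑ʳ zero v y i = refl
  append-↑ʳ (suc a) v y i = append-↑ʳ a (v ∘ suc) y i

  append-all : ∀ {a b} {A : Set} (P : A → Set) (v : Fin a → A) (y : Fin b → A) → (∀ i → P (v i)) → (∀ i → P (y i)) → ∀ i → P (append v y i)
  append-all {zero} P v y p q i = q i
  append-all {suc a} P v y p q zero = p zero
  append-all {suc a} P v y p q (suc i) = append-all P (v ∘ suc) y (p ∘ suc) q i

  split-all : ∀ a {b} (P : Fin (a ℕ.+ b) → Set) → (∀ i → P (i ↑ˡ b)) → (∀ i → P (a ↑ʳ i)) → ∀ i → P i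
  split-all zero P p q i = q i
  split-all (suc a) P p q zero = p zero
  split-all (suc a) P p q (suc i) = split-all a (P ∘ suc) (p ∘ suc) q i

  lc-append : ∀ {n} a {b} (c : Fin (a ℕ.+ b) → R) (v : Fin a → Ext n) (y : Fin b → Ext n) → lc c (append v y) ≡ lc (c ∘ (_↑ˡ b)) v + lc (c ∘ (a ↑ʳ_)) y
  lc-append zero {b} c v y = sym (trans (cong (_+ lc c y) (lc-empty (c ∘ (_↑ˡ b)) v)) (+-identityˡ _))
  lc-append (suc a) {b} c v y = begin
    lc c (append v y)                                                              ≡⟨ lc-suc c (append v y) ⟩
    c zero · v zero + lc (c ∘ suc) (append (v ∘ suc) y)                            ≡⟨ cong (c zero · v zero +_) (lc-append a (c ∘ suc) (v ∘ suc) y) ⟩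
    c zero · v zero + (lc (c ∘ suc ∘ (_↑ˡ b)) (v ∘ suc) + lc (c ∘ (suc a ↑ʳ_)) y)  ≡⟨ sym (+-assoc _ _ _) ⟩
    c zero · v zero + lc (c ∘ suc ∘ (_↑ˡ b)) (v ∘ suc) + lc (c ∘ (suc a ↑ʳ_)) y    ≡⟨ cong (_+ lc (c ∘ (suc a ↑ʳ_)) y) (sym (lc-suc (c ∘ (_↑ˡ b)) v)) ⟩
    lc (c ∘ (_↑ˡ b)) v + lc (c ∘ (suc a ↑ʳ_)) y                                    ∎

  lc-append′ : ∀ {n} a {b} (c : Fin a → R) (d : Fin b → R) (v : Fin a → Ext n) (y : Fin b → Ext n) → lc (append c d) (append v y) ≡ lc c v + lc d y
  lc-append′ a c d v y = trans (lc-append a (append c d) v y) (cong₂ _+_ (lc-cong (append-↑ˡ c d)) (lc-cong (append-↑ʳ a c d)))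

  ι-lc : ∀ {n k} (φ : Form n) (c : Fin k → R) (v : Fin k → Ext n) → ι φ (lc c v) ≡ lc c (ι φ ∘ v)
  ι-lc φ c v = trans (∑-map (ι φ) (ι-𝟎 φ) (ι-+ φ) (λ i → c i · v i)) (∑-cong (λ i → ι-· φ (c i) (v i)))

  Kernel ImageOf : ∀ {n} → Form n → (Ext n → Set) → Ext n → Set
  Kernel φ V z = V z × ι φ z ≡ 𝟎
  ImageOf φ V z = ∃ λ y → V y × z ≡ ι φ y

  rank-nullity : ∀ {n a b} {V : Ext n → Set} → IsSubspace V → ∀ φ → Dim (Kernel φ V) a → Dim (ImageOf φ V) b → Dim V (a ℕ.+ b)
  rank-nullity {n} {a} {b} {V} Vsub φ (v , Kv , vind , vspan) (w , Iw , wind , wspan) = append v y , append-all V v y (proj₁ ∘ Kv) (λ i → proj₁ (proj₂ (Iw i))) , ind , span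
    where
    open IsSubspace Vsub
    y : Fin b → Ext n
    y i = proj₁ (Iw i)
    φy : ∀ i → w i ≡ ι φ (y i)
    φy i = proj₂ (proj₂ (Iw i))
    φ-lc-v : ∀ c → ι φ (lc c v) ≡ 𝟎
    φ-lc-v c = trans (ι-lc φ c v) (IsSubspace.lc∈ zero-subspace c (λ i → proj₂ (Kv i)))
    φ-lc-y : ∀ d → ι φ (lc d y) ≡ lc d w
    φ-lc-y d = trans (ι-lc φ d y) (∑-cong (λ i → cong (d i ·_) (sym (φy i))))
    ind : Independent (append v y)
    ind c e = split-all a (λ i → c i ≡ 0#) (vind (c ∘ (_↑ˡ b)) left≡𝟎) right≡0
      where
      sum≡𝟎 : lc (c ∘ (_↑ˡ b)) v + lc (c ∘ (a ↑ʳ_)) y ≡ 𝟎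
      sum≡𝟎 = trans (sym (lc-append a c v y)) e
      right≡0 : ∀ i → c (a ↑ʳ i) ≡ 0#
      right≡0 = wind (c ∘ (a ↑ʳ_)) (begin
        lc (c ∘ (a ↑ʳ_)) w                              ≡⟨ sym (φ-lc-y _) ⟩
        ι φ (lc (c ∘ (a ↑ʳ_)) y)                        ≡⟨ sym (+-identityˡ _) ⟩
        𝟎 + ι φ (lc (c ∘ (a ↑ʳ_)) y)                    ≡⟨ cong (_+ ι φ (lc (c ∘ (a ↑ʳ_)) y)) (sym (φ-lc-v (c ∘ (_↑ˡ b)))) ⟩
        ι φ (lc (c ∘ (_↑ˡ b)) v) + ι φ (lc (c ∘ (a ↑ʳ_)) y) ≡⟨ sym (ι-+ φ _ _) ⟩
        ι φ (lc (c ∘ (_↑ˡ b)) v + lc (c ∘ (a ↑ʳ_)) y)   ≡⟨ trans (cong (ι φ) sum≡𝟎) (ι-𝟎 φ) ⟩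
        𝟎                                               ∎)
      left≡𝟎 : lc (c ∘ (_↑ˡ b)) v ≡ 𝟎
      left≡𝟎 = trans (sym (+-identityʳ _)) (trans (cong (lc (c ∘ (_↑ˡ b)) v +_) (sym (trans (lc-cong right≡0) (lc-𝟎 y)))) sum≡𝟎)
    span : ∀ z → V z → ¬ ¬ SpanMod Zero (append v y) z
    span z Vz =
      wspan (ι φ z) (z , Vz , refl) >>= λ (d , e) →
      vspan (z − lc d y) (−∈ Vz (lc∈ d (λ i → proj₁ (proj₂ (Iw i)))) ,
        trans (ι-+ φ z (- lc d y)) (trans (cong (ι φ z +_) (trans (ι-neg φ (lc d y)) (cong -_ (φ-lc-y d)))) e)) >>= λ (c , e′) →
      return (append c d , trans (cong (z −_) (lc-append′ a c d v y)) (trans (solve 3 (λ z a b → z :- (a :+ b) := z :- b :- a) refl z (lc c v) (lc d y)) e′))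

  coef-lc : ∀ {n k} (c : Fin k → R) (v : Fin k → Ext n) A → coef (lc c v) A ≡ S.sum (λ i → c i Q.* coef (v i) A)
  coef-lc {k = zero} c v A = trans (cong (λ x → coef x A) (lc-empty c v)) (coef-𝟎 A)
  coef-lc {k = suc k} c v A = trans (cong (λ x → coef x A) (lc-suc c v)) (trans (coef-+ (c zero · v zero) (lc (c ∘ suc) (v ∘ suc)) A)
    (cong₂ Q._+_ (coef-· (c zero) (v zero) A) (coef-lc (c ∘ suc) (v ∘ suc) A)))

  single : ∀ {n} → Subset n → Ext n
  single A = tabulate (QC.indicator A)

  dim-supported : ∀ {n} (Φ : Family n) (V : Ext n → Set) → (∀ z → V z → ∀ A → coef z A ≢ 0# → Φ A ≡ true) →
    (∀ z → (∀ A → coef z A ≢ 0# → Φ A ≡ true) → V z) → Dim V (count Φ)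
  dim-supported {n} Φ V V⇒ ⇒V = single ∘ enum Φ , (λ i → ⇒V _ (member i)) , ind , λ z Vz → return ((λ i → coef z (enum Φ i)) , ≡⇒−≡𝟎 (coef-ext z _ (expand z Vz)))
    where
    coefs : ∀ c A → coef (lc c (single ∘ enum Φ)) A ≡ QC.combination c (QC.indicator ∘ enum Φ) A
    coefs c A = trans (coef-lc c (single ∘ enum Φ) A) (S.sum-cong-≋ (λ i → cong (c i Q.*_) (coef-tabulate (QC.indicator (enum Φ i)) A)))
    at : ∀ c j → coef (lc c (single ∘ enum Φ)) (enum Φ j) ≡ c j
    at c j = trans (coefs c (enum Φ j)) (QC.combination-indicator c (enum Φ) (enum-injective Φ) j)
    member : ∀ i A → coef (single (enum Φ i)) A ≢ 0# → Φ A ≡ true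
    member i A ≢0 with enum Φ i ≟ₛ A
    ... | yes refl = enum-∈ Φ i
    ... | no ne = ⊥-elim (≢0 (trans (coef-tabulate (QC.indicator (enum Φ i)) A) (QC.indicator-other (enum Φ i) A ne)))
    ind : Independent (single ∘ enum Φ)
    ind c e j = trans (sym (at c j)) (trans (cong (λ x → coef x (enum Φ j)) e) (coef-𝟎 (enum Φ j)))
    expand : ∀ z → V z → ∀ A → coef z A ≡ coef (lc (λ i → coef z (enum Φ i)) (single ∘ enum Φ)) A
    expand z Vz A with bool-cases (Φ A)
    ... | inj₁ A∈ with index Φ A A∈
    ...   | j , refl = sym (at (λ i → coef z (enum Φ i)) j)
    expand z Vz A | inj₂ A∉ = trans (decidable-stable (coef z A ≟ 0#) λ ≢0 → true≢false (V⇒ z Vz A ≢0) A∉)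
      (sym (trans (coefs _ A) (QC.combination-supported {Φ = Φ} (λ i → coef z (enum Φ i)) (λ i → QC.indicator-supported {Φ = Φ} (enum Φ i) (enum-∈ Φ i)) A A∉)))

  dim-In : ∀ {n} (Δ : Family n) i → Dim (In Δ i) (f Δ i)
  dim-In Δ i = dim-supported (faces Δ i) (In Δ i) (λ z p A ≢0 → let (a , b) = p A ≢0 in ⇒faces Δ i A a b) (λ z h A ≢0 → faces⇒ Δ i A (h A ≢0))

-- Generic linear forms

module Generic (Q : Rationals) {n : ℕ} where
  open Rationals Q hiding (_+_; _*_; -_)
  open Exterior Q
  open LinearAlgebra Q
  open Contraction Q
  open Dimension Q
  private
    module Q = Rationals Q
    module QR = CommutativeRing scalarRing
    module QS = FromInteger.Solver scalarRing
    module QI = FromInteger scalarRing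
    module S = SemiringSum QR.semiring
  open ES using (solve; _:+_; _:*_; :-_; _:=_; _:-_; con)
  open ≡-Reasoning

  nat : ℕ → R
  nat t = fromℤ (ℤ.+ t)

  nat-injective : ∀ s t → nat s Q.+ Q.- nat t ≡ 0# → s ≡ t
  nat-injective s t e = ℤₚ.+-injective (ℤₚ.i-j≡0⇒i≡j (ℤ.+ s) (ℤ.+ t) (fromℤ-injective (ℤ.+ s ℤ.- ℤ.+ t)
    (trans (QI.fromℤ-+ (ℤ.+ s) (ℤ.- (ℤ.+ t))) (trans (cong (nat s Q.+_) (QI.fromℤ-neg (ℤ.+ t))) e))))

  sum-cong : ∀ {k} (g h : Fin k → R) → (∀ i → g i ≡ h i) → S.sum g ≡ S.sum h
  sum-cong g h e = S.sum-cong-≋ {x = g} {y = h} e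

  sum-zero : ∀ {k} (g : Fin k → R) → (∀ i → g i ≡ 0#) → S.sum g ≡ 0#
  sum-zero {k} g e = trans (sum-cong g (λ _ → 0#) e) (S.sum-replicate-zero k)

  module _ {I : Set} where
    evaluate : ∀ {k} → (Fin k → I → R) → (Fin k → R) → I → R
    evaluate u c i = S.sum (λ l → c l Q.* u l i)

    IndependentFunctions : ∀ {k} → (Fin k → I → R) → Set
    IndependentFunctions u = ∀ c → (∀ i → evaluate u c i ≡ 0#) → ∀ l → c l ≡ 0#

    evaluate-combination : ∀ {k m} (u : Fin k → I → R) (b : Fin m → R) (c : Fin m → Fin k → R) i →
      evaluate u (λ l → S.sum (λ j → b j Q.* c j l)) i ≡ S.sum (λ j → b j Q.* evaluate u (c j) i)
    evaluate-combination {k} {m} u b c i = begin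
      S.sum (λ l → S.sum (λ j → b j Q.* c j l) Q.* u l i)        ≡⟨ S.sum-cong-≋ (λ l → S.*-distribʳ-sum (u l i) (λ j → b j Q.* c j l)) ⟩
      S.sum (λ l → S.sum (λ j → b j Q.* c j l Q.* u l i))        ≡⟨ S.∑-comm (λ l j → b j Q.* c j l Q.* u l i) ⟩
      S.sum (λ j → S.sum (λ l → b j Q.* c j l Q.* u l i))        ≡⟨ S.sum-cong-≋ (λ j → trans (S.sum-cong-≋ (λ l → QR.*-assoc (b j) (c j l) (u l i))) (sym (S.*-distribˡ-sum (b j) (λ l → c j l Q.* u l i)))) ⟩
      S.sum (λ j → b j Q.* evaluate u (c j) i)                   ∎

    module _ {k} (u w : Fin k → I → R) (ind : IndependentFunctions u) where
      -- Eigenvectors of the pencil `t u + w`; the eigenvalues are the values of `t` at which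
      -- independence is lost.
      Eigen : R → (Fin k → R) → Set
      Eigen t c = (∃ λ l → c l ≢ 0#) × ∀ i → t Q.* evaluate u c i Q.+ evaluate w c i ≡ 0#

      -- As for eigenvectors: u is injective, so vectors for different values of t are independent.
      eigen-independent : ∀ m (t : Fin m → R) (c : Fin m → Fin k → R) → (∀ i j → i ≢ j → t i Q.+ Q.- t j ≢ 0#) → (∀ j → Eigen (t j) (c j)) →
        ∀ (a : Fin m → R) → (∀ l → S.sum (λ j → a j Q.* c j l) ≡ 0#) → ∀ j → a j ≡ 0#
      eigen-independent (suc m) t c distinct eigen a e = λ { zero → head ; (suc j) → tail j }
        where
        eigen-term : ∀ t a u w → t Q.* u Q.+ w ≡ 0# → t Q.* a Q.* u ≡ (Q.- nat 1) Q.* (a Q.* w)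
        eigen-term t a u w e = begin
          t Q.* a Q.* u                                ≡⟨ QS.solve 4 (λ t a u w → t QS.:* a QS.:* u QS.:= a QS.:* (t QS.:* u QS.:+ w) QS.:+ (QS.:- QS.con (ℤ.+ 1)) QS.:* (a QS.:* w)) refl t a u w ⟩
          a Q.* (t Q.* u Q.+ w) Q.+ (Q.- nat 1) Q.* (a Q.* w) ≡⟨ cong (λ s → a Q.* s Q.+ (Q.- nat 1) Q.* (a Q.* w)) e ⟩
          a Q.* 0# Q.+ (Q.- nat 1) Q.* (a Q.* w)       ≡⟨ trans (cong (Q._+ (Q.- nat 1) Q.* (a Q.* w)) (QR.zeroʳ a)) (QR.+-identityˡ _) ⟩
          (Q.- nat 1) Q.* (a Q.* w)                    ∎
        weighted : ∀ l → S.sum (λ j → (t j Q.* a j) Q.* c j l) ≡ 0#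
        weighted = ind (λ l → S.sum (λ j → (t j Q.* a j) Q.* c j l)) λ i → begin
          evaluate u (λ l → S.sum (λ j → (t j Q.* a j) Q.* c j l)) i         ≡⟨ evaluate-combination u (λ j → t j Q.* a j) c i ⟩
          S.sum (λ j → t j Q.* a j Q.* evaluate u (c j) i)                   ≡⟨ sum-cong (λ j → t j Q.* a j Q.* evaluate u (c j) i) (λ j → (Q.- nat 1) Q.* (a j Q.* evaluate w (c j) i)) (λ j → eigen-term (t j) (a j) (evaluate u (c j) i) (evaluate w (c j) i) (proj₂ (eigen j) i)) ⟩
          S.sum (λ j → (Q.- nat 1) Q.* (a j Q.* evaluate w (c j) i))         ≡⟨ sym (S.*-distribˡ-sum (Q.- nat 1) (λ j → a j Q.* evaluate w (c j) i)) ⟩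
          (Q.- nat 1) Q.* S.sum (λ j → a j Q.* evaluate w (c j) i)           ≡⟨ cong ((Q.- nat 1) Q.*_) (trans (sym (evaluate-combination w a c i)) (sum-zero (λ l → S.sum (λ j → a j Q.* c j l) Q.* w l i) (λ l → trans (cong (Q._* w l i) (e l)) (QR.zeroˡ _)))) ⟩
          (Q.- nat 1) Q.* 0#                                                 ≡⟨ QR.zeroʳ _ ⟩
          0#                                                                 ∎
        reduced : ∀ l → S.sum (λ j → ((t (suc j) Q.+ Q.- t zero) Q.* a (suc j)) Q.* c (suc j) l) ≡ 0#
        reduced l = begin
          S.sum (λ j → ((t (suc j) Q.+ Q.- t zero) Q.* a (suc j)) Q.* c (suc j) l)
            ≡⟨ sum-cong (λ j → ((t (suc j) Q.+ Q.- t zero) Q.* a (suc j)) Q.* c (suc j) l) (λ j → t (suc j) Q.* a (suc j) Q.* c (suc j) l Q.+ (Q.- t zero) Q.* (a (suc j) Q.* c (suc j) l)) (λ j → QS.solve 4 (λ t s a c → (t QS.:- s) QS.:* a QS.:* c QS.:= t QS.:* a QS.:* c QS.:+ (QS.:- s) QS.:* (a QS.:* c)) refl (t (suc j)) (t zero) (a (suc j)) (c (suc j) l)) ⟩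
          S.sum (λ j → t (suc j) Q.* a (suc j) Q.* c (suc j) l Q.+ (Q.- t zero) Q.* (a (suc j) Q.* c (suc j) l))
            ≡⟨ S.∑-distrib-+ (λ j → t (suc j) Q.* a (suc j) Q.* c (suc j) l) (λ j → (Q.- t zero) Q.* (a (suc j) Q.* c (suc j) l)) ⟩
          T Q.+ S.sum (λ j → (Q.- t zero) Q.* (a (suc j) Q.* c (suc j) l))
            ≡⟨ cong (T Q.+_) (sym (S.*-distribˡ-sum (Q.- t zero) (λ j → a (suc j) Q.* c (suc j) l))) ⟩
          T Q.+ (Q.- t zero) Q.* A
            ≡⟨ QS.solve 5 (λ T A s a c → T QS.:+ (QS.:- s) QS.:* A QS.:= (s QS.:* a QS.:* c QS.:+ T) QS.:- s QS.:* (a QS.:* c QS.:+ A)) refl T A (t zero) (a zero) (c zero l) ⟩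
          (t zero Q.* a zero Q.* c zero l Q.+ T) Q.+ Q.- (t zero Q.* (a zero Q.* c zero l Q.+ A))
            ≡⟨ cong₂ (λ x y → x Q.+ Q.- (t zero Q.* y)) (weighted l) (e l) ⟩
          0# Q.+ Q.- (t zero Q.* 0#)
            ≡⟨ QS.solve 1 (λ s → QS.con (ℤ.+ 0) QS.:- s QS.:* QS.con (ℤ.+ 0) QS.:= QS.con (ℤ.+ 0)) refl (t zero) ⟩
          0# ∎
          where
          T A : R
          T = S.sum (λ j → t (suc j) Q.* a (suc j) Q.* c (suc j) l)
          A = S.sum (λ j → a (suc j) Q.* c (suc j) l)
        tail : ∀ j → a (suc j) ≡ 0#
        tail j = decidable-stable (a (suc j) ≟ 0#) λ ≢0 → *≢0 (distinct (suc j) zero λ ()) ≢0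
          (eigen-independent m (t ∘ suc) (c ∘ suc) (λ i j i≢j → distinct (suc i) (suc j) (i≢j ∘ Finₚ.suc-injective)) (eigen ∘ suc) (λ j → (t (suc j) Q.+ Q.- t zero) Q.* a (suc j)) reduced j)
        head : a zero ≡ 0#
        head = decidable-stable (a zero ≟ 0#) λ ≢0 → let (l , cl≢0) = proj₁ (eigen zero) in *≢0 ≢0 cl≢0 (begin
          a zero Q.* c zero l                                    ≡⟨ sym (QR.+-identityʳ _) ⟩
          a zero Q.* c zero l Q.+ 0#                             ≡⟨ cong (a zero Q.* c zero l Q.+_) (sym (sum-zero (λ j → a (suc j) Q.* c (suc j) l) (λ j → trans (cong (Q._* c (suc j) l) (tail j)) (QR.zeroˡ _)))) ⟩
          S.sum (λ j → a j Q.* c j l)                            ≡⟨ e l ⟩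
          0#                                                     ∎)

      perturbed : ℕ → Fin k → I → R
      perturbed t l i = nat t Q.* u l i Q.+ w l i

      evaluate-perturbed : ∀ t c i → evaluate (perturbed t) c i ≡ nat t Q.* evaluate u c i Q.+ evaluate w c i
      evaluate-perturbed t c i = trans (sum-cong (λ l → c l Q.* perturbed t l i) (λ l → nat t Q.* (c l Q.* u l i) Q.+ c l Q.* w l i) (λ l → QS.solve 4 (λ c t u w → c QS.:* (t QS.:* u QS.:+ w) QS.:= t QS.:* (c QS.:* u) QS.:+ c QS.:* w) refl (c l) (nat t) (u l i) (w l i)))
        (trans (S.∑-distrib-+ (λ l → nat t Q.* (c l Q.* u l i)) (λ l → c l Q.* w l i)) (cong (Q._+ evaluate w c i) (sym (S.*-distribˡ-sum (nat t) (λ l → c l Q.* u l i)))))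

      Collection : ℕ → Set
      Collection m = ∃ λ T → ∃ λ (t : Fin m → ℕ) → ∃ λ (c : Fin m → Fin k → R) →
        (∀ j → t j < T) × (∀ i j → t i ≡ t j → i ≡ j) × (∀ j → Eigen (nat (t j)) (c j))

      extend-collection : ∀ {m} T (t : Fin m → ℕ) (c : Fin m → Fin k → R) → (∀ j → t j < T) → (∀ i j → t i ≡ t j → i ≡ j) → (∀ j → Eigen (nat (t j)) (c j)) →
        ∀ s → T ≤ s → ∀ d → Eigen (nat s) d → Collection (suc m)
      extend-collection T t c bounded injective eigen s T≤s d d-eigen = suc s , (s ◂ t) , (d ◂ c) ,
        (λ { zero → ℕₚ.≤-refl ; (suc j) → ℕₚ.m<n⇒m<1+n (ℕₚ.<-≤-trans (bounded j) T≤s) }) ,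
        (λ { zero zero _ → refl ; zero (suc j) e → ⊥-elim (ℕₚ.<-irrefl (sym e) (ℕₚ.<-≤-trans (bounded j) T≤s))
           ; (suc i) zero e → ⊥-elim (ℕₚ.<-irrefl e (ℕₚ.<-≤-trans (bounded i) T≤s)) ; (suc i) (suc j) e → cong suc (injective i j e) }) ,
        (λ { zero → d-eigen ; (suc j) → eigen j })

      too-many : Collection (suc k) → ⊥
      too-many (T , t , c , bounded , injective , eigen) = Dependence.nonzero-solution scalarField c ℕₚ.≤-refl λ (a , (j , aj≢0) , eqs) →
        aj≢0 (eigen-independent (suc k) (nat ∘ t) c (λ i j i≢j e → i≢j (injective i j (nat-injective (t i) (t j) e))) eigen a eqs j)

      -- Every bad `t` has an eigenvector, and those for different `t` are independent vectors with
      -- `k` coordinates, so fewer than `suc k` values are bad. Since the bad values cannot be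
      -- listed, the assumption that they never end is used to collect `suc k` of them.
      eventually-independent : ¬ ¬ (∃ λ T → ∀ t → T ≤ t → IndependentFunctions (perturbed t))
      eventually-independent never = collect (suc k) too-many
        where
        collect : ∀ m → ¬ ¬ Collection m
        collect zero = return (0 , (λ ()) , (λ ()) , (λ ()) , (λ ()) , (λ ()))
        collect (suc m) none = collect m λ (T , t , c , bounded , injective , eigen) →
          never (T , λ s T≤s d e l → decidable-stable (d l ≟ 0#) λ dl≢0 → none (extend-collection T t c bounded injective eigen s T≤s d
            ((l , dl≢0) , λ i → trans (sym (evaluate-perturbed s d i)) (e i))))

  independent-functions : ∀ {k} (v : Fin k → Ext n) → Independent v → IndependentFunctions (λ l A → coef (v l) A)
  independent-functions v ind c e = ind c (coef-ext _ 𝟎 λ A → trans (coef-lc c v A) (trans (e A) (sym (coef-𝟎 A))))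

  functions-independent : ∀ {k} (v : Fin k → Ext n) → IndependentFunctions (λ l A → coef (v l) A) → Independent v
  functions-independent v ind c e = ind c λ A → trans (sym (coef-lc c v A)) (trans (cong (λ x → coef x A) e) (coef-𝟎 A))

  independent-perturb : ∀ {k} (v w : Fin k → Ext n) → Independent v → ¬ ¬ (∃ λ T → ∀ t → T ≤ t → Independent (λ l → nat t · v l + w l))
  independent-perturb v w ind = eventually-independent (λ l A → coef (v l) A) (λ l A → coef (w l) A) (independent-functions v ind) >>= λ (T , h) →
    return (T , λ t T≤t → functions-independent (λ l → nat t · v l + w l) λ c e → h t T≤t c (λ A → trans (sum-cong (λ l → c l Q.* (nat t Q.* coef (v l) A Q.+ coef (w l) A)) (λ l → c l Q.* coef (nat t · v l + w l) A) (λ l → cong (c l Q.*_) (sym (trans (coef-+ (nat t · v l) (w l) A) (cong (Q._+ coef (w l) A) (coef-· (nat t) (v l) A)))))) (e A)))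

  -- A small multiple of `basis x` is added to `φ`, up to the scalar `t`. Multiplying `φ` by a large
  -- integer avoids fractions and turns openness into a statement about all large `t`.
  perturb : ℕ → Fin n → Form n → Form n
  perturb t x φ v = nat t Q.* φ v Q.+ basis x v

  ι-perturb : ∀ t x φ z → ι (perturb t x φ) z ≡ nat t · ι φ z + ι (basis x) z
  ι-perturb t x φ z = trans (ι-form+ (λ v → nat t Q.* φ v) (basis x) z) (cong (_+ ι (basis x) z) (ι-form· (nat t) φ z))

  Open : (Form n → Set) → Set
  Open P = ∀ φ x → P φ → ¬ ¬ (∃ λ T → ∀ t → T ≤ t → P (perturb t x φ))

  open-× : ∀ {P P′ : Form n → Set} → Open P → Open P′ → Open (λ φ → P φ × P′ φ)
  open-× o o′ φ x (p , p′) = o φ x p >>= λ (T , h) → o′ φ x p′ >>= λ (T′ , h′) →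
    return (T ℕ.⊔ T′ , λ t le → h t (ℕₚ.≤-trans (ℕₚ.m≤m⊔n T T′) le) , h′ t (ℕₚ.≤-trans (ℕₚ.m≤n⊔m T T′) le))

  open-∀ : ∀ {m} {P : Fin m → Form n → Set} → (∀ i → Open (P i)) → Open (λ φ → ∀ i → P i φ)
  open-∀ {zero} o φ x p = return (0 , λ t _ ())
  open-∀ {suc m} {P} o φ x p = open-× {P zero} {λ φ → ∀ i → P (suc i) φ} (o zero) (open-∀ (o ∘ suc)) φ x (p zero , p ∘ suc) >>= λ (T , h) →
    return (T , λ t le → λ { zero → proj₁ (h t le) ; (suc i) → proj₂ (h t le) i })

  Rank≥ : (Ext n → Set) → ℕ → Form n → Set
  Rank≥ V ρ φ = ∃ λ (y : Fin ρ → Ext n) → (∀ i → V (y i)) × Independent (ι φ ∘ y)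

  independent-cong : ∀ {k} {v w : Fin k → Ext n} → (∀ i → v i ≡ w i) → Independent v → Independent w
  independent-cong e ind c h = ind c (trans (∑-cong (λ i → cong (c i ·_) (e i))) h)

  rank-open : ∀ V ρ → Open (Rank≥ V ρ)
  rank-open V ρ φ x (y , Vy , ind) = independent-perturb (ι φ ∘ y) (ι (basis x) ∘ y) ind >>= λ (T , h) →
    return (T , λ t le → y , Vy , independent-cong (λ i → sym (ι-perturb t x φ (y i))) (h t le))

  -- The first-order condition for maximal rank of the contraction on `V`: in every direction, the
  -- derivative maps the kernel into the image.
  Gen : (Ext n → Set) → Form n → Set
  Gen V φ = ∀ x z → V z → ι φ z ≡ 𝟎 → ¬ ¬ ImageOf φ V (ι (basis x) z)

  module _ {V : Ext n → Set} (Vsub : IsSubspace V) where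
    open IsSubspace Vsub

    rank-increase : ∀ {ρ φ} x z → Rank≥ V ρ φ → V z → ι φ z ≡ 𝟎 → ¬ ImageOf φ V (ι (basis x) z) → ¬ ¬ (∃ λ T → ∀ t → T ≤ t → Rank≥ V (suc ρ) (perturb t x φ))
    rank-increase {ρ} {φ} x z (y , Vy , ind) Vz φz≡𝟎 outside-image =
      independent-perturb (ι (basis x) z ◂ (ι φ ∘ y)) (𝟎 ◂ (ι (basis x) ∘ y))
        (extend-independent zero-subspace (ι φ ∘ y) (ι (basis x) z) ind λ (c , e) →
          outside-image (lc c y , lc∈ c Vy , trans (−≡𝟎 e) (sym (ι-lc φ c y)))) >>= λ (T , h) →
      -- The new vector is `z` multiplied by `t`: `φ` kills it, so its perturbed contraction is `t`
      -- times `ι (basis x) z`, which matches the leading terms of the other vectors.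
      return (T , λ t le → (nat t · z ◂ y) , (λ { zero → ·∈ (nat t) Vz ; (suc i) → Vy i }) ,
        independent-cong (λ { zero → trans (+-identityʳ _) (sym (trans (ι-perturb t x φ (nat t · z)) (trans (cong₂ _+_ (trans (cong (nat t ·_) (trans (ι-· φ (nat t) z) (trans (cong (nat t ·_) φz≡𝟎) (·𝟎 _)))) (·𝟎 _)) (ι-· (basis x) (nat t) z)) (+-identityˡ _))))
                            ; (suc i) → sym (ι-perturb t x φ (y i)) }) (h t le))

    -- The open condition added to `P` is that the rank on `V` reaches the largest value attained
    -- under `P`. A form where `Gen` fails could be perturbed inside `P` to a larger rank.
    maximal : ∀ {P} → Open P → ∃ P → ¬ ¬ (Σ (Form n → Set) λ P′ → Open P′ × ∃ P′ × ∀ φ → P′ φ → P φ × Gen V φ)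
    maximal {P} open-P (φ₀ , Pφ₀) = climb (suc (dimExt n)) 0 refl (φ₀ , Pφ₀ , (λ ()) , (λ ()) , λ _ _ ())
      where
      climb : ∀ fuel ρ → ρ ℕ.+ fuel ≡ suc (dimExt n) → (∃ λ φ → P φ × Rank≥ V ρ φ) → ¬ ¬ (Σ (Form n → Set) λ P′ → Open P′ × ∃ P′ × ∀ φ → P′ φ → P φ × Gen V φ)
      climb zero ρ e (φ , _ , y , _ , ind) = λ _ → ℕₚ.1+n≰n (subst (_≤ dimExt n) (trans (sym (ℕₚ.+-identityʳ ρ)) e) (independent-bound zero-subspace (ι φ ∘ y) ind))
      climb (suc fuel) ρ e here = ¬¬-excluded-middle {A = ∃ λ φ → P φ × Rank≥ V (suc ρ) φ} >>= λ where
        (yes higher) → climb fuel (suc ρ) (trans (sym (ℕₚ.+-suc ρ fuel)) e) higher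
        (no none) → return ((λ φ → P φ × Rank≥ V ρ φ) , open-× open-P (rank-open V ρ) , here , λ φ (Pφ , rank) → Pφ , λ x z Vz φz≡𝟎 outside-image →
          rank-increase x z rank Vz φz≡𝟎 outside-image (λ (T , h) → open-P φ x Pφ (λ (T′ , h′) →
            none (perturb (T ℕ.⊔ T′) x φ , h′ (T ℕ.⊔ T′) (ℕₚ.m≤n⊔m T T′) , h (T ℕ.⊔ T′) (ℕₚ.m≤m⊔n T T′)))))

  -- Genericity for one subspace is kept as an open condition while the next subspace is treated, so
  -- all of them can be satisfied by one form.
  generic-form : ∀ k {V : Subset k → Ext n → Set} → (∀ w → IsSubspace (V w)) → ∀ {P} → Open P → ∃ P →
    ¬ ¬ (Σ (Form n → Set) λ P′ → Open P′ × ∃ P′ × ∀ φ → P′ φ → P φ × ∀ w → Gen (V w) φ)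
  generic-form zero sub open-P here = maximal (sub []) open-P here >>= λ (P′ , o , there , h) →
    return (P′ , o , there , λ φ p → proj₁ (h φ p) , λ { [] → proj₂ (h φ p) })
  generic-form (suc k) sub open-P here =
    generic-form k (sub ∘ (outside ∷_)) open-P here >>= λ (P′ , o′ , here′ , h′) →
    generic-form k (sub ∘ (inside ∷_)) o′ here′ >>= λ (P″ , o″ , here″ , h″) →
    return (P″ , o″ , here″ , λ φ p → let (p′ , g) = h″ φ p ; (p₀ , g′) = h′ φ p′ in p₀ , λ { (outside ∷ w) → g′ w ; (inside ∷ w) → g w })

-- Sums over words and over disjoint pairs of words

module Words where
  open import Data.Nat using (_+_; _*_)
  open import Data.Nat.Properties

  Word : Set
  Word = List Bool

  wordSum : ℕ → ℕ → (Word → ℕ) → ℕ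
  wordSum zero    zero    g = g []
  wordSum zero    (suc j) g = wordSum zero j (g ∘ (true ∷_))
  wordSum (suc z) zero    g = wordSum z zero (g ∘ (false ∷_))
  wordSum (suc z) (suc j) g = wordSum z (suc j) (g ∘ (false ∷_)) + wordSum (suc z) j (g ∘ (true ∷_))

  data Letters : ℕ → ℕ → Word → Set where
    []  : Letters 0 0 []
    off : ∀ {z j w} → Letters z j w → Letters (suc z) j (false ∷ w)
    on  : ∀ {z j w} → Letters z j w → Letters z (suc j) (true ∷ w)

  wordSum-mono : ∀ z j {g h : Word → ℕ} → (∀ w → Letters z j w → g w ≤ h w) → wordSum z j g ≤ wordSum z j h
  wordSum-mono zero    zero    le = le [] []
  wordSum-mono zero    (suc j) le = wordSum-mono zero j (λ w → le (true ∷ w) ∘ on)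
  wordSum-mono (suc z) zero    le = wordSum-mono z zero (λ w → le (false ∷ w) ∘ off)
  wordSum-mono (suc z) (suc j) le = +-mono-≤ (wordSum-mono z (suc j) (λ w → le (false ∷ w) ∘ off)) (wordSum-mono (suc z) j (λ w → le (true ∷ w) ∘ on))

  wordSum-cong : ∀ z j {g h : Word → ℕ} → (∀ w → Letters z j w → g w ≡ h w) → wordSum z j g ≡ wordSum z j h
  wordSum-cong z j e = ≤-antisym (wordSum-mono z j (λ w l → ≤-reflexive (e w l))) (wordSum-mono z j (λ w l → ≤-reflexive (sym (e w l))))

  wordSum-+ : ∀ z j (g h : Word → ℕ) → wordSum z j (λ w → g w + h w) ≡ wordSum z j g + wordSum z j h
  wordSum-+ zero    zero    g h = refl
  wordSum-+ zero    (suc j) g h = wordSum-+ zero j (g ∘ (true ∷_)) (h ∘ (true ∷_))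
  wordSum-+ (suc z) zero    g h = wordSum-+ z zero (g ∘ (false ∷_)) (h ∘ (false ∷_))
  wordSum-+ (suc z) (suc j) g h = trans (cong₂ _+_ (wordSum-+ z (suc j) (g ∘ (false ∷_)) (h ∘ (false ∷_))) (wordSum-+ (suc z) j (g ∘ (true ∷_)) (h ∘ (true ∷_))))
    (+-interchange (wordSum z (suc j) (g ∘ (false ∷_))) _ _ _)

  wordSum-* : ∀ z j c (g : Word → ℕ) → wordSum z j (λ w → g w * c) ≡ wordSum z j g * c
  wordSum-* zero    zero    c g = refl
  wordSum-* zero    (suc j) c g = wordSum-* zero j c (g ∘ (true ∷_))
  wordSum-* (suc z) zero    c g = wordSum-* z zero c (g ∘ (false ∷_))
  wordSum-* (suc z) (suc j) c g = trans (cong₂ _+_ (wordSum-* z (suc j) c (g ∘ (false ∷_))) (wordSum-* (suc z) j c (g ∘ (true ∷_))))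
    (sym (*-distribʳ-+ c (wordSum z (suc j) (g ∘ (false ∷_))) _))

  -- The binomial coefficient of `z + j` over `j`, in the form of Pascal's recursion.
  number : ℕ → ℕ → ℕ
  number z j = wordSum z j (λ _ → 1)

  wordSum-const : ∀ z j c → wordSum z j (λ _ → c) ≡ number z j * c
  wordSum-const z j c = trans (wordSum-cong z j {λ _ → c} {λ _ → 1 * c} (λ w _ → sym (*-identityˡ c))) (wordSum-* z j c (λ _ → 1))

  number-positive : ∀ z j → 1 ≤ number z j
  number-positive zero    zero    = s≤s z≤n
  number-positive zero    (suc j) = number-positive zero j
  number-positive (suc z) zero    = number-positive z zero
  number-positive (suc z) (suc j) = ≤-trans (number-positive z (suc j)) (m≤m+n _ _)

  -- j letters are true on the left only, k on the right only, and m on neither side.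
  pairSum : ℕ → ℕ → ℕ → (Word → Word → ℕ) → ℕ
  pairSum zero    zero    zero    h = h [] []
  pairSum (suc j) zero    zero    h = pairSum j zero zero (λ u v → h (true ∷ u) (false ∷ v))
  pairSum zero    (suc k) zero    h = pairSum zero k zero (λ u v → h (false ∷ u) (true ∷ v))
  pairSum zero    zero    (suc m) h = pairSum zero zero m (λ u v → h (false ∷ u) (false ∷ v))
  pairSum (suc j) (suc k) zero    h = pairSum j (suc k) zero (λ u v → h (true ∷ u) (false ∷ v)) + pairSum (suc j) k zero (λ u v → h (false ∷ u) (true ∷ v))
  pairSum (suc j) zero    (suc m) h = pairSum j zero (suc m) (λ u v → h (true ∷ u) (false ∷ v)) + pairSum (suc j) zero m (λ u v → h (false ∷ u) (false ∷ v))
  pairSum zero    (suc k) (suc m) h = pairSum zero k (suc m) (λ u v → h (false ∷ u) (true ∷ v)) + pairSum zero (suc k) m (λ u v → h (false ∷ u) (false ∷ v))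
  pairSum (suc j) (suc k) (suc m) h = pairSum j (suc k) (suc m) (λ u v → h (true ∷ u) (false ∷ v)) +
    (pairSum (suc j) k (suc m) (λ u v → h (false ∷ u) (true ∷ v)) + pairSum (suc j) (suc k) m (λ u v → h (false ∷ u) (false ∷ v)))

  data Disjoint : ℕ → ℕ → ℕ → Word → Word → Set where
    []    : Disjoint 0 0 0 [] []
    left  : ∀ {j k m u v} → Disjoint j k m u v → Disjoint (suc j) k m (true ∷ u) (false ∷ v)
    right : ∀ {j k m u v} → Disjoint j k m u v → Disjoint j (suc k) m (false ∷ u) (true ∷ v)
    none  : ∀ {j k m u v} → Disjoint j k m u v → Disjoint j k (suc m) (false ∷ u) (false ∷ v)

  pairSum-mono : ∀ j k m {g h : Word → Word → ℕ} → (∀ u v → Disjoint j k m u v → g u v ≤ h u v) → pairSum j k m g ≤ pairSum j k m h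
  pairSum-mono zero    zero    zero    le = le [] [] []
  pairSum-mono (suc j) zero    zero    le = pairSum-mono j zero zero (λ u v → le _ _ ∘ left)
  pairSum-mono zero    (suc k) zero    le = pairSum-mono zero k zero (λ u v → le _ _ ∘ right)
  pairSum-mono zero    zero    (suc m) le = pairSum-mono zero zero m (λ u v → le _ _ ∘ none)
  pairSum-mono (suc j) (suc k) zero    le = +-mono-≤ (pairSum-mono j (suc k) zero (λ u v → le _ _ ∘ left)) (pairSum-mono (suc j) k zero (λ u v → le _ _ ∘ right))
  pairSum-mono (suc j) zero    (suc m) le = +-mono-≤ (pairSum-mono j zero (suc m) (λ u v → le _ _ ∘ left)) (pairSum-mono (suc j) zero m (λ u v → le _ _ ∘ none))
  pairSum-mono zero    (suc k) (suc m) le = +-mono-≤ (pairSum-mono zero k (suc m) (λ u v → le _ _ ∘ right)) (pairSum-mono zero (suc k) m (λ u v → le _ _ ∘ none))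
  pairSum-mono (suc j) (suc k) (suc m) le = +-mono-≤ (pairSum-mono j (suc k) (suc m) (λ u v → le _ _ ∘ left))
    (+-mono-≤ (pairSum-mono (suc j) k (suc m) (λ u v → le _ _ ∘ right)) (pairSum-mono (suc j) (suc k) m (λ u v → le _ _ ∘ none)))

  pairSum-+ : ∀ j k m (g h : Word → Word → ℕ) → pairSum j k m (λ u v → g u v + h u v) ≡ pairSum j k m g + pairSum j k m h
  pairSum-+ zero    zero    zero    g h = refl
  pairSum-+ (suc j) zero    zero    g h = pairSum-+ j zero zero _ _
  pairSum-+ zero    (suc k) zero    g h = pairSum-+ zero k zero _ _
  pairSum-+ zero    zero    (suc m) g h = pairSum-+ zero zero m _ _
  pairSum-+ (suc j) (suc k) zero    g h = trans (cong₂ _+_ (pairSum-+ j (suc k) zero (λ u v → g (true ∷ u) (false ∷ v)) (λ u v → h (true ∷ u) (false ∷ v))) (pairSum-+ (suc j) k zero (λ u v → g (false ∷ u) (true ∷ v)) (λ u v → h (false ∷ u) (true ∷ v))))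
    (+-interchange (pairSum j (suc k) zero (λ u v → g (true ∷ u) (false ∷ v))) _ _ _)
  pairSum-+ (suc j) zero    (suc m) g h = trans (cong₂ _+_ (pairSum-+ j zero (suc m) (λ u v → g (true ∷ u) (false ∷ v)) (λ u v → h (true ∷ u) (false ∷ v))) (pairSum-+ (suc j) zero m (λ u v → g (false ∷ u) (false ∷ v)) (λ u v → h (false ∷ u) (false ∷ v))))
    (+-interchange (pairSum j zero (suc m) (λ u v → g (true ∷ u) (false ∷ v))) _ _ _)
  pairSum-+ zero    (suc k) (suc m) g h = trans (cong₂ _+_ (pairSum-+ zero k (suc m) (λ u v → g (false ∷ u) (true ∷ v)) (λ u v → h (false ∷ u) (true ∷ v))) (pairSum-+ zero (suc k) m (λ u v → g (false ∷ u) (false ∷ v)) (λ u v → h (false ∷ u) (false ∷ v))))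
    (+-interchange (pairSum zero k (suc m) (λ u v → g (false ∷ u) (true ∷ v))) _ _ _)
  pairSum-+ (suc j) (suc k) (suc m) g h = trans (cong₂ _+_ (pairSum-+ j (suc k) (suc m) (λ u v → g (true ∷ u) (false ∷ v)) (λ u v → h (true ∷ u) (false ∷ v)))
      (trans (cong₂ _+_ (pairSum-+ (suc j) k (suc m) (λ u v → g (false ∷ u) (true ∷ v)) (λ u v → h (false ∷ u) (true ∷ v))) (pairSum-+ (suc j) (suc k) m (λ u v → g (false ∷ u) (false ∷ v)) (λ u v → h (false ∷ u) (false ∷ v))))
        (+-interchange (pairSum (suc j) k (suc m) (λ u v → g (false ∷ u) (true ∷ v))) _ _ _)))
    (+-interchange (pairSum j (suc k) (suc m) (λ u v → g (true ∷ u) (false ∷ v))) _ _ _)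

  number-zero : ∀ k → number k zero ≡ 1
  number-zero zero    = refl
  number-zero (suc k) = number-zero k

  -- For a fixed left word, the `k` true letters of its partner can be placed anywhere among its
  -- `k + m` false positions.
  pairSum-left : ∀ j k m (g : Word → ℕ) → pairSum j k m (λ u v → g u) ≡ number k m * wordSum (k + m) j g
  pairSum-left zero    zero    zero    g = sym (*-identityˡ _)
  pairSum-left (suc j) zero    zero    g = pairSum-left j zero zero (g ∘ (true ∷_))
  pairSum-left zero    (suc k) zero    g = pairSum-left zero k zero (g ∘ (false ∷_))
  pairSum-left zero    zero    (suc m) g = pairSum-left zero zero m (g ∘ (false ∷_))
  pairSum-left (suc j) (suc k) zero    g = trans (cong₂ _+_ (pairSum-left j (suc k) zero (g ∘ (true ∷_))) (pairSum-left (suc j) k zero (g ∘ (false ∷_))))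
    (trans (+-comm (number k 0 * wordSum (suc k + zero) j (g ∘ (true ∷_))) _) (sym (*-distribˡ-+ (number k 0) _ _)))
  pairSum-left (suc j) zero    (suc m) g = trans (cong₂ _+_ (pairSum-left j zero (suc m) (g ∘ (true ∷_))) (pairSum-left (suc j) zero m (g ∘ (false ∷_))))
    (trans (+-comm (number zero m * wordSum (suc m) j (g ∘ (true ∷_))) _) (sym (*-distribˡ-+ (number zero m) _ _)))
  pairSum-left zero    (suc k) (suc m) g = trans (cong₂ _+_ (pairSum-left zero k (suc m) (g ∘ (false ∷_))) (trans (pairSum-left zero (suc k) m (g ∘ (false ∷_)))
      (cong (λ t → number (suc k) m * wordSum t zero (g ∘ (false ∷_))) (sym (+-suc k m)))))
    (sym (*-distribʳ-+ (wordSum (k + suc m) zero (g ∘ (false ∷_))) (number k (suc m)) (number (suc k) m)))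
  pairSum-left (suc j) (suc k) (suc m) g = trans (cong₂ _+_ (pairSum-left j (suc k) (suc m) (g ∘ (true ∷_)))
      (cong₂ _+_ (pairSum-left (suc j) k (suc m) (g ∘ (false ∷_))) (trans (pairSum-left (suc j) (suc k) m (g ∘ (false ∷_))) (cong (λ t → number (suc k) m * wordSum t (suc j) (g ∘ (false ∷_))) (sym (+-suc k m))))))
    (solve 4 (λ a b x y → (a :+ b) :* x :+ (a :* y :+ b :* y) := (a :+ b) :* (y :+ x)) refl (number k (suc m)) (number (suc k) m) (wordSum (suc k + suc m) j (g ∘ (true ∷_))) (wordSum (k + suc m) (suc j) (g ∘ (false ∷_))))
    where open +-*-Solver

  pairSum-right : ∀ j k m (g : Word → ℕ) → pairSum j k m (λ u v → g v) ≡ number j m * wordSum (j + m) k g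
  pairSum-right j k m g = trans (swap j k m (λ u v → g v)) (pairSum-left k j m g)
    where
    swap : ∀ j k m (h : Word → Word → ℕ) → pairSum j k m h ≡ pairSum k j m (λ v u → h u v)
    swap zero    zero    zero    h = refl
    swap (suc j) zero    zero    h = swap j zero zero _
    swap zero    (suc k) zero    h = swap zero k zero _
    swap zero    zero    (suc m) h = swap zero zero m _
    swap (suc j) (suc k) zero    h = trans (cong₂ _+_ (swap j (suc k) zero _) (swap (suc j) k zero _)) (+-comm _ (pairSum k (suc j) zero (λ v u → h (false ∷ u) (true ∷ v))))
    swap (suc j) zero    (suc m) h = cong₂ _+_ (swap j zero (suc m) _) (swap (suc j) zero m _)
    swap zero    (suc k) (suc m) h = cong₂ _+_ (swap zero k (suc m) _) (swap zero (suc k) m _)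
    swap (suc j) (suc k) (suc m) h = trans (cong₂ _+_ (swap j (suc k) (suc m) (λ u v → h (true ∷ u) (false ∷ v))) (cong₂ _+_ (swap (suc j) k (suc m) (λ u v → h (false ∷ u) (true ∷ v))) (swap (suc j) (suc k) m (λ u v → h (false ∷ u) (false ∷ v)))))
      (solve 3 (λ x y z → x :+ (y :+ z) := y :+ (x :+ z)) refl (pairSum (suc k) j (suc m) (λ v u → h (true ∷ u) (false ∷ v))) (pairSum k (suc j) (suc m) (λ v u → h (false ∷ u) (true ∷ v))) (pairSum (suc k) (suc j) m (λ v u → h (false ∷ u) (false ∷ v))))
      where open +-*-Solver

  -- Double count the disjoint pairs, each of which contributes at most 1.
  cross-intersecting : ∀ j m (U V : Word → ℕ) → (∀ u v → Disjoint j j m u v → U u + V v ≤ 1) →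
    wordSum (j + m) j U + wordSum (j + m) j V ≤ number (j + m) j
  cross-intersecting j m U V h = cancel (number j m) (number-positive j m) (begin
    number j m * (wordSum (j + m) j U + wordSum (j + m) j V)                       ≡⟨ *-distribˡ-+ (number j m) (wordSum (j + m) j U) _ ⟩
    number j m * wordSum (j + m) j U + number j m * wordSum (j + m) j V            ≡⟨ cong₂ _+_ (sym (pairSum-left j j m U)) (sym (pairSum-right j j m V)) ⟩
    pairSum j j m (λ u v → U u) + pairSum j j m (λ u v → V v)                      ≡⟨ sym (pairSum-+ j j m (λ u v → U u) (λ u v → V v)) ⟩
    pairSum j j m (λ u v → U u + V v)                                              ≤⟨ pairSum-mono j j m h ⟩
    pairSum j j m (λ u v → 1)                                                      ≡⟨ pairSum-left j j m (λ _ → 1) ⟩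
    number j m * number (j + m) j                                                  ∎)
    where
    open ≤-Reasoning
    cancel : ∀ c → 1 ≤ c → ∀ {a b} → c * a ≤ c * b → a ≤ b
    cancel (suc c) _ {a} {b} = *-cancelˡ-≤ (suc c)

  sumTo : ℕ → (ℕ → ℕ) → ℕ
  sumTo zero    h = h zero
  sumTo (suc i) h = sumTo i h + h (suc i)

  sumTo-cong : ∀ i {g h : ℕ → ℕ} → (∀ j → j ≤ i → g j ≡ h j) → sumTo i g ≡ sumTo i h
  sumTo-cong zero    e = e zero z≤n
  sumTo-cong (suc i) e = cong₂ _+_ (sumTo-cong i (λ j le → e j (m≤n⇒m≤1+n le))) (e (suc i) ≤-refl)

  sumTo-+ : ∀ i (g h : ℕ → ℕ) → sumTo i (λ j → g j + h j) ≡ sumTo i g + sumTo i h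
  sumTo-+ zero    g h = refl
  sumTo-+ (suc i) g h = trans (cong (_+ (g (suc i) + h (suc i))) (sumTo-+ i g h)) (+-interchange (sumTo i g) (sumTo i h) (g (suc i)) (h (suc i)))

  module _ (r : ℕ) (D : Word → ℕ) where
    private
      p ρ : ℕ → ℕ → ℕ
      p z j = wordSum z j (D ∘ (false ∷_))
      ρ z j = wordSum z j (D ∘ (true ∷_))

    -- Telescoping over the words with z letters false: refining each of them by one letter
    -- trades the words ending in their z-th false letter for those ending in the next one.
    leaf-sum : ∀ Z → (∀ w z j → z ≤ Z → j ≤ r → Letters z j w → D w ≡ D (false ∷ w) + D (true ∷ w)) →
      (∀ w z → z ≤ Z → Letters z r w → D (true ∷ w) ≡ 0) → sumTo r (p Z) ≡ D []
    leaf-sum Z split top = cancel Z ≤-refl (total r refl Z ≤-refl)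
      where
      refine : ∀ z j → z ≤ Z → j ≤ r → wordSum z j D ≡ p z j + ρ z j
      refine z j z≤ le = trans (wordSum-cong z j (λ w l → split w z j z≤ le l)) (wordSum-+ z j (D ∘ (false ∷_)) (D ∘ (true ∷_)))
      ρ-top : ∀ z → z ≤ Z → ρ z r ≡ 0
      ρ-top z z≤ = trans (wordSum-cong z r (λ w l → top w z z≤ l)) (trans (wordSum-const z r 0) (*-zeroʳ (number z r)))
      cancel : ∀ z → z ≤ Z → sumTo r (λ j → wordSum z j D) ≡ D [] + sumTo r (ρ z) → sumTo r (p z) ≡ D []
      cancel z z≤ e = +-cancelʳ-≡ (sumTo r (ρ z)) (sumTo r (p z)) (D [])
        (trans (sym (sumTo-+ r (p z) (ρ z))) (trans (sumTo-cong r (λ j le → sym (refine z j z≤ le))) e))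
      -- A word with `suc z` letters false starts with false over `z` of them, or with true over one
      -- true letter fewer. The second kind shifts the index of the sum by one.
      shifted : ∀ z i → sumTo (suc i) (λ j → wordSum (suc z) j D) ≡ sumTo (suc i) (p z) + sumTo i (ρ (suc z))
      shifted z zero = sym (+-assoc (p z 0) (p z 1) (ρ (suc z) 0))
      shifted z (suc i) = trans (cong (_+ (p z (suc (suc i)) + ρ (suc z) (suc i))) (shifted z i)) (+-interchange (sumTo (suc i) (p z)) _ _ _)
      shifted₀ : ∀ i → sumTo (suc i) (λ j → wordSum 0 j D) ≡ D [] + sumTo i (ρ 0)
      shifted₀ zero = refl
      shifted₀ (suc i) = trans (cong (_+ ρ 0 (suc i)) (shifted₀ i)) (+-assoc (D []) _ _)
      ρ-drop : ∀ i → suc i ≡ r → ∀ z → z ≤ Z → sumTo (suc i) (ρ z) ≡ sumTo i (ρ z)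
      ρ-drop i refl z z≤ = trans (cong (sumTo i (ρ z) +_) (ρ-top z z≤)) (+-identityʳ _)
      total : ∀ s → s ≡ r → ∀ z → z ≤ Z → sumTo s (λ j → wordSum z j D) ≡ D [] + sumTo s (ρ z)
      total zero refl zero z≤ = trans (sym (+-identityʳ (D []))) (cong (D [] +_) (sym (ρ-top 0 z≤)))
      total zero refl (suc z) z≤ = trans (cancel z (<⇒≤ z≤) (total zero refl z (<⇒≤ z≤)))
        (trans (sym (+-identityʳ (D []))) (cong (D [] +_) (sym (ρ-top (suc z) z≤))))
      total (suc i) refl zero z≤ = trans (shifted₀ i) (cong (D [] +_) (sym (ρ-drop i refl 0 z≤)))
      total (suc i) refl (suc z) z≤ = trans (shifted z i)
        (cong₂ _+_ (cancel z (<⇒≤ z≤) (total (suc i) refl z (<⇒≤ z≤))) (sym (ρ-drop i refl (suc z) z≤)))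

open Words

-- The exterior product

module Wedge (Q : Rationals) where
  open Rationals Q hiding (_+_; _*_; -_)
  open Exterior Q
  private
    module Q = Rationals Q
    module QR = CommutativeRing scalarRing
  open ES using (solve; _:+_; _:*_; :-_; _:=_; _:-_; con)
  open ≡-Reasoning

  infixl 7 _⋏_

  opaque
    unfolding _+_ ι coef

    -- The grade involution: the sign that a generator picks up when moved across.
    flip : ∀ {n} → Ext n → Ext n
    flip ⟨ x ⟩ = ⟨ x ⟩
    flip (x & y) = flip x & - flip y

    _⋏_ : ∀ {n} → Ext n → Ext n → Ext n
    ⟨ x ⟩ ⋏ ⟨ y ⟩ = ⟨ x Q.* y ⟩
    (x & x′) ⋏ (y & y′) = x ⋏ y & x′ ⋏ y + flip x ⋏ y′

    flip-+ : ∀ {n} (x y : Ext n) → flip (x + y) ≡ flip x + flip y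
    flip-+ ⟨ x ⟩ ⟨ y ⟩ = refl
    flip-+ (x & x′) (y & y′) = cong₂ _&_ (flip-+ x y) (trans (cong -_ (flip-+ x′ y′)) (solve 2 (λ a b → :- (a :+ b) := :- a :+ :- b) refl (flip x′) (flip y′)))

    flip-neg : ∀ {n} (x : Ext n) → flip (- x) ≡ - flip x
    flip-neg ⟨ x ⟩ = refl
    flip-neg (x & y) = cong₂ _&_ (flip-neg x) (cong -_ (flip-neg y))

    flip-· : ∀ {n} c (x : Ext n) → flip (c · x) ≡ c · flip x
    flip-· c ⟨ x ⟩ = refl
    flip-· c (x & y) = cong₂ _&_ (flip-· c x) (trans (cong -_ (flip-· c y)) (sym (·-neg c (flip y))))

    flip-𝟎 : ∀ {n} → flip (𝟎 {n}) ≡ 𝟎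
    flip-𝟎 {zero}  = refl
    flip-𝟎 {suc n} = cong₂ _&_ flip-𝟎 (trans (cong -_ flip-𝟎) -𝟎)

    flip-flip : ∀ {n} (x : Ext n) → flip (flip x) ≡ x
    flip-flip ⟨ x ⟩ = refl
    flip-flip (x & y) = cong₂ _&_ (flip-flip x) (trans (cong -_ (trans (flip-neg (flip y)) (cong -_ (flip-flip y)))) (solve 1 (λ a → :- (:- a) := a) refl y))

    flip-support : ∀ {n} (x : Ext n) A → coef (flip x) A ≢ 0# → coef x A ≢ 0#
    flip-support ⟨ x ⟩ [] h = h
    flip-support (x & y) (outside ∷ A) h = flip-support x A h
    flip-support (x & y) (inside ∷ A) h = flip-support y A (≢0-neg (λ e → h (trans (coef-neg (flip y) A) e)))

    ⋏-+ˡ : ∀ {n} (x y z : Ext n) → (x + y) ⋏ z ≡ x ⋏ z + y ⋏ z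
    ⋏-+ˡ ⟨ x ⟩ ⟨ y ⟩ ⟨ z ⟩ = cong ⟨_⟩ (QR.distribʳ z x y)
    ⋏-+ˡ (x & x′) (y & y′) (z & z′) = cong₂ _&_ (⋏-+ˡ x y z) (trans (cong₂ _+_ (⋏-+ˡ x′ y′ z) (trans (cong (_⋏ z′) (flip-+ x y)) (⋏-+ˡ (flip x) (flip y) z′)))
      (solve 4 (λ a b c d → a :+ b :+ (c :+ d) := a :+ c :+ (b :+ d)) refl (x′ ⋏ z) (y′ ⋏ z) (flip x ⋏ z′) (flip y ⋏ z′)))

    ⋏-+ʳ : ∀ {n} (z x y : Ext n) → z ⋏ (x + y) ≡ z ⋏ x + z ⋏ y
    ⋏-+ʳ ⟨ z ⟩ ⟨ x ⟩ ⟨ y ⟩ = cong ⟨_⟩ (QR.distribˡ z x y)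
    ⋏-+ʳ (z & z′) (x & x′) (y & y′) = cong₂ _&_ (⋏-+ʳ z x y) (trans (cong₂ _+_ (⋏-+ʳ z′ x y) (⋏-+ʳ (flip z) x′ y′))
      (solve 4 (λ a b c d → a :+ b :+ (c :+ d) := a :+ c :+ (b :+ d)) refl (z′ ⋏ x) (z′ ⋏ y) (flip z ⋏ x′) (flip z ⋏ y′)))

    ⋏-·ˡ : ∀ {n} c (x y : Ext n) → (c · x) ⋏ y ≡ c · (x ⋏ y)
    ⋏-·ˡ c ⟨ x ⟩ ⟨ y ⟩ = cong ⟨_⟩ (QR.*-assoc c x y)
    ⋏-·ˡ c (x & x′) (y & y′) = cong₂ _&_ (⋏-·ˡ c x y) (trans (cong₂ _+_ (⋏-·ˡ c x′ y) (trans (cong (_⋏ y′) (flip-· c x)) (⋏-·ˡ c (flip x) y′))) (sym (·-+ c (x′ ⋏ y) (flip x ⋏ y′))))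

    ⋏-·ʳ : ∀ {n} c (x y : Ext n) → x ⋏ (c · y) ≡ c · (x ⋏ y)
    ⋏-·ʳ c ⟨ x ⟩ ⟨ y ⟩ = cong ⟨_⟩ (trans (sym (QR.*-assoc x c y)) (trans (cong (Q._* y) (QR.*-comm x c)) (QR.*-assoc c x y)))
    ⋏-·ʳ c (x & x′) (y & y′) = cong₂ _&_ (⋏-·ʳ c x y) (trans (cong₂ _+_ (⋏-·ʳ c x′ y) (⋏-·ʳ c (flip x) y′)) (sym (·-+ c (x′ ⋏ y) (flip x ⋏ y′))))

  -1· : ∀ {n} (x : Ext n) → (Q.- 1#) · x ≡ - x
  -1· x = trans (neg-· 1# x) (cong -_ (1· x))

  ⋏-negˡ : ∀ {n} (x y : Ext n) → (- x) ⋏ y ≡ - (x ⋏ y)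
  ⋏-negˡ x y = trans (cong (_⋏ y) (sym (-1· x))) (trans (⋏-·ˡ (Q.- 1#) x y) (-1· (x ⋏ y)))

  ⋏-negʳ : ∀ {n} (x y : Ext n) → x ⋏ (- y) ≡ - (x ⋏ y)
  ⋏-negʳ x y = trans (cong (x ⋏_) (sym (-1· y))) (trans (⋏-·ʳ (Q.- 1#) x y) (-1· (x ⋏ y)))

  𝟎⋏ : ∀ {n} (x : Ext n) → 𝟎 ⋏ x ≡ 𝟎
  𝟎⋏ x = trans (cong (_⋏ x) (sym (0· 𝟎))) (trans (⋏-·ˡ 0# 𝟎 x) (0· (𝟎 ⋏ x)))

  ⋏𝟎 : ∀ {n} (x : Ext n) → x ⋏ 𝟎 ≡ 𝟎
  ⋏𝟎 x = trans (cong (x ⋏_) (sym (0· 𝟎))) (trans (⋏-·ʳ 0# x 𝟎) (0· (x ⋏ 𝟎)))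

  opaque
    unfolding _+_ ι coef flip

    flip-ι : ∀ {n} φ (x : Ext n) → flip (ι φ x) ≡ - ι φ (flip x)
    flip-ι φ ⟨ x ⟩ = trans flip-𝟎 (sym -𝟎)
    flip-ι φ (x & y) = cong₂ _&_
      (begin
        flip (ι (φ ∘ suc) x + φ zero · y)                     ≡⟨ flip-+ (ι (φ ∘ suc) x) (φ zero · y) ⟩
        flip (ι (φ ∘ suc) x) + flip (φ zero · y)              ≡⟨ cong₂ _+_ (flip-ι (φ ∘ suc) x) (flip-· (φ zero) y) ⟩
        - ι (φ ∘ suc) (flip x) + φ zero · flip y              ≡⟨ solve 3 (λ i p y → :- i :+ p :* y := :- (i :+ p :* :- y)) refl (ι (φ ∘ suc) (flip x)) (const (φ zero)) (flip y) ⟩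
        - (ι (φ ∘ suc) (flip x) + φ zero · (- flip y))        ∎)
      (begin
        - flip (- ι (φ ∘ suc) y)        ≡⟨ cong -_ (trans (flip-neg (ι (φ ∘ suc) y)) (cong -_ (flip-ι (φ ∘ suc) y))) ⟩
        - - - ι (φ ∘ suc) (flip y)      ≡⟨ cong (λ t → - - t) (sym (ι-neg (φ ∘ suc) (flip y))) ⟩
        - - ι (φ ∘ suc) (- flip y)      ∎)

    derivation : ∀ {n} φ (x y : Ext n) → ι φ (x ⋏ y) ≡ ι φ x ⋏ y + flip x ⋏ ι φ y
    derivation φ ⟨ x ⟩ ⟨ y ⟩ = sym (trans (cong₂ _+_ (𝟎⋏ ⟨ y ⟩) (⋏𝟎 ⟨ x ⟩)) (+-identityˡ 𝟎))
    derivation {suc n} φ (x & x′) (y & y′) = cong₂ _&_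
      (begin
        ι ψ (x ⋏ y) + p · (x′ ⋏ y + flip x ⋏ y′)
          ≡⟨ cong (_+ p · (x′ ⋏ y + flip x ⋏ y′)) (derivation ψ x y) ⟩
        ι ψ x ⋏ y + flip x ⋏ ι ψ y + p · (x′ ⋏ y + flip x ⋏ y′)
          ≡⟨ solve 5 (λ a b p c d → a :+ b :+ p :* (c :+ d) := a :+ p :* c :+ (b :+ p :* d)) refl (ι ψ x ⋏ y) (flip x ⋏ ι ψ y) (const p) (x′ ⋏ y) (flip x ⋏ y′) ⟩
        ι ψ x ⋏ y + p · (x′ ⋏ y) + (flip x ⋏ ι ψ y + p · (flip x ⋏ y′))
          ≡⟨ sym (cong₂ _+_ (trans (⋏-+ˡ (ι ψ x) (p · x′) y) (cong (ι ψ x ⋏ y +_) (⋏-·ˡ p x′ y))) (trans (⋏-+ʳ (flip x) (ι ψ y) (p · y′)) (cong (flip x ⋏ ι ψ y +_) (⋏-·ʳ p (flip x) y′)))) ⟩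
        (ι ψ x + p · x′) ⋏ y + flip x ⋏ (ι ψ y + p · y′) ∎)
      (begin
        - ι ψ (x′ ⋏ y + flip x ⋏ y′)
          ≡⟨ cong -_ (trans (ι-+ ψ (x′ ⋏ y) (flip x ⋏ y′)) (cong₂ _+_ (derivation ψ x′ y) (trans (derivation ψ (flip x) y′) (cong₂ _+_ refl (cong (_⋏ ι ψ y′) (flip-flip x)))))) ⟩
        - (ι ψ x′ ⋏ y + flip x′ ⋏ ι ψ y + (ι ψ (flip x) ⋏ y′ + x ⋏ ι ψ y′))
          ≡⟨ solve 6 (λ a b c d p e → :- (a :+ b :+ (c :+ d)) := :- a :+ (:- c :+ p :* e) :+ (:- (b :+ p :* e) :+ :- d)) refl
               (ι ψ x′ ⋏ y) (flip x′ ⋏ ι ψ y) (ι ψ (flip x) ⋏ y′) (x ⋏ ι ψ y′) (const p) (flip x′ ⋏ y′) ⟩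
        - (ι ψ x′ ⋏ y) + (- (ι ψ (flip x) ⋏ y′) + p · (flip x′ ⋏ y′)) + (- (flip x′ ⋏ ι ψ y + p · (flip x′ ⋏ y′)) + - (x ⋏ ι ψ y′))
          ≡⟨ sym (cong₂ _+_
               (cong₂ _+_ (⋏-negˡ (ι ψ x′) y) (trans (cong (_⋏ y′) (trans (flip-+ (ι ψ x) (p · x′)) (cong₂ _+_ (flip-ι ψ x) (flip-· p x′)))) (trans (⋏-+ˡ (- ι ψ (flip x)) (p · flip x′) y′) (cong₂ _+_ (⋏-negˡ (ι ψ (flip x)) y′) (⋏-·ˡ p (flip x′) y′)))))
               (cong₂ _+_ (trans (⋏-negˡ (flip x′) (ι ψ y + p · y′)) (cong -_ (trans (⋏-+ʳ (flip x′) (ι ψ y) (p · y′)) (cong (flip x′ ⋏ ι ψ y +_) (⋏-·ʳ p (flip x′) y′))))) (trans (cong (_⋏ (- ι ψ y′)) (flip-flip x)) (⋏-negʳ x (ι ψ y′))))) ⟩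
        (- ι ψ x′) ⋏ y + flip (ι ψ x + p · x′) ⋏ y′ + ((- flip x′) ⋏ (ι ψ y + p · y′) + flip (flip x) ⋏ (- ι ψ y′)) ∎)
      where
      ψ : Form n
      ψ = φ ∘ suc
      p : R
      p = φ zero

    ⋏-support : ∀ {n} (x y : Ext n) C → coef (x ⋏ y) C ≢ 0# → ∃ λ A → ∃ λ B → coef x A ≢ 0# × coef y B ≢ 0# × disjointᵇ A B ≡ true
    ⋏-support ⟨ x ⟩ ⟨ y ⟩ [] h = [] , [] , ≢0-*ˡ h , ≢0-*ʳ {x} h , refl
    ⋏-support (x & x′) (y & y′) (outside ∷ C) h with ⋏-support x y C h
    ... | A , B , a , b , d = outside ∷ A , outside ∷ B , a , b , d
    ⋏-support (x & x′) (y & y′) (inside ∷ C) h with coef (x′ ⋏ y) C ≟ 0#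
    ... | no ≢0 with ⋏-support x′ y C ≢0
    ...   | A , B , a , b , d = inside ∷ A , outside ∷ B , a , b , d
    ⋏-support (x & x′) (y & y′) (inside ∷ C) h | yes ≡0 with ⋏-support (flip x) y′ C (≢0-+ (λ e → h (trans (coef-+ (x′ ⋏ y) (flip x ⋏ y′) C) e)) ≡0)
    ... | A , B , a , b , d = outside ∷ A , inside ∷ B , flip-support x A a , b , d

    scalar-⋏ : ∀ {n} (x y : Ext n) → (∀ A → coef x A ≢ 0# → ∣ A ∣ ≡ 0) → x ⋏ y ≡ coef x ∅ · y
    scalar-⋏ ⟨ x ⟩ ⟨ y ⟩ h = refl
    scalar-⋏ (x & x′) (y & y′) h = cong₂ _&_ (scalar-⋏ x y (h ∘ (outside ∷_)))
      (trans (cong₂ _+_ (trans (cong (_⋏ y) (upper x′ (λ A → h (inside ∷ A)))) (𝟎⋏ y)) (trans (cong (_⋏ y′) (flip-scalar x (h ∘ (outside ∷_)))) (scalar-⋏ x y′ (h ∘ (outside ∷_))))) (+-identityˡ _))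
      where
      upper : ∀ {n} (x : Ext n) → (∀ A → coef x A ≢ 0# → suc ∣ A ∣ ≡ 0) → x ≡ 𝟎
      upper x h = zero-by-coef x λ A ≢0 → ℕₚ.1+n≢0 (h A ≢0)
      flip-scalar : ∀ {n} (x : Ext n) → (∀ A → coef x A ≢ 0# → ∣ A ∣ ≡ 0) → flip x ≡ x
      flip-scalar ⟨ x ⟩ h = refl
      flip-scalar (x & x′) h = cong₂ _&_ (flip-scalar x (h ∘ (outside ∷_)))
        (trans (cong (λ t → - flip t) (upper x′ (λ A → h (inside ∷ A)))) (trans (trans (cong -_ flip-𝟎) -𝟎) (sym (upper x′ (λ A → h (inside ∷ A))))))

-- Components of a subspace along words

data Raise : Word → Word → Set where
  here  : ∀ {w} → Raise (false ∷ w) (true ∷ w)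
  there : ∀ {b w w′} → Raise w w′ → Raise (b ∷ w) (b ∷ w′)

data RaiseMany : ℕ → Word → Word → Set where
  done : ∀ {w} → RaiseMany 0 w w
  step : ∀ {i w w′ W} → Raise w w′ → RaiseMany i w′ W → RaiseMany (suc i) w W

raise-length : ∀ {w w′} → Raise w w′ → length w ≡ length w′
raise-length here      = refl
raise-length (there p) = cong suc (raise-length p)

raise-cons : ∀ {i w W} b → RaiseMany i w W → RaiseMany i (b ∷ w) (b ∷ W)
raise-cons b done       = done
raise-cons b (step p q) = step (there p) (raise-cons b q)

disjoint-length : ∀ {j k m u v} → Disjoint j k m u v → length u ≡ length v
disjoint-length []        = refl
disjoint-length (left p)  = cong suc (disjoint-length p)
disjoint-length (right p) = cong suc (disjoint-length p)
disjoint-length (none p)  = cong suc (disjoint-length p)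

-- The positions where both words are false are made true on the left, so that the words become
-- complementary. Each raised letter will be paid for by one contraction.
complete : ∀ {j k m u v} → Disjoint j k m u v → ∃ λ W → ∃ λ J → RaiseMany m u W × Disjoint J k 0 W v
complete [] = [] , 0 , done , []
complete (left p) with complete p
... | W , J , q , d = true ∷ W , suc J , raise-cons true q , left d
complete (right p) with complete p
... | W , J , q , d = false ∷ W , J , raise-cons false q , right d
complete (none p) with complete p
... | W , J , q , d = true ∷ W , suc J , step here (raise-cons true q) , left d

disjoint-zeros : ∀ {z j w} → Letters z j w → Disjoint j 0 z w (replicate (length w) false)
disjoint-zeros []      = []
disjoint-zeros (off l) = none (disjoint-zeros l)
disjoint-zeros (on l)  = left (disjoint-zeros l)

module Components (Q : Rationals) {n : ℕ} where
  open Rationals Q hiding (_+_; _*_; -_)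
  open Exterior Q
  open LinearAlgebra Q
  open Contraction Q
  open Dimension Q
  open Generic Q {n}
  open Wedge Q
  private
    module Q = Rationals Q
    module QR = CommutativeRing scalarRing
  open ES using (solve; _:+_; _:*_; :-_; _:=_; _:-_; con)

  Forms : Set
  Forms = ℕ → Form n

  -- The last letter read is the head of the word: false selects the kernel of the next form, true its image.
  comp : Forms → (Ext n → Set) → Word → Ext n → Set
  comp Φ X []          = X
  comp Φ X (false ∷ w) = Kernel (Φ (length w)) (comp Φ X w)
  comp Φ X (true ∷ w)  = ImageOf (Φ (length w)) (comp Φ X w)

  kernel-subspace : ∀ {φ : Form n} {V} → IsSubspace V → IsSubspace (Kernel φ V)
  kernel-subspace {φ} sub = record
    { 𝟎∈ = 𝟎∈ , ι-𝟎 φ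
    ; +∈ = λ {x} {y} (p , e) (q , e′) → +∈ p q , trans (ι-+ φ x y) (trans (cong₂ _+_ e e′) (+-identityˡ 𝟎))
    ; ·∈ = λ c {x} (p , e) → ·∈ c p , trans (ι-· φ c x) (trans (cong (c ·_) e) (·𝟎 c)) }
    where open IsSubspace sub

  image-of-subspace : ∀ {φ : Form n} {V} → IsSubspace V → IsSubspace (ImageOf φ V)
  image-of-subspace {φ} sub = record
    { 𝟎∈ = 𝟎 , 𝟎∈ , sym (ι-𝟎 φ)
    ; +∈ = λ (x , p , e) (y , q , e′) → x + y , +∈ p q , trans (cong₂ _+_ e e′) (sym (ι-+ φ x y))
    ; ·∈ = λ c (x , p , e) → c · x , ·∈ c p , trans (cong (c ·_) e) (sym (ι-· φ c x)) }
    where open IsSubspace sub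

  comp-subspace : ∀ {Φ X} → IsSubspace X → ∀ w → IsSubspace (comp Φ X w)
  comp-subspace sub []          = sub
  comp-subspace sub (false ∷ w) = kernel-subspace (comp-subspace sub w)
  comp-subspace sub (true ∷ w)  = image-of-subspace (comp-subspace sub w)

  comp-cong : ∀ {Φ Ψ : Forms} {X} w → (∀ l → l < length w → Φ l ≡ Ψ l) → ∀ {z} → comp Φ X w z → comp Ψ X w z
  comp-cong [] e p = p
  comp-cong (false ∷ w) e (p , q) = comp-cong w (λ l l< → e l (ℕₚ.m<n⇒m<1+n l<)) p , subst (λ φ → ι φ _ ≡ 𝟎) (e (length w) ℕₚ.≤-refl) q
  comp-cong (true ∷ w) e (y , p , q) = y , comp-cong w (λ l l< → e l (ℕₚ.m<n⇒m<1+n l<)) p , subst (λ φ → _ ≡ ι φ y) (e (length w) ℕₚ.≤-refl) q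

  -- The derivation rule applies the grade involution to its left factor, so components have to be
  -- stable under it.
  comp-flip : ∀ {Φ X} → IsSubspace X → (∀ z → X z → X (flip z)) → ∀ w z → comp Φ X w z → comp Φ X w (flip z)
  comp-flip sub closed [] z p = closed z p
  comp-flip {Φ} sub closed (false ∷ w) z (p , e) = comp-flip sub closed w z p ,
    trans (solve 1 (λ a → a := :- (:- a)) refl (ι (Φ (length w)) (flip z))) (trans (cong -_ (trans (sym (flip-ι (Φ (length w)) z)) (trans (cong flip e) flip-𝟎))) -𝟎)
  comp-flip {Φ} sub closed (true ∷ w) z (y , p , e) = - flip y , IsSubspace.neg∈ (comp-subspace sub w) (comp-flip sub closed w y p) ,
    trans (cong flip e) (trans (flip-ι (Φ (length w)) y) (sym (ι-neg (Φ (length w)) (flip y))))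

  KilledBy : Forms → ℕ → Ext n → Set
  KilledBy Φ J z = ∀ l → l < J → ι (Φ l) z ≡ 𝟎

  killed-suc : ∀ {Φ J z} → KilledBy Φ J z → ι (Φ J) z ≡ 𝟎 → KilledBy Φ (suc J) z
  killed-suc {J = J} k e l l<sJ with l ℕₚ.≟ J
  ... | yes refl = e
  ... | no l≢J = k l (ℕₚ.≤∧≢⇒< (ℕₚ.≤-pred l<sJ) l≢J)

  killed-ι : ∀ {Φ J z} φ → KilledBy Φ J z → KilledBy Φ J (ι φ z)
  killed-ι {Φ} {z = z} φ k l l<J = trans (ι-anti (Φ l) φ z) (trans (cong -_ (trans (cong (ι φ) (k l l<J)) (ι-𝟎 φ))) -𝟎)

  comp-killed : ∀ {Φ X} w {z} → comp Φ X w z → KilledBy Φ (length w) z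
  comp-killed [] p l ()
  comp-killed (false ∷ w) (p , e) = killed-suc (comp-killed w p) e
  comp-killed {Φ} (true ∷ w) (y , p , refl) = killed-suc (killed-ι (Φ (length w)) (comp-killed w p)) (ι-ι (Φ (length w)) y)

  module _ {Δ : Family n} (dc : DownClosed Δ) {r : ℕ} where
    comp-In : ∀ {Φ X} → (∀ z → X z → In Δ r z) → ∀ {a j w} → Letters a j w → ∀ i → j ℕ.+ i ≡ r → ∀ {z} → comp Φ X w z → In Δ i z
    comp-In X⇒ [] i e {z} p = subst (λ k → In Δ k z) (sym e) (X⇒ z p)
    comp-In X⇒ (off l) i e (p , _) = comp-In X⇒ l i e p
    comp-In {Φ} X⇒ (on {j = j} l) i e (y , p , refl) = ι-In dc (Φ _) (comp-In X⇒ l (suc i) (trans (ℕₚ.+-suc j i) e) p)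

    comp-image-zero : ∀ {Φ X} → (∀ z → X z → In Δ r z) → ∀ {a w} → Letters a r w → ∀ {z} → comp Φ X (true ∷ w) z → z ≡ 𝟎
    comp-image-zero {Φ} X⇒ {w = w} l (y , p , refl) = ι-In₀ {Γ = Δ} (Φ (length w)) (comp-In X⇒ l 0 (ℕₚ.+-identityʳ r) p)

  -- At each letter one factor is a contraction by the form read there and the other is killed by
  -- it. By the derivation rule their product is the contraction of a product for shorter words.
  comp-⋏ : ∀ {Φ X Y} → IsSubspace X → (∀ z → X z → X (flip z)) → (∀ a b → X a → Y b → a ⋏ b ≡ 𝟎) →
    ∀ {j k u v} → Disjoint j k 0 u v → ∀ {a b} → comp Φ X u a → comp Φ Y v b → a ⋏ b ≡ 𝟎
  comp-⋏ sub closed cross [] {a} {b} p q = cross a b p q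
  comp-⋏ {Φ} sub closed cross (left {u = u} {v} d) {a} {b} (a′ , p , refl) (q , e) = begin
    ι φ a′ ⋏ b                         ≡⟨ sym (trans (cong (ι φ a′ ⋏ b +_) (trans (cong (flip a′ ⋏_) e′) (⋏𝟎 (flip a′)))) (+-identityʳ _)) ⟩
    ι φ a′ ⋏ b + flip a′ ⋏ ι φ b       ≡⟨ sym (derivation φ a′ b) ⟩
    ι φ (a′ ⋏ b)                       ≡⟨ trans (cong (ι φ) (comp-⋏ sub closed cross d p q)) (ι-𝟎 φ) ⟩
    𝟎                                  ∎
    where
    open ≡-Reasoning
    φ : Form n
    φ = Φ (length u)
    e′ : ι φ b ≡ 𝟎
    e′ = subst (λ l → ι (Φ l) b ≡ 𝟎) (sym (disjoint-length d)) e
  comp-⋏ {Φ} {X} sub closed cross (right {u = u} {v} d) {a} {b} (p , e) (b′ , q , refl) = begin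
    a ⋏ ι (Φ (length v)) b′                    ≡⟨ cong₂ (λ x l → x ⋏ ι (Φ l) b′) (sym (flip-flip a)) (sym (disjoint-length d)) ⟩
    flip c ⋏ ι φ b′                            ≡⟨ sym (trans (cong (_+ flip c ⋏ ι φ b′) (trans (cong (_⋏ b′) (proj₂ c∈)) (𝟎⋏ b′))) (+-identityˡ _)) ⟩
    ι φ c ⋏ b′ + flip c ⋏ ι φ b′               ≡⟨ sym (derivation φ c b′) ⟩
    ι φ (c ⋏ b′)                               ≡⟨ trans (cong (ι φ) (comp-⋏ sub closed cross d (proj₁ c∈) q)) (ι-𝟎 φ) ⟩
    𝟎                                          ∎
    where
    open ≡-Reasoning
    φ : Form n
    φ = Φ (length u)
    c : Ext n
    c = flip a
    c∈ : comp Φ X (false ∷ u) c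
    c∈ = comp-flip sub closed (false ∷ u) a (p , e)

  GenericFor : Forms → (Ext n → Set) → ℕ → Set
  GenericFor Φ X M = ∀ w → length w < M → Gen (comp Φ X w) (Φ (length w))

  module _ {Φ : Forms} {X : Ext n → Set} (sub : IsSubspace X) {M : ℕ} (generic : GenericFor Φ X M) where
    -- At the raised letter, genericity sends the kernel into the image. The letters read afterwards
    -- are unaffected because contractions anticommute.
    comp-raise : ∀ {w w′} → Raise w w′ → length w ≤ M → ∀ x {z} → comp Φ X w z → ¬ ¬ comp Φ X w′ (ι (basis x) z)
    comp-raise (here {w}) w≤M x {z} (p , e) = generic w w≤M x z p e
    comp-raise (there {false} {w} {w′} q) w≤M x {z} (p , e) = comp-raise q (ℕₚ.<⇒≤ w≤M) x p >>= λ p′ → return (p′ ,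
      trans (cong (λ l → ι (Φ l) (ι (basis x) z)) (sym (raise-length q))) (trans (ι-anti (Φ (length w)) (basis x) z) (trans (cong -_ (trans (cong (ι (basis x)) e) (ι-𝟎 _))) -𝟎)))
    comp-raise (there {true} {w} {w′} q) w≤M x {z} (y , p , refl) = comp-raise q (ℕₚ.<⇒≤ w≤M) x p >>= λ p′ →
      return (- ι (basis x) y , IsSubspace.neg∈ (comp-subspace sub w′) p′ ,
        trans (ι-anti (basis x) (Φ (length w)) y) (trans (sym (ι-neg (Φ (length w)) (ι (basis x) y))) (cong (λ l → ι (Φ l) (- ι (basis x) y)) (raise-length q))))

    -- If `basis x` kills `z`, the Clifford relation makes `z` a contraction by `basis x`, so no set
    -- in its support contains `x`. This cannot hold for all `x` when the support contains a
    -- nonempty face.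
    nonzero-contraction : ∀ {Δ : Family n} {i z} → In Δ (suc i) z → z ≢ 𝟎 → ¬ ¬ (∃ λ x → ι (basis x) z ≢ 𝟎)
    nonzero-contraction {z = z} zI z≢𝟎 vanishing = z≢𝟎 (zero-by-coef z λ A ≢0 →
      let (x , x∈ , _) = missing (∅ {n}) A (λ v p → ⊥-elim (true≢false p (Vecₚ.lookup-replicate v outside)))
            (subst (_< ∣ A ∣) (sym (Subₚ.∣⊥∣≡0 n)) (subst (0 <_) (sym (proj₂ (zI A ≢0))) (s≤s z≤n))) in
      vanishing (x , λ e → absent A x x∈ e ≢0))
      where
      absent : ∀ A x → lookup A x ≡ inside → ι (basis x) z ≡ 𝟎 → ¬ (coef z A ≢ 0#)
      absent A x x∈ e ≢0 with ι-support (basis x) (ε x z) A (λ e′ → ≢0 (trans (cong (λ t → coef t A) z≡) e′))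
        where
        z≡ : z ≡ ι (basis x) (ε x z)
        z≡ = sym (trans (ι-ε (basis x) x z) (trans (cong₂ _−_ (trans (cong (_· z) (basis-diag x)) (1· z)) (trans (cong (ε x) e) (ε-𝟎 x))) (trans (cong (z +_) -𝟎) (+-identityʳ z))))
      ... | w , b≢0 , w∉ , _ with basis-support x w b≢0
      ...   | refl = true≢false x∈ w∉

    comp-fill : ∀ {Δ : Family n} → DownClosed Δ → ∀ {i w W} → RaiseMany i w W → length w ≤ M → ∀ {z} → comp Φ X w z → In Δ i z → z ≢ 𝟎 →
      ¬ ¬ (∃ λ y → comp Φ X W y × In Δ 0 y × y ≢ 𝟎)
    comp-fill dc done w≤M {z} p zI z≢𝟎 = return (z , p , zI , z≢𝟎)
    comp-fill {Δ} dc {suc i} (step q rest) w≤M {z} p zI z≢𝟎 =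
      nonzero-contraction {Δ} zI z≢𝟎 >>= λ (x , ≢𝟎) →
      comp-raise q w≤M x p >>= λ p′ →
      comp-fill {Δ} dc rest (subst (_≤ M) (raise-length q) w≤M) p′ (ι-In dc (basis x) zI) ≢𝟎

    -- Contractions by `m` vertices turn `a` into a nonzero scalar in the component complementary to
    -- that of `b`. The product of this scalar with `b` is zero by `comp-⋏`, so `b` is zero.
    crossing : ∀ {Δ : Family n} → DownClosed Δ → ∀ {Y} → (∀ z → X z → X (flip z)) → (∀ a b → X a → Y b → a ⋏ b ≡ 𝟎) →
      ∀ {j k m u v} → Disjoint j k m u v → length u ≤ M → ∀ {a b} → comp Φ X u a → In Δ m a → a ≢ 𝟎 → comp Φ Y v b → b ≢ 𝟎 → ⊥
    crossing {Δ} dc closed cross d u≤M {a} {b} p aI a≢𝟎 q b≢𝟎 with complete d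
    ... | W , J , raising , d′ = comp-fill {Δ} dc raising u≤M p aI a≢𝟎 λ (y , y∈ , yI , y≢𝟎) →
      b≢𝟎 (·-injective (coef y ∅) b (λ e → y≢𝟎 (zero-by-coef y λ A ≢0 → ≢0 (trans (cong (coef y) (empty A (proj₂ (yI A ≢0)))) e)))
        (trans (sym (scalar-⋏ y b (λ A ≢0 → proj₂ (yI A ≢0)))) (comp-⋏ sub closed cross d′ y∈ q)))
      where
      empty : ∀ {n} (A : Subset n) → ∣ A ∣ ≡ 0 → A ≡ ∅
      empty [] e = refl
      empty (outside ∷ A) e = cong (outside ∷_) (empty A e)

    -- A nonzero element of a component is either killed by the next form or has a nonzero
    -- contraction; the letter is chosen accordingly.
    nonzero-word : ∀ {Δ : Family n} → DownClosed Δ → ∀ {r} → (∀ z → X z → In Δ r z) → ∀ k {x} → X x → x ≢ 𝟎 →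
      ¬ ¬ (∃ λ w → ∃ λ a → ∃ λ j → ∃ λ i → Letters a j w × a ℕ.+ j ≡ k × j ℕ.+ i ≡ r × ∃ λ z → comp Φ X w z × z ≢ 𝟎)
    nonzero-word dc {r} X⇒ zero {x} Xx x≢𝟎 = return ([] , 0 , 0 , r , [] , refl , refl , x , Xx , x≢𝟎)
    nonzero-word {Δ} dc X⇒ (suc k) Xx x≢𝟎 =
      nonzero-word {Δ} dc X⇒ k Xx x≢𝟎 >>= λ (w , a , j , i , l , e , e′ , z , p , z≢𝟎) →
      ¬¬-excluded-middle {A = ι (Φ (length w)) z ≡ 𝟎} >>= λ where
        (yes ≡𝟎) → return (false ∷ w , suc a , j , i , off l , cong suc e , e′ , z , (p , ≡𝟎) , z≢𝟎)
        (no ≢𝟎) → image w a j i l e e′ z p ≢𝟎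
      where
      image : ∀ w a j i → Letters a j w → a ℕ.+ j ≡ k → j ℕ.+ i ≡ _ → ∀ z → comp Φ X w z → ι (Φ (length w)) z ≢ 𝟎 → _
      image w a j zero l e e′ z p ≢𝟎 = ⊥-elim (≢𝟎 (ι-In₀ {Γ = Δ} (Φ (length w)) (comp-In {Δ} dc X⇒ l 0 e′ p)))
      image w a j (suc i) l e e′ z p ≢𝟎 = return (true ∷ w , a , suc j , i , on l , trans (ℕₚ.+-suc a j) (cong suc e) , trans (sym (ℕₚ.+-suc j i)) e′ ,
        ι (Φ (length w)) z , (z , p , refl) , ≢𝟎)

-- Generic sequences of forms

module Sequence (Q : Rationals) {n : ℕ} where
  open Rationals Q hiding (_+_; _*_; -_)
  open Exterior Q
  open LinearAlgebra Q
  open Contraction Q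
  open Dimension Q
  open Generic Q {n}
  open Components Q {n}
  private
    module Q = Rationals Q
    module QR = CommutativeRing scalarRing
    module S = SemiringSum QR.semiring
  open ES using (solve; _:+_; _:*_; :-_; _:=_; _:-_; con)

  put : ℕ → Form n → Forms → Forms
  put k φ Φ l with l ℕₚ.≟ k
  ... | yes _ = φ
  ... | no _  = Φ l

  put-same : ∀ k φ Φ → put k φ Φ k ≡ φ
  put-same k φ Φ with k ℕₚ.≟ k
  ... | yes _ = refl
  ... | no h  = ⊥-elim (h refl)

  put-other : ∀ k φ Φ l → l ≢ k → put k φ Φ l ≡ Φ l
  put-other k φ Φ l l≢k with l ℕₚ.≟ k
  ... | yes e = ⊥-elim (l≢k e)
  ... | no _  = refl

  put-self : ∀ k Φ l → Φ l ≡ put k (Φ k) Φ l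
  put-self k Φ l with l ℕₚ.≟ k
  ... | yes refl = refl
  ... | no _  = refl

  -- Openness in each form separately, the others being fixed. This suffices because the forms are
  -- replaced one at a time.
  record Admissible (C : Forms → Set) : Set where
    field
      respects : ∀ Φ Ψ → (∀ l → Φ l ≡ Ψ l) → C Φ → C Ψ
      opened   : ∀ k Φ → Open (λ φ → C (put k φ Φ))

  admissible-× : ∀ {C D} → Admissible C → Admissible D → Admissible (λ Φ → C Φ × D Φ)
  admissible-× c d = record
    { respects = λ Φ Ψ e (p , q) → Admissible.respects c Φ Ψ e p , Admissible.respects d Φ Ψ e q
    ; opened = λ k Φ → open-× (Admissible.opened c k Φ) (Admissible.opened d k Φ) }

  admissible-∀ : ∀ {m} {C : Fin m → Forms → Set} → (∀ i → Admissible (C i)) → Admissible (λ Φ → ∀ i → C i Φ)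
  admissible-∀ c = record
    { respects = λ Φ Ψ e p i → Admissible.respects (c i) Φ Ψ e (p i)
    ; opened = λ k Φ → open-∀ (λ i → Admissible.opened (c i) k Φ) }

  gen-cong : ∀ {V V′ φ φ′} → (∀ z → V z → V′ z) → (∀ z → V′ z → V z) → φ ≡ φ′ → Gen V φ → Gen V′ φ′
  gen-cong to from refl gen x z p e = gen x z (from z p) e >>= λ (y , q , e′) → return (y , to y q , e′)

  generic-sequence : ∀ {C} → Admissible C → (X : Bool → Ext n → Set) → (∀ b → IsSubspace (X b)) → ∀ M Φ₀ → C Φ₀ →
    ¬ ¬ (∃ λ Φ → C Φ × ∀ b → GenericFor Φ (X b) M)
  generic-sequence adm X sub zero Φ₀ c = return (Φ₀ , c , λ b w ())
  generic-sequence {C} adm X sub (suc M) Φ₀ c =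
    generic-sequence adm X sub M Φ₀ c >>= λ (Φ , CΦ , gens) →
    -- A subset of `suc M` points codes a choice of `X b` together with a word of length `M`, so one
    -- call makes the new form generic for all components of both subspaces.
    generic-form (suc M) {λ s → comp Φ (X (Vec.head s)) (Vec.toList (Vec.tail s))} (λ s → comp-subspace (sub (Vec.head s)) (Vec.toList (Vec.tail s)))
      (Admissible.opened adm M Φ) (Φ M , Admissible.respects adm Φ (put M (Φ M) Φ) (put-self M Φ) CΦ) >>= λ (P , _ , (φ , Pφ) , h) →
    return (put M φ Φ , proj₁ (h φ Pφ) , extend Φ φ gens (proj₂ (h φ Pφ)))
    where
    extend : ∀ Φ φ → (∀ b → GenericFor Φ (X b) M) → (∀ (s : Subset (suc M)) → Gen (comp Φ (X (Vec.head s)) (Vec.toList (Vec.tail s))) φ) → ∀ b → GenericFor (put M φ Φ) (X b) (suc M)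
    extend Φ φ gens now b w w<sM = [ earlier , latest ]′ (ℕₚ.m≤n⇒m<n∨m≡n (ℕₚ.≤-pred w<sM))
      where
      below : ∀ l → l < length w → Φ l ≡ put M φ Φ l
      below l l<w = sym (put-other M φ Φ l (ℕₚ.<⇒≢ (ℕₚ.<-≤-trans l<w (ℕₚ.≤-pred w<sM))))
      to : ∀ z → comp Φ (X b) w z → comp (put M φ Φ) (X b) w z
      to z = comp-cong w below
      from : ∀ z → comp (put M φ Φ) (X b) w z → comp Φ (X b) w z
      from z = comp-cong w (λ l l<w → sym (below l l<w))
      earlier : length w < M → Gen (comp (put M φ Φ) (X b) w) (put M φ Φ (length w))
      earlier w<M = gen-cong to from (sym (put-other M φ Φ (length w) (ℕₚ.<⇒≢ w<M))) (gens b w w<M)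
      latest : length w ≡ M → Gen (comp (put M φ Φ) (X b) w) (put M φ Φ (length w))
      latest refl = gen-cong to from (sym (put-same (length w) φ Φ))
        (subst (λ u → Gen (comp Φ (X b) u) φ) (Vecₚ.toList∘fromList w) (now (b ∷ Vec.fromList w)))

  -- Independence modulo the killed elements means that the coefficients of the contractions by the
  -- first `J` forms are independent functions on the index set. These functions are linear in each
  -- form, so a perturbation is a pencil.
  independent-admissible : ∀ {k} J (c : Fin k → Ext n) → Admissible (λ Φ → IndependentMod (KilledBy Φ J) c)
  independent-admissible {k} J c = record
    { respects = λ Φ Ψ e ind a kill → ind a (λ l l<J → trans (cong (λ φ → ι φ (lc a c)) (e l)) (kill l l<J))
    ; opened = opened }
    where
    Index : Set
    Index = (∃ λ l → l < J) × Subset n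
    values : Forms → Fin k → Index → R
    values Φ i ((l , _) , A) = coef (ι (Φ l) (c i)) A
    evaluated : ∀ Φ a l l<J A → evaluate (values Φ) a ((l , l<J) , A) ≡ coef (ι (Φ l) (lc a c)) A
    evaluated Φ a l l<J A = sym (trans (cong (λ t → coef t A) (ι-lc (Φ l) a c)) (coef-lc a (ι (Φ l) ∘ c) A))
    -- Only the form with index `m` moves. For the others the pencil merely multiplies the values by
    -- `t`, which does not affect their vanishing.
    change : ℕ → Fin n → Fin k → Index → R
    change m x i ((l , _) , A) with l ℕₚ.≟ m
    ... | yes _ = coef (ι (basis x) (c i)) A
    ... | no _  = 0#
    opened : ∀ m Φ → Open (λ φ → IndependentMod (KilledBy (put m φ Φ) J) c)
    opened m Φ φ x ind =
      eventually-independent (values (put m φ Φ)) (change m x) (λ a e → ind a (λ l l<J → coef-ext _ 𝟎 (λ A → trans (sym (evaluated (put m φ Φ) a l l<J A)) (trans (e ((l , l<J) , A)) (sym (coef-𝟎 A)))))) >>= λ (T , h) →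
      return (T , λ t T≤t a kill → h t T≤t a (λ { ((l , l<J) , A) → trans (evaluate-perturbed (values (put m φ Φ)) (change m x) dummy t a ((l , l<J) , A)) (vanish t a l l<J A (kill l l<J)) }))
      where
      dummy : IndependentFunctions (values (put m φ Φ))
      dummy a e = ind a (λ l l<J → coef-ext _ 𝟎 (λ A → trans (sym (evaluated (put m φ Φ) a l l<J A)) (trans (e ((l , l<J) , A)) (sym (coef-𝟎 A)))))
      vanish : ∀ t a l l<J A → ι (put m (perturb t x φ) Φ l) (lc a c) ≡ 𝟎 → nat t Q.* evaluate (values (put m φ Φ)) a ((l , l<J) , A) Q.+ evaluate (change m x) a ((l , l<J) , A) ≡ 0#
      vanish t a l l<J A e with l ℕₚ.≟ m | evaluated (put m φ Φ) a l l<J A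
      ... | yes refl | ev = begin
        nat t Q.* S.sum (λ i → a i Q.* coef (ι φ (c i)) A) Q.+ S.sum (λ i → a i Q.* coef (ι (basis x) (c i)) A)
          ≡⟨ cong₂ (λ p q → nat t Q.* p Q.+ q) ev (sym (trans (cong (λ z → coef z A) (ι-lc (basis x) a c)) (coef-lc a (ι (basis x) ∘ c) A))) ⟩
        nat t Q.* coef (ι φ (lc a c)) A Q.+ coef (ι (basis x) (lc a c)) A
          ≡⟨ sym (trans (coef-+ (nat t · ι φ (lc a c)) (ι (basis x) (lc a c)) A) (cong (Q._+ coef (ι (basis x) (lc a c)) A) (coef-· (nat t) (ι φ (lc a c)) A))) ⟩
        coef (nat t · ι φ (lc a c) + ι (basis x) (lc a c)) A
          ≡⟨ cong (λ z → coef z A) (trans (sym (ι-perturb t x φ (lc a c))) e) ⟩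
        coef 𝟎 A ≡⟨ coef-𝟎 A ⟩
        0# ∎
        where open ≡-Reasoning
      ... | no _ | ev = trans (cong₂ (λ p q → nat t Q.* p Q.+ q) (trans ev (trans (cong (λ z → coef z A) e) (coef-𝟎 A))) (sum-zero (λ i → a i Q.* 0#) (λ i → QR.zeroʳ (a i))))
        (trans (cong (Q._+ 0#) (QR.zeroʳ (nat t))) (QR.+-identityˡ 0#))

  contract : Forms → ℕ → Ext n → Ext n
  contract Φ zero    w = w
  contract Φ (suc k) w = ι (Φ k) (contract Φ k w)

  contract-cong : ∀ Φ Ψ k w → (∀ l → l < k → Φ l ≡ Ψ l) → contract Φ k w ≡ contract Ψ k w
  contract-cong Φ Ψ zero w e = refl
  contract-cong Φ Ψ (suc k) w e = cong₂ ι (e k ℕₚ.≤-refl) (contract-cong Φ Ψ k w (λ l l<k → e l (ℕₚ.m<n⇒m<1+n l<k)))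

  contract-killed : ∀ Φ k w → KilledBy Φ k (contract Φ k w)
  contract-killed Φ zero w l ()
  contract-killed Φ (suc k) w = killed-suc (killed-ι (Φ k) (contract-killed Φ k w)) (ι-ι (Φ k) (contract Φ k w))

  contract-In : ∀ {Δ : Family n} → DownClosed Δ → ∀ Φ k i {w} → In Δ (k ℕ.+ i) w → In Δ i (contract Φ k w)
  contract-In dc Φ zero i p = p
  contract-In {Δ} dc Φ (suc k) i {w} p = ι-In dc (Φ k) (contract-In {Δ} dc Φ k (suc i) (subst (λ d → In Δ d w) (sym (ℕₚ.+-suc k i)) p))

  contract-perturb : ∀ m Φ t x φ k w → m < k → contract (put m (perturb t x φ) Φ) k w ≡ nat t · contract (put m φ Φ) k w + contract (put m (basis x) Φ) k w
  contract-perturb m Φ t x φ (suc k) w m<sk with ℕₚ.m≤n⇒m<n∨m≡n (ℕₚ.≤-pred m<sk)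
  ... | inj₂ refl = begin
    ι (put k (perturb t x φ) Φ k) (contract (put k (perturb t x φ) Φ) k w)
      ≡⟨ cong₂ ι (put-same k (perturb t x φ) Φ) (base (perturb t x φ)) ⟩
    ι (perturb t x φ) (contract Φ k w)
      ≡⟨ ι-perturb t x φ (contract Φ k w) ⟩
    nat t · ι φ (contract Φ k w) + ι (basis x) (contract Φ k w)
      ≡⟨ sym (cong₂ (λ p q → nat t · p + q) (cong₂ ι (put-same k φ Φ) (base φ)) (cong₂ ι (put-same k (basis x) Φ) (base (basis x)))) ⟩
    nat t · contract (put k φ Φ) (suc k) w + contract (put k (basis x) Φ) (suc k) w ∎
    where
    open ≡-Reasoning
    base : ∀ ψ → contract (put k ψ Φ) k w ≡ contract Φ k w
    base ψ = contract-cong (put k ψ Φ) Φ k w (λ l l<k → put-other k ψ Φ l (ℕₚ.<⇒≢ l<k))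
  ... | inj₁ m<k = begin
    ι (put m (perturb t x φ) Φ k) (contract (put m (perturb t x φ) Φ) k w)
      ≡⟨ cong₂ ι (other (perturb t x φ)) (contract-perturb m Φ t x φ k w m<k) ⟩
    ι (Φ k) (nat t · contract (put m φ Φ) k w + contract (put m (basis x) Φ) k w)
      ≡⟨ trans (ι-+ (Φ k) _ _) (cong (_+ ι (Φ k) (contract (put m (basis x) Φ) k w)) (ι-· (Φ k) (nat t) _)) ⟩
    nat t · ι (Φ k) (contract (put m φ Φ) k w) + ι (Φ k) (contract (put m (basis x) Φ) k w)
      ≡⟨ sym (cong₂ (λ p q → nat t · p + q) (cong (λ ψ → ι ψ (contract (put m φ Φ) k w)) (other φ)) (cong (λ ψ → ι ψ (contract (put m (basis x) Φ) k w)) (other (basis x)))) ⟩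
    nat t · contract (put m φ Φ) (suc k) w + contract (put m (basis x) Φ) (suc k) w ∎
    where
    open ≡-Reasoning
    other : ∀ ψ → put m ψ Φ k ≡ Φ k
    other ψ = put-other m ψ Φ k (ℕₚ.<⇒≢ m<k ∘ sym)

  contract-admissible : ∀ k w → Admissible (λ Φ → contract Φ k w ≢ 𝟎)
  contract-admissible k w = record
    { respects = λ Φ Ψ e ≢𝟎 ≡𝟎 → ≢𝟎 (trans (contract-cong Φ Ψ k w (λ l _ → e l)) ≡𝟎)
    ; opened = opened }
    where
    single-independent : ∀ {z : Ext n} → z ≢ 𝟎 → Independent (λ (_ : Fin 1) → z)
    single-independent {z} z≢𝟎 c e zero = decidable-stable (c zero ≟ 0#) λ c≢0 → z≢𝟎 (·-injective (c zero) z c≢0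
      (trans (sym (trans (lc-suc c (λ _ → z)) (trans (cong (c zero · z +_) (lc-empty (c ∘ suc) (λ _ → z))) (+-identityʳ _)))) e))
    independent-single : ∀ {z : Ext n} → Independent (λ (_ : Fin 1) → z) → z ≢ 𝟎
    independent-single {z} ind e = 1≢0 (ind (λ _ → 1#) (IsSubspace.lc∈ zero-subspace (λ _ → 1#) (λ _ → e)) zero)
    opened : ∀ m Φ → Open (λ φ → contract (put m φ Φ) k w ≢ 𝟎)
    opened m Φ φ x ≢𝟎 with m ℕ.<? k
    ... | yes m<k = independent-perturb (λ (_ : Fin 1) → contract (put m φ Φ) k w) (λ _ → contract (put m (basis x) Φ) k w) (single-independent ≢𝟎) >>= λ (T , h) →
      return (T , λ t T≤t e → independent-single (h t T≤t) (trans (sym (contract-perturb m Φ t x φ k w m<k)) e))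
    ... | no m≮k = return (0 , λ t _ e → ≢𝟎 (trans (unaffected φ (perturb t x φ)) e))
      where
      unaffected : ∀ ψ χ → contract (put m ψ Φ) k w ≡ contract (put m χ Φ) k w
      unaffected ψ χ = contract-cong (put m ψ Φ) (put m χ Φ) k w (λ l l<k → trans (put-other m ψ Φ l (l≢m l l<k)) (sym (put-other m χ Φ l (l≢m l l<k))))
        where
        l≢m : ∀ l → l < k → l ≢ m
        l≢m l l<k refl = m≮k l<k

  killedBy-subspace : ∀ {Φ J} → IsSubspace (KilledBy Φ J)
  killedBy-subspace {Φ} = record
    { 𝟎∈ = λ l _ → ι-𝟎 (Φ l)
    ; +∈ = λ {x} {y} p q l l<J → trans (ι-+ (Φ l) x y) (trans (cong₂ _+_ (p l l<J) (q l l<J)) (+-identityˡ 𝟎))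
    ; ·∈ = λ c {x} p l l<J → trans (ι-· (Φ l) c x) (trans (cong (c ·_) (p l l<J)) (·𝟎 c)) }

  dim-transfer : ∀ {k} {V W : Ext n → Set} → Dim V k → (∀ z → V z → ¬ ¬ W z) → (∀ z → W z → V z) → ¬ ¬ Dim W k
  dim-transfer (v , Vv , ind , span) to from = ¬¬-choice (λ i → to (v i) (Vv i)) >>= λ Wv → return (v , Wv , ind , λ z Wz → span z (from z Wz))

  module _ {Δ : Family n} {i : ℕ} where
    Killed-in : Forms → ℕ → Ext n → Set
    Killed-in Φ J z = In Δ i z × KilledBy Φ J z

    -- An upper bound for a kernel is made into an open condition: a complement of the kernel, given
    -- by vectors independent modulo it, stays independent under perturbation and forces the same
    -- bound through `witness-bound`.
    witness : ∀ {Φ J e} → Dim (Killed-in Φ J) e →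
      ¬ ¬ (∃ λ m → ∃ λ (c : Fin m → Ext n) → (∀ l → In Δ i (c l)) × IndependentMod (KilledBy Φ J) c × f Δ i ≤ m ℕ.+ e)
    witness {Φ} {J} {e} (v , Zv , vind , vspan) = basis-mod killedBy-subspace (In Δ i) >>= λ (m , c , cI , cind , cspan) →
      return (m , c , cI , cind , enough m c cI cspan (dim-In Δ i))
      where
      enough : ∀ m (c : Fin m → Ext n) → (∀ l → In Δ i (c l)) → (∀ z → In Δ i z → ¬ ¬ SpanMod (KilledBy Φ J) c z) → Dim (In Δ i) (f Δ i) → f Δ i ≤ m ℕ.+ e
      enough m c cI cspan (u , uI , uind , _) = steinitz zero-subspace u (append c v) uind λ l →
        cspan (u l) (uI l) >>= λ (a , kill) →
        vspan (u l − lc a c) (IsSubspace.−∈ (In-subspace {Γ = Δ}) (uI l) (IsSubspace.lc∈ (In-subspace {Γ = Δ}) a cI) , kill) >>= λ (b , e′) →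
        return (append a b , trans (cong (u l −_) (lc-append′ m a b c v)) (trans (solve 3 (λ u a b → u :- (a :+ b) := u :- a :- b) refl (u l) (lc a c) (lc b v)) e′))

    witness-bound : ∀ {Φ J e k m} {c : Fin m → Ext n} → (∀ l → In Δ i (c l)) → IndependentMod (KilledBy Φ J) c → f Δ i ≤ m ℕ.+ e → Dim (Killed-in Φ J) k → k ≤ e
    witness-bound {Φ} {J} {e} {k} {m} {c} cI cind enough (v , Zv , vind , _) = ℕₚ.+-cancelˡ-≤ m k e (ℕₚ.≤-trans
      (dim-bound (dim-In Δ i) (append c v) (append-all (In Δ i) c v cI (proj₁ ∘ Zv)) ind) enough)
      where
      ind : Independent (append c v)
      ind a e = split-all m (λ l → a l ≡ 0#) left≡0 (vind (a ∘ (m ↑ʳ_)) (trans (sym (trans (cong (_+ lc (a ∘ (m ↑ʳ_)) v) (trans (lc-cong left≡0) (lc-𝟎 c))) (+-identityˡ _))) sum≡𝟎))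
        where
        sum≡𝟎 : lc (a ∘ (_↑ˡ k)) c + lc (a ∘ (m ↑ʳ_)) v ≡ 𝟎
        sum≡𝟎 = trans (sym (lc-append m a c v)) e
        left≡0 : ∀ l → a (l ↑ˡ k) ≡ 0#
        left≡0 = cind (a ∘ (_↑ˡ k)) (subst (KilledBy Φ J) (trans (solve 2 (λ x y → :- y := x :- (x :+ y)) refl (lc (a ∘ (_↑ˡ k)) c) (lc (a ∘ (m ↑ʳ_)) v)) (trans (cong (lc (a ∘ (_↑ˡ k)) c −_) sum≡𝟎) (trans (cong (lc (a ∘ (_↑ˡ k)) c +_) -𝟎) (+-identityʳ _))))
          (IsSubspace.neg∈ (killedBy-subspace {Φ} {J}) (IsSubspace.lc∈ (killedBy-subspace {Φ} {J}) (a ∘ (m ↑ʳ_)) (proj₂ ∘ Zv))))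

-- Dimensions of the spaces killed by Vandermonde forms

module VandermondeDimensions (Q : Rationals) {n : ℕ} (x̂ : Fin n → Rationals.R Q) (distinct : ∀ {v w} → x̂ v ≡ x̂ w → v ≡ w)
  (b : Rationals.R Q) (b-fresh : ∀ v → x̂ v ≢ b) (Δ : Family n) (dc : DownClosed Δ) (R : ℕ) (cm : Contraction.CM Q Δ R) where
  open Rationals Q using (1≢0; 0#; 1#)
  open Exterior Q
  open LinearAlgebra Q
  open Contraction Q
  open Dimension Q
  open Components Q {n}
  open Sequence Q {n}
  open Vandermonde Q x̂ distinct b b-fresh using (pw; Ω; Ω-In; Ω-killed)
  open Cofreeness Q x̂ distinct b b-fresh using (cofree)

  powers : Forms
  powers = pw one

  Z : ℕ → ℕ → Ext n → Set
  Z J i = Killed-in {Δ} {i} powers J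

  Z-subspace : ∀ {J i} → IsSubspace (Z J i)
  Z-subspace {J} {i} = record
    { 𝟎∈ = I.𝟎∈ , K.𝟎∈ ; +∈ = λ (p , q) (p′ , q′) → I.+∈ p p′ , K.+∈ q q′ ; ·∈ = λ c (p , q) → I.·∈ c p , K.·∈ c q }
    where
    module I = IsSubspace (In-subspace {Γ = Δ} {i})
    module K = IsSubspace (killedBy-subspace {powers} {J})

  -- Cofreeness writes `z` as a contraction by `suc J` forms; omitting the last contraction leaves a
  -- preimage that is killed by the first `J`.
  Z-image : ∀ J i → J ℕ.+ suc i ≤ R → ∀ z → Z (suc J) i z → ¬ ¬ ImageOf (powers J) (Z J (suc i)) z
  Z-image J i le z (zI , kill) = cofree (suc J) R dc cm one (λ _ → 1≢0) i (subst (_≤ R) (trans (ℕₚ.+-suc J i) (trans (cong suc (ℕₚ.+-comm J i)) (sym (ℕₚ.+-suc i J)))) le) z zI kill >>= λ (w , wI , e) →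
    return (Ω one J w , (Ω-In {Δ} dc one J (subst (λ d → In Δ d w) (sym (ℕₚ.+-suc J i)) wI) , Ω-killed one J w) , e)

  -- Rank and nullity of the contraction by the form with index `J` on `Z J (suc i)`: the kernel is
  -- immediate, and the image is everything by `Z-image`.
  Z-recursion : ∀ {J i a c} → J ℕ.+ suc i ≤ R → Dim (Z (suc J) (suc i)) a → Dim (Z (suc J) i) c → ¬ ¬ Dim (Z J (suc i)) (a ℕ.+ c)
  Z-recursion {J} {i} le dimK dimI =
    dim-transfer dimK (λ z (zI , kill) → return ((zI , λ l l<J → kill l (ℕₚ.m<n⇒m<1+n l<J)) , kill J ℕₚ.≤-refl)) (λ z ((zI , kill) , e) → zI , killed-suc kill e) >>= λ dimK′ →
    dim-transfer dimI (Z-image J i le) (λ { z (y , (yI , kill) , refl) → ι-In dc (powers J) yI , killed-suc (killed-ι (powers J) kill) (ι-ι (powers J) y) }) >>= λ dimI′ →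
    return (rank-nullity Z-subspace (powers J) dimK′ dimI′)

  dim-Z : ∀ J i → J ℕ.+ i ≤ R → ¬ ¬ Dim (Z J i) (E (f Δ) J i)
  dim-Z zero i le = dim-transfer (dim-In Δ i) (λ z p → return (p , λ _ ())) (λ z → proj₁)
  dim-Z (suc J) zero le = dim-Z J zero (ℕₚ.<⇒≤ le) >>= λ d → dim-transfer d (λ z (p , _) → return (p , λ l _ → ι-In₀ {Γ = Δ} (powers l) p)) (λ z (p , k) → p , λ l l<J → k l (ℕₚ.m<n⇒m<1+n l<J))
  dim-Z (suc J) (suc i) le =
    dim-exists (Z (suc J) (suc i)) >>= λ (a , dimK) →
    dim-Z (suc J) i (ℕₚ.≤-trans (ℕₚ.+-monoʳ-≤ (suc J) (ℕₚ.n≤1+n i)) le) >>= λ dimI →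
    dim-Z J (suc i) (ℕₚ.<⇒≤ le) >>= λ dimV →
    Z-recursion (ℕₚ.<⇒≤ le) dimK dimI >>= λ dimV′ →
    return (subst (Dim (Z (suc J) (suc i))) (sym (trans (cong (ℕ._∸ E (f Δ) (suc J) i) (dim-unique dimV dimV′)) (ℕₚ.m+n∸n≡m a (E (f Δ) (suc J) i)))) dimK)

  E-recursion : ∀ J i → J ℕ.+ suc i ≤ R → E (f Δ) J (suc i) ≡ E (f Δ) (suc J) (suc i) ℕ.+ E (f Δ) (suc J) i
  E-recursion J i le = decidable-stable (_ ℕ.≟ _) (
    dim-exists (Z (suc J) (suc i)) >>= λ (a , dimK) →
    dim-Z (suc J) i (subst (_≤ R) (ℕₚ.+-suc J i) le) >>= λ dimI →
    dim-Z J (suc i) le >>= λ dimV →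
    Z-recursion le dimK dimI >>= λ dimV′ →
    return (let e = dim-unique dimV dimV′ in trans e (cong (ℕ._+ E (f Δ) (suc J) i) (sym (trans (cong (ℕ._∸ E (f Δ) (suc J) i) e) (ℕₚ.m+n∸n≡m a (E (f Δ) (suc J) i)))))))

  -- Cofreeness in degree 0: the unit is a full contraction.
  nondegenerate : Δ ∅ ≡ true → ¬ ¬ (∃ λ w → In Δ R w × contract powers R w ≢ 𝟎)
  nondegenerate ∅∈ = cofree R R dc cm one (λ _ → 1≢0) 0 ℕₚ.≤-refl unit unit-In (λ l _ → ι-In₀ {Γ = Δ} (powers l) unit-In) >>= λ (w , wI , e) →
    return (w , subst (λ d → In Δ d w) (ℕₚ.+-identityʳ R) wI , λ e′ → 1≢0 (trans (sym unit-coef) (trans (cong (λ z → coef z ∅) (trans e (trans (same R w) e′))) (coef-𝟎 ∅))))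
    where
    module QC = Chains (Rationals.scalarField Q)
    unit : Ext n
    unit = single ∅
    unit-coef : coef unit ∅ ≡ 1#
    unit-coef = trans (coef-tabulate (QC.indicator ∅) ∅) (QC.indicator-self (∅ {n}))
    unit-In : In Δ 0 unit
    unit-In A ≢0 with ∅ ≟ₛ A
    ... | yes refl = ∅∈ , Subₚ.∣⊥∣≡0 n
    ... | no ne = ⊥-elim (≢0 (trans (coef-tabulate (QC.indicator ∅) A) (QC.indicator-other ∅ A ne)))
    same : ∀ k w → Ω one k w ≡ contract powers k w
    same zero w = refl
    same (suc k) w = cong (ι (powers k)) (same k w)

-- The counting argument

trues : ℕ → Word → Word
trues zero    w = w
trues (suc i) w = true ∷ trues i w

trues-length : ∀ i w → length (trues i w) ≡ i ℕ.+ length w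
trues-length zero    w = refl
trues-length (suc i) w = cong suc (trues-length i w)

letters-length : ∀ {z j w} → Letters z j w → length w ≡ z ℕ.+ j
letters-length []              = refl
letters-length (off l)         = cong suc (letters-length l)
letters-length (on {z} {j} l)  = trans (cong suc (letters-length l)) (sym (ℕₚ.+-suc z j))

letters-zeros : ∀ {z w} → Letters z 0 w → w ≡ replicate (length w) false
letters-zeros []      = refl
letters-zeros (off l) = cong (false ∷_) (letters-zeros l)

disjoint-letters : ∀ {j k m u v} → Disjoint j k m u v → Letters (k ℕ.+ m) j u
disjoint-letters [] = []
disjoint-letters (left d) = on (disjoint-letters d)
disjoint-letters (right d) = off (disjoint-letters d)
disjoint-letters (none {j} {k} {m} {u} d) = subst (λ z → Letters z j (false ∷ u)) (sym (ℕₚ.+-suc k m)) (off (disjoint-letters d))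

disjoint-sym : ∀ {j k m u v} → Disjoint j k m u v → Disjoint k j m v u
disjoint-sym [] = []
disjoint-sym (left d) = right (disjoint-sym d)
disjoint-sym (right d) = left (disjoint-sym d)
disjoint-sym (none d) = none (disjoint-sym d)

-- Words are classified by the last false letter read; everything after it is true.
last-false : ∀ q i (g : Word → ℕ) → wordSum (suc q) i g ≡ sumTo i (λ j → wordSum q j (λ u → g (trues (i ℕ.∸ j) (false ∷ u))))
last-false q zero g = refl
last-false q (suc i) g = trans (ℕₚ.+-comm (wordSum q (suc i) (g ∘ (false ∷_))) _) (cong₂ ℕ._+_
  (trans (last-false q i (g ∘ (true ∷_))) (sumTo-cong i (λ j j≤i → wordSum-cong q j (λ u _ → cong (λ t → g (trues t (false ∷ u))) (sym (ℕₚ.+-∸-assoc 1 j≤i))))))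
  (wordSum-cong q (suc i) (λ u _ → cong (λ t → g (trues t (false ∷ u))) (sym (ℕₚ.n∸n≡0 i)))))

sumTo-head : ∀ i {g h : ℕ → ℕ} x y → g 0 ℕ.+ x ≤ h 0 ℕ.+ y → (∀ j → 1 ≤ j → j ≤ i → g j ≤ h j) → sumTo i g ℕ.+ x ≤ sumTo i h ℕ.+ y
sumTo-head zero x y base rest = base
sumTo-head (suc i) {g} {h} x y base rest = ℕₚ.≤-trans (ℕₚ.≤-reflexive (move (sumTo i g) (g (suc i)) x))
  (ℕₚ.≤-trans (ℕₚ.+-mono-≤ (sumTo-head i x y base (λ j 1≤j j≤i → rest j 1≤j (ℕₚ.m≤n⇒m≤1+n j≤i))) (rest (suc i) (s≤s z≤n) ℕₚ.≤-refl)) (ℕₚ.≤-reflexive (sym (move (sumTo i h) (h (suc i)) y))))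
  where
  move : ∀ a b c → a ℕ.+ b ℕ.+ c ≡ a ℕ.+ c ℕ.+ b
  move a b c = trans (ℕₚ.+-assoc a b c) (trans (cong (a ℕ.+_) (ℕₚ.+-comm b c)) (sym (ℕₚ.+-assoc a c b)))

word-choice : ∀ M {P : Word → ℕ → Set} → (∀ w → ¬ ¬ (∃ λ k → P w k)) → ¬ ¬ (∃ λ (D : Word → ℕ) → ∀ w → length w ≤ M → P w (D w))
word-choice zero h = h [] >>= λ (k , p) → return ((λ _ → k) , λ { [] _ → p })
word-choice (suc M) {P} h =
  h [] >>= λ (k , p) →
  word-choice M (h ∘ (false ∷_)) >>= λ (D₀ , p₀) →
  word-choice M (h ∘ (true ∷_)) >>= λ (D₁ , p₁) →
  return (combine k D₀ D₁ , λ { [] _ → p ; (false ∷ w) (s≤s le) → p₀ w le ; (true ∷ w) (s≤s le) → p₁ w le })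
  where
  combine : ℕ → (Word → ℕ) → (Word → ℕ) → Word → ℕ
  combine k D₀ D₁ []          = k
  combine k D₀ D₁ (false ∷ w) = D₀ w
  combine k D₀ D₁ (true ∷ w)  = D₁ w

faces₀≤1 : ∀ {n} (Δ : Family n) → f Δ 0 ≤ 1
faces₀≤1 {n} Δ = ℕₚ.≤-trans (count-mono {Ψ = sizeIs 0} (λ S e → proj₂ (∧-split {Δ S} e))) (ℕₚ.≤-reflexive (empty-only n))
  where
  empty-only : ∀ n → count {n} (sizeIs 0) ≡ 1
  empty-only zero    = refl
  empty-only (suc n) = cong₂ ℕ._+_ (empty-only n) (count-void n)

E-bottom : ∀ h J → E h J 0 ≡ h 0
E-bottom h zero    = refl
E-bottom h (suc J) = E-bottom h J

-- D b is the dimension of the component of the family b along a word.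
module Counting (q : ℕ) (s : ℕ → ℕ) (f₀ : ℕ) (D : Bool → Word → ℕ)
  (s-positive : ∀ j → j ≤ suc q → 1 ≤ s j) (s-top : s (suc q) ≤ 1)
  (total : f₀ ≡ sumTo (suc q) (λ j → number q j ℕ.* s j))
  (leaves : ∀ b → sumTo (suc q) (λ j → wordSum q j (λ u → D b (false ∷ u))) ≡ D b [])
  (bottom : ∀ b u → Letters q 0 u → D b (false ∷ u) ≡ 0)
  (leaf-bound : ∀ b j → j ≤ suc q → ∀ u → Letters q j u → D b (false ∷ u) ≤ D b (trues (suc q ℕ.∸ j) (false ∷ u)) ℕ.+ (D b (false ∷ u) ℕ.⊓ 1) ℕ.* (s j ℕ.∸ 1))
  (crossing-leaves : ∀ j m → j ℕ.+ m ≡ q → ∀ u v → Disjoint j j m u v → (D false (false ∷ u) ℕ.⊓ 1) ℕ.+ (D true (false ∷ v) ℕ.⊓ 1) ≤ 1)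
  (crossing-top : ∀ u v → Disjoint (suc q) (suc q) 0 u v → D false u ℕ.+ D true v ≤ 1) where
  private
    r : ℕ
    r = suc q

  U : Bool → Word → ℕ
  U b u = D b (false ∷ u) ℕ.⊓ 1

  level top : Bool → ℕ → ℕ
  level b j = wordSum q j (λ u → D b (false ∷ u))
  top   b j = wordSum q j (λ u → D b (trues (r ℕ.∸ j) (false ∷ u)))

  -- Below `r`, the words of nonzero leaves are cross-intersecting, and `cross-intersecting` applies
  -- once the false letter common to all of them is dropped. At `j = r` the factor `s j ∸ 1` is
  -- zero.
  U-bound : ∀ j → 1 ≤ j → j ≤ r → (wordSum q j (U false) ℕ.+ wordSum q j (U true)) ℕ.* (s j ℕ.∸ 1) ≤ number q j ℕ.* (s j ℕ.∸ 1)
  U-bound j 1≤j j≤r with ℕₚ.m≤n⇒m<n∨m≡n j≤r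
  ... | inj₁ j<r = ℕₚ.*-monoˡ-≤ (s j ℕ.∸ 1) (subst (λ z → wordSum z j (U false) ℕ.+ wordSum z j (U true) ≤ number z j) j+m≡q
      (cross-intersecting j (q ℕ.∸ j) (U false) (U true) (crossing-leaves j (q ℕ.∸ j) j+m≡q)))
    where
    j+m≡q : j ℕ.+ (q ℕ.∸ j) ≡ q
    j+m≡q = ℕₚ.m+[n∸m]≡n (ℕₚ.≤-pred j<r)
  ... | inj₂ refl = subst (λ t → (wordSum q r (U false) ℕ.+ wordSum q r (U true)) ℕ.* t ≤ number q r ℕ.* t) (sym (ℕₚ.m≤n⇒m∸n≡0 s-top))
      (ℕₚ.≤-trans (ℕₚ.≤-reflexive (ℕₚ.*-zeroʳ (wordSum q r (U false) ℕ.+ wordSum q r (U true)))) z≤n)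

  level-bound : ∀ b j → j ≤ r → level b j ≤ top b j ℕ.+ wordSum q j (U b) ℕ.* (s j ℕ.∸ 1)
  level-bound b j j≤r = ℕₚ.≤-trans (wordSum-mono q j (leaf-bound b j j≤r))
    (ℕₚ.≤-reflexive (trans (wordSum-+ q j (λ u → D b (trues (r ℕ.∸ j) (false ∷ u))) (λ u → U b u ℕ.* (s j ℕ.∸ 1))) (cong (top b j ℕ.+_) (wordSum-* q j (s j ℕ.∸ 1) (U b)))))

  level-step : ∀ j → 1 ≤ j → j ≤ r → level false j ℕ.+ level true j ℕ.+ number q j ≤ top false j ℕ.+ top true j ℕ.+ number q j ℕ.* s j
  level-step j 1≤j j≤r = begin
    level false j ℕ.+ level true j ℕ.+ N
      ≤⟨ ℕₚ.+-monoˡ-≤ N (ℕₚ.+-mono-≤ (level-bound false j j≤r) (level-bound true j j≤r)) ⟩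
    (top false j ℕ.+ u₀ ℕ.* t) ℕ.+ (top true j ℕ.+ u₁ ℕ.* t) ℕ.+ N
      ≡⟨ cong (ℕ._+ N) (trans (+-interchange (top false j) (u₀ ℕ.* t) (top true j) (u₁ ℕ.* t)) (cong (top false j ℕ.+ top true j ℕ.+_) (sym (ℕₚ.*-distribʳ-+ t u₀ u₁)))) ⟩
    top false j ℕ.+ top true j ℕ.+ (u₀ ℕ.+ u₁) ℕ.* t ℕ.+ N
      ≤⟨ ℕₚ.+-monoˡ-≤ N (ℕₚ.+-monoʳ-≤ (top false j ℕ.+ top true j) (U-bound j 1≤j j≤r)) ⟩
    top false j ℕ.+ top true j ℕ.+ N ℕ.* t ℕ.+ N
      ≡⟨ trans (ℕₚ.+-assoc (top false j ℕ.+ top true j) (N ℕ.* t) N) (cong (top false j ℕ.+ top true j ℕ.+_) (trans (ℕₚ.+-comm (N ℕ.* t) N) (sym (ℕₚ.*-suc N t)))) ⟩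
    top false j ℕ.+ top true j ℕ.+ N ℕ.* suc t
      ≡⟨ cong (λ x → top false j ℕ.+ top true j ℕ.+ N ℕ.* x) (ℕₚ.m+[n∸m]≡n (s-positive j j≤r)) ⟩
    top false j ℕ.+ top true j ℕ.+ N ℕ.* s j ∎
    where
    open ℕₚ.≤-Reasoning
    N t u₀ u₁ : ℕ
    N = number q j
    t = s j ℕ.∸ 1
    u₀ = wordSum q j (U false)
    u₁ = wordSum q j (U true)

  bottom-level : ∀ b → level b 0 ≡ 0
  bottom-level b = trans (wordSum-cong q 0 {h = λ _ → 0} (λ u l → bottom b u l)) (trans (wordSum-const q 0 0) (ℕₚ.*-zeroʳ (number q 0)))

  top-total : sumTo r (λ j → top false j ℕ.+ top true j) ≤ sumTo r (number q)
  top-total = begin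
    sumTo r (λ j → top false j ℕ.+ top true j)    ≡⟨ sumTo-+ r (top false) (top true) ⟩
    sumTo r (top false) ℕ.+ sumTo r (top true)    ≡⟨ sym (cong₂ ℕ._+_ (last-false q r (D false)) (last-false q r (D true))) ⟩
    wordSum r r (D false) ℕ.+ wordSum r r (D true) ≤⟨ subst (λ z → wordSum z r (D false) ℕ.+ wordSum z r (D true) ≤ number z r) (ℕₚ.+-identityʳ r) (cross-intersecting r 0 (D false) (D true) crossing-top) ⟩
    number r r                                    ≡⟨ last-false q r (λ _ → 1) ⟩
    sumTo r (number q)                            ∎
    where open ℕₚ.≤-Reasoning

  -- The number of leaf words is added on both sides to avoid subtraction. On the left it completes
  -- each `s j ∸ 1` with positive `j` to `s j`, the summands of `f₀`; on the right it bounds the top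
  -- components.
  conclusion : D false [] ℕ.+ D true [] ℕ.+ s 0 ≤ f₀ ℕ.+ 1
  conclusion = ℕₚ.+-cancelʳ-≤ (sumTo r (number q)) _ _ (begin
    D false [] ℕ.+ D true [] ℕ.+ s 0 ℕ.+ sumTo r (number q)
      ≡⟨ trans (ℕₚ.+-assoc (D false [] ℕ.+ D true []) (s 0) _) (trans (cong (D false [] ℕ.+ D true [] ℕ.+_) (ℕₚ.+-comm (s 0) _)) (sym (ℕₚ.+-assoc (D false [] ℕ.+ D true []) _ (s 0)))) ⟩
    D false [] ℕ.+ D true [] ℕ.+ sumTo r (number q) ℕ.+ s 0
      ≡⟨ cong (ℕ._+ s 0) (sym (trans (sumTo-+ r (λ j → level false j ℕ.+ level true j) (number q)) (cong (ℕ._+ sumTo r (number q)) (trans (sumTo-+ r (level false) (level true)) (cong₂ ℕ._+_ (leaves false) (leaves true)))))) ⟩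
    sumTo r (λ j → level false j ℕ.+ level true j ℕ.+ number q j) ℕ.+ s 0
      ≤⟨ sumTo-head r (s 0) 1 base level-step ⟩
    sumTo r (λ j → top false j ℕ.+ top true j ℕ.+ number q j ℕ.* s j) ℕ.+ 1
      ≡⟨ cong (ℕ._+ 1) (sumTo-+ r (λ j → top false j ℕ.+ top true j) (λ j → number q j ℕ.* s j)) ⟩
    sumTo r (λ j → top false j ℕ.+ top true j) ℕ.+ sumTo r (λ j → number q j ℕ.* s j) ℕ.+ 1
      ≤⟨ ℕₚ.+-monoˡ-≤ 1 (ℕₚ.+-mono-≤ top-total (ℕₚ.≤-reflexive (sym total))) ⟩
    sumTo r (number q) ℕ.+ f₀ ℕ.+ 1
      ≡⟨ trans (ℕₚ.+-assoc (sumTo r (number q)) f₀ 1) (ℕₚ.+-comm (sumTo r (number q)) (f₀ ℕ.+ 1)) ⟩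
    f₀ ℕ.+ 1 ℕ.+ sumTo r (number q) ∎)
    where
    open ℕₚ.≤-Reasoning
    -- Level 0 has a single leaf word, of dimension 0 for both families. Its count `number q 0`,
    -- equal to 1, becomes the summand 1 of the bound, while its share `s 0` of `f₀` is saved.
    base : level false 0 ℕ.+ level true 0 ℕ.+ number q 0 ℕ.+ s 0 ≤ top false 0 ℕ.+ top true 0 ℕ.+ number q 0 ℕ.* s 0 ℕ.+ 1
    base = begin
      level false 0 ℕ.+ level true 0 ℕ.+ number q 0 ℕ.+ s 0    ≡⟨ cong₂ (λ x y → x ℕ.+ y ℕ.+ number q 0 ℕ.+ s 0) (bottom-level false) (bottom-level true) ⟩
      number q 0 ℕ.+ s 0                                       ≡⟨ cong (ℕ._+ s 0) (number-zero q) ⟩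
      1 ℕ.+ s 0                                                ≡⟨ ℕₚ.+-comm 1 (s 0) ⟩
      s 0 ℕ.+ 1                                                ≡⟨ cong (ℕ._+ 1) (sym (trans (cong (ℕ._* s 0) (number-zero q)) (ℕₚ.*-identityˡ (s 0)))) ⟩
      number q 0 ℕ.* s 0 ℕ.+ 1                                 ≤⟨ ℕₚ.+-monoˡ-≤ 1 (ℕₚ.m≤n+m (number q 0 ℕ.* s 0) (top false 0 ℕ.+ top true 0)) ⟩
      top false 0 ℕ.+ top true 0 ℕ.+ number q 0 ℕ.* s 0 ℕ.+ 1  ∎

ones : Word → ℕ
ones []          = 0
ones (false ∷ w) = ones w
ones (true ∷ w)  = suc (ones w)

letters-ones : ∀ {z j w} → Letters z j w → ones w ≡ j
letters-ones []      = refl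
letters-ones (off l) = letters-ones l
letters-ones (on l)  = cong suc (letters-ones l)

module _ (q : ℕ) (h : ℕ → ℕ)
  (recursion : ∀ J i → J ℕ.+ suc i ≤ suc q ℕ.+ suc q → E h J (suc i) ≡ E h (suc J) (suc i) ℕ.+ E h (suc J) i) where
  private
    r : ℕ
    r = suc q

    -- The expected dimension for a word of length `J` with `j` letters true. More than `r` true
    -- letters would mean negative degree, and there the value 0 is what `leaf-sum` requires.
    value : ℕ → ℕ → ℕ
    value J j with j ℕ.≤? r
    ... | yes _ = E h J (r ℕ.∸ j)
    ... | no _  = 0

    value-in : ∀ J j → j ≤ r → value J j ≡ E h J (r ℕ.∸ j)
    value-in J j j≤r with j ℕ.≤? r
    ... | yes _ = refl
    ... | no ≰  = ⊥-elim (≰ j≤r)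

    value-out : ∀ J j → r < j → value J j ≡ 0
    value-out J j r<j with j ℕ.≤? r
    ... | yes j≤r = ⊥-elim (ℕₚ.<-irrefl refl (ℕₚ.<-≤-trans r<j j≤r))
    ... | no _  = refl

    split : ∀ z j → z ≤ q → j ≤ r → value (z ℕ.+ j) j ≡ value (suc (z ℕ.+ j)) j ℕ.+ value (suc (z ℕ.+ j)) (suc j)
    split z j z≤q j≤r with ℕₚ.m≤n⇒m<n∨m≡n j≤r
    ... | inj₁ j<r = trans (value-in (z ℕ.+ j) j j≤r) (trans (cong (E h (z ℕ.+ j)) r∸j) (trans (recursion (z ℕ.+ j) (r ℕ.∸ suc j) le)
          (sym (cong₂ ℕ._+_ (trans (value-in (suc (z ℕ.+ j)) j j≤r) (cong (E h (suc (z ℕ.+ j))) r∸j)) (value-in (suc (z ℕ.+ j)) (suc j) j<r)))))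
      where
      r∸j : r ℕ.∸ j ≡ suc (r ℕ.∸ suc j)
      r∸j = trans (cong (ℕ._∸ j) (sym (ℕₚ.m+[n∸m]≡n j<r))) (trans (cong (ℕ._∸ j) (sym (ℕₚ.+-suc j (r ℕ.∸ suc j)))) (ℕₚ.m+n∸m≡n j (suc (r ℕ.∸ suc j))))
      le : z ℕ.+ j ℕ.+ suc (r ℕ.∸ suc j) ≤ r ℕ.+ r
      le = subst (_≤ r ℕ.+ r) (sym (trans (ℕₚ.+-assoc z j _) (cong (z ℕ.+_) (trans (cong (j ℕ.+_) (sym r∸j)) (ℕₚ.m+[n∸m]≡n j≤r))))) (ℕₚ.+-monoˡ-≤ r (ℕₚ.m≤n⇒m≤1+n z≤q))
    ... | inj₂ refl = trans (value-in (z ℕ.+ r) r j≤r) (trans (cong (E h (z ℕ.+ r)) (ℕₚ.n∸n≡0 r)) (sym (trans (cong₂ ℕ._+_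
          (trans (value-in (suc (z ℕ.+ r)) r j≤r) (cong (E h (suc (z ℕ.+ r))) (ℕₚ.n∸n≡0 r))) (value-out (suc (z ℕ.+ r)) (suc r) ℕₚ.≤-refl)) (ℕₚ.+-identityʳ _))))

    weight : Word → ℕ
    weight w = value (length w) (ones w)

    weight-letters : ∀ {z j w} → Letters z j w → weight w ≡ value (z ℕ.+ j) j
    weight-letters l = cong₂ value (letters-length l) (letters-ones l)

  -- `leaf-sum` with expected dimensions in place of actual ones: the recursion for `E` is exactly
  -- the splitting of a word by its next letter.
  E-total : h r ≡ sumTo r (λ j → number q j ℕ.* E h (r ℕ.+ j) (r ℕ.∸ j))
  E-total = sym (trans (sumTo-cong r (λ j j≤r → trans (sym (wordSum-const q j _)) (wordSum-cong q j (λ u l → sym (trans (weight-letters (off l)) (value-in (r ℕ.+ j) j j≤r))))))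
    (trans (leaf-sum r weight q
      (λ w z j z≤q j≤r l → trans (weight-letters l) (trans (split z j z≤q j≤r) (sym (cong₂ ℕ._+_ (weight-letters (off l)) (trans (weight-letters (on l)) (cong (λ J → value J (suc j)) (ℕₚ.+-suc z j)))))))
      (λ w z z≤q l → trans (weight-letters (on l)) (value-out (z ℕ.+ suc r) (suc r) ℕₚ.≤-refl)))
    (value-in 0 0 z≤n)))

clash : ∀ a b → (1 ≤ a → 1 ≤ b → ⊥) → (a ℕ.⊓ 1) ℕ.+ (b ℕ.⊓ 1) ≤ 1
clash zero b h = ℕₚ.m⊓n≤n b 1
clash (suc a) zero h = s≤s (ℕₚ.≤-reflexive (cong (ℕ._+ 0) (ℕₚ.⊓-zeroʳ a)))
clash (suc a) (suc b) h = ⊥-elim (h (s≤s z≤n) (s≤s z≤n))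

-- The inequality for two subspaces with zero product

module Assembly (Q : Rationals) {n : ℕ} (x̂ : Fin n → Rationals.R Q) (distinct : ∀ {v w} → x̂ v ≡ x̂ w → v ≡ w)
  (b : Rationals.R Q) (b-fresh : ∀ v → x̂ v ≢ b) (Δ : Family n) (dc : DownClosed Δ) (∅∈ : Δ ∅ ≡ true) (q : ℕ)
  (cm : Contraction.CM Q Δ (suc q ℕ.+ suc q)) where
  private
    r : ℕ
    r = suc q

  open Exterior Q
  open LinearAlgebra Q
  open Contraction Q
  open Dimension Q
  open Generic Q {n}
  open Wedge Q
  open Components Q {n}
  open Sequence Q {n}
  open VandermondeDimensions Q x̂ distinct b b-fresh Δ dc (r ℕ.+ r) cm

  -- A leaf with `j` letters true lies in degree `r ∸ j` and is killed by `r + j` forms; this is the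
  -- dimension of that space for the Vandermonde forms, and an upper bound after perturbation.
  s : ℕ → ℕ
  s j = E (f Δ) (r ℕ.+ j) (r ℕ.∸ j)

  dim⇒nonzero : ∀ {k} {V : Ext n → Set} → Dim V k → 1 ≤ k → ∃ λ z → V z × z ≢ 𝟎
  dim⇒nonzero {suc k} d _ = dim-nonzero d

  module _ (X : Bool → Ext n → Set) (sub : ∀ c → IsSubspace (X c)) (X⇒In : ∀ c z → X c z → In Δ r z) (flip-closed : ∀ c z → X c z → X c (flip z))
    (cross : ∀ x y → X false x → X true y → x ⋏ y ≡ 𝟎) (cross′ : ∀ x y → X true x → X false y → x ⋏ y ≡ 𝟎) (nonzero : ∀ c → ∃ λ x → X c x × x ≢ 𝟎) where

    module _ (Φ : Forms) (generic : ∀ c → GenericFor Φ (X c) (r ℕ.+ r)) (bounded : ∀ j → j ≤ r → ∀ k → Dim (Killed-in {Δ} {r ℕ.∸ j} Φ (r ℕ.+ j)) k → k ≤ s j)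
      (w₀ : Ext n) (w₀-In : In Δ (r ℕ.+ r) w₀) (w₀-nonzero : contract Φ (r ℕ.+ r) w₀ ≢ 𝟎)
      (D : Bool → Word → ℕ) (dims : ∀ c w → length w ≤ r ℕ.+ r → Dim (comp Φ (X c) w) (D c w)) where

      split : ∀ c w z j → z ≤ q → j ≤ r → Letters z j w → D c w ≡ D c (false ∷ w) ℕ.+ D c (true ∷ w)
      split c w z j z≤q j≤r l = dim-unique (dims c w (ℕₚ.<⇒≤ w<)) (rank-nullity (comp-subspace (sub c) w) (Φ (length w)) (dims c (false ∷ w) w<) (dims c (true ∷ w) w<))
        where
        w< : suc (length w) ≤ r ℕ.+ r
        w< = subst (λ t → suc t ≤ r ℕ.+ r) (sym (letters-length l)) (s≤s (ℕₚ.+-mono-≤ z≤q j≤r))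

      no-image : ∀ c w z → z ≤ q → Letters z r w → D c (true ∷ w) ≡ 0
      no-image c w z z≤q l = ℕₚ.n≤0⇒n≡0 (ℕₚ.≮⇒≥ λ positive → let (y , p , y≢𝟎) = dim⇒nonzero (dims c (true ∷ w) w<) positive in y≢𝟎 (comp-image-zero {Δ} dc (X⇒In c) l p))
        where
        w< : suc (length w) ≤ r ℕ.+ r
        w< = subst (λ t → suc t ≤ r ℕ.+ r) (sym (letters-length l)) (s≤s (ℕₚ.+-monoˡ-≤ r z≤q))

      leaves : ∀ c → sumTo r (λ j → wordSum q j (λ u → D c (false ∷ u))) ≡ D c []
      leaves c = leaf-sum r (D c) q (split c) (no-image c)

      -- The other subspace is nonzero, so one of its components along a word of length `r` is
      -- nonzero. The word with all letters false is disjoint from every word, and `crossing`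
      -- excludes a nonzero component there.
      bottom′ : ∀ c c′ → (∀ x y → X c′ x → X c y → x ⋏ y ≡ 𝟎) → ∀ u → Letters q 0 u → D c (false ∷ u) ≡ 0
      bottom′ c c′ cr u l = ℕₚ.n≤0⇒n≡0 (ℕₚ.≮⇒≥ λ positive →
        let (x , Xx , x≢𝟎) = nonzero c′
            (y , y∈ , y≢𝟎) = dim⇒nonzero (dims c (false ∷ u) short) positive
        in nonzero-word (sub c′) (generic c′) {Δ} dc (X⇒In c′) r Xx x≢𝟎 λ (w , a , j , i , lw , e , e′ , z , p , z≢𝟎) →
          crossing (sub c′) (generic c′) {Δ} dc (flip-closed c′) cr (subst (Disjoint j 0 a w) (zeros w (trans (letters-length lw) e)) (disjoint-zeros lw))
            (subst (_≤ r ℕ.+ r) (sym (trans (letters-length lw) e)) (ℕₚ.m≤m+n r r)) p (comp-In {Δ} dc (X⇒In c′) lw a (trans (ℕₚ.+-comm j a) e) p) z≢𝟎 y∈ y≢𝟎)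
        where
        length-u : length (false ∷ u) ≡ r
        length-u = trans (letters-length (off l)) (ℕₚ.+-identityʳ r)
        short : length (false ∷ u) ≤ r ℕ.+ r
        short = subst (_≤ r ℕ.+ r) (sym length-u) (ℕₚ.m≤m+n r r)
        zeros : ∀ w → length w ≡ r → replicate (length w) false ≡ false ∷ u
        zeros w e = trans (cong (λ t → replicate t false) (trans e (sym length-u))) (sym (letters-zeros (off l)))

      bottom : ∀ c u → Letters q 0 u → D c (false ∷ u) ≡ 0
      bottom false = bottom′ false true cross′
      bottom true  = bottom′ true false cross

      module _ (j : ℕ) (j≤r : j ≤ r) where
        degree : j ℕ.+ (r ℕ.∸ j) ≡ r
        degree = ℕₚ.m+[n∸m]≡n j≤r

        lengths : (r ℕ.∸ j) ℕ.+ (r ℕ.+ j) ≡ r ℕ.+ r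
        lengths = trans (ℕₚ.+-comm (r ℕ.∸ j) (r ℕ.+ j)) (trans (ℕₚ.+-assoc r j (r ℕ.∸ j)) (cong (r ℕ.+_) degree))

        -- A partial contraction of `w₀`: an element of the ambient space of the leaf that the
        -- remaining forms do not annihilate.
        y₀ : Ext n
        y₀ = contract Φ (r ℕ.+ j) w₀

        y₀∈ : Killed-in {Δ} {r ℕ.∸ j} Φ (r ℕ.+ j) y₀
        y₀∈ = contract-In {Δ} dc Φ (r ℕ.+ j) (r ℕ.∸ j) (subst (λ t → In Δ t w₀) (trans (sym lengths) (ℕₚ.+-comm (r ℕ.∸ j) (r ℕ.+ j))) w₀-In) , contract-killed Φ (r ℕ.+ j) w₀

        more : ℕ → Ext n → Ext n
        more zero    y = y
        more (suc i) y = ι (Φ (i ℕ.+ (r ℕ.+ j))) (more i y)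

        more-y₀ : ∀ i → more i y₀ ≡ contract Φ (i ℕ.+ (r ℕ.+ j)) w₀
        more-y₀ zero    = refl
        more-y₀ (suc i) = cong (ι (Φ (i ℕ.+ (r ℕ.+ j)))) (more-y₀ i)

        more-y₀≢𝟎 : more (r ℕ.∸ j) y₀ ≢ 𝟎
        more-y₀≢𝟎 e = w₀-nonzero (trans (cong (λ t → contract Φ t w₀) (sym lengths)) (trans (sym (more-y₀ (r ℕ.∸ j))) e))

        y₀≢𝟎 : y₀ ≢ 𝟎
        y₀≢𝟎 e = more-y₀≢𝟎 (trans (cong (more (r ℕ.∸ j)) e) (more-𝟎 (r ℕ.∸ j)))
          where
          more-𝟎 : ∀ i → more i 𝟎 ≡ 𝟎
          more-𝟎 zero    = refl
          more-𝟎 (suc i) = trans (cong (ι (Φ (i ℕ.+ (r ℕ.+ j)))) (more-𝟎 i)) (ι-𝟎 _)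

        s-positive : 1 ≤ s j
        s-positive = decidable-stable (1 ℕ.≤? s j) (dim-exists (Killed-in {Δ} {r ℕ.∸ j} Φ (r ℕ.+ j)) >>= λ (k , d) →
          return (ℕₚ.≤-trans (dim-positive d y₀ y₀∈ y₀≢𝟎) (bounded j j≤r k d)))

        module _ (c : Bool) (u : Word) (l : Letters q j u) where
          w : Word
          w = false ∷ u

          w-length : length w ≡ r ℕ.+ j
          w-length = letters-length (off l)

          short : length w ≤ r ℕ.+ r
          short = subst (_≤ r ℕ.+ r) (sym w-length) (ℕₚ.+-monoʳ-≤ r j≤r)

          comp⇒killed : ∀ z → comp Φ (X c) w z → Killed-in {Δ} {r ℕ.∸ j} Φ (r ℕ.+ j) z
          comp⇒killed z p = comp-In {Δ} dc (X⇒In c) (off l) (r ℕ.∸ j) degree p , subst (λ t → KilledBy Φ t z) w-length (comp-killed w p)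

          comp-more : ∀ i {z} → comp Φ (X c) w z → comp Φ (X c) (trues i w) (more i z)
          comp-more zero p = p
          comp-more (suc i) {z} p = more i z , comp-more i p , cong (λ t → ι (Φ t) (more i z)) (sym (trans (trues-length i w) (cong (i ℕ.+_) w-length)))

          top-length : length (trues (r ℕ.∸ j) w) ≤ r ℕ.+ r
          top-length = ℕₚ.≤-reflexive (trans (trues-length (r ℕ.∸ j) w) (trans (cong ((r ℕ.∸ j) ℕ.+_) w-length) lengths))

          dimension≤s : D c w ≤ s j
          dimension≤s = decidable-stable (D c w ℕ.≤? s j) (dim-exists (Killed-in {Δ} {r ℕ.∸ j} Φ (r ℕ.+ j)) >>= λ (k , d) →
            return (ℕₚ.≤-trans (dim-mono comp⇒killed (dims c w short) d) (bounded j j≤r k d)))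

          -- If the top component vanishes, then contract Φ (r + j) w₀ lies outside the component of w.
          dimension<s : D c (trues (r ℕ.∸ j) w) ≡ 0 → D c w < s j
          dimension<s top≡0 = decidable-stable (D c w ℕ.<? s j) (dim-exists (Killed-in {Δ} {r ℕ.∸ j} Φ (r ℕ.+ j)) >>= λ (k , d) →
            return (ℕₚ.≤-trans (larger (dims c w short) d) (bounded j j≤r k d)))
            where
            top-zero : ∀ z → comp Φ (X c) (trues (r ℕ.∸ j) w) z → ¬ z ≢ 𝟎
            top-zero z p z≢𝟎 = ℕₚ.1+n≰n (subst (1 ≤_) top≡0 (dim-positive (dims c (trues (r ℕ.∸ j) w) top-length) z p z≢𝟎))
            larger : ∀ {m k} → Dim (comp Φ (X c) w) m → Dim (Killed-in {Δ} {r ℕ.∸ j} Φ (r ℕ.+ j)) k → suc m ≤ k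
            larger (v , v∈ , vind , _) d = dim-bound d (y₀ ◂ v) (λ { zero → y₀∈ ; (suc i) → comp⇒killed (v i) (v∈ i) })
              (extend-independent zero-subspace v y₀ vind λ (a , e) → top-zero (more (r ℕ.∸ j) y₀)
                (comp-more (r ℕ.∸ j) (subst (comp Φ (X c) w) (sym (−≡𝟎 e)) (IsSubspace.lc∈ (comp-subspace (sub c) w) a v∈))) more-y₀≢𝟎)

          -- A nonzero leaf either has a nonzero top component, which pays for the last dimension,
          -- or misses `y₀` and has dimension less than `s j`.
          leaf-bound : D c w ≤ D c (trues (r ℕ.∸ j) w) ℕ.+ (D c w ℕ.⊓ 1) ℕ.* (s j ℕ.∸ 1)
          leaf-bound = estimate (D c w) (D c (trues (r ℕ.∸ j) w)) (s j) dimension≤s dimension<s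
            where
            estimate : ∀ k t s → k ≤ s → (t ≡ 0 → k < s) → k ≤ t ℕ.+ (k ℕ.⊓ 1) ℕ.* (s ℕ.∸ 1)
            estimate zero t s _ _ = z≤n
            estimate (suc k) zero (suc s) _ strict = ℕₚ.≤-trans (ℕₚ.≤-pred (strict refl)) (ℕₚ.≤-reflexive (sym (trans (cong (λ x → suc x ℕ.* s) (ℕₚ.⊓-zeroʳ k)) (ℕₚ.*-identityˡ s))))
            estimate (suc k) (suc t) (suc s) (s≤s k≤s) _ = s≤s (ℕₚ.≤-trans k≤s (ℕₚ.≤-trans (ℕₚ.≤-reflexive (sym (trans (cong (λ x → suc x ℕ.* s) (ℕₚ.⊓-zeroʳ k)) (ℕₚ.*-identityˡ s)))) (ℕₚ.m≤n+m _ t)))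
            estimate (suc k) zero zero () _
            estimate (suc k) (suc t) zero () _

      s-top : s r ≤ 1
      s-top = subst (_≤ 1) (sym (trans (cong (E (f Δ) (r ℕ.+ r)) (ℕₚ.n∸n≡0 r)) (E-bottom (f Δ) (r ℕ.+ r)))) (faces₀≤1 Δ)

      conflict : ∀ {j m u v} → Disjoint j j m u v → j ℕ.+ m ≡ r → 1 ≤ D false u → 1 ≤ D true v → ⊥
      conflict {j} {m} {u} {v} d e pu pv =
        let (x , x∈ , x≢𝟎) = dim⇒nonzero (dims false u u≤) pu
            (y , y∈ , y≢𝟎) = dim⇒nonzero (dims true v (subst (_≤ r ℕ.+ r) (disjoint-length d) u≤)) pv
        in crossing (sub false) (generic false) {Δ} dc (flip-closed false) cross d u≤ x∈ (comp-In {Δ} dc (X⇒In false) (disjoint-letters d) m e x∈) x≢𝟎 y∈ y≢𝟎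
        where
        u≤ : length u ≤ r ℕ.+ r
        u≤ = subst (_≤ r ℕ.+ r) (sym (letters-length (disjoint-letters d))) (ℕₚ.+-mono-≤ (ℕₚ.≤-reflexive e) (subst (j ≤_) e (ℕₚ.m≤m+n j m)))

      D≤1 : ∀ c u → Letters r r u → D c u ≤ 1
      D≤1 c u l = ℕₚ.≤-trans (dim-mono (λ z p → comp-In {Δ} dc (X⇒In c) l 0 (ℕₚ.+-identityʳ r) p) (dims c u (ℕₚ.≤-reflexive (letters-length l))) (dim-In Δ 0)) (faces₀≤1 Δ)

      conclusion : D false [] ℕ.+ D true [] ℕ.+ s 0 ≤ f Δ r ℕ.+ 1
      conclusion = Counting.conclusion q s (f Δ r) D s-positive s-top (E-total q (f Δ) E-recursion) leaves bottom
        (λ c j j≤r u l → leaf-bound j j≤r c u l)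
        (λ j m e u v d → clash (D false (false ∷ u)) (D true (false ∷ v)) (conflict (none d) (trans (ℕₚ.+-suc j m) (cong suc e))))
        (λ u v d → untruncate (D≤1 false u (subst (λ z → Letters z r u) (ℕₚ.+-identityʳ r) (disjoint-letters d))) (D≤1 true v (subst (λ z → Letters z r v) (ℕₚ.+-identityʳ r) (disjoint-letters (disjoint-sym d))))
          (clash (D false u) (D true v) (conflict d (ℕₚ.+-identityʳ r))))
        where
        untruncate : ∀ {a b} → a ≤ 1 → b ≤ 1 → (a ℕ.⊓ 1) ℕ.+ (b ℕ.⊓ 1) ≤ 1 → a ℕ.+ b ≤ 1
        untruncate a≤1 b≤1 = subst (_≤ 1) (cong₂ ℕ._+_ (ℕₚ.m≤n⇒m⊓n≡m a≤1) (ℕₚ.m≤n⇒m⊓n≡m b≤1))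

    Witness : ℕ → Set
    Witness j = ∃ λ m → ∃ λ (c : Fin m → Ext n) → (∀ l → In Δ (r ℕ.∸ j) (c l)) × IndependentMod (KilledBy powers (r ℕ.+ j)) c × f Δ (r ℕ.∸ j) ≤ m ℕ.+ s j

    witnesses : ¬ ¬ (∀ (j : Fin (suc r)) → Witness (toℕ j))
    witnesses = ¬¬-choice λ j → dim-Z (r ℕ.+ toℕ j) (r ℕ.∸ toℕ j) (ℕₚ.≤-reflexive (trans (ℕₚ.+-assoc r (toℕ j) _) (cong (r ℕ.+_) (ℕₚ.m+[n∸m]≡n (ℕₚ.≤-pred (Finₚ.toℕ<n j)))))) >>= witness

    bound : ∀ {k₀ k₁} → Dim (X false) k₀ → Dim (X true) k₁ → k₀ ℕ.+ k₁ ℕ.+ s 0 ≤ f Δ r ℕ.+ 1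
    bound {k₀} {k₁} dim₀ dim₁ = decidable-stable (_ ℕ.≤? _) (
      witnesses >>= λ wit →
      nondegenerate ∅∈ >>= λ (w₀ , w₀-In , w₀-nonzero) →
      -- The Vandermonde forms satisfy both open conditions, by `dim-Z` and `nondegenerate`, and
      -- serve as the starting point of the perturbation.
      generic-sequence (admissible-× (admissible-∀ (λ j → independent-admissible (r ℕ.+ toℕ j) (proj₁ (proj₂ (wit j))))) (contract-admissible (r ℕ.+ r) w₀))
        X sub (r ℕ.+ r) powers ((λ j → proj₁ (proj₂ (proj₂ (proj₂ (wit j))))) , w₀-nonzero) >>= λ (Φ , (ind , ≢𝟎) , generic) →
      word-choice (r ℕ.+ r) (λ w → dim-exists (comp Φ (X false) w)) >>= λ (D₀ , dims₀) →
      word-choice (r ℕ.+ r) (λ w → dim-exists (comp Φ (X true) w)) >>= λ (D₁ , dims₁) →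
      return (finish wit Φ ind w₀ w₀-In ≢𝟎 generic D₀ dims₀ D₁ dims₁))
      where
      finish : (wit : ∀ j → Witness (toℕ j)) → ∀ Φ → (∀ j → IndependentMod (KilledBy Φ (r ℕ.+ toℕ j)) (proj₁ (proj₂ (wit j)))) →
        ∀ w₀ → In Δ (r ℕ.+ r) w₀ → contract Φ (r ℕ.+ r) w₀ ≢ 𝟎 → (∀ c → GenericFor Φ (X c) (r ℕ.+ r)) →
        ∀ D₀ → (∀ w → length w ≤ r ℕ.+ r → Dim (comp Φ (X false) w) (D₀ w)) → ∀ D₁ → (∀ w → length w ≤ r ℕ.+ r → Dim (comp Φ (X true) w) (D₁ w)) →
        k₀ ℕ.+ k₁ ℕ.+ s 0 ≤ f Δ r ℕ.+ 1
      finish wit Φ ind w₀ w₀-In ≢𝟎 generic D₀ dims₀ D₁ dims₁ =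
        subst (_≤ f Δ r ℕ.+ 1) (cong₂ (λ x y → x ℕ.+ y ℕ.+ s 0) (dim-unique (dims₀ [] z≤n) dim₀) (dim-unique (dims₁ [] z≤n) dim₁))
          (conclusion Φ generic bounded w₀ w₀-In ≢𝟎 D dims)
        where
        D : Bool → Word → ℕ
        D false = D₀
        D true  = D₁
        dims : ∀ c w → length w ≤ r ℕ.+ r → Dim (comp Φ (X c) w) (D c w)
        dims false = dims₀
        dims true  = dims₁
        bounded : ∀ j → j ≤ r → ∀ k → Dim (Killed-in {Δ} {r ℕ.∸ j} Φ (r ℕ.+ j)) k → k ≤ s j
        bounded j j≤r k d = subst (λ t → ∀ k → Dim (Killed-in {Δ} {r ℕ.∸ t} Φ (r ℕ.+ t)) k → k ≤ s t) (Finₚ.toℕ-fromℕ< (s≤s j≤r)) at k d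
          where
          i : Fin (suc r)
          i = fromℕ< (s≤s j≤r)
          at : ∀ k → Dim (Killed-in {Δ} {r ℕ.∸ toℕ i} Φ (r ℕ.+ toℕ i)) k → k ≤ s (toℕ i)
          at k d = let (m , c , cI , _ , enough) = wit i in witness-bound {Δ} cI (ind i) enough d

-- The field of rational numbers

ℚ-ring : CommutativeRing _ _
ℚ-ring = record { isCommutativeRing = ℚₚ.+-*-isCommutativeRing }

module ℚI = FromInteger ℚ-ring

fromℕ-ℚ : ∀ k → toℚᵘ (ℚI.fromℤ (ℤ.+ k)) ≃ mkℚᵘ (ℤ.+ k) 0
fromℕ-ℚ zero    = *≡* refl
fromℕ-ℚ (suc k) = ℚᵘₚ.≃-trans (ℚₚ.toℚᵘ-homo-+ 1ℚ (ℚI.fromℤ (ℤ.+ k))) (ℚᵘₚ.≃-trans (ℚᵘₚ.+-congʳ (toℚᵘ 1ℚ) (fromℕ-ℚ k))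
  (*≡* (cong (ℤ._* ℤ.1ℤ) (cong (λ t → ℤ.1ℤ ℤ.+ t) (ℤₚ.*-identityʳ (ℤ.+ k))))))

fromℤ-ℚ : ∀ i → toℚᵘ (ℚI.fromℤ i) ≃ mkℚᵘ i 0
fromℤ-ℚ (ℤ.+ k)  = fromℕ-ℚ k
fromℤ-ℚ -[1+ k ] = ℚᵘₚ.≃-trans (ℚₚ.toℚᵘ-homo‿- (ℚI.fromℤ (ℤ.+ suc k))) (ℚᵘₚ.-‿cong (fromℕ-ℚ (suc k)))

rationals : Rationals
rationals = record
  { R = ℚ ; _+_ = ℚ._+_ ; _*_ = ℚ._*_ ; -_ = ℚ.-_ ; 0# = 0ℚ ; 1# = 1ℚ
  ; isCommutativeRing = ℚₚ.+-*-isCommutativeRing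
  ; _≟_ = ℚ._≟_
  ; 1≢0 = λ ()
  ; inverse = λ x x≢0 → let instance _ = ℚ.≢-nonZero x≢0 in 1/ x , ℚₚ.*-inverseʳ x
  ; fromℕ-suc≢0 = λ k e → nonzero k (ℚᵘₚ.≃-trans (ℚᵘₚ.≃-sym (fromℕ-ℚ (suc k))) (ℚᵘₚ.≃-reflexive (cong toℚᵘ e)))
  ; fraction = fraction }
  where
  nonzero : ∀ k → mkℚᵘ (ℤ.+ suc k) 0 ≃ toℚᵘ 0ℚ → ⊥
  nonzero k (*≡* ())
  fraction : ∀ x → ∃ λ k → ∃ λ i → x ℚ.* ℚI.fromℤ (ℤ.+ suc k) ≡ ℚI.fromℤ i
  fraction x@(mkℚ i k _) = k , i , ℚₚ.toℚᵘ-injective (ℚᵘₚ.≃-trans (ℚₚ.toℚᵘ-homo-* x (ℚI.fromℤ (ℤ.+ suc k)))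
    (ℚᵘₚ.≃-trans (ℚᵘₚ.*-congˡ {toℚᵘ x} (fromℕ-ℚ (suc k))) (ℚᵘₚ.≃-trans (*≡* cross) (ℚᵘₚ.≃-sym (fromℤ-ℚ i)))))
    where
    cross : (i ℤ.* ℤ.+ suc k) ℤ.* ℤ.1ℤ ≡ i ℤ.* (ℤ.+ suc (k ℕ.* 1))
    cross = trans (ℤₚ.*-identityʳ (i ℤ.* ℤ.+ suc k)) (cong (λ t → i ℤ.* ℤ.+ suc t) (sym (ℕₚ.*-identityʳ k)))

-- The bound for cross-intersecting families

disjoint-lookup : ∀ {n} (A B : Subset n) x → disjointᵇ A B ≡ true → lookup A x ≡ inside → lookup B x ≡ inside → ⊥
disjoint-lookup (inside ∷ A) (inside ∷ B) zero () p q
disjoint-lookup (outside ∷ A) (outside ∷ B) (suc x) e p q = disjoint-lookup A B x e p q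
disjoint-lookup (outside ∷ A) (inside ∷ B) (suc x) e p q = disjoint-lookup A B x e p q
disjoint-lookup (inside ∷ A) (outside ∷ B) (suc x) e p q = disjoint-lookup A B x e p q
disjoint-lookup (inside ∷ A) (inside ∷ B) (suc x) () p q

module CrossIntersecting (Q : Rationals) where
  open Rationals Q using (fromℤ; scalarRing)
  open Exterior Q using (𝟎; zero-by-coef)
  open Contraction Q using (In; In-subspace; fromℤ-injective)
  open Dimension Q using (Dim; dim-supported; dim-nonzero)
  open Wedge Q using (flip; flip-support; _⋏_; ⋏-support)

  module _ {n : ℕ} where
    open Generic Q {n} using (nat; nat-injective)

    -- The interpolation points of the vertices are natural numbers, so -1 can serve as the
    -- additional point `b`, at which no vertex sits.
    x̂ : Fin n → Rationals.R Q
    x̂ v = nat (toℕ v)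

    x̂-injective : ∀ {v w} → x̂ v ≡ x̂ w → v ≡ w
    x̂-injective {v} {w} e = Finₚ.toℕ-injective (nat-injective (toℕ v) (toℕ w) (trans (cong (λ t → Rationals._+_ Q t (Rationals.-_ Q (x̂ w))) e) (CommutativeRing.-‿inverseʳ scalarRing (x̂ w))))

    x̂-fresh : ∀ v → x̂ v ≢ fromℤ -[1+ 0 ]
    x̂-fresh v e = impossible (toℕ v) (fromℤ-injective (ℤ.+ toℕ v ℤ.+ ℤ.1ℤ) (trans (QI.fromℤ-+ (ℤ.+ toℕ v) ℤ.1ℤ)
      (trans (cong (λ t → Rationals._+_ Q t (fromℤ ℤ.1ℤ)) e) (CommutativeRing.-‿inverseˡ scalarRing (fromℤ ℤ.1ℤ)))))
      where
      module QI = FromInteger scalarRing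
      impossible : ∀ k → ℤ.+ k ℤ.+ ℤ.1ℤ ≢ ℤ.0ℤ
      impossible k e = ℕₚ.1+n≢0 (trans (ℕₚ.+-comm 1 k) (ℤₚ.+-injective e))

  module _ {c ℓ : Level} (F : Field c ℓ) {n : ℕ} (Δ : Family n) (complex : IsComplex Δ) (d : ℕ) (depth : Homology.DepthIsPred F Δ d)
    (q : ℕ) (r+r≤d : suc q ℕ.+ suc q ≤ d) where
    private
      r : ℕ
      r = suc q

    open LinkHomology F using (pure; cohenMacaulay; down)

    closed : DownClosed Δ
    closed A v = down Δ complex d A (A [ v ]≔ inside) (⊑-insert A v)

    ∅∈ : Δ ∅ ≡ true
    ∅∈ = down Δ complex d ∅ (proj₁ (IsComplex.nonempty complex)) (λ v p → ⊥-elim (true≢false p (Vecₚ.lookup-replicate v outside))) (proj₂ (IsComplex.nonempty complex))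

    extend : ∀ A → Δ A ≡ true → ∣ A ∣ < r ℕ.+ r → ∃ λ y → lookup A y ≡ outside × Δ (A [ y ]≔ inside) ≡ true
    extend A A∈ small =
      let (D , A⊑D , D∈ , D-size) = pure Δ complex d (proj₁ (proj₂ depth)) (proj₁ depth) ∣ A ∣ A refl (ℕₚ.≤-trans (ℕₚ.<⇒≤ small) r+r≤d) A∈
          (y , y∈ , y∉) = missing A D A⊑D (subst (∣ A ∣ <_) (sym D-size) (ℕₚ.<-≤-trans small r+r≤d))
      in y , y∉ , down Δ complex d (A [ y ]≔ inside) D (insert-⊑ A D y A⊑D y∈) D∈

    module _ (𝒜 ℬ : Family n) (𝒜⊆ : ∀ A → A ∈F 𝒜 → A ∈F Δ × ∣ A ∣ ≡ r) (ℬ⊆ : ∀ B → B ∈F ℬ → B ∈F Δ × ∣ B ∣ ≡ r)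
      (𝒜-nonempty : ∃ λ A → A ∈F 𝒜) (ℬ-nonempty : ∃ λ B → B ∈F ℬ) (meet : ∀ A B → A ∈F 𝒜 → B ∈F ℬ → Nonempty (A ∩ B)) where

      families : Bool → Family n
      families false = 𝒜
      families true  = ℬ

      families⊆ : ∀ c A → families c A ≡ true → Δ A ≡ true × ∣ A ∣ ≡ r
      families⊆ false = 𝒜⊆
      families⊆ true  = ℬ⊆

      dim-family : ∀ c → Dim (In (families c) r) (count (families c))
      dim-family c = dim-supported (families c) (In (families c) r) (λ z p A ≢0 → proj₁ (p A ≢0)) (λ z h A ≢0 → h A ≢0 , proj₂ (families⊆ c A (h A ≢0)))

      nonempty : ∀ c → ∃ λ A → families c A ≡ true
      nonempty false = 𝒜-nonempty
      nonempty true  = ℬ-nonempty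

      nonzero : ∀ c → ∃ λ z → In (families c) r z × z ≢ 𝟎
      nonzero c with count (families c) | dim-family c | positive
        where
        positive : 1 ≤ count (families c)
        positive = ℕₚ.≤-trans (s≤s z≤n) (count-strict {Φ = λ _ → false} {Ψ = families c} (λ _ ()) (proj₁ (nonempty c)) refl (proj₂ (nonempty c)))
      ... | suc k | d | _ = dim-nonzero d

      -- A nonzero coefficient of the product needs disjoint members of the two families, which
      -- cross-intersection rules out.
      disjoint-product : ∀ c c′ → (∀ A B → families c A ≡ true → families c′ B ≡ true → Nonempty (A ∩ B)) →
        ∀ x y → In (families c) r x → In (families c′) r y → x ⋏ y ≡ 𝟎
      disjoint-product c c′ meets x y p p′ = zero-by-coef (x ⋏ y) λ C ≢0 →
        let (A , B , a , b , disjoint) = ⋏-support x y C ≢0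
            (v , v∈) = meets A B (proj₁ (p A a)) (proj₁ (p′ B b))
            (v∈A , v∈B) = Subₚ.x∈p∩q⁻ A B v∈
        in disjoint-lookup A B v disjoint (Vecₚ.[]=⇒lookup v∈A) (Vecₚ.[]=⇒lookup v∈B)

      cross-intersecting-bound : (v : Fin r → Fin n) → IsShiftedWrt Δ v → count 𝒜 ℕ.+ count ℬ ℕ.+ γ Δ v r ≤ f Δ r ℕ.+ 1
      cross-intersecting-bound v shifted = ℕₚ.≤-trans
        (ℕₚ.+-monoʳ-≤ (count 𝒜 ℕ.+ count ℬ) (ℕₚ.≤-trans (Avoiding.γ≤E Δ complex r v shifted extend) (ℕₚ.≤-reflexive (cong (λ t → E (f Δ) t r) (sym (ℕₚ.+-identityʳ r))))))
        (Assembly.bound Q x̂ x̂-injective (fromℤ -[1+ 0 ]) x̂-fresh Δ closed ∅∈ q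
          (cohenMacaulay Δ complex d (proj₁ (proj₂ depth)) (proj₁ depth) Q (r ℕ.+ r) r+r≤d)
          (λ c → In (families c) r) (λ c → In-subspace {Γ = families c})
          (λ c z p A ≢0 → families⊆ c A (proj₁ (p A ≢0)))
          (λ c z p A ≢0 → p A (flip-support z A ≢0))
          (disjoint-product false true meet)
          (disjoint-product true false (λ B A B∈ A∈ → subst Nonempty (Subₚ.∩-comm A B) (meet A B A∈ B∈)))
          nonzero (dim-family false) (dim-family true))

open import Data.Nat using (_+_; _*_)

theorem1p6 : ∀ {c ℓ : Level} (F : Field c ℓ) (n : ℕ) (Δ : Family n) → IsComplex Δ →
    (d : ℕ) → Homology.DepthIsPred F Δ d →
    (r : ℕ) → 2 ≤ r → 2 * r ≤ d →
    (𝒜 ℬ : Family n) →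
    (∀ A → A ∈F 𝒜 → A ∈F Δ × ∣ A ∣ ≡ r) →
    (∀ B → B ∈F ℬ → B ∈F Δ × ∣ B ∣ ≡ r) →
    (∃ λ A → A ∈F 𝒜) → (∃ λ B → B ∈F ℬ) →
    (∀ A B → A ∈F 𝒜 → B ∈F ℬ → Nonempty (A ∩ B)) →
    (v : Fin r → Fin n) → IsShiftedWrt Δ v →
    count 𝒜 + count ℬ + γ Δ v r ≤ f Δ r + 1
theorem1p6 F n Δ complex d depth (suc q) _ 2r≤d =
  CrossIntersecting.cross-intersecting-bound rationals F Δ complex d depth q (subst (λ t → suc q ℕ.+ t ≤ d) (ℕₚ.+-identityʳ (suc q)) 2r≤d)
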